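{- There exist absolute constants $c>0$ and $C>0$ such that the following holds. Let $N\geq 2$ be an integer and let $A \subset \{1,2,\dots,N\}\times \{1,2,\dots,N\}$. Suppose $A$ contains no triple of the form $$(x,y),\ (x+d, y),\ (x,y+d^2)\quad \text{with } x,y,d\in\mathbb{Z},\ d \neq 0.$$ Then $|A| \leq C N^2/(\log N)^{c}$. -}

module Defs where

open import Data.Nat using (ℕ)
open import Data.Integer using (ℤ; +_; _+_; _*_; _≤_)
open import Data.Product using (_×_; _,_)
open import Data.List using (List)
open import Data.List.Membership.Propositional using (_∈_)
open import Data.Empty using (⊥)
open import Relation.Binary.PropositionalEquality using (_≢_)

InGrid : ℕ → ℤ × ℤ → Set
InGrid N (x , y) = ((+ 1 ≤ x) × (x ≤ + N)) × ((+ 1 ≤ y) × (y ≤ + N))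

NoSquareCorner : List (ℤ × ℤ) → Set
NoSquareCorner A =
  ∀ (x y d : ℤ) → d ≢ + 0 →
  (x , y) ∈ A → (x + d , y) ∈ A → (x , y + d * d) ∈ A → ⊥

{-# OPTIONS --safe #-}
module Submission where

-- Embed the grid into the torus X = (ℤ/2N)², on which ℤ² acts, and let f be the indicator of A.  For
-- operators averaging f over arithmetic progressions, P horizontally and Q vertically, the correlation
-- ⟨ f , P*P f · Q*Q f ⟩ is bounded below in terms of E f alone.  It is compared with the number of
-- square corners whose differences range over the family
--     d = a t + 2 L g i,   a g = L  (in units p and q),
-- where a runs over 1, …, K and L = K!.  Cauchy–Schwarz in i and a shift of t replace a pair of
-- differences by d′ and d″ whose squares differ by 4 L² k t, a quantity independent of a: this frees the
-- average over a, and further applications of van der Corput's inequality show that the two counts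
-- differ by little unless the energy N (Q f) = E (Q f)², or that of the products f₁ · S^k f₁ of the
-- residual f₁ = f − P*P f, drops between two neighbouring scales.  Energies are bounded, so some scale
-- shows no drop.  The number of scales is polynomial in h = 1 / η and the ratio of two scales is
-- 2^poly(h), hence only N ≤ 2^poly(h) is excluded when A has no square corner and density above 4 η.

-- A corner moves f by d in one direction and by d² in the other, so no substitution makes both
-- motions simple. The differences are built on the relation a g = L. It frees the vertical factor
-- of a pair of corners from a, so that Cauchy-Schwarz discards that factor and leaves the products
-- f₁ · S^k f₁ alone, compared along two moves (δ, -δ²) with different a and a′. By the same
-- relation the terms of δ² linear in t agree for a and a′, and the relative motion is, up to
-- constants, the parabola ((a′ - a) p t, (a² - a′²) p² t²), which one differencing makes linear. L
-- = K! serves all a up to K at once. Two nested choices of scale are needed because f₁ depends on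
-- P. A window across which the horizontal energy of f is flat comes first and fixes f₁; only then
-- can the energies of the products of f₁ be compared between scales inside the window, and the step
-- of S is kept constant there. Ratios of scales are powers of one integer D that must be divisible
-- by many small integers; the factorials in D explain the size 2^poly(h).

module Corners where
  open import Defs using (InGrid; NoSquareCorner)
  open import Data.Nat as ℕ using (ℕ; zero; suc; NonZero; _!)
  import Data.Nat.Properties as ℕ
  import Data.Nat.DivMod as ℕ
  import Data.Nat.Divisibility as ℕᵈ
  open ℕᵈ using (divides)
  open import Data.Nat.Logarithm using (⌊log₂_⌋; ⌊log₂⌋-mono-≤; ⌊log₂[2^n]⌋≡n)
  import Data.Nat.Tactic.RingSolver as ℕR
  open import Data.Integer as ℤ using (ℤ; +_; -[1+_])
  import Data.Integer.Properties as ℤ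
  import Data.Integer.DivMod as ℤ
  open import Data.Integer.Tactic.RingSolver using (solve-∀)
  open import Data.Rational as ℚ using (ℚ; 0ℚ; 1ℚ; ½; _≤_; _<_)
  import Data.Rational.Properties as ℚ
  open import Data.Fin as Fin using (Fin; toℕ)
  open import Data.Fin.Properties using (toℕ<n; toℕ-injective; toℕ-fromℕ<)
  open import Data.List using (List; []; _∷_; length)
  open import Data.List.Relation.Unary.All as All using (All; []; _∷_)
  open import Data.List.Relation.Unary.Any using (here; there)
  open import Data.List.Relation.Unary.AllPairs using ([]; _∷_)
  open import Data.List.Relation.Unary.Unique.Propositional using (Unique)
  open import Data.List.Membership.Propositional using (_∈_)
  open import Data.Product using (_×_; _,_; proj₁; proj₂; ∃-syntax)
  open import Data.Sum using (_⊎_; inj₁; inj₂)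
  open import Data.Empty using (⊥-elim)
  open import Relation.Nullary using (Dec; yes; no)
  open import Relation.Binary.PropositionalEquality using (_≡_; _≢_; refl; sym; trans; cong; cong₂; subst; subst₂; module ≡-Reasoning)
  open import Relation.Binary.Consequences using (dec⇒weaklyDec)
  open import Algebra.Structures using (IsCommutativeRing)
  open import Algebra.Bundles using (CommutativeRing)
  open import Algebra.Solver.Ring.AlmostCommutativeRing using (AlmostCommutativeRing; fromCommutativeRing; _-Raw-AlmostCommutative⟶_)
  import Algebra.Solver.Ring

  -- Opaque, so that unification treats the operations of ℚ as constructors.

  infixl 6 _+_ _-_
  infixl 7 _*_
  infix 8 -_

  opaque
    _+_ _*_ : ℚ → ℚ → ℚ
    _+_ = ℚ._+_
    _*_ = ℚ._*_

    -_ ∣_∣ : ℚ → ℚ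
    -_ = ℚ.-_
    ∣_∣ = ℚ.∣_∣

  _-_ : ℚ → ℚ → ℚ
  a - b = a + - b

  opaque
    unfolding _+_ -_

    +-*-isCommutativeRing : IsCommutativeRing _≡_ _+_ _*_ -_ 0ℚ 1ℚ
    +-*-isCommutativeRing = ℚ.+-*-isCommutativeRing

  +-*-ring : CommutativeRing _ _
  +-*-ring = record { isCommutativeRing = +-*-isCommutativeRing }

  ℚ-ring : AlmostCommutativeRing _ _
  ℚ-ring = fromCommutativeRing +-*-ring

  opaque
    unfolding _+_ -_ ∣_∣

    homo-+ : ∀ a b → a ℚ.+ b ≡ a + b
    homo-+ a b = refl

    homo-* : ∀ a b → a ℚ.* b ≡ a * b
    homo-* a b = refl

    homo-- : ∀ a → ℚ.- a ≡ - a
    homo-- a = refl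

    +-mono-≤ : ∀ {a b c d} → a ≤ b → c ≤ d → a + c ≤ b + d
    +-mono-≤ = ℚ.+-mono-≤

    +-mono-< : ∀ {a b c d} → a < b → c < d → a + c < b + d
    +-mono-< = ℚ.+-mono-<

    +-mono-<-≤ : ∀ {a b c d} → a < b → c ≤ d → a + c < b + d
    +-mono-<-≤ = ℚ.+-mono-<-≤

    neg-antimono-≤ : ∀ {a b} → a ≤ b → - b ≤ - a
    neg-antimono-≤ = ℚ.neg-antimono-≤

    *-monoˡ : ∀ {c a b} → 0ℚ ≤ c → a ≤ b → c * a ≤ c * b
    *-monoˡ {c} p q = ℚ.*-monoˡ-≤-nonNeg c {{ℚ.nonNegative p}} q

    *-monoʳ : ∀ {c a b} → 0ℚ ≤ c → a ≤ b → a * c ≤ b * c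
    *-monoʳ {c} p q = ℚ.*-monoʳ-≤-nonNeg c {{ℚ.nonNegative p}} q

    *-cancelˡ : ∀ {c a b} → 0ℚ < c → c * a ≤ c * b → a ≤ b
    *-cancelˡ {c} p q = ℚ.*-cancelˡ-≤-pos c {{ℚ.positive p}} q

    0<* : ∀ {a b} → 0ℚ < a → 0ℚ < b → 0ℚ < a * b
    0<* {a} {b} p q = ℚ.positive⁻¹ (a ℚ.* b) {{ℚ.pos*pos⇒pos a {{ℚ.positive p}} b {{ℚ.positive q}}}}

    ∣p∣≡p∨∣p∣≡-p : ∀ p → ∣ p ∣ ≡ p ⊎ ∣ p ∣ ≡ - p
    ∣p∣≡p∨∣p∣≡-p = ℚ.∣p∣≡p∨∣p∣≡-p

    0≤p⇒∣p∣≡p : ∀ {p} → 0ℚ ≤ p → ∣ p ∣ ≡ p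
    0≤p⇒∣p∣≡p = ℚ.0≤p⇒∣p∣≡p

    0≤∣p∣ : ∀ p → 0ℚ ≤ ∣ p ∣
    0≤∣p∣ = ℚ.0≤∣p∣

    ∣-p∣≡∣p∣ : ∀ p → ∣ - p ∣ ≡ ∣ p ∣
    ∣-p∣≡∣p∣ = ℚ.∣-p∣≡∣p∣

    ∣p+q∣≤∣p∣+∣q∣ : ∀ p q → ∣ p + q ∣ ≤ ∣ p ∣ + ∣ q ∣
    ∣p+q∣≤∣p∣+∣q∣ = ℚ.∣p+q∣≤∣p∣+∣q∣

    ∣p*q∣≡∣p∣*∣q∣ : ∀ p q → ∣ p * q ∣ ≡ ∣ p ∣ * ∣ q ∣
    ∣p*q∣≡∣p∣*∣q∣ = ℚ.∣p*q∣≡∣p∣*∣q∣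

    1/_ : (p : ℚ) → 0ℚ < p → ℚ
    (1/ p) q = (ℚ.1/ p) {{ℚ.pos⇒nonZero p {{ℚ.positive q}}}}

    *-inverse : ∀ p (q : 0ℚ < p) → p * (1/ p) q ≡ 1ℚ
    *-inverse p q = ℚ.*-inverseʳ p {{ℚ.pos⇒nonZero p {{ℚ.positive q}}}}

    0<1/ : ∀ p (q : 0ℚ < p) → 0ℚ < (1/ p) q
    0<1/ p q = ℚ.positive⁻¹ _ {{ℚ.1/pos⇒pos p {{ℚ.positive q}}}}

  ℚ-coefficients : CommutativeRing.rawRing ℚ.+-*-commutativeRing -Raw-AlmostCommutative⟶ ℚ-ring
  ℚ-coefficients = record
    { ⟦_⟧ = λ c → c ; +-homo = homo-+ ; *-homo = homo-* ; -‿homo = homo-- ; 0-homo = refl ; 1-homo = refl }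

  open Algebra.Solver.Ring (CommutativeRing.rawRing ℚ.+-*-commutativeRing) ℚ-ring ℚ-coefficients (dec⇒weaklyDec ℚ._≟_)
    public using (solve; _:=_; _:+_; _:*_; _:-_; :-_; con)
  open CommutativeRing +-*-ring public using (+-comm; +-assoc; *-assoc; *-comm; +-identityˡ; +-identityʳ; *-identityˡ; *-identityʳ; zeroˡ; zeroʳ) renaming (distribˡ to *-distribˡ-+)

  -- Inequalities and absolute values in ℚ

  *-zeroˡ : ∀ a → 0ℚ * a ≡ 0ℚ
  *-zeroˡ = zeroˡ

  *-zeroʳ : ∀ a → a * 0ℚ ≡ 0ℚ
  *-zeroʳ = zeroʳ

  +-inverseʳ : ∀ a → a - a ≡ 0ℚ
  +-inverseʳ = CommutativeRing.-‿inverseʳ +-*-ring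

  +-monoˡ-≤ : ∀ c {a b} → a ≤ b → a + c ≤ b + c
  +-monoˡ-≤ c p = +-mono-≤ p ℚ.≤-refl

  +-monoʳ-≤ : ∀ c {a b} → a ≤ b → c + a ≤ c + b
  +-monoʳ-≤ c p = +-mono-≤ ℚ.≤-refl p

  ≤≡ : ∀ {a b c} → a ≤ b → b ≡ c → a ≤ c
  ≤≡ p q = ℚ.≤-trans p (ℚ.≤-reflexive q)

  ≡≤ : ∀ {a b c} → a ≡ b → b ≤ c → a ≤ c
  ≡≤ p q = ℚ.≤-trans (ℚ.≤-reflexive p) q

  0≤b-a⇒a≤b : ∀ {a b} → 0ℚ ≤ b - a → a ≤ b
  0≤b-a⇒a≤b {a} {b} p = ≡≤ (sym (+-identityˡ a))
    (≤≡ (+-monoˡ-≤ a p) (solve 2 (λ a b → (b :- a) :+ a := b) refl a b))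

  a≤b⇒0≤b-a : ∀ {a b} → a ≤ b → 0ℚ ≤ b - a
  a≤b⇒0≤b-a {a} {b} p = ≡≤ (sym (+-inverseʳ a)) (+-monoˡ-≤ (- a) p)

  0≤+ : ∀ {a b} → 0ℚ ≤ a → 0ℚ ≤ b → 0ℚ ≤ a + b
  0≤+ p q = ≡≤ (sym (+-identityˡ 0ℚ)) (+-mono-≤ p q)

  0≤* : ∀ {a b} → 0ℚ ≤ a → 0ℚ ≤ b → 0ℚ ≤ a * b
  0≤* {a} p q = ≡≤ (sym (*-zeroʳ a)) (*-monoˡ p q)

  *-mono : ∀ {a b c d} → 0ℚ ≤ a → 0ℚ ≤ d → a ≤ b → c ≤ d → a * c ≤ b * d
  *-mono p q r s = ℚ.≤-trans (*-monoˡ p s) (*-monoʳ q r)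

  0≤1 : 0ℚ ≤ 1ℚ
  0≤1 = ℚ.nonNegative⁻¹ 1ℚ

  0<+ : ∀ {a b} → 0ℚ < a → 0ℚ < b → 0ℚ < a + b
  0<+ {a} {b} p q = subst (_< a + b) (+-identityˡ 0ℚ) (+-mono-< p q)

  -0≡0 : - 0ℚ ≡ 0ℚ
  -0≡0 = sym (homo-- 0ℚ)

  0≤neg : ∀ {a} → a ≤ 0ℚ → 0ℚ ≤ - a
  0≤neg p = ≡≤ (sym -0≡0) (neg-antimono-≤ p)

  neg≤0 : ∀ {a} → 0ℚ ≤ a → - a ≤ 0ℚ
  neg≤0 p = ≤≡ (neg-antimono-≤ p) -0≡0

  0≤sq : ∀ a → 0ℚ ≤ a * a
  0≤sq a with ℚ.≤-total 0ℚ a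
  ... | inj₁ p = 0≤* p p
  ... | inj₂ p = ≤≡ (0≤* (0≤neg p) (0≤neg p)) (solve 1 (λ a → (:- a) :* (:- a) := a :* a) refl a)

  ∣∣≤ : ∀ {a c} → a ≤ c → - a ≤ c → ∣ a ∣ ≤ c
  ∣∣≤ {a} p q with ∣p∣≡p∨∣p∣≡-p a
  ... | inj₁ e = ≡≤ e p
  ... | inj₂ e = ≡≤ e q

  a≤∣a∣ : ∀ a → a ≤ ∣ a ∣
  a≤∣a∣ a with ℚ.≤-total 0ℚ a
  ... | inj₁ p = ℚ.≤-reflexive (sym (0≤p⇒∣p∣≡p p))
  ... | inj₂ p = ℚ.≤-trans p (0≤∣p∣ a)

  -a≤∣a∣ : ∀ a → - a ≤ ∣ a ∣
  -a≤∣a∣ a = ≤≡ (a≤∣a∣ (- a)) (∣-p∣≡∣p∣ a)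

  ∣∣-sym : ∀ a b → ∣ a - b ∣ ≡ ∣ b - a ∣
  ∣∣-sym a b = trans (sym (∣-p∣≡∣p∣ (a - b))) (cong ∣_∣ (solve 2 (λ a b → :- (a :- b) := b :- a) refl a b))

  ∣∣-tri : ∀ {a b c d e} → ∣ a - b ∣ ≤ d → ∣ b - c ∣ ≤ e → ∣ a - c ∣ ≤ d + e
  ∣∣-tri {a} {b} {c} p q = ℚ.≤-trans
    (≡≤ (cong ∣_∣ (solve 3 (λ a b c → a :- c := (a :- b) :+ (b :- c)) refl a b c)) (∣p+q∣≤∣p∣+∣q∣ (a - b) (b - c)))
    (+-mono-≤ p q)

  near⇒≤ : ∀ {a b e} → ∣ a - b ∣ ≤ e → a ≤ b + e
  near⇒≤ {a} {b} {e} p = ≡≤ (solve 2 (λ a b → a := b :+ (a :- b)) refl a b)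
    (+-monoʳ-≤ b (ℚ.≤-trans (a≤∣a∣ (a - b)) p))

  near⇒≥ : ∀ {a b e} → ∣ a - b ∣ ≤ e → b ≤ a + e
  near⇒≥ {a} {b} p = near⇒≤ (≡≤ (∣∣-sym b a) p)

  ∣*∣≤ : ∀ {a b c} → ∣ a ∣ ≤ c → ∣ b ∣ ≤ 1ℚ → ∣ a * b ∣ ≤ c
  ∣*∣≤ {a} {b} {c} p q = ≡≤ (∣p*q∣≡∣p∣*∣q∣ a b)
    (≤≡ (*-mono (0≤∣p∣ a) 0≤1 p q) (*-identityʳ c))

  ∣*∣≤′ : ∀ {a b c} → ∣ a ∣ ≤ 1ℚ → ∣ b ∣ ≤ c → ∣ a * b ∣ ≤ c
  ∣*∣≤′ {a} {b} p q = ≡≤ (cong ∣_∣ (*-comm a b)) (∣*∣≤ q p)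

  ∣a∣≤c⇒a≤c : ∀ {a c} → ∣ a ∣ ≤ c → a ≤ c
  ∣a∣≤c⇒a≤c {a} p = ℚ.≤-trans (a≤∣a∣ a) p

  unit⇒∣∣ : ∀ {a} → 0ℚ ≤ a → a ≤ 1ℚ → ∣ a ∣ ≤ 1ℚ
  unit⇒∣∣ p q = ≡≤ (0≤p⇒∣p∣≡p p) q

  unit-diff : ∀ {a b} → 0ℚ ≤ a → a ≤ 1ℚ → 0ℚ ≤ b → b ≤ 1ℚ → ∣ a - b ∣ ≤ 1ℚ
  unit-diff {a} {b} p q r s = ∣∣≤
    (ℚ.≤-trans (≤≡ (+-monoʳ-≤ a (neg≤0 r)) (+-identityʳ a)) q)
    (≡≤ (solve 2 (λ a b → :- (a :- b) := b :- a) refl a b)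
      (ℚ.≤-trans (≤≡ (+-monoʳ-≤ b (neg≤0 p)) (+-identityʳ b)) s))

  -- Natural numbers and their reciprocals in ℚ

  ι : ℕ → ℚ
  ι zero = 0ℚ
  ι (suc n) = 1ℚ + ι n

  0≤ι : ∀ n → 0ℚ ≤ ι n
  0≤ι zero = ℚ.≤-refl
  0≤ι (suc n) = 0≤+ 0≤1 (0≤ι n)

  0<ι : ∀ n .{{_ : NonZero n}} → 0ℚ < ι n
  0<ι (suc n) = subst (_< 1ℚ + ι n) (+-identityˡ 0ℚ) (+-mono-<-≤ (ℚ.positive⁻¹ 1ℚ) (0≤ι n))

  -- inv 0 = 0
  inv : ℕ → ℚ
  inv zero = 0ℚ
  inv (suc n) = (1/ ι (suc n)) (0<ι (suc n))

  ι*inv : ∀ n .{{_ : NonZero n}} → ι n * inv n ≡ 1ℚ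
  ι*inv (suc n) = *-inverse (ι (suc n)) (0<ι (suc n))

  0<inv : ∀ n .{{_ : NonZero n}} → 0ℚ < inv n
  0<inv (suc n) = 0<1/ (ι (suc n)) (0<ι (suc n))

  0≤inv : ∀ n → 0ℚ ≤ inv n
  0≤inv zero = ℚ.≤-refl
  0≤inv (suc n) = ℚ.<⇒≤ (0<inv (suc n))

  ι-+ : ∀ m n → ι (m ℕ.+ n) ≡ ι m + ι n
  ι-+ zero n = sym (+-identityˡ (ι n))
  ι-+ (suc m) n = trans (cong₂ _+_ refl (ι-+ m n)) (sym (+-assoc 1ℚ (ι m) (ι n)))

  ι-* : ∀ m n → ι (m ℕ.* n) ≡ ι m * ι n
  ι-* zero n = sym (*-zeroˡ (ι n))
  ι-* (suc m) n = trans (ι-+ n (m ℕ.* n)) (trans (cong₂ _+_ refl (ι-* m n))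
    (solve 2 (λ a b → b :+ a :* b := (con 1ℚ :+ a) :* b) refl (ι m) (ι n)))

  ι-mono : ∀ {m n} → m ℕ.≤ n → ι m ≤ ι n
  ι-mono {n = n} ℕ.z≤n = 0≤ι n
  ι-mono (ℕ.s≤s p) = +-monoʳ-≤ 1ℚ (ι-mono p)

  ι-cancel : ∀ {m n} → ι m ≤ ι n → m ℕ.≤ n
  ι-cancel {zero} p = ℕ.z≤n
  ι-cancel {suc m} {zero} p = ⊥-elim (ℚ.<-irrefl refl (ℚ.<-≤-trans (0<ι (suc m)) p))
  ι-cancel {suc m} {suc n} p = ℕ.s≤s (ι-cancel (≡≤ (e m) (≤≡ (+-monoˡ-≤ (- 1ℚ) p) (sym (e n)))))
    where
      e : ∀ k → ι k ≡ (1ℚ + ι k) + (- 1ℚ)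
      e k = solve 1 (λ a → a := (con 1ℚ :+ a) :+ (:- con 1ℚ)) refl (ι k)

  -- The bridge from size conditions in ℕ to error bounds in ℚ: multiplying by k n leaves an
  -- inequality between naturals.
  ι*inv≤inv : ∀ a n k .{{_ : NonZero n}} .{{_ : NonZero k}} → a ℕ.* k ℕ.≤ n → ι a * inv n ≤ inv k
  ι*inv≤inv a n k p = *-cancelˡ (0<* (0<ι k) (0<ι n))
    (≡≤ (trans (solve 4 (λ k n a i → (k :* n) :* (a :* i) := (a :* k) :* (n :* i)) refl (ι k) (ι n) (ι a) (inv n))
          (trans (cong ((ι a * ι k) *_) (ι*inv n)) (trans (*-identityʳ _) (sym (ι-* a k)))))
      (≤≡ (ι-mono p) (sym (trans (solve 3 (λ k n i → (k :* n) :* i := n :* (k :* i)) refl (ι k) (ι n) (inv k))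
          (trans (cong (ι n *_) (ι*inv k)) (*-identityʳ (ι n)))))))

  inv-anti : ∀ n k .{{_ : NonZero n}} .{{_ : NonZero k}} → k ℕ.≤ n → inv n ≤ inv k
  inv-anti n k p = ≡≤ (solve 1 (λ a → a := (con 1ℚ :+ con 0ℚ) :* a) refl (inv n)) (ι*inv≤inv 1 n k (subst (ℕ._≤ n) (sym (trans (ℕ.+-identityʳ k) refl)) p))


  inv-* : ∀ m n .{{_ : NonZero m}} .{{_ : NonZero n}} .{{_ : NonZero (m ℕ.* n)}} → inv (m ℕ.* n) ≡ inv m * inv n
  inv-* m n = trans (sym (*-identityʳ _)) (trans (cong (inv (m ℕ.* n) *_) (sym e))
    (trans (solve 3 (λ a b c → a :* (b :* c) := (b :* a) :* c) refl (inv (m ℕ.* n)) (ι (m ℕ.* n)) (inv m * inv n))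
    (trans (cong (_* (inv m * inv n)) (ι*inv (m ℕ.* n))) (*-identityˡ _))))
    where
      e : ι (m ℕ.* n) * (inv m * inv n) ≡ 1ℚ
      e = trans (cong (_* (inv m * inv n)) (ι-* m n))
          (trans (solve 4 (λ a b c d → (a :* b) :* (c :* d) := (a :* c) :* (b :* d)) refl (ι m) (ι n) (inv m) (inv n))
          (trans (cong₂ _*_ (ι*inv m) (ι*inv n)) (*-identityʳ 1ℚ)))

  -- Means and averaging operators

  record Mean (Y : Set) : Set where
    field
      E : (Y → ℚ) → ℚ
      E-+ : ∀ φ ψ → E (λ y → φ y + ψ y) ≡ E φ + E ψ
      E-* : ∀ c φ → E (λ y → c * φ y) ≡ c * E φ
      E-mono : ∀ {φ ψ} → (∀ y → φ y ≤ ψ y) → E φ ≤ E ψ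
      E-1 : E (λ _ → 1ℚ) ≡ 1ℚ

    -- Monotonicity in both directions gives congruence, so functions under a mean need only agree
    -- pointwise.
    E-cong : ∀ {φ ψ} → (∀ y → φ y ≡ ψ y) → E φ ≡ E ψ
    E-cong p = ℚ.≤-antisym (E-mono (λ y → ℚ.≤-reflexive (p y))) (E-mono (λ y → ℚ.≤-reflexive (sym (p y))))

    E-const : ∀ c → E (λ _ → c) ≡ c
    E-const c = trans (E-cong (λ _ → sym (*-identityʳ c))) (trans (E-* c _) (trans (cong (c *_) E-1) (*-identityʳ c)))

    E-neg : ∀ φ → E (λ y → - φ y) ≡ - E φ
    E-neg φ = trans (E-cong (λ y → neg1 (φ y))) (trans (E-* (- 1ℚ) φ) (sym (neg1 (E φ))))
      where
        neg1 : ∀ a → - a ≡ (- 1ℚ) * a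
        neg1 = solve 1 (λ a → :- a := (:- con 1ℚ) :* a) refl

    E-- : ∀ φ ψ → E (λ y → φ y - ψ y) ≡ E φ - E ψ
    E-- φ ψ = trans (E-+ φ (λ y → - ψ y)) (cong₂ _+_ refl (E-neg ψ))

    E-≤ : ∀ {φ c} → (∀ y → φ y ≤ c) → E φ ≤ c
    E-≤ {c = c} p = ≤≡ (E-mono p) (E-const c)

    E-≥ : ∀ {φ c} → (∀ y → c ≤ φ y) → c ≤ E φ
    E-≥ {c = c} p = ≡≤ (sym (E-const c)) (E-mono p)

    E-∣∣ : ∀ {φ c} → (∀ y → ∣ φ y ∣ ≤ c) → ∣ E φ ∣ ≤ c
    E-∣∣ {φ} {c} p = ∣∣≤ (E-≤ (λ y → ℚ.≤-trans (a≤∣a∣ (φ y)) (p y)))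
      (≡≤ (sym (E-neg φ)) (E-≤ (λ y → ℚ.≤-trans (-a≤∣a∣ (φ y)) (p y))))

    E-near : ∀ {φ ψ e} → (∀ y → ∣ φ y - ψ y ∣ ≤ e) → ∣ E φ - E ψ ∣ ≤ e
    E-near {φ} {ψ} p = ≡≤ (cong ∣_∣ (sym (E-- φ ψ))) (E-∣∣ p)

    E-unit : ∀ {φ} → (∀ y → 0ℚ ≤ φ y) → (∀ y → φ y ≤ 1ℚ) → (0ℚ ≤ E φ) × (E φ ≤ 1ℚ)
    E-unit p q = E-≥ p , E-≤ q

    -- From (s φ - ψ)² ≥ 0 follows 2 s φ ψ ≤ s² φ² + ψ², whose mean is at most 2 s². Prescribing s
    -- avoids square roots, which need not exist in ℚ; for this reason every later threshold comes
    -- with a bound by its square.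
    cauchy-schwarz : ∀ (φ ψ : Y → ℚ) {s} → 0ℚ < s → E (λ y → φ y * φ y) ≤ 1ℚ → E (λ y → ψ y * ψ y) ≤ s * s →
      E (λ y → φ y * ψ y) ≤ s
    cauchy-schwarz φ ψ {s} 0<s p q = *-cancelˡ (0<+ 0<s 0<s)
      (≡≤ (sym (E-* (s + s) (λ y → φ y * ψ y))) (ℚ.≤-trans (E-mono pointwise)
        (≡≤ (trans (E-+ (λ y → (s * s) * (φ y * φ y)) (λ y → ψ y * ψ y))
                   (cong (_+ E (λ y → ψ y * ψ y)) (E-* (s * s) (λ y → φ y * φ y))))
          (≤≡ (+-mono-≤ (*-monoˡ (0≤sq s) p) q)
            (solve 1 (λ s → (s :* s) :* con 1ℚ :+ s :* s := (s :+ s) :* s) refl s)))))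
      where
        pointwise : ∀ y → (s + s) * (φ y * ψ y) ≤ (s * s) * (φ y * φ y) + ψ y * ψ y
        pointwise y = 0≤b-a⇒a≤b {(s + s) * (φ y * ψ y)} {(s * s) * (φ y * φ y) + ψ y * ψ y} (≤≡ (0≤sq (s * φ y - ψ y))
          (solve 3 (λ s a b → (s :* a :- b) :* (s :* a :- b) := ((s :* s) :* (a :* a) :+ b :* b) :- (s :+ s) :* (a :* b)) refl s (φ y) (ψ y)))

    -- The variance of φ is nonnegative.
    jensen : ∀ (φ : Y → ℚ) → E φ * E φ ≤ E (λ y → φ y * φ y)
    jensen φ = 0≤b-a⇒a≤b (≤≡ (E-≥ (λ y → 0≤sq (φ y - c))) eq)
      where
        c = E φ
        eq : E (λ y → (φ y - c) * (φ y - c)) ≡ E (λ y → φ y * φ y) - c * c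
        eq = begin
          E (λ y → (φ y - c) * (φ y - c))
            ≡⟨ E-cong (λ y → solve 2 (λ a c → (a :- c) :* (a :- c) := a :* a :+ ((:- (c :+ c)) :* a :+ c :* c)) refl (φ y) c) ⟩
          E (λ y → φ y * φ y + ((- (c + c)) * φ y + c * c))
            ≡⟨ E-+ _ _ ⟩
          E (λ y → φ y * φ y) + E (λ y → (- (c + c)) * φ y + c * c)
            ≡⟨ cong₂ _+_ refl (trans (E-+ _ _) (cong₂ _+_ (E-* _ φ) (E-const (c * c)))) ⟩
          E (λ y → φ y * φ y) + ((- (c + c)) * c + c * c)
            ≡⟨ solve 2 (λ a c → a :+ ((:- (c :+ c)) :* c :+ c :* c) := a :- c :* c) refl (E (λ y → φ y * φ y)) c ⟩
          E (λ y → φ y * φ y) - c * c ∎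
          where open ≡-Reasoning

  open Mean public

  -- Index means commute with every mean; only finite averages will be used.
  record FMean (I : Set) : Set₁ where
    field
      mean : Mean I
      swap : ∀ {Y} (μ : Mean Y) (φ : I → Y → ℚ) →
        E μ (λ y → E mean (λ i → φ i y)) ≡ E mean (λ i → E μ (φ i))

  open FMean public

  -- Finite sums, uniform averages and shifts of blocks

  ∑ : ∀ {n} → (Fin n → ℚ) → ℚ
  ∑ {zero} φ = 0ℚ
  ∑ {suc n} φ = φ Fin.zero + ∑ (λ i → φ (Fin.suc i))

  ∑-+ : ∀ {n} (φ ψ : Fin n → ℚ) → ∑ (λ y → φ y + ψ y) ≡ ∑ φ + ∑ ψ
  ∑-+ {zero} φ ψ = sym (+-identityˡ 0ℚ)
  ∑-+ {suc n} φ ψ = trans (cong₂ _+_ refl (∑-+ (λ i → φ (Fin.suc i)) (λ i → ψ (Fin.suc i))))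
    (solve 4 (λ a b c d → (a :+ b) :+ (c :+ d) := (a :+ c) :+ (b :+ d)) refl (φ Fin.zero) (ψ Fin.zero) _ _)

  ∑-* : ∀ {n} c (φ : Fin n → ℚ) → ∑ (λ y → c * φ y) ≡ c * ∑ φ
  ∑-* {zero} c φ = sym (*-zeroʳ c)
  ∑-* {suc n} c φ = trans (cong₂ _+_ refl (∑-* c (λ i → φ (Fin.suc i)))) (sym (*-distribˡ-+ c _ _))

  ∑-mono : ∀ {n} {φ ψ : Fin n → ℚ} → (∀ y → φ y ≤ ψ y) → ∑ φ ≤ ∑ ψ
  ∑-mono {zero} p = ℚ.≤-refl
  ∑-mono {suc n} p = +-mono-≤ (p Fin.zero) (∑-mono (λ i → p (Fin.suc i)))

  ∑-1 : ∀ n → ∑ {n} (λ _ → 1ℚ) ≡ ι n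
  ∑-1 zero = refl
  ∑-1 (suc n) = cong₂ _+_ refl (∑-1 n)

  ∑-swap : ∀ {n Y} (μ : Mean Y) (φ : Fin n → Y → ℚ) → E μ (λ y → ∑ (λ i → φ i y)) ≡ ∑ (λ i → E μ (φ i))
  ∑-swap {zero} μ φ = E-const μ 0ℚ
  ∑-swap {suc n} μ φ = trans (E-+ μ (φ Fin.zero) _) (cong₂ _+_ refl (∑-swap μ (λ i → φ (Fin.suc i))))

  -- The laws are kept opaque: otherwise comparing two averages would compare their proofs.
  opaque
    avg-+ : ∀ n .{{_ : NonZero n}} (φ ψ : Fin n → ℚ) → inv n * ∑ (λ i → φ i + ψ i) ≡ inv n * ∑ φ + inv n * ∑ ψ
    avg-+ n φ ψ = trans (cong (inv n *_) (∑-+ φ ψ)) (*-distribˡ-+ (inv n) _ _)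

    avg-* : ∀ n .{{_ : NonZero n}} c (φ : Fin n → ℚ) → inv n * ∑ (λ i → c * φ i) ≡ c * (inv n * ∑ φ)
    avg-* n c φ = trans (cong (inv n *_) (∑-* c φ)) (solve 3 (λ a b c → a :* (b :* c) := b :* (a :* c)) refl (inv n) c (∑ φ))

    avg-mono : ∀ n .{{_ : NonZero n}} {φ ψ : Fin n → ℚ} → (∀ i → φ i ≤ ψ i) → inv n * ∑ φ ≤ inv n * ∑ ψ
    avg-mono n p = *-monoˡ (0≤inv n) (∑-mono p)

    avg-1 : ∀ n .{{_ : NonZero n}} → inv n * ∑ {n} (λ _ → 1ℚ) ≡ 1ℚ
    avg-1 n = trans (cong (inv n *_) (∑-1 n)) (trans (*-comm (inv n) (ι n)) (ι*inv n))

    avg-swap : ∀ n .{{_ : NonZero n}} {Y} (μ : Mean Y) (φ : Fin n → Y → ℚ) →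
      E μ (λ y → inv n * ∑ (λ i → φ i y)) ≡ inv n * ∑ (λ i → E μ (φ i))
    avg-swap n μ φ = trans (E-* μ (inv n) _) (cong (inv n *_) (∑-swap μ φ))

  avg : ∀ n .{{_ : NonZero n}} → FMean (Fin n)
  avg n = record
    { mean = record { E = λ φ → inv n * ∑ φ ; E-+ = avg-+ n ; E-* = avg-* n ; E-mono = avg-mono n ; E-1 = avg-1 n }
    ; swap = avg-swap n
    }

  opaque
    ⊗-+ : ∀ {Y Z} (μ : Mean Y) (ν : Mean Z) (φ ψ : Y × Z → ℚ) → E μ (λ y → E ν (λ z → φ (y , z) + ψ (y , z))) ≡
      E μ (λ y → E ν (λ z → φ (y , z))) + E μ (λ y → E ν (λ z → ψ (y , z)))
    ⊗-+ μ ν φ ψ = trans (E-cong μ (λ y → E-+ ν _ _)) (E-+ μ _ _)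

    ⊗-* : ∀ {Y Z} (μ : Mean Y) (ν : Mean Z) c (φ : Y × Z → ℚ) → E μ (λ y → E ν (λ z → c * φ (y , z))) ≡ c * E μ (λ y → E ν (λ z → φ (y , z)))
    ⊗-* μ ν c φ = trans (E-cong μ (λ y → E-* ν c _)) (E-* μ c _)

    ⊗-1 : ∀ {Y Z} (μ : Mean Y) (ν : Mean Z) → E μ (λ _ → E ν (λ _ → 1ℚ)) ≡ 1ℚ
    ⊗-1 μ ν = trans (E-cong μ (λ y → E-1 ν)) (E-1 μ)

  infixr 4 _⊗_
  _⊗_ : ∀ {Y Z} → Mean Y → Mean Z → Mean (Y × Z)
  μ ⊗ ν = record
    { E = λ φ → E μ (λ y → E ν (λ z → φ (y , z)))
    ; E-+ = ⊗-+ μ ν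
    ; E-* = ⊗-* μ ν
    ; E-mono = λ p → E-mono μ (λ y → E-mono ν (λ z → p (y , z)))
    ; E-1 = ⊗-1 μ ν
    }

  opaque
    ⊠-swap : ∀ {I J} (μ : FMean I) (ν : FMean J) {Y} (ρ : Mean Y) (φ : I × J → Y → ℚ) →
      E ρ (λ y → E (mean μ ⊗ mean ν) (λ i → φ i y)) ≡ E (mean μ ⊗ mean ν) (λ i → E ρ (φ i))
    ⊠-swap μ ν ρ φ = trans (swap μ ρ (λ i y → E (mean ν) (λ j → φ (i , j) y)))
        (E-cong (mean μ) (λ i → swap ν ρ (λ j → φ (i , j))))

  infixr 4 _⊠_
  _⊠_ : ∀ {I J} → FMean I → FMean J → FMean (I × J)
  μ ⊠ ν = record { mean = mean μ ⊗ mean ν ; swap = ⊠-swap μ ν }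

  ∑-δ : ∀ {n} (i : Fin n) c → ∃[ φ ] (∑ φ ≡ c) × (φ i ≡ c) × (∀ (j : Fin n) → i ≢ j → φ j ≡ 0ℚ)
  ∑-δ {suc n} Fin.zero c = φ , trans (cong₂ _+_ refl (z n)) (+-identityʳ c) , refl , off
    where
      φ : Fin (suc n) → ℚ
      φ Fin.zero = c
      φ (Fin.suc j) = 0ℚ
      z : ∀ n → ∑ {n} (λ _ → 0ℚ) ≡ 0ℚ
      z zero = refl
      z (suc n) = trans (+-identityˡ _) (z n)
      off : ∀ j → Fin.zero ≢ j → φ j ≡ 0ℚ
      off Fin.zero p = ⊥-elim (p refl)
      off (Fin.suc j) p = refl
  ∑-δ {suc n} (Fin.suc i) c with ∑-δ i c
  ... | φ , s , d , o = ψ , trans (+-identityˡ _) s , d , off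
    where
      ψ : Fin (suc n) → ℚ
      ψ Fin.zero = 0ℚ
      ψ (Fin.suc j) = φ j
      off : ∀ j → Fin.suc i ≢ j → ψ j ≡ 0ℚ
      off Fin.zero p = refl
      off (Fin.suc j) p = o j (λ e → p (cong Fin.suc e))

  -- φ lies below a point mass at i plus the constant s, and the point mass has mean 1 / K.
  offdiag₁ : ∀ {K} .{{_ : NonZero K}} (i : Fin K) (φ : Fin K → ℚ) {s} → 0ℚ ≤ s →
    φ i ≤ 1ℚ → (∀ j → i ≢ j → φ j ≤ s) → E (mean (avg K)) φ ≤ inv K + s
  offdiag₁ {K} i φ {s} 0≤s d o with ∑-δ i 1ℚ
  ... | δ , sδ , δi , δj = ℚ.≤-trans (E-mono (mean (avg K)) {φ} {λ j → δ j + s} bound)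
      (ℚ.≤-reflexive (trans (E-+ (mean (avg K)) δ (λ _ → s))
        (cong₂ _+_ (trans (cong (inv K *_) sδ) (*-identityʳ (inv K))) (E-const (mean (avg K)) s))))
    where
      bound : ∀ j → φ j ≤ δ j + s
      bound j with i Fin.≟ j
      ... | yes refl = ℚ.≤-trans d (≡≤ (sym δi) (≡≤ (sym (+-identityʳ (δ i))) (+-monoʳ-≤ (δ i) 0≤s)))
      ... | no i≢j = ℚ.≤-trans (o j i≢j) (≡≤ (sym (+-identityˡ s)) (+-monoˡ-≤ s (ℚ.≤-reflexive (sym (δj j i≢j)))))

  offdiag : ∀ {K} .{{_ : NonZero K}} (φ : Fin K → Fin K → ℚ) {s} → 0ℚ ≤ s →
    (∀ i → φ i i ≤ 1ℚ) → (∀ i j → i ≢ j → φ i j ≤ s) →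
    E (mean (avg K)) (λ i → E (mean (avg K)) (φ i)) ≤ inv K + s
  offdiag {K} φ 0≤s d o = E-≤ (mean (avg K)) (λ i → offdiag₁ i (φ i) 0≤s (d i) (o i))

  -- Sliding a block by one place trades its first term for a new last one. Stated without
  -- subtraction, this serves twice: for approximate invariance of averages over blocks, and for
  -- exact invariance on a torus, where both end terms coincide.
  ∑-near-cyclic : ∀ n (φ : ℤ → ℚ) z → ∑ {n} (λ i → φ (z ℤ.+ ℤ.+ suc (toℕ i))) + φ (z ℤ.+ ℤ.+ 0) ≡
    ∑ {n} (λ i → φ (z ℤ.+ ℤ.+ toℕ i)) + φ (z ℤ.+ ℤ.+ n)
  ∑-near-cyclic zero φ z = refl
  ∑-near-cyclic (suc n) φ z = begin
    (a + s) + b ≡⟨ solve 3 (λ a s b → (a :+ s) :+ b := (s :+ a) :+ b) refl a s b ⟩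
    (s + a) + b ≡⟨ cong (_+ b) ih ⟩
    (t + c) + b ≡⟨ solve 3 (λ t c b → (t :+ c) :+ b := (b :+ t) :+ c) refl t c b ⟩
    (b + t) + c ∎
    where
      open ≡-Reasoning
      import Data.Integer.Properties as ℤ
      sh : ∀ m → (z ℤ.+ ℤ.+ 1) ℤ.+ ℤ.+ m ≡ z ℤ.+ ℤ.+ suc m
      sh m = ℤ.+-assoc z (ℤ.+ 1) (ℤ.+ m)
      a = φ (z ℤ.+ ℤ.+ 1)
      b = φ (z ℤ.+ ℤ.+ 0)
      c = φ (z ℤ.+ ℤ.+ suc n)
      s = ∑ {n} (λ i → φ (z ℤ.+ ℤ.+ suc (suc (toℕ i))))
      t = ∑ {n} (λ i → φ (z ℤ.+ ℤ.+ suc (toℕ i)))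
      cg : ∀ {m} {f g : Fin m → ℚ} → (∀ i → f i ≡ g i) → ∑ f ≡ ∑ g
      cg {zero} p = refl
      cg {suc m} p = cong₂ _+_ (p Fin.zero) (cg (λ i → p (Fin.suc i)))
      ih : s + a ≡ t + c
      ih = trans (cong₂ _+_ (cg {n} (λ i → sym (cong φ (sh (suc (toℕ i)))))) (sym (cong φ (sh 0))))
        (trans (∑-near-cyclic n φ (z ℤ.+ ℤ.+ 1)) (cong₂ _+_ (cg {n} (λ i → cong φ (sh (toℕ i)))) (cong φ (sh n))))


  ∑-cong : ∀ {n} {φ ψ : Fin n → ℚ} → (∀ i → φ i ≡ ψ i) → ∑ φ ≡ ∑ ψ
  ∑-cong {zero} p = refl
  ∑-cong {suc n} p = cong₂ _+_ (p Fin.zero) (∑-cong (λ i → p (Fin.suc i)))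

  module _ {n : ℕ} .{{_ : NonZero n}} (φ : ℤ → ℚ) (φ≤1 : ∀ z → ∣ φ z ∣ ≤ 1ℚ) where

    private
      A : ℤ → ℚ
      A z = E (mean (avg n)) (λ i → φ (z ℤ.+ + toℕ i))

      step : ∀ z → ∣ A (z ℤ.+ + 1) - A z ∣ ≤ ι 2 * inv n
      step z = ≡≤ (cong ∣_∣ eq) (≡≤ (∣p*q∣≡∣p∣*∣q∣ (inv n) _)
        (≡≤ (cong (_* ∣ φ (z ℤ.+ + n) - φ (z ℤ.+ + 0) ∣) (0≤p⇒∣p∣≡p (0≤inv n)))
          (≤≡ (*-monoˡ (0≤inv n) two) (*-comm (inv n) (ι 2)))))
        where
          two : ∣ φ (z ℤ.+ + n) - φ (z ℤ.+ + 0) ∣ ≤ ι 2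
          two = ℚ.≤-trans (∣p+q∣≤∣p∣+∣q∣ _ _) (≤≡ (+-mono-≤ (φ≤1 _) (≡≤ (∣-p∣≡∣p∣ _) (φ≤1 _)))
            (solve 0 (con 1ℚ :+ con 1ℚ := con 1ℚ :+ (con 1ℚ :+ con 0ℚ)) refl))
          s = ∑ {n} (λ i → φ (z ℤ.+ + suc (toℕ i)))
          t = ∑ {n} (λ i → φ (z ℤ.+ + toℕ i))
          eq : A (z ℤ.+ + 1) - A z ≡ inv n * (φ (z ℤ.+ + n) - φ (z ℤ.+ + 0))
          eq = begin
            inv n * ∑ {n} (λ i → φ ((z ℤ.+ + 1) ℤ.+ + toℕ i)) - inv n * t
              ≡⟨ cong (λ r → inv n * r - inv n * t) (∑-cong {n} (λ i → cong φ (ℤ.+-assoc z (+ 1) (+ toℕ i)))) ⟩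
            inv n * s - inv n * t
              ≡⟨ solve 4 (λ i s t b → i :* s :- i :* t := i :* ((s :+ b) :- b :- t)) refl (inv n) s t (φ (z ℤ.+ + 0)) ⟩
            inv n * ((s + φ (z ℤ.+ + 0)) - φ (z ℤ.+ + 0) - t)
              ≡⟨ cong (λ r → inv n * (r - φ (z ℤ.+ + 0) - t)) (∑-near-cyclic n φ z) ⟩
            inv n * ((t + φ (z ℤ.+ + n)) - φ (z ℤ.+ + 0) - t)
              ≡⟨ solve 4 (λ i t b c → i :* ((t :+ c) :- b :- t) := i :* (c :- b)) refl (inv n) t (φ (z ℤ.+ + 0)) (φ (z ℤ.+ + n)) ⟩
            inv n * (φ (z ℤ.+ + n) - φ (z ℤ.+ + 0)) ∎
            where open ≡-Reasoning

      steps : ∀ k z → ∣ A (z ℤ.+ + k) - A z ∣ ≤ ι (2 ℕ.* k) * inv n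
      steps zero z = ≡≤ (trans (cong (λ w → ∣ A w - A z ∣) (ℤ.+-identityʳ z)) (trans (cong ∣_∣ (+-inverseʳ (A z))) (0≤p⇒∣p∣≡p ℚ.≤-refl)))
        (0≤* (0≤ι (2 ℕ.* zero)) (0≤inv n))
      steps (suc k) z = ≤≡ (∣∣-tri {A (z ℤ.+ + suc k)} {A (z ℤ.+ + 1)} {A z}
          (≡≤ (cong (λ w → ∣ A w - A (z ℤ.+ + 1) ∣) (sym (ℤ.+-assoc z (+ 1) (+ k)))) (steps k (z ℤ.+ + 1))) (step z))
        (trans (solve 3 (λ a b i → a :* i :+ b :* i := (b :+ a) :* i) refl (ι (2 ℕ.* k)) (ι 2) (inv n))
          (cong (_* inv n) (trans (sym (ι-+ 2 (2 ℕ.* k))) (cong ι (sym (ℕ.*-suc 2 k))))))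

    -- Each unit step replaces one value out of n, a change of at most 2 / n, and |z| steps add up.
    avg-shift : ∀ z → ∣ A z - A (+ 0) ∣ ≤ ι (2 ℕ.* ℤ.∣ z ∣) * inv n
    avg-shift (+ k) = ≡≤ (cong (λ w → ∣ A w - A (+ 0) ∣) (sym (ℤ.+-identityˡ (+ k)))) (steps k (+ 0))
    -- A negative shift is undone by k + 1 positive steps from z to 0.
    avg-shift z@(-[1+ k ]) = ≡≤ (∣∣-sym (A z) (A (+ 0)))
      (≡≤ (cong (λ w → ∣ A w - A z ∣) (sym (ℤ.+-inverseˡ (+ suc k)))) (steps (suc k) z))

    -- The form in which all invariance is obtained later: a block much longer than 2 |z| hardly
    -- notices a shift by z.
    avg-shift′ : ∀ z Θ .{{_ : NonZero Θ}} → 2 ℕ.* ℤ.∣ z ∣ ℕ.* Θ ℕ.≤ n →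
      ∣ E (mean (avg n)) (λ i → φ (+ toℕ i ℤ.+ z)) - E (mean (avg n)) (λ i → φ (+ toℕ i)) ∣ ≤ inv Θ
    avg-shift′ z Θ p = ≡≤ (cong₂ (λ a b → ∣ a - b ∣)
        (E-cong (mean (avg n)) (λ i → cong φ (ℤ.+-comm (+ toℕ i) z)))
        (E-cong (mean (avg n)) (λ i → cong φ (sym (ℤ.+-identityˡ (+ toℕ i))))))
      (ℚ.≤-trans (avg-shift z) (ι*inv≤inv (2 ℕ.* ℤ.∣ z ∣) n Θ p))

  sq-expand : ∀ {I Y} (μ : FMean I) (ν : Mean Y) (φ : I → Y → ℚ) →
    E ν (λ y → E (mean μ) (λ i → φ i y) * E (mean μ) (λ i → φ i y)) ≡
    E (mean μ) (λ i → E (mean μ) (λ j → E ν (λ y → φ i y * φ j y)))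
  sq-expand μ ν φ = trans (E-cong ν (λ y → trans (*-comm _ _) (trans (sym (E-* (mean μ) _ (λ i → φ i y)))
      (E-cong (mean μ) (λ i → trans (*-comm _ _) (sym (E-* (mean μ) (φ i y) (λ j → φ j y))))))))
    (trans (swap μ ν (λ i y → E (mean μ) (λ j → φ i y * φ j y)))
      (E-cong (mean μ) (λ i → swap μ ν (λ j y → φ i y * φ j y))))

  -- Measure-preserving actions of ℤ² and their averaging operators

  record System : Set₁ where
    field
      X : Set
      act : ℤ → ℤ → X → X
      act-0 : ∀ x → act (+ 0) (+ 0) x ≡ x
      act-+ : ∀ a b c d x → act a b (act c d x) ≡ act (a ℤ.+ c) (b ℤ.+ d) x
      𝔼 : Mean X
      𝔼-act : ∀ a b F → E 𝔼 (λ x → F (act a b x)) ≡ E 𝔼 F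

  -- An averaging operator: the displacements (u i , v i) averaged over i.
  record Op : Set₁ where
    field
      {Ix} : Set
      μ : FMean Ix
      u v : Ix → ℤ

  open Op public

  infixr 9 _∘_
  _∘_ : Op → Op → Op
  A ∘ B = record { μ = μ A ⊠ μ B ; u = λ { (i , j) → u B j ℤ.+ u A i } ; v = λ { (i , j) → v B j ℤ.+ v A i } }

  adj : Op → Op
  adj A = record { μ = μ A ; u = λ i → ℤ.- u A i ; v = λ i → ℤ.- v A i }

  -- A* A plays the role of a conditional expectation: it is symmetric and ⟨F , A* A F⟩ = ‖A F‖²,
  -- neither of which holds in general for the one-sided average A.
  sq : Op → Op
  sq A = adj A ∘ A

  -- Invariance is tested on functions of the displacement in ℤ² and not on X. One proof then serves
  -- every system, in particular the torus and its product with a space of index pairs.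
  Inv : Op → ℤ → ℤ → ℚ → Set
  Inv B a b e = ∀ (φ : ℤ → ℤ → ℚ) → (∀ s t → ∣ φ s t ∣ ≤ 1ℚ) →
    ∣ E (mean (μ B)) (λ j → φ (u B j ℤ.+ a) (v B j ℤ.+ b)) - E (mean (μ B)) (λ j → φ (u B j) (v B j)) ∣ ≤ e

  -- Expresses that the displacements of A are short compared with the averaging of B, so that A (B
  -- F) ≈ B F for bounded F.
  Fine : Op → Op → ℚ → Set
  Fine A B e = ∀ i → Inv B (u A i) (v A i) e

  +-swap : ∀ a b c → (a ℤ.+ b) ℤ.+ c ≡ (a ℤ.+ c) ℤ.+ b
  +-swap a b c = trans (ℤ.+-assoc a b c) (trans (cong (λ w → a ℤ.+ w) (ℤ.+-comm b c)) (sym (ℤ.+-assoc a c b)))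

  Inv-∘ʳ : ∀ A B {a b e} → Inv B a b e → Inv (A ∘ B) a b e
  Inv-∘ʳ A B {a} {b} p φ φ≤1 = E-near (mean (μ A)) (λ i →
    ≡≤ (cong (λ w → ∣ w - E (mean (μ B)) (λ j → φ (u B j ℤ.+ u A i) (v B j ℤ.+ v A i)) ∣)
         (E-cong (mean (μ B)) (λ j → cong₂ φ (+-swap (u B j) (u A i) a) (+-swap (v B j) (v A i) b))))
       (p (λ s t → φ (s ℤ.+ u A i) (t ℤ.+ v A i)) (λ _ _ → φ≤1 _ _)))

  -- Displacements add commutatively, so the average over A may be taken innermost.
  Inv-∘ˡ : ∀ A B {a b e} → Inv A a b e → Inv (A ∘ B) a b e
  Inv-∘ˡ A B {a} {b} p φ φ≤1 = ≡≤ (cong₂ (λ x y → ∣ x - y ∣)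
      (swap (μ B) (mean (μ A)) (λ j i → φ ((u B j ℤ.+ u A i) ℤ.+ a) ((v B j ℤ.+ v A i) ℤ.+ b)))
      (swap (μ B) (mean (μ A)) (λ j i → φ (u B j ℤ.+ u A i) (v B j ℤ.+ v A i))))
    (E-near (mean (μ B)) (λ j →
      ≡≤ (cong (λ w → ∣ w - E (mean (μ A)) (λ i → φ (u B j ℤ.+ u A i) (v B j ℤ.+ v A i)) ∣)
           (E-cong (mean (μ A)) (λ i → cong₂ φ (ℤ.+-assoc (u B j) (u A i) a) (ℤ.+-assoc (v B j) (v A i) b))))
         (p (λ s t → φ (u B j ℤ.+ s) (v B j ℤ.+ t)) (λ _ _ → φ≤1 _ _))))

  Inv-+ : ∀ B {a b a′ b′ e e′} → Inv B a b e → Inv B a′ b′ e′ → Inv B (a ℤ.+ a′) (b ℤ.+ b′) (e + e′)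
  Inv-+ B {a} {b} {a′} {b′} p q φ φ≤1 = ≡≤ (cong (λ w → ∣ w - E (mean (μ B)) (λ j → φ (u B j) (v B j)) ∣)
      (E-cong (mean (μ B)) (λ j → cong₂ φ (r (u B j) a a′) (r (v B j) b b′))))
    (∣∣-tri (p (λ s t → φ (s ℤ.+ a′) (t ℤ.+ b′)) (λ _ _ → φ≤1 _ _)) (q φ φ≤1))
    where
      r : ∀ x y z → x ℤ.+ (y ℤ.+ z) ≡ (x ℤ.+ y) ℤ.+ z
      r x y z = sym (ℤ.+-assoc x y z)

  -- The hypothesis is tested against the function moved back by (a , b), which reverses the shift.
  Inv-neg : ∀ B {a b e} → Inv B a b e → Inv B (ℤ.- a) (ℤ.- b) e
  Inv-neg B {a} {b} p φ φ≤1 = ≡≤ (trans (∣∣-sym _ _) (cong (λ w → ∣ w - E (mean (μ B)) (λ j → φ (u B j ℤ.- a) (v B j ℤ.- b)) ∣)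
      (E-cong (mean (μ B)) (λ j → cong₂ φ (r (u B j) a) (r (v B j) b)))))
    (p (λ s t → φ (s ℤ.- a) (t ℤ.- b)) (λ _ _ → φ≤1 _ _))
    where
      r : ∀ x y → x ≡ (x ℤ.+ y) ℤ.- y
      r x y = sym (trans (ℤ.+-assoc x y (ℤ.- y)) (trans (cong (λ w → x ℤ.+ w) (ℤ.+-inverseʳ y)) (ℤ.+-identityʳ x)))

  module Ops (𝒮 : System) where
    open System 𝒮 public

    Bd : (X → ℚ) → Set
    Bd F = ∀ x → ∣ F x ∣ ≤ 1ℚ

    N : (X → ℚ) → ℚ
    N F = E 𝔼 (λ x → F x * F x)

    ⟨_,_⟩ : (X → ℚ) → (X → ℚ) → ℚ
    ⟨ F , G ⟩ = E 𝔼 (λ x → F x * G x)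

    ⟦_⟧ : Op → (X → ℚ) → X → ℚ
    ⟦ A ⟧ F x = E (mean (μ A)) (λ i → F (act (u A i) (v A i) x))

    Bd-N : ∀ {F} → Bd F → N F ≤ 1ℚ
    Bd-N {F} p = E-≤ 𝔼 (λ x → ∣a∣≤c⇒a≤c (∣*∣≤ (p x) (p x)))

    Bd-⟨⟩ : ∀ {F G} → Bd F → Bd G → ⟨ F , G ⟩ ≤ 1ℚ
    Bd-⟨⟩ p q = E-≤ 𝔼 (λ x → ∣a∣≤c⇒a≤c (∣*∣≤ (p x) (q x)))

    Bd-⟦⟧ : ∀ A {F} → Bd F → Bd (⟦ A ⟧ F)
    Bd-⟦⟧ A p x = E-∣∣ (mean (μ A)) (λ i → p _)

    Unit : (X → ℚ) → Set
    Unit F = ∀ x → (0ℚ ≤ F x) × (F x ≤ 1ℚ)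

    Unit-⟦⟧ : ∀ A {F} → Unit F → Unit (⟦ A ⟧ F)
    Unit-⟦⟧ A p x = E-unit (mean (μ A)) (λ i → proj₁ (p _)) (λ i → proj₂ (p _))

    Unit⇒Bd : ∀ {F} → Unit F → Bd F
    Unit⇒Bd p x = unit⇒∣∣ (proj₁ (p x)) (proj₂ (p x))

    ⟦⟧-- : ∀ A F G x → ⟦ A ⟧ (λ y → F y - G y) x ≡ ⟦ A ⟧ F x - ⟦ A ⟧ G x
    ⟦⟧-- A F G x = E-- (mean (μ A)) _ _

    ⟦⟧-* : ∀ A c F x → ⟦ A ⟧ (λ y → c * F y) x ≡ c * ⟦ A ⟧ F x
    ⟦⟧-* A c F x = E-* (mean (μ A)) c _

    ⟦∘⟧ : ∀ A B F x → ⟦ A ∘ B ⟧ F x ≡ ⟦ A ⟧ (⟦ B ⟧ F) x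
    ⟦∘⟧ A B F x = E-cong (mean (μ A)) (λ i → E-cong (mean (μ B)) (λ j →
      cong F (sym (act-+ (u B j) (v B j) (u A i) (v A i) x))))

    ⟦⟧-comm : ∀ A B F x → ⟦ A ⟧ (⟦ B ⟧ F) x ≡ ⟦ B ⟧ (⟦ A ⟧ F) x
    ⟦⟧-comm A B F x = trans (swap (μ B) (mean (μ A)) (λ j i → F (act (u B j) (v B j) (act (u A i) (v A i) x))))
      (E-cong (mean (μ B)) (λ j → E-cong (mean (μ A)) (λ i → cong F
        (trans (act-+ (u B j) (v B j) (u A i) (v A i) x)
          (trans (cong₂ (λ s t → act s t x) (ℤ.+-comm (u B j) (u A i)) (ℤ.+-comm (v B j) (v A i)))
            (sym (act-+ (u A i) (v A i) (u B j) (v B j) x)))))))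

    ⟨⟩-act : ∀ a b F G → ⟨ (λ x → F (act a b x)) , G ⟩ ≡ ⟨ F , (λ x → G (act (ℤ.- a) (ℤ.- b) x)) ⟩
    ⟨⟩-act a b F G = trans (E-cong 𝔼 (λ x → cong (λ y → F (act a b x) * G y) (sym (back x))))
      (𝔼-act a b (λ x → F x * G (act (ℤ.- a) (ℤ.- b) x)))
      where
        back : ∀ x → act (ℤ.- a) (ℤ.- b) (act a b x) ≡ x
        back x = trans (act-+ _ _ _ _ x) (trans (cong₂ (λ s t → act s t x) (ℤ.+-inverseˡ a) (ℤ.+-inverseˡ b)) (act-0 x))

    adjoint : ∀ A F G → ⟨ ⟦ A ⟧ F , G ⟩ ≡ ⟨ F , ⟦ adj A ⟧ G ⟩
    adjoint A F G = begin
      E 𝔼 (λ x → ⟦ A ⟧ F x * G x)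
        ≡⟨ E-cong 𝔼 (λ x → trans (*-comm _ _) (trans (sym (E-* (mean (μ A)) (G x) _)) (E-cong (mean (μ A)) (λ i → *-comm _ _)))) ⟩
      E 𝔼 (λ x → E (mean (μ A)) (λ i → F (act (u A i) (v A i) x) * G x))
        ≡⟨ swap (μ A) 𝔼 (λ i x → F (act (u A i) (v A i) x) * G x) ⟩
      E (mean (μ A)) (λ i → ⟨ (λ x → F (act (u A i) (v A i) x)) , G ⟩)
        ≡⟨ E-cong (mean (μ A)) (λ i → ⟨⟩-act (u A i) (v A i) F G) ⟩
      E (mean (μ A)) (λ i → E 𝔼 (λ x → F x * G (act (ℤ.- u A i) (ℤ.- v A i) x)))
        ≡⟨ sym (swap (μ A) 𝔼 (λ i x → F x * G (act (ℤ.- u A i) (ℤ.- v A i) x))) ⟩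
      E 𝔼 (λ x → E (mean (μ A)) (λ i → F x * G (act (ℤ.- u A i) (ℤ.- v A i) x)))
        ≡⟨ E-cong 𝔼 (λ x → E-* (mean (μ A)) (F x) _) ⟩
      ⟨ F , ⟦ adj A ⟧ G ⟩ ∎
      where open ≡-Reasoning

    inv-act : ∀ B {a b e} → Inv B a b e → ∀ {F} → Bd F → ∀ x → ∣ ⟦ B ⟧ F (act a b x) - ⟦ B ⟧ F x ∣ ≤ e
    inv-act B {a} {b} p {F} q x = ≡≤ (cong (λ w → ∣ w - ⟦ B ⟧ F x ∣) (E-cong (mean (μ B)) (λ j → cong F (act-+ (u B j) (v B j) a b x))))
      (p (λ s t → F (act s t x)) (λ _ _ → q _))

    absorb : ∀ A {F : X → ℚ} {e} → (∀ i x → ∣ F (act (u A i) (v A i) x) - F x ∣ ≤ e) → ∀ x → ∣ ⟦ A ⟧ F x - F x ∣ ≤ e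
    absorb A {F} p x = ≡≤ (cong (λ w → ∣ ⟦ A ⟧ F x - w ∣) (sym (E-const (mean (μ A)) (F x))))
      (E-near (mean (μ A)) (λ i → p i x))

    N-cong : ∀ {F G} → (∀ x → F x ≡ G x) → N F ≡ N G
    N-cong p = E-cong 𝔼 (λ x → cong₂ _*_ (p x) (p x))

    N-⟦⟧ : ∀ A F → N (⟦ A ⟧ F) ≤ N F
    N-⟦⟧ A F = ℚ.≤-trans (E-mono 𝔼 (λ x → jensen (mean (μ A)) (λ i → F (act (u A i) (v A i) x))))
      (ℚ.≤-reflexive (trans (swap (μ A) 𝔼 (λ i x → F (act (u A i) (v A i) x) * F (act (u A i) (v A i) x)))
        (trans (E-cong (mean (μ A)) (λ i → 𝔼-act (u A i) (v A i) (λ x → F x * F x))) (E-const (mean (μ A)) _))))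

    N-near : ∀ {F G e} → Bd F → Bd G → (∀ x → ∣ F x - G x ∣ ≤ e) → N F ≤ N G + (e + e)
    N-near {F} {G} {e} p q r = near⇒≤ (E-near 𝔼 (λ x → ≡≤ (cong ∣_∣
        (solve 2 (λ a b → a :* a :- b :* b := (a :- b) :* a :+ (a :- b) :* b) refl (F x) (G x)))
      (ℚ.≤-trans (∣p+q∣≤∣p∣+∣q∣ _ _) (+-mono-≤ (∣*∣≤ (r x) (p x)) (∣*∣≤ (r x) (q x))))))

    ⟨⟩-near : ∀ {F G H e} → Bd H → (∀ x → ∣ F x - G x ∣ ≤ e) → ∣ ⟨ H , F ⟩ - ⟨ H , G ⟩ ∣ ≤ e
    ⟨⟩-near {F} {G} {H} p r = E-near 𝔼 (λ x → ≡≤ (cong ∣_∣ (solve 3 (λ a b h → h :* a :- h :* b := h :* (a :- b)) refl (F x) (G x) (H x)))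
      (∣*∣≤′ (p x) (r x)))

    -- B F ≈ A (B F) = B (A F), and B is a contraction. Energies thus cannot rise along a chain of
    -- scales by more than 2 e per link, which later allows a sum of energy drops to be controlled
    -- term by term.
    N-fine : ∀ A B {e F} → Fine A B e → Bd F → N (⟦ B ⟧ F) ≤ N (⟦ A ⟧ F) + (e + e)
    N-fine A B {e} {F} fine p = ℚ.≤-trans
      (N-near (Bd-⟦⟧ B p) (Bd-⟦⟧ A (Bd-⟦⟧ B p)) (λ x → ≡≤ (∣∣-sym _ _) (absorb A (λ i → inv-act B (fine i) p) x)))
      (+-monoˡ-≤ (e + e) (≡≤ (N-cong (⟦⟧-comm A B F)) (N-⟦⟧ B (⟦ A ⟧ F))))

    N-minus : ∀ F G → N (λ x → F x - G x) ≡ N F - (⟨ F , G ⟩ + ⟨ F , G ⟩) + N G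
    N-minus F G = trans (E-cong 𝔼 (λ x → solve 2 (λ a b → (a :- b) :* (a :- b) := (a :* a :- (a :* b :+ a :* b)) :+ b :* b) refl (F x) (G x)))
      (trans (E-+ 𝔼 _ _) (cong (_+ N G) (trans (E-- 𝔼 _ _) (cong (λ w → N F - w) (E-+ 𝔼 _ _)))))

    -- An approximate Pythagoras. With K = B* B F, both A K and A* K are close to K, so ⟨A F , A K⟩
    -- is at least about ⟨F , K⟩ = ‖B F‖², while ‖A K‖² ≤ ‖B F‖². Expanding the square leaves the
    -- energy drop from A to B: where the energy is flat, A does not see the residual of B.
    N-residual : ∀ A B {e F} → Fine A B e → Bd F →
      N (⟦ A ⟧ (λ x → F x - ⟦ sq B ⟧ F x)) ≤ N (⟦ A ⟧ F) - N (⟦ B ⟧ F) + ((e + e) + (e + e))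
    N-residual A B {e} {F} fine p = ≡≤ (trans (N-cong (⟦⟧-- A F K)) (N-minus (⟦ A ⟧ F) (⟦ A ⟧ K))) final
      where
        K = ⟦ sq B ⟧ F
        invK : ∀ i → Inv (sq B) (u A i) (v A i) e
        invK i = Inv-∘ʳ (adj B) B (fine i)
        AK≈K : ∀ x → ∣ ⟦ A ⟧ K x - K x ∣ ≤ e
        AK≈K = absorb A (λ i → inv-act (sq B) (invK i) p)
        A*K≈K : ∀ x → ∣ ⟦ adj A ⟧ K x - K x ∣ ≤ e
        A*K≈K = absorb (adj A) (λ i → inv-act (sq B) (Inv-neg (sq B) (invK i)) p)
        FK : ⟨ F , K ⟩ ≡ N (⟦ B ⟧ F)
        FK = trans (E-cong 𝔼 (λ x → cong (F x *_) (⟦∘⟧ (adj B) B F x))) (sym (adjoint B F (⟦ B ⟧ F)))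
        i₁ : ⟨ ⟦ A ⟧ F , K ⟩ ≤ ⟨ ⟦ A ⟧ F , ⟦ A ⟧ K ⟩ + e
        i₁ = near⇒≥ (⟨⟩-near (Bd-⟦⟧ A p) AK≈K)
        i₂ : N (⟦ B ⟧ F) ≤ ⟨ ⟦ A ⟧ F , K ⟩ + e
        i₂ = ≡≤ (sym FK) (≤≡ (near⇒≥ (⟨⟩-near p A*K≈K)) (cong (_+ e) (sym (adjoint A F K))))
        i₃ : N (⟦ A ⟧ K) ≤ N (⟦ B ⟧ F)
        i₃ = ℚ.≤-trans (N-⟦⟧ A K) (≡≤ (N-cong (⟦∘⟧ (adj B) B F)) (N-⟦⟧ (adj B) (⟦ B ⟧ F)))
        i₄ : N (⟦ B ⟧ F) ≤ ⟨ ⟦ A ⟧ F , ⟦ A ⟧ K ⟩ + e + e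
        i₄ = ℚ.≤-trans i₂ (+-monoˡ-≤ e i₁)
        final : N (⟦ A ⟧ F) - (⟨ ⟦ A ⟧ F , ⟦ A ⟧ K ⟩ + ⟨ ⟦ A ⟧ F , ⟦ A ⟧ K ⟩) + N (⟦ A ⟧ K) ≤ N (⟦ A ⟧ F) - N (⟦ B ⟧ F) + ((e + e) + (e + e))
        final = 0≤b-a⇒a≤b (≤≡ (0≤+ (0≤+ (a≤b⇒0≤b-a i₄) (a≤b⇒0≤b-a i₄)) (a≤b⇒0≤b-a i₃))
          (solve 5 (λ a b c d e → ((c :+ e :+ e :- b) :+ (c :+ e :+ e :- b)) :+ (b :- d)
              := (a :- b :+ ((e :+ e) :+ (e :+ e))) :- (a :- (c :+ c) :+ d)) refl
            (N (⟦ A ⟧ F)) (N (⟦ B ⟧ F)) ⟨ ⟦ A ⟧ F , ⟦ A ⟧ K ⟩ (N (⟦ A ⟧ K)) e))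

  -- Van der Corput bounds and the main term

  module Bounds (𝒮 : System) where
    open Ops 𝒮 public

    module _ {K : ℕ} .{{_ : NonZero K}} (R : Fin K → Op) (Q : Op) {e s g} (0<s : 0ℚ < s) (0≤e : 0ℚ ≤ e) (bg : Bd g)
      (fine : ∀ i j → i ≢ j → Fine Q (R i ∘ R j) e) (small : inv K + (N (⟦ Q ⟧ g) + (e + e)) ≤ s * s) where

      private
        ρ = mean (avg K)
        W : Fin K → X → ℚ
        W i = ⟦ adj (R i) ⟧ (⟦ R i ⟧ g)

        -- All operators commute and can be moved across the inner product, so the correlation of
        -- two positive operators is the norm of a composite. It is for this composite that
        -- invariance is assumed.
        WW : ∀ i j → ⟨ W i , W j ⟩ ≡ N (⟦ R i ∘ R j ⟧ g)
        WW i j = begin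
          ⟨ W i , W j ⟩
            ≡⟨ E-cong 𝔼 (λ x → *-comm _ _) ⟩
          ⟨ W j , W i ⟩
            ≡⟨ sym (adjoint (R i) (W j) (⟦ R i ⟧ g)) ⟩
          ⟨ ⟦ R i ⟧ (W j) , ⟦ R i ⟧ g ⟩
            ≡⟨ E-cong 𝔼 (λ x → trans (*-comm _ _) (cong (⟦ R i ⟧ g x *_) (⟦⟧-comm (R i) (adj (R j)) (⟦ R j ⟧ g) x))) ⟩
          ⟨ ⟦ R i ⟧ g , ⟦ adj (R j) ⟧ (⟦ R i ⟧ (⟦ R j ⟧ g)) ⟩
            ≡⟨ sym (adjoint (R j) (⟦ R i ⟧ g) (⟦ R i ⟧ (⟦ R j ⟧ g))) ⟩
          ⟨ ⟦ R j ⟧ (⟦ R i ⟧ g) , ⟦ R i ⟧ (⟦ R j ⟧ g) ⟩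
            ≡⟨ E-cong 𝔼 (λ x → cong₂ _*_ (trans (⟦⟧-comm (R j) (R i) g x) (sym (⟦∘⟧ (R i) (R j) g x))) (sym (⟦∘⟧ (R i) (R j) g x))) ⟩
          N (⟦ R i ∘ R j ⟧ g) ∎
          where open ≡-Reasoning

        bW : ∀ i → Bd (W i)
        bW i = Bd-⟦⟧ (adj (R i)) (Bd-⟦⟧ (R i) bg)

        NW : N (λ x → E ρ (λ i → W i x)) ≤ s * s
        NW = ≡≤ (sq-expand (avg K) 𝔼 W) (ℚ.≤-trans
          (offdiag (λ i j → ⟨ W i , W j ⟩) (0≤+ (E-≥ 𝔼 (λ x → 0≤sq _)) (0≤+ 0≤e 0≤e))
            (λ i → Bd-⟨⟩ (bW i) (bW i))
            (λ i j i≢j → ≡≤ (WW i j) (N-fine Q (R i ∘ R j) (fine i j i≢j) bg)))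
          small)

      -- If the runs R i are pairwise jointly invariant, they all see only the structure that Q sees.
      pairwise-invariant : E ρ (λ i → N (⟦ R i ⟧ g)) ≤ s
      pairwise-invariant = ≡≤ (trans (E-cong ρ (λ i → adjoint (R i) g (⟦ R i ⟧ g)))
          (trans (sym (swap (avg K) 𝔼 (λ i x → g x * W i x))) (E-cong 𝔼 (λ x → E-* ρ (g x) (λ i → W i x)))))
        (cauchy-schwarz 𝔼 g (λ x → E ρ (λ i → W i x)) 0<s (Bd-N bg) NW)

    module _ {K : ℕ} .{{_ : NonZero K}} {I : Set} (T : FMean I)
      (cu cv : Fin K → Fin K → I → ℤ)
      (ru rv : Fin K → Fin K → Fin K → Fin K → I → ℤ)
      (pu pv : Fin K → Fin K → Fin K → Fin K → ℤ)
      (eu : ∀ ι γ ι′ γ′ t → cu ι′ γ′ t ℤ.+ ℤ.- cu ι γ t ≡ ru ι γ ι′ γ′ t ℤ.+ pu ι γ ι′ γ′)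
      (ev : ∀ ι γ ι′ γ′ t → cv ι′ γ′ t ℤ.+ ℤ.- cv ι γ t ≡ rv ι γ ι′ γ′ t ℤ.+ pv ι γ ι′ γ′) where

      vdC-run : Op
      vdC-run = record { μ = avg K ⊠ (avg K ⊠ T) ; u = λ { (ι , γ , t) → cu ι γ t } ; v = λ { (ι , γ , t) → cv ι γ t } }

      vdC-diff : Fin K → Fin K → Fin K → Fin K → Op
      vdC-diff ι γ ι′ γ′ = record { μ = T ; u = ru ι γ ι′ γ′ ; v = rv ι γ ι′ γ′ }

      module _ {s g} (0<s : 0ℚ < s) (bg : Bd g)
        (small : ∀ ι ι′ → ι ≢ ι′ → ∀ γ → E (mean (avg K)) (λ γ′ → N (⟦ vdC-diff ι γ ι′ γ′ ⟧ g)) ≤ s * s) where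

        private
          ρ = mean (avg K)
          ψ : Fin K → Fin K → I → X → ℚ
          ψ ι γ t x = g (act (cu ι γ t) (cv ι γ t) x)
          R : Fin K → Fin K → Fin K → Fin K → X → ℚ
          R ι γ ι′ γ′ x = ⟦ vdC-diff ι γ ι′ γ′ ⟧ g (act (pu ι γ ι′ γ′) (pv ι γ ι′ γ′) x)

          corr : ∀ ι γ ι′ γ′ → E (mean T) (λ t → ⟨ ψ ι γ t , ψ ι′ γ′ t ⟩) ≡ ⟨ g , R ι γ ι′ γ′ ⟩
          corr ι γ ι′ γ′ = begin
            E (mean T) (λ t → ⟨ ψ ι γ t , ψ ι′ γ′ t ⟩)
              ≡⟨ E-cong (mean T) (λ t → ⟨⟩-act (cu ι γ t) (cv ι γ t) g (ψ ι′ γ′ t)) ⟩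
            E (mean T) (λ t → E 𝔼 (λ x → g x * ψ ι′ γ′ t (act (ℤ.- cu ι γ t) (ℤ.- cv ι γ t) x)))
              ≡⟨ E-cong (mean T) (λ t → E-cong 𝔼 (λ x → cong (λ y → g x * g y) (trans (act-+ _ _ _ _ x)
                   (trans (cong₂ (λ a b → act a b x) (eu ι γ ι′ γ′ t) (ev ι γ ι′ γ′ t)) (sym (act-+ _ _ _ _ x)))))) ⟩
            E (mean T) (λ t → E 𝔼 (λ x → g x * g (act (ru ι γ ι′ γ′ t) (rv ι γ ι′ γ′ t) (act (pu ι γ ι′ γ′) (pv ι γ ι′ γ′) x))))
              ≡⟨ sym (swap T 𝔼 (λ t x → g x * g (act (ru ι γ ι′ γ′ t) (rv ι γ ι′ γ′ t) (act (pu ι γ ι′ γ′) (pv ι γ ι′ γ′) x)))) ⟩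
            E 𝔼 (λ x → E (mean T) (λ t → g x * g (act (ru ι γ ι′ γ′ t) (rv ι γ ι′ γ′ t) (act (pu ι γ ι′ γ′) (pv ι γ ι′ γ′) x))))
              ≡⟨ E-cong 𝔼 (λ x → E-* (mean T) (g x) (λ t → g (act (ru ι γ ι′ γ′ t) (rv ι γ ι′ γ′ t) (act (pu ι γ ι′ γ′) (pv ι γ ι′ γ′) x)))) ⟩
            ⟨ g , R ι γ ι′ γ′ ⟩ ∎
            where open ≡-Reasoning

          NR : ∀ ι γ ι′ γ′ → N (R ι γ ι′ γ′) ≡ N (⟦ vdC-diff ι γ ι′ γ′ ⟧ g)
          NR ι γ ι′ γ′ = 𝔼-act (pu ι γ ι′ γ′) (pv ι γ ι′ γ′) (λ x → ⟦ vdC-diff ι γ ι′ γ′ ⟧ g x * ⟦ vdC-diff ι γ ι′ γ′ ⟧ g x)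

          bR : ∀ ι γ ι′ γ′ → Bd (R ι γ ι′ γ′)
          bR ι γ ι′ γ′ x = Bd-⟦⟧ (vdC-diff ι γ ι′ γ′) bg _

          H = avg K ⊠ avg K

          off : ∀ ι ι′ → ι ≢ ι′ → E ρ (λ γ → E ρ (λ γ′ → ⟨ g , R ι γ ι′ γ′ ⟩)) ≤ s
          off ι ι′ ι≢ι′ = E-≤ ρ (λ γ → cauchy-schwarz (ρ ⊗ 𝔼) (λ { (γ′ , x) → g x }) (λ { (γ′ , x) → R ι γ ι′ γ′ x }) 0<s
            (E-≤ ρ (λ _ → Bd-N bg))
            (≡≤ (E-cong ρ (λ γ′ → NR ι γ ι′ γ′)) (small ι ι′ ι≢ι′ γ)))

        -- Squaring in (ι , γ) for fixed t and moving one factor to the origin leaves only the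
        -- difference of two runs depending on t; the part p free of t is a mere translation. Pairs
        -- with ι = ι′ cost 1 / K. The average over γ′ stays in the hypothesis because
        -- `pairwise-invariant` controls the difference operators only on average.
        van-der-corput : N (⟦ vdC-run ⟧ g) ≤ inv K + s
        van-der-corput = begin
          N (⟦ vdC-run ⟧ g)
            ≡⟨ N-cong (λ x → swap T (mean H) (λ { t (ι , γ) → ψ ι γ t x })) ⟩
          N (λ x → E (mean T) (λ t → E (mean H) (λ { (ι , γ) → ψ ι γ t x })))
            ≤⟨ E-mono 𝔼 (λ x → jensen (mean T) (λ t → E (mean H) (λ { (ι , γ) → ψ ι γ t x }))) ⟩
          E 𝔼 (λ x → E (mean T) (λ t → E (mean H) (λ { (ι , γ) → ψ ι γ t x }) * E (mean H) (λ { (ι , γ) → ψ ι γ t x })))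
            ≡⟨ swap T 𝔼 (λ t x → E (mean H) (λ { (ι , γ) → ψ ι γ t x }) * E (mean H) (λ { (ι , γ) → ψ ι γ t x })) ⟩
          E (mean T) (λ t → N (λ x → E (mean H) (λ { (ι , γ) → ψ ι γ t x })))
            ≡⟨ E-cong (mean T) (λ t → sq-expand H 𝔼 (λ { (ι , γ) → ψ ι γ t })) ⟩
          E (mean T) (λ t → E ρ (λ ι → E ρ (λ γ → E ρ (λ ι′ → E ρ (λ γ′ → ⟨ ψ ι γ t , ψ ι′ γ′ t ⟩)))))
            ≡⟨ swap (avg K) (mean T) (λ ι t → E ρ (λ γ → E ρ (λ ι′ → E ρ (λ γ′ → ⟨ ψ ι γ t , ψ ι′ γ′ t ⟩)))) ⟩
          E ρ (λ ι → E (mean T) (λ t → E ρ (λ γ → E ρ (λ ι′ → E ρ (λ γ′ → ⟨ ψ ι γ t , ψ ι′ γ′ t ⟩)))))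
            ≡⟨ E-cong ρ (λ ι → trans (swap (avg K) (mean T) _) (E-cong ρ (λ γ → trans (swap (avg K) (mean T) _)
                 (E-cong ρ (λ ι′ → trans (swap (avg K) (mean T) _) (E-cong ρ (λ γ′ → corr ι γ ι′ γ′))))))) ⟩
          E ρ (λ ι → E ρ (λ γ → E ρ (λ ι′ → E ρ (λ γ′ → ⟨ g , R ι γ ι′ γ′ ⟩))))
            ≡⟨ E-cong ρ (λ ι → swap (avg K) ρ (λ ι′ γ → E ρ (λ γ′ → ⟨ g , R ι γ ι′ γ′ ⟩))) ⟩
          E ρ (λ ι → E ρ (λ ι′ → E ρ (λ γ → E ρ (λ γ′ → ⟨ g , R ι γ ι′ γ′ ⟩))))
            ≤⟨ offdiag (λ ι ι′ → E ρ (λ γ → E ρ (λ γ′ → ⟨ g , R ι γ ι′ γ′ ⟩))) (ℚ.<⇒≤ 0<s)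
                 (λ ι → E-≤ ρ (λ γ → E-≤ ρ (λ γ′ → Bd-⟨⟩ bg (bR ι γ ι γ′)))) off ⟩
          inv K + s ∎
          where open ℚ.≤-Reasoning

    module _ {f : X → ℚ} (uf : Unit f) {η} (0<η : 0ℚ < η) where

      private
        low : Op → X → ℚ
        low P x with ⟦ sq P ⟧ f x ℚ.≤? η
        ... | yes _ = f x
        ... | no _ = 0ℚ

        low-bounds : ∀ P x → (0ℚ ≤ low P x) × (low P x ≤ f x) × (low P x * ⟦ sq P ⟧ f x ≤ η * low P x)
        low-bounds P x with ⟦ sq P ⟧ f x ℚ.≤? η
        ... | yes p = proj₁ (uf x) , ℚ.≤-refl , ≤≡ (*-monoˡ (proj₁ (uf x)) p) (*-comm _ _)
        ... | no _ = ℚ.≤-refl , proj₁ (uf x) , ℚ.≤-reflexive (trans (*-zeroˡ _) (sym (*-zeroʳ η)))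

        low-dichotomy : ∀ P x → (low P x ≡ f x) ⊎ (η ≤ ⟦ sq P ⟧ f x)
        low-dichotomy P x with ⟦ sq P ⟧ f x ℚ.≤? η
        ... | yes p = inj₁ refl
        ... | no p = inj₂ (ℚ.<⇒≤ (ℚ.≰⇒> p))

        E⟦⟧ : ∀ P b → E 𝔼 (⟦ P ⟧ b) ≡ E 𝔼 b
        E⟦⟧ P b = trans (swap (μ P) 𝔼 (λ i x → b (act (u P i) (v P i) x)))
          (trans (E-cong (mean (μ P)) (λ i → 𝔼-act (u P i) (v P i) b)) (E-const (mean (μ P)) _))
          where open Op

        -- ⟨ b , P* P b ⟩ = ‖ P b ‖² ≥ (E b)² , so b cannot live where P* P f ≤ η unless E b ≤ η.
        E-low : ∀ P → E 𝔼 (low P) ≤ η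
        E-low P with ℚ.≤-total (E 𝔼 (low P)) η
        ... | inj₁ p = p
        ... | inj₂ p = *-cancelˡ (ℚ.<-≤-trans 0<η p) (begin
          E 𝔼 b * E 𝔼 b
            ≡⟨ cong₂ _*_ (sym (E⟦⟧ P b)) (sym (E⟦⟧ P b)) ⟩
          E 𝔼 (⟦ P ⟧ b) * E 𝔼 (⟦ P ⟧ b)
            ≤⟨ jensen 𝔼 (⟦ P ⟧ b) ⟩
          N (⟦ P ⟧ b)
            ≡⟨ adjoint P b (⟦ P ⟧ b) ⟩
          ⟨ b , ⟦ adj P ⟧ (⟦ P ⟧ b) ⟩
            ≡⟨ E-cong 𝔼 (λ x → cong (b x *_) (sym (⟦∘⟧ (adj P) P b x))) ⟩
          ⟨ b , ⟦ sq P ⟧ b ⟩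
            ≤⟨ E-mono 𝔼 (λ x → *-monoˡ (proj₁ (low-bounds P x)) (E-mono (mean (μ (sq P))) (λ i → proj₁ (proj₂ (low-bounds P _))))) ⟩
          ⟨ b , ⟦ sq P ⟧ f ⟩
            ≤⟨ E-mono 𝔼 (λ x → proj₂ (proj₂ (low-bounds P x))) ⟩
          E 𝔼 (λ x → η * b x)
            ≡⟨ trans (E-* 𝔼 η b) (*-comm η _) ⟩
          E 𝔼 b * η ∎)
          where
            open ℚ.≤-Reasoning
            open Op
            b = low P

        pointwise : ∀ P Q x → (η * η) * (f x - (low P x + low Q x)) ≤ f x * (⟦ sq P ⟧ f x * ⟦ sq Q ⟧ f x)
        pointwise P Q x with low-dichotomy P x | low-dichotomy Q x
        ... | inj₂ p | inj₂ q = ℚ.≤-trans (*-monoˡ (0≤sq η) (0≤b-a⇒a≤b (≤≡ (0≤+ (proj₁ (low-bounds P x)) (proj₁ (low-bounds Q x)))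
                (solve 3 (λ f a b → a :+ b := f :- (f :- (a :+ b))) refl (f x) (low P x) (low Q x)))))
              (≡≤ (*-comm _ _) (*-monoˡ (proj₁ (uf x)) (*-mono (ℚ.<⇒≤ 0<η) (ℚ.≤-trans (ℚ.<⇒≤ 0<η) q) p q)))
        ... | inj₁ p | _ = ℚ.≤-trans (0≤b-a⇒a≤b (≤≡ (0≤* (0≤sq η) (proj₁ (low-bounds Q x)))
                (trans (solve 3 (λ h f b → h :* b := con 0ℚ :- h :* (f :- (f :+ b))) refl (η * η) (f x) (low Q x)) (cong (λ w → 0ℚ - (η * η) * (f x - (w + low Q x))) (sym p)))))
              (0≤* (proj₁ (uf x)) (0≤* (proj₁ (Unit-⟦⟧ (sq P) uf x)) (proj₁ (Unit-⟦⟧ (sq Q) uf x))))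
        ... | inj₂ _ | inj₁ q = ℚ.≤-trans (0≤b-a⇒a≤b (≤≡ (0≤* (0≤sq η) (proj₁ (low-bounds P x)))
                (trans (solve 3 (λ h f b → h :* b := con 0ℚ :- h :* (f :- (b :+ f))) refl (η * η) (f x) (low P x)) (cong (λ w → 0ℚ - (η * η) * (f x - (low P x + w))) (sym q)))))
              (0≤* (proj₁ (uf x)) (0≤* (proj₁ (Unit-⟦⟧ (sq P) uf x)) (proj₁ (Unit-⟦⟧ (sq Q) uf x))))

      -- Where both P* P f and Q* Q f exceed η the product is at least η² f, and the two exceptional
      -- parts of f have mean at most η each.
      main-term : ∀ P Q → (η * η) * (E 𝔼 f - (η + η)) ≤ ⟨ f , (λ x → ⟦ sq P ⟧ f x * ⟦ sq Q ⟧ f x) ⟩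
      main-term P Q = begin
        (η * η) * (E 𝔼 f - (η + η))
          ≤⟨ *-monoˡ (0≤sq η) (+-monoʳ-≤ (E 𝔼 f) (neg-antimono-≤ (+-mono-≤ (E-low P) (E-low Q)))) ⟩
        (η * η) * (E 𝔼 f - (E 𝔼 (low P) + E 𝔼 (low Q)))
          ≡⟨ cong ((η * η) *_) (sym (trans (E-- 𝔼 f _) (cong (λ w → E 𝔼 f - w) (E-+ 𝔼 (low P) (low Q))))) ⟩
        (η * η) * E 𝔼 (λ x → f x - (low P x + low Q x))
          ≡⟨ sym (E-* 𝔼 (η * η) _) ⟩
        E 𝔼 (λ x → (η * η) * (f x - (low P x + low Q x)))
          ≤⟨ E-mono 𝔼 (pointwise P Q) ⟩
        ⟨ f , (λ x → ⟦ sq P ⟧ f x * ⟦ sq Q ⟧ f x) ⟩ ∎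
        where open ℚ.≤-Reasoning

  infixr 5 _⋉_
  -- The index pair w becomes a coordinate on which ℤ² acts trivially. The products of f₁ with its
  -- shifts by multiples of κ w are then one function on one system, and energies average over all
  -- pairs at once.
  _⋉_ : ∀ {W} → Mean W → System → System
  _⋉_ {W} ω 𝒮 = record
    { X = W × X
    ; act = λ a b z → proj₁ z , act a b (proj₂ z)
    ; act-0 = λ z → cong (proj₁ z ,_) (act-0 (proj₂ z))
    ; act-+ = λ a b c d z → cong (proj₁ z ,_) (act-+ a b c d (proj₂ z))
    ; 𝔼 = ω ⊗ 𝔼
    ; 𝔼-act = λ a b F → E-cong ω (λ w → 𝔼-act a b (λ x → F (w , x)))
    }
    where open System 𝒮

  -- Counting corners at one scale

  -- The corners counted are those with difference d j t i = a j p t + 2 L (g j) q i, where t and i run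
  -- over blocks.  The block index, weighted by S resp. Y, and the offset γ make differences of two
  -- indices nonzero except with probability 1 / K.
  record Run : Set where
    field
      K m M Θ : ℕ
      {{K≢0}} : NonZero K
      {{m≢0}} : NonZero m
      {{M≢0}} : NonZero M
      {{Θ≢0}} : NonZero Θ
      p q′ S Y L : ℤ
      a g : Fin K → ℤ
      ag : ∀ j → a j ℤ.* g j ≡ L

    q : ℤ
    q = p ℤ.* q′

    e : ℚ
    e = inv Θ

    IxT IxI : Set
    IxT = Fin K × (Fin K × Fin M)
    IxI = Fin K × (Fin m × Fin K)

    Tμ : FMean IxT
    Tμ = avg K ⊠ (avg K ⊠ avg M)

    Iμ : FMean IxI
    Iμ = avg K ⊠ (avg m ⊠ avg K)

    h : Fin K → Fin K → ℤ
    h ι γ = + toℕ γ ℤ.+ S ℤ.* + toℕ ι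

    tv : IxT → ℤ
    tv (ι , γ , t) = + toℕ t ℤ.+ h ι γ

    iv : IxI → ℤ
    -- The summand 1 keeps `iv` positive in the construction below, so that no difference `d`
    -- vanishes.
    iv (ι , i , γ) = + toℕ i ℤ.+ (+ toℕ γ ℤ.+ (Y ℤ.* + toℕ ι ℤ.+ + 1))

    κ : IxI × IxI → ℤ
    κ w = iv (proj₂ w) ℤ.- iv (proj₁ w)

    ee : Fin K → ℤ
    ee j = + 2 ℤ.* L ℤ.* g j ℤ.* q

    -- Shifting t turns the differences at i and i′ into δ and δ + ee j k with k = i′ − i;
    -- their squares then differ by ω k t, which does not depend on j because a j * g j ≡ L.
    d : Fin K → ℤ → ℤ → ℤ
    d j t i = a j ℤ.* p ℤ.* t ℤ.+ ee j ℤ.* i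

    δ : Fin K → ℤ → ℤ → ℤ
    δ j t k = a j ℤ.* p ℤ.* t ℤ.- L ℤ.* g j ℤ.* q ℤ.* k

    ω : ℤ → ℤ → ℤ
    ω k t = + 4 ℤ.* L ℤ.* L ℤ.* p ℤ.* q ℤ.* k ℤ.* t

    -- Coefficients of the motion of j′ relative to j. The moves are (δ , -δ²), and the term of δ²
    -- linear in t is -2 L (a g) p q k t, the same for all j since a g = L. The rest of the
    -- difference is α p t, resp. β p² t², plus constants.
    α β : Fin K → Fin K → ℤ
    α j j′ = a j′ ℤ.- a j
    β j j′ = a j ℤ.* a j ℤ.- a j′ ℤ.* a j′

    linear-run : ℤ → Op
    linear-run c = record { μ = avg M ; u = λ _ → + 0 ; v = λ t → c ℤ.* + toℕ t }

    curve : Fin K → Fin K → Op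
    curve j j′ = record { μ = Tμ ; u = λ t → α j j′ ℤ.* p ℤ.* tv t ; v = λ t → β j j′ ℤ.* p ℤ.* p ℤ.* (tv t ℤ.* tv t) }

    line : Fin K → Fin K → Op
    line j j′ = record { μ = Tμ ; u = λ t → α j j′ ℤ.* p ℤ.* tv t ; v = λ _ → + 0 }

    squares : Fin K → ℤ → Op
    squares j i = record { μ = Tμ ; u = λ _ → + 0 ; v = λ t → d j (tv t) i ℤ.* d j (tv t) i }

    ω-run : IxI × IxI → Op
    ω-run w = record { μ = Tμ ; u = λ _ → + 0 ; v = λ t → ω (κ w) (tv t) }

    shifts : Fin K → Op
    shifts j = record { μ = Iμ ; u = λ i → ee j ℤ.* iv i ; v = λ _ → + 0 }

    -- The derivative of b p² t² between two offsets: (t + h′)² - (t + h)² is 2 (h′ - h) t plus a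
    -- constant.
    quad-run : ℤ → Fin K → Fin K → Fin K → Fin K → Op
    quad-run b ι γ ι′ γ′ = linear-run (+ 2 ℤ.* b ℤ.* p ℤ.* p ℤ.* (h ι′ γ′ ℤ.- h ι γ))

  -- P averages horizontally, Q and R vertically with steps of the size of squares of differences and
  -- of ω respectively; larger indices mean smaller steps and longer ranges.
  record Scales (𝓇 : Run) : Set₁ where
    open Run 𝓇
    field
      Pc Pf P₀ P₁ P₂ Q₀ Q₁ Q₂ R₀ R₁ : Op
      offset-small : ∀ j i i′ → 2 ℕ.* ℤ.∣ q′ ℤ.* (g j ℤ.* g j) ℤ.* (iv i ℤ.+ iv i′) ∣ ℕ.* Θ ℕ.≤ M
      Pc-d : ∀ j t i → Inv Pc (d j (tv t) (iv i)) (+ 0) e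
      P₁-δ : ∀ j t w → Inv P₁ (δ j (tv t) (κ w)) (+ 0) e
      P₁-e : ∀ j i → Inv P₁ (ee j ℤ.* iv i) (+ 0) e
      Q₁-δ : ∀ j t w → Inv Q₁ (+ 0) (ℤ.- (δ j (tv t) (κ w) ℤ.* δ j (tv t) (κ w))) e
      Q₁-d : ∀ j t i → Inv Q₁ (+ 0) (d j (tv t) (iv i) ℤ.* d j (tv t) (iv i)) e
      Q₁-β : ∀ j j′ t → Inv Q₁ (+ 0) (β j j′ ℤ.* p ℤ.* p ℤ.* (tv t ℤ.* tv t)) e
      R₁-ω : ∀ t w → Inv R₁ (+ 0) (ω (κ w) (tv t)) e
      P₀P₁ : Fine P₀ P₁ e
      P₁P₂ : Fine P₁ P₂ e
      Q₀Q₁ : Fine Q₀ Q₁ e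
      Q₁Q₂ : Fine Q₁ Q₂ e
      R₀R₁ : Fine R₀ R₁ e
      P₀-line : ∀ j j′ → j ≢ j′ → Fine P₀ (line j j′) e
      Q₀-β : ∀ j j′ → j ≢ j′ → ∀ ι ι′ → ι ≢ ι′ → ∀ γ γ₁ γ₂ → γ₁ ≢ γ₂ →
        Fine Q₀ (quad-run (β j j′) ι γ ι′ γ₁ ∘ quad-run (β j j′) ι γ ι′ γ₂) e
      Q₀-a² : ∀ j ι ι′ → ι ≢ ι′ → ∀ γ γ₁ γ₂ → γ₁ ≢ γ₂ →
        Fine Q₀ (quad-run (a j ℤ.* a j) ι γ ι′ γ₁ ∘ quad-run (a j ℤ.* a j) ι γ ι′ γ₂) e
      R₀-ω : ∀ ι ι′ → ι ≢ ι′ → ∀ i γ i′ γ₁ γ₂ → γ₁ ≢ γ₂ →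
        Fine R₀ (ω-run ((ι , i , γ) , (ι′ , i′ , γ₁)) ∘ ω-run ((ι , i , γ) , (ι′ , i′ , γ₂))) e
      Pf-shifts : ∀ j → Fine Pf (shifts j) e

  Inv-sq : ∀ B {a b e} → Inv B a b e → Inv (sq B) a b e
  Inv-sq B = Inv-∘ʳ (adj B) B

  module OpsLemmas (𝒮 : System) where
    open Bounds 𝒮 public

    N-scale : ∀ c F → N (λ x → c * F x) ≡ (c * c) * N F
    N-scale c F = trans (E-cong 𝔼 (λ x → solve 2 (λ c a → (c :* a) :* (c :* a) := (c :* c) :* (a :* a)) refl c (F x))) (E-* 𝔼 (c * c) _)

    0≤N : ∀ F → 0ℚ ≤ N F
    0≤N F = E-≥ 𝔼 (λ x → 0≤sq (F x))

    -- The factor ½ keeps a difference of two functions with values in [-1 , 1] in that range;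
    -- residuals of functions with values in [0 , 1] are bounded by 1 already.
    half-residual : Op → (X → ℚ) → X → ℚ
    half-residual B F x = ½ * (F x - ⟦ sq B ⟧ F x)

    Bd-half : ∀ {F G} → Bd F → Bd G → Bd (λ x → ½ * (F x - G x))
    Bd-half {F} {G} p q x = ≡≤ (∣p*q∣≡∣p∣*∣q∣ ½ _) (≡≤ (cong (_* ∣ F x - G x ∣) (0≤p⇒∣p∣≡p (ℚ.nonNegative⁻¹ ½)))
      (≤≡ (*-monoˡ (ℚ.nonNegative⁻¹ ½) (ℚ.≤-trans (∣p+q∣≤∣p∣+∣q∣ (F x) (- G x)) (+-mono-≤ (p x) (≡≤ (∣-p∣≡∣p∣ (G x)) (q x)))))
        (solve 0 (con ½ :* (con 1ℚ :+ con 1ℚ) := con 1ℚ) refl)))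

    N-half-residual : ∀ A B {e F} → Fine A B e → Bd F →
      N (⟦ A ⟧ (half-residual B F)) ≤ N (⟦ A ⟧ F) - N (⟦ B ⟧ F) + ((e + e) + (e + e))
    N-half-residual A B {e} {F} fine p = ℚ.≤-trans
      (≡≤ (trans (N-cong (⟦⟧-* A ½ (λ x → F x - ⟦ sq B ⟧ F x))) (N-scale ½ (⟦ A ⟧ (λ x → F x - ⟦ sq B ⟧ F x))))
        (≤≡ (*-monoʳ (0≤N (⟦ A ⟧ (λ x → F x - ⟦ sq B ⟧ F x))) quarter) (*-identityˡ _)))
      (N-residual A B fine p)
      where
        quarter : ½ * ½ ≤ 1ℚ
        quarter = ≡≤ (sym (homo-* ½ ½)) (ℚ.≤ᵇ⇒≤ _)

    sq-self : ∀ A F G → ⟨ ⟦ sq A ⟧ F , G ⟩ ≡ ⟨ F , ⟦ sq A ⟧ G ⟩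
    sq-self A F G = begin
      ⟨ ⟦ sq A ⟧ F , G ⟩
        ≡⟨ E-cong 𝔼 (λ x → trans (*-comm _ _) (cong (G x *_) (⟦∘⟧ (adj A) A F x))) ⟩
      ⟨ G , ⟦ adj A ⟧ (⟦ A ⟧ F) ⟩
        ≡⟨ sym (adjoint A G (⟦ A ⟧ F)) ⟩
      ⟨ ⟦ A ⟧ G , ⟦ A ⟧ F ⟩
        ≡⟨ E-cong 𝔼 (λ x → *-comm _ _) ⟩
      ⟨ ⟦ A ⟧ F , ⟦ A ⟧ G ⟩
        ≡⟨ adjoint A F (⟦ A ⟧ G) ⟩
      ⟨ F , ⟦ adj A ⟧ (⟦ A ⟧ G) ⟩
        ≡⟨ E-cong 𝔼 (λ x → cong (F x *_) (sym (⟦∘⟧ (adj A) A G x))) ⟩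
      ⟨ F , ⟦ sq A ⟧ G ⟩ ∎
      where open ≡-Reasoning

    N-sq : ∀ A F → N (⟦ sq A ⟧ F) ≤ N (⟦ A ⟧ F)
    N-sq A F = ≡≤ (N-cong (⟦∘⟧ (adj A) A F)) (N-⟦⟧ (adj A) (⟦ A ⟧ F))

  -- From corner averages to correlations over pairs of indices

  module Core (𝒮 : System) {𝓇 : Run} (𝓈 : Scales 𝓇) where
    open Run 𝓇
    open Scales 𝓈
    open OpsLemmas 𝒮

    Ω : Mean (IxI × IxI)
    Ω = mean Iμ ⊗ mean Iμ

    module P = OpsLemmas (Ω ⋉ 𝒮)

    private
      ρ = mean (avg K)
      τ = mean Tμ

      -- Since a g = L, shifting t by q′ g² (i + i′) subtracts L g q (i + i′), the mean of 2 L g q i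
      -- and 2 L g q i′. The two differences become symmetric about a p t.
      δ-first : ∀ a g {L} → a ℤ.* g ≡ L → ∀ p q′ t i i′ →
        a ℤ.* p ℤ.* (t ℤ.- q′ ℤ.* (g ℤ.* g) ℤ.* (i ℤ.+ i′)) ℤ.+ + 2 ℤ.* L ℤ.* g ℤ.* (p ℤ.* q′) ℤ.* i ≡
        a ℤ.* p ℤ.* t ℤ.- L ℤ.* g ℤ.* (p ℤ.* q′) ℤ.* (i′ ℤ.- i)
      δ-first a g refl = lem a g
        where
          lem : ∀ a g p q′ t i i′ →
            a ℤ.* p ℤ.* (t ℤ.- q′ ℤ.* (g ℤ.* g) ℤ.* (i ℤ.+ i′)) ℤ.+ + 2 ℤ.* (a ℤ.* g) ℤ.* g ℤ.* (p ℤ.* q′) ℤ.* i ≡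
            a ℤ.* p ℤ.* t ℤ.- (a ℤ.* g) ℤ.* g ℤ.* (p ℤ.* q′) ℤ.* (i′ ℤ.- i)
          lem = solve-∀

      δ-second : ∀ a g {L} → a ℤ.* g ≡ L → ∀ p q′ t i i′ →
        a ℤ.* p ℤ.* (t ℤ.- q′ ℤ.* (g ℤ.* g) ℤ.* (i ℤ.+ i′)) ℤ.+ + 2 ℤ.* L ℤ.* g ℤ.* (p ℤ.* q′) ℤ.* i′ ≡
        + 2 ℤ.* L ℤ.* g ℤ.* (p ℤ.* q′) ℤ.* (i′ ℤ.- i) ℤ.+ (a ℤ.* p ℤ.* t ℤ.- L ℤ.* g ℤ.* (p ℤ.* q′) ℤ.* (i′ ℤ.- i))
      δ-second a g refl = lem a g
        where
          lem : ∀ a g p q′ t i i′ →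
            a ℤ.* p ℤ.* (t ℤ.- q′ ℤ.* (g ℤ.* g) ℤ.* (i ℤ.+ i′)) ℤ.+ + 2 ℤ.* (a ℤ.* g) ℤ.* g ℤ.* (p ℤ.* q′) ℤ.* i′ ≡
            + 2 ℤ.* (a ℤ.* g) ℤ.* g ℤ.* (p ℤ.* q′) ℤ.* (i′ ℤ.- i) ℤ.+ (a ℤ.* p ℤ.* t ℤ.- (a ℤ.* g) ℤ.* g ℤ.* (p ℤ.* q′) ℤ.* (i′ ℤ.- i))
          lem = solve-∀

      -- (A + B)² - (A - B)² = 4 A B with A = a p t and B = L g q k, and the product contains a g.
      δ-squares : ∀ a g {L} → a ℤ.* g ≡ L → ∀ p q t k →
        (+ 2 ℤ.* L ℤ.* g ℤ.* q ℤ.* k ℤ.+ (a ℤ.* p ℤ.* t ℤ.- L ℤ.* g ℤ.* q ℤ.* k)) ℤ.* (+ 2 ℤ.* L ℤ.* g ℤ.* q ℤ.* k ℤ.+ (a ℤ.* p ℤ.* t ℤ.- L ℤ.* g ℤ.* q ℤ.* k))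
          ℤ.+ ℤ.- ((a ℤ.* p ℤ.* t ℤ.- L ℤ.* g ℤ.* q ℤ.* k) ℤ.* (a ℤ.* p ℤ.* t ℤ.- L ℤ.* g ℤ.* q ℤ.* k)) ≡
        + 4 ℤ.* L ℤ.* L ℤ.* p ℤ.* q ℤ.* k ℤ.* t
      δ-squares a g refl = lem a g
        where
          lem : ∀ a g p q t k →
            (+ 2 ℤ.* (a ℤ.* g) ℤ.* g ℤ.* q ℤ.* k ℤ.+ (a ℤ.* p ℤ.* t ℤ.- (a ℤ.* g) ℤ.* g ℤ.* q ℤ.* k)) ℤ.* (+ 2 ℤ.* (a ℤ.* g) ℤ.* g ℤ.* q ℤ.* k ℤ.+ (a ℤ.* p ℤ.* t ℤ.- (a ℤ.* g) ℤ.* g ℤ.* q ℤ.* k))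
              ℤ.+ ℤ.- ((a ℤ.* p ℤ.* t ℤ.- (a ℤ.* g) ℤ.* g ℤ.* q ℤ.* k) ℤ.* (a ℤ.* p ℤ.* t ℤ.- (a ℤ.* g) ℤ.* g ℤ.* q ℤ.* k)) ≡
            + 4 ℤ.* (a ℤ.* g) ℤ.* (a ℤ.* g) ℤ.* p ℤ.* q ℤ.* k ℤ.* t
          lem = solve-∀

    module Pairs (f f₁ : X → ℚ) (bf : Bd f) (bf₁ : Bd f₁) where

      ψ : Fin K → ℤ → IxI → X → ℚ
      ψ j t i x = f₁ (act (d j t (iv i)) (+ 0) x) * f (act (+ 0) (d j t (iv i) ℤ.* d j t (iv i)) x)

      corner-average : Fin K → X → ℚ
      corner-average j x = E τ (λ t → E (mean Iμ) (λ i → ψ j (tv t) i x))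

      F : Fin K → P.X → ℚ
      F j z = f₁ (proj₂ z) * f₁ (act (ee j ℤ.* κ (proj₁ z)) (+ 0) (proj₂ z))

      bF : ∀ j → P.Bd (F j)
      bF j z = ∣*∣≤ (bf₁ _) (bf₁ _)

      Φ : IxT → P.X → ℚ
      Φ t z = f (proj₂ z) * f (act (+ 0) (ω (κ (proj₁ z)) (tv t)) (proj₂ z))

      bΦ : ∀ t → P.Bd (Φ t)
      bΦ t z = ∣*∣≤ (bf _) (bf _)

      move : Fin K → IxT → P.X → P.X
      move j t z = proj₁ z , act (δ j (tv t) (κ (proj₁ z))) (ℤ.- (δ j (tv t) (κ (proj₁ z)) ℤ.* δ j (tv t) (κ (proj₁ z)))) (proj₂ z)

      -- Only G and the move involve j; Φ does not. The expression is linear in G, so F can be split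
      -- into parts that are estimated separately.
      𝒯 : (Fin K → P.X → ℚ) → ℚ
      𝒯 G = E τ (λ t → E ρ (λ j → P.⟨ Φ t , (λ z → G j (move j t z)) ⟩))

      private
        ξ : Fin K → IxI × IxI → ℤ → ℚ
        ξ j w t = ⟨ ψ j t (proj₁ w) , ψ j t (proj₂ w) ⟩

        bψ : ∀ j t i → Bd (ψ j t i)
        bψ j t i x = ∣*∣≤ (bf₁ _) (bf _)

        bξ : ∀ j w t → ∣ ξ j w t ∣ ≤ 1ℚ
        bξ j w t = E-∣∣ 𝔼 (λ x → ∣*∣≤ (bψ j t (proj₁ w) x) (bψ j t (proj₂ w) x))

        off : Fin K → IxI × IxI → ℤ
        off j w = q′ ℤ.* (g j ℤ.* g j) ℤ.* (iv (proj₁ w) ℤ.+ iv (proj₂ w))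

        N-average : ∀ j → N (corner-average j) ≤ E τ (λ t → E Ω (λ w → ξ j w (tv t)))
        N-average j = begin
          N (corner-average j)
            ≤⟨ E-mono 𝔼 (λ x → jensen τ (λ t → E (mean Iμ) (λ i → ψ j (tv t) i x))) ⟩
          E 𝔼 (λ x → E τ (λ t → E (mean Iμ) (λ i → ψ j (tv t) i x) * E (mean Iμ) (λ i → ψ j (tv t) i x)))
            ≡⟨ swap Tμ 𝔼 (λ t x → E (mean Iμ) (λ i → ψ j (tv t) i x) * E (mean Iμ) (λ i → ψ j (tv t) i x)) ⟩
          E τ (λ t → N (λ x → E (mean Iμ) (λ i → ψ j (tv t) i x)))
            ≡⟨ E-cong τ (λ t → sq-expand Iμ 𝔼 (λ i → ψ j (tv t) i)) ⟩
          E τ (λ t → E Ω (λ w → ξ j w (tv t))) ∎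
          where open ℚ.≤-Reasoning

        -- The recentring of t depends on j and on the pair of indices, but it is short against the
        -- block length M.
        recentre : ∀ j w → ∣ E τ (λ t → ξ j w (tv t ℤ.- off j w)) - E τ (λ t → ξ j w (tv t)) ∣ ≤ e
        recentre j w = E-near ρ (λ ι → E-near ρ (λ γ → ≡≤
          (cong (λ r → ∣ r - E (mean (avg M)) (λ t → ξ j w (+ toℕ t ℤ.+ h ι γ)) ∣)
            (E-cong (mean (avg M)) (λ t → cong (ξ j w) (+-swap (+ toℕ t) (h ι γ) (ℤ.- off j w)))))
          (avg-shift′ (λ z → ξ j w (z ℤ.+ h ι γ)) (λ z → bξ j w _) (ℤ.- off j w) Θ
            (subst (λ r → 2 ℕ.* r ℕ.* Θ ℕ.≤ M) (sym (ℤ.∣-i∣≡∣i∣ (off j w))) (offset-small j (proj₁ w) (proj₂ w))))))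

        at : ∀ {a b a′ b′} → a ≡ a′ → b ≡ b′ → ∀ x → act a b x ≡ act a′ b′ x
        at refl refl x = refl

        unwind : ∀ j w t → ξ j w (t ℤ.- off j w) ≡
          E 𝔼 (λ x → (f x * f (act (+ 0) (ω (κ w) t) x)) *
            F j (w , act (δ j t (κ w)) (ℤ.- (δ j t (κ w) ℤ.* δ j t (κ w))) x))
        -- Moving x down by δ² puts the first vertical factor at x itself; the second one then sits
        -- at height ω, and both horizontal factors at the moved point.
        unwind j w t = trans (sym (𝔼-act (+ 0) (ℤ.- D²) (λ x → ψ j s (proj₁ w) x * ψ j s (proj₂ w) x))) (E-cong 𝔼 pointwise)
          where
            s = t ℤ.- off j w
            D = δ j t (κ w)
            D² = D ℤ.* D
            e₁ : d j s (iv (proj₁ w)) ≡ D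
            e₁ = δ-first (a j) (g j) (ag j) p q′ t (iv (proj₁ w)) (iv (proj₂ w))
            e₂ : d j s (iv (proj₂ w)) ≡ ee j ℤ.* κ w ℤ.+ D
            e₂ = δ-second (a j) (g j) (ag j) p q′ t (iv (proj₁ w)) (iv (proj₂ w))
            e₃ : (ee j ℤ.* κ w ℤ.+ D) ℤ.* (ee j ℤ.* κ w ℤ.+ D) ℤ.+ ℤ.- D² ≡ ω (κ w) t
            e₃ = δ-squares (a j) (g j) (ag j) p q t (κ w)
            module _ (x : X) where
              y = act (+ 0) (ℤ.- D²) x
              z = act D (ℤ.- D²) x
              p₁ : act (d j s (iv (proj₁ w))) (+ 0) y ≡ z
              p₁ = trans (act-+ _ _ _ _ x) (at (trans (ℤ.+-identityʳ _) e₁) (ℤ.+-identityˡ _) x)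
              p₂ : act (+ 0) (d j s (iv (proj₁ w)) ℤ.* d j s (iv (proj₁ w))) y ≡ x
              p₂ = trans (act-+ _ _ _ _ x) (trans (at refl (trans (cong (λ r → r ℤ.* r ℤ.- D²) e₁) (ℤ.+-inverseʳ D²)) x) (act-0 x))
              p₃ : act (d j s (iv (proj₂ w))) (+ 0) y ≡ act (ee j ℤ.* κ w) (+ 0) z
              p₃ = trans (act-+ _ _ _ _ x) (trans (at (trans (ℤ.+-identityʳ _) e₂) refl x) (sym (act-+ _ _ _ _ x)))
              p₄ : act (+ 0) (d j s (iv (proj₂ w)) ℤ.* d j s (iv (proj₂ w))) y ≡ act (+ 0) (ω (κ w) t) x
              p₄ = trans (act-+ _ _ _ _ x) (at refl (trans (cong (λ r → r ℤ.* r ℤ.- D²) e₂) e₃) x)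
              pointwise : ψ j s (proj₁ w) y * ψ j s (proj₂ w) y ≡ (f x * f (act (+ 0) (ω (κ w) t) x)) * F j (w , z)
              pointwise = trans (cong₂ _*_ (cong₂ _*_ (cong f₁ p₁) (cong f p₂)) (cong₂ _*_ (cong f₁ p₃) (cong f p₄)))
                (solve 4 (λ a b c d → (a :* b) :* (c :* d) := (b :* d) :* (a :* c)) refl (f₁ z) (f x) (f₁ (act (ee j ℤ.* κ w) (+ 0) z)) (f (act (+ 0) (ω (κ w) t) x)))

      average-bound : E ρ (λ j → N (corner-average j)) ≤ 𝒯 F + e
      average-bound = begin
        E ρ (λ j → N (corner-average j))
          ≤⟨ E-mono ρ N-average ⟩
        E ρ (λ j → E τ (λ t → E Ω (λ w → ξ j w (tv t))))
          ≡⟨ E-cong ρ (λ j → sym (swap Tμ Ω (λ t w → ξ j w (tv t)))) ⟩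
        E ρ (λ j → E Ω (λ w → E τ (λ t → ξ j w (tv t))))
          ≤⟨ E-mono ρ (λ j → E-mono Ω (λ w → near⇒≥ (recentre j w))) ⟩
        E ρ (λ j → E Ω (λ w → E τ (λ t → ξ j w (tv t ℤ.- off j w)) + e))
          ≡⟨ E-cong ρ (λ j → trans (E-+ Ω _ _) (cong₂ _+_ (swap Tμ Ω (λ t w → ξ j w (tv t ℤ.- off j w))) (E-const Ω e))) ⟩
        E ρ (λ j → E τ (λ t → E Ω (λ w → ξ j w (tv t ℤ.- off j w))) + e)
          ≡⟨ trans (E-+ ρ _ _) (cong₂ _+_ (E-cong ρ (λ j → E-cong τ (λ t → E-cong Ω (λ w → unwind j w (tv t))))) (E-const ρ e)) ⟩
        E ρ (λ j → E τ (λ t → P.⟨ Φ t , (λ z → F j (move j t z)) ⟩)) + e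
          ≡⟨ cong (_+ e) (sym (swap (avg K) τ (λ j t → P.⟨ Φ t , (λ z → F j (move j t z)) ⟩))) ⟩
        𝒯 F + e ∎
        where open ℚ.≤-Reasoning

  -- Averages along parabolas

  module Parabola (𝒮 : System) {𝓇 : Run} (𝓈 : Scales 𝓇) where
    open Run 𝓇
    open Scales 𝓈
    open OpsLemmas 𝒮

    0≤e : 0ℚ ≤ e
    0≤e = 0≤inv Θ

    module _ (b : ℤ)
      (fine : ∀ ι ι′ → ι ≢ ι′ → ∀ γ γ₁ γ₂ → γ₁ ≢ γ₂ → Fine Q₀ (quad-run b ι γ ι′ γ₁ ∘ quad-run b ι γ ι′ γ₂) e)
      (cu cv : Fin K → Fin K → Fin M → ℤ) (pu pv : Fin K → Fin K → Fin K → Fin K → ℤ)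
      (eu : ∀ ι γ ι′ γ′ t → cu ι′ γ′ t ℤ.+ ℤ.- cu ι γ t ≡ + 0 ℤ.+ pu ι γ ι′ γ′)
      (ev : ∀ ι γ ι′ γ′ t → cv ι′ γ′ t ℤ.+ ℤ.- cv ι γ t ≡ + 2 ℤ.* b ℤ.* p ℤ.* p ℤ.* (h ι′ γ′ ℤ.- h ι γ) ℤ.* + toℕ t ℤ.+ pv ι γ ι′ γ′)
      {s g′} (0<s : 0ℚ < s) (bg : Bd g′) (small : inv K + (N (⟦ Q₀ ⟧ g′) + (e + e)) ≤ (s * s) * (s * s)) where

      private
        ru rv : Fin K → Fin K → Fin K → Fin K → Fin M → ℤ
        ru _ _ _ _ _ = + 0
        rv ι γ ι′ γ′ t = + 2 ℤ.* b ℤ.* p ℤ.* p ℤ.* (h ι′ γ′ ℤ.- h ι γ) ℤ.* + toℕ t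

      -- One differencing turns b p² t² into the linear runs `quad-run` and makes the horizontal
      -- displacement constant, hence ru = 0. Runs with γ₁ ≠ γ₂ are jointly invariant under Q₀, so
      -- `pairwise-invariant` applies with s² in place of s; this accounts for the fourth power.
      parabola : N (⟦ vdC-run (avg M) cu cv ru rv pu pv eu ev ⟧ g′) ≤ inv K + s
      parabola = van-der-corput (avg M) cu cv ru rv pu pv eu ev 0<s bg
        (λ ι ι′ ι≢ι′ γ → pairwise-invariant (quad-run b ι γ ι′) Q₀ (0<* 0<s 0<s) 0≤e bg (fine ι ι′ ι≢ι′ γ) small)

  -- Each s is a root taken by a Cauchy-Schwarz step and fixed in advance: s₂ for a parabola, s₃ for
  -- a pair of curves, s₄ for the removal of Φ, s₅ for replacing averages along ω or along squares
  -- by structured functions.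
  record Constants {𝓇 : Run} (𝓈 : Scales 𝓇) : Set where
    open Run 𝓇
    open Scales 𝓈
    field
      θ s₂ s₃ s₄ s₅ : ℚ
      0<s₂ : 0ℚ < s₂
      0<s₃ : 0ℚ < s₃
      0<s₄ : 0ℚ < s₄
      0<s₅ : 0ℚ < s₅
      s₂≤1 : s₂ ≤ 1ℚ
      c₁ : inv K + ((θ + ((e + e) + (e + e))) + (e + e)) ≤ (s₂ * s₂) * (s₂ * s₂)
      c₂ : inv K + s₂ ≤ s₃ * s₃
      c₃ : inv K + s₃ ≤ s₄ * s₄
      c₄ : θ + ι 16 * e ≤ s₃ * s₃
      c₅ : (inv K + s₂) + (e + e) ≤ s₅ * s₅

  -- Splitting the product function into structured and residual parts

  module Decomposition (𝒮 : System) {𝓇 : Run} (𝓈 : Scales 𝓇) (𝒸 : Constants 𝓈) (f f₁ : System.X 𝒮 → ℚ)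
    (bf : Ops.Bd 𝒮 f) (bf₁ : Ops.Bd 𝒮 f₁) where
    open Run 𝓇
    open Scales 𝓈
    open Constants 𝒸
    open OpsLemmas 𝒮
    open Core 𝒮 𝓈
    open Pairs f f₁ bf bf₁
    module PP = Parabola (Ω ⋉ 𝒮) 𝓈
    open PP using (0≤e)

    private
      ρ = mean (avg K)
      τ = mean Tμ

      const-u : ∀ a a′ g g′ L p q k t →
        (a ℤ.* p ℤ.* t ℤ.- L ℤ.* g ℤ.* q ℤ.* k) ℤ.+ ((a′ ℤ.- a) ℤ.* p ℤ.* t ℤ.- (a′ ℤ.* p ℤ.* t ℤ.- L ℤ.* g′ ℤ.* q ℤ.* k)) ≡
        L ℤ.* q ℤ.* k ℤ.* (g′ ℤ.- g)
      const-u = solve-∀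

      -- The terms linear in t add up to 2 L p q k t (a g - a′ g′), which vanishes.
      const-v : ∀ {a g a′ g′ L} → a ℤ.* g ≡ L → a′ ℤ.* g′ ≡ L → ∀ p q k t →
        ℤ.- ((a ℤ.* p ℤ.* t ℤ.- L ℤ.* g ℤ.* q ℤ.* k) ℤ.* (a ℤ.* p ℤ.* t ℤ.- L ℤ.* g ℤ.* q ℤ.* k)) ℤ.+
          ((a ℤ.* a ℤ.- a′ ℤ.* a′) ℤ.* p ℤ.* p ℤ.* (t ℤ.* t) ℤ.-
            ℤ.- ((a′ ℤ.* p ℤ.* t ℤ.- L ℤ.* g′ ℤ.* q ℤ.* k) ℤ.* (a′ ℤ.* p ℤ.* t ℤ.- L ℤ.* g′ ℤ.* q ℤ.* k))) ≡
        L ℤ.* L ℤ.* q ℤ.* q ℤ.* k ℤ.* k ℤ.* (g′ ℤ.* g′ ℤ.- g ℤ.* g)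
      const-v {a} {g} {a′} {g′} {L} e₁ e₂ p q k t = trans (lem a g a′ g′ L p q k t)
        (trans (cong₂ (λ x y → + 2 ℤ.* L ℤ.* p ℤ.* q ℤ.* k ℤ.* t ℤ.* (x ℤ.- y) ℤ.+ L ℤ.* L ℤ.* q ℤ.* q ℤ.* k ℤ.* k ℤ.* (g′ ℤ.* g′ ℤ.- g ℤ.* g)) e₁ e₂)
          (lem₂ L p q k t (L ℤ.* L ℤ.* q ℤ.* q ℤ.* k ℤ.* k ℤ.* (g′ ℤ.* g′ ℤ.- g ℤ.* g))))
        where
          lem : ∀ a g a′ g′ L p q k t →
            ℤ.- ((a ℤ.* p ℤ.* t ℤ.- L ℤ.* g ℤ.* q ℤ.* k) ℤ.* (a ℤ.* p ℤ.* t ℤ.- L ℤ.* g ℤ.* q ℤ.* k)) ℤ.+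
              ((a ℤ.* a ℤ.- a′ ℤ.* a′) ℤ.* p ℤ.* p ℤ.* (t ℤ.* t) ℤ.-
                ℤ.- ((a′ ℤ.* p ℤ.* t ℤ.- L ℤ.* g′ ℤ.* q ℤ.* k) ℤ.* (a′ ℤ.* p ℤ.* t ℤ.- L ℤ.* g′ ℤ.* q ℤ.* k))) ≡
            + 2 ℤ.* L ℤ.* p ℤ.* q ℤ.* k ℤ.* t ℤ.* (a ℤ.* g ℤ.- a′ ℤ.* g′) ℤ.+ L ℤ.* L ℤ.* q ℤ.* q ℤ.* k ℤ.* k ℤ.* (g′ ℤ.* g′ ℤ.- g ℤ.* g)
          lem = solve-∀
          lem₂ : ∀ L p q k t r → + 2 ℤ.* L ℤ.* p ℤ.* q ℤ.* k ℤ.* t ℤ.* (L ℤ.- L) ℤ.+ r ≡ r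
          lem₂ = solve-∀

    module _ (j j′ : Fin K) (G G′ : P.X → ℚ) (bG : P.Bd G) (bG′ : P.Bd G′) {s} (0<s : 0ℚ < s)
      (small : P.N (P.⟦ curve j j′ ⟧ G′) ≤ s * s) where

      private
        cu cv : IxI × IxI → ℤ
        cu w = L ℤ.* q ℤ.* κ w ℤ.* (g j′ ℤ.- g j)
        cv w = L ℤ.* L ℤ.* q ℤ.* q ℤ.* κ w ℤ.* κ w ℤ.* (g j′ ℤ.* g j′ ℤ.- g j ℤ.* g j)
        G₀ : P.X → ℚ
        G₀ z = G (proj₁ z , act (cu (proj₁ z)) (cv (proj₁ z)) (proj₂ z))
        Gc : IxT → P.X → ℚ
        Gc t z = G′ (proj₁ z , act (u (curve j j′) t) (v (curve j j′) t) (proj₂ z))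

        back : ∀ x y → x ℤ.+ (y ℤ.- x) ≡ y
        back = solve-∀

        at : ∀ {a b a′ b′} → a ≡ a′ → b ≡ b′ → ∀ x → act a b x ≡ act a′ b′ x
        at refl refl x = refl

        single : ∀ t → P.⟨ (λ z → G (move j t z)) , (λ z → G′ (move j′ t z)) ⟩ ≡ P.⟨ G₀ , Gc t ⟩
        single t = E-cong Ω (λ w →
          let D = δ j (tv t) (κ w) ; D′ = δ j′ (tv t) (κ w)
              bu = u (curve j j′) t ℤ.- D′ ; bv = v (curve j j′) t ℤ.- (ℤ.- (D′ ℤ.* D′)) in
          trans (sym (𝔼-act bu bv (λ x → G (move j t (w , x)) * G′ (move j′ t (w , x)))))
            (E-cong 𝔼 (λ x → cong₂ _*_
              (cong (λ y → G (w , y)) (trans (act-+ _ _ _ _ x) (at (const-u (a j) (a j′) (g j) (g j′) L p q (κ w) (tv t)) (const-v {a j} {g j} {a j′} {g j′} (ag j) (ag j′) p q (κ w) (tv t)) x)))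
              (cong (λ y → G′ (w , y)) (trans (act-+ _ _ _ _ x) (at (back D′ _) (back (ℤ.- (D′ ℤ.* D′)) _) x))))))

      -- A translation frees the argument of G from t and turns that of G′ into a pure displacement
      -- along the curve, so that the average over t falls on G′ alone.
      curve-correlation : E τ (λ t → P.⟨ (λ z → G (move j t z)) , (λ z → G′ (move j′ t z)) ⟩) ≤ s
      curve-correlation = begin
        E τ (λ t → P.⟨ (λ z → G (move j t z)) , (λ z → G′ (move j′ t z)) ⟩)
          ≡⟨ E-cong τ single ⟩
        E τ (λ t → P.⟨ G₀ , Gc t ⟩)
          ≡⟨ sym (swap Tμ P.𝔼 (λ t z → G₀ z * Gc t z)) ⟩
        E P.𝔼 (λ z → E τ (λ t → G₀ z * Gc t z))
          ≡⟨ E-cong P.𝔼 (λ z → E-* τ (G₀ z) (λ t → Gc t z)) ⟩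
        P.⟨ G₀ , P.⟦ curve j j′ ⟧ G′ ⟩
          ≤⟨ cauchy-schwarz P.𝔼 G₀ (P.⟦ curve j j′ ⟧ G′) 0<s (P.Bd-N (λ z → bG _)) small ⟩
        s ∎
        where open ℚ.≤-Reasoning

    -- Cauchy-Schwarz in (t , z) discards Φ and doubles the average over j; here the independence of
    -- Φ from j is used. The diagonal j = j′ costs 1 / K.
    𝒯-bound : (G : Fin K → P.X → ℚ) → (∀ j → P.Bd (G j)) →
      (∀ j j′ → j ≢ j′ → P.N (P.⟦ curve j j′ ⟧ (G j′)) ≤ s₃ * s₃) → 𝒯 G ≤ s₄
    𝒯-bound G bG small = begin
      𝒯 G
        ≡⟨ E-cong τ (λ t → trans (sym (swap (avg K) P.𝔼 (λ j z → Φ t z * G j (move j t z)))) (E-cong P.𝔼 (λ z → E-* ρ (Φ t z) (λ j → G j (move j t z))))) ⟩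
      E τ (λ t → P.⟨ Φ t , (λ z → E ρ (λ j → G j (move j t z))) ⟩)
        ≤⟨ cauchy-schwarz (τ ⊗ P.𝔼) (λ y → Φ (proj₁ y) (proj₂ y)) (λ y → E ρ (λ j → G j (move j (proj₁ y) (proj₂ y)))) 0<s₄
             (E-≤ τ (λ t → P.Bd-N (bΦ t))) norm ⟩
      s₄ ∎
      where
        open ℚ.≤-Reasoning
        corr : Fin K → Fin K → ℚ
        corr j j′ = E τ (λ t → P.⟨ (λ z → G j (move j t z)) , (λ z → G j′ (move j′ t z)) ⟩)
        norm : E τ (λ t → P.N (λ z → E ρ (λ j → G j (move j t z)))) ≤ s₄ * s₄
        norm = begin
          E τ (λ t → P.N (λ z → E ρ (λ j → G j (move j t z))))
            ≡⟨ E-cong τ (λ t → sq-expand (avg K) P.𝔼 (λ j z → G j (move j t z))) ⟩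
          E τ (λ t → E ρ (λ j → E ρ (λ j′ → P.⟨ (λ z → G j (move j t z)) , (λ z → G j′ (move j′ t z)) ⟩)))
            ≡⟨ swap (avg K) τ (λ j t → E ρ (λ j′ → P.⟨ (λ z → G j (move j t z)) , (λ z → G j′ (move j′ t z)) ⟩)) ⟩
          E ρ (λ j → E τ (λ t → E ρ (λ j′ → P.⟨ (λ z → G j (move j t z)) , (λ z → G j′ (move j′ t z)) ⟩)))
            ≡⟨ E-cong ρ (λ j → swap (avg K) τ (λ j′ t → P.⟨ (λ z → G j (move j t z)) , (λ z → G j′ (move j′ t z)) ⟩)) ⟩
          E ρ (λ j → E ρ (corr j))
            ≤⟨ offdiag corr (ℚ.<⇒≤ 0<s₃) (λ j → E-≤ τ (λ t → P.Bd-⟨⟩ (λ z → bG j _) (λ z → bG j _)))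
                 (λ j j′ j≢j′ → curve-correlation j j′ (G j) (G j′) (bG j) (bG j′) 0<s₃ (small j j′ j≢j′)) ⟩
          inv K + s₃
            ≤⟨ c₃ ⟩
          s₄ * s₄ ∎

    H : Fin K → P.X → ℚ
    H j = P.⟦ sq Q₁ ⟧ (F j)

    bH : ∀ j → P.Bd (H j)
    bH j = P.Bd-⟦⟧ (sq Q₁) (bF j)

    -- F = 2 G₁ + 2 G₂ + G₃: the vertical residual, the horizontal residual of the vertically
    -- structured part, and the part structured in both directions.
    G₁ G₂ G₃ : Fin K → P.X → ℚ
    G₁ j = P.half-residual Q₁ (F j)
    G₂ j = P.half-residual P₁ (H j)
    G₃ j = P.⟦ sq P₁ ⟧ (H j)

    bG₁ : ∀ j → P.Bd (G₁ j)
    bG₁ j = P.Bd-half (bF j) (bH j)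

    bG₂ : ∀ j → P.Bd (G₂ j)
    bG₂ j = P.Bd-half (bH j) (P.Bd-⟦⟧ (sq P₁) (bH j))

    module _ (gap : ∀ j → P.N (P.⟦ Q₀ ⟧ (F j)) - P.N (P.⟦ Q₁ ⟧ (F j)) ≤ θ) where

      -- By the energy gap Q₀ hardly sees the residual of Q₁, and differencing the curve leaves
      -- vertical linear runs, which retain only what Q₀ sees.
      G₁-small : ∀ j j′ → j ≢ j′ → P.N (P.⟦ curve j j′ ⟧ (G₁ j′)) ≤ s₃ * s₃
      G₁-small j j′ j≢j′ = ℚ.≤-trans
        (PP.parabola (β j j′) (Q₀-β j j′ j≢j′)
          (λ ι γ t → α j j′ ℤ.* p ℤ.* (+ toℕ t ℤ.+ h ι γ))
          (λ ι γ t → β j j′ ℤ.* p ℤ.* p ℤ.* ((+ toℕ t ℤ.+ h ι γ) ℤ.* (+ toℕ t ℤ.+ h ι γ)))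
          (λ ι γ ι′ γ′ → α j j′ ℤ.* p ℤ.* (h ι′ γ′ ℤ.- h ι γ))
          (λ ι γ ι′ γ′ → β j j′ ℤ.* p ℤ.* p ℤ.* (h ι′ γ′ ℤ.* h ι′ γ′ ℤ.- h ι γ ℤ.* h ι γ))
          (λ ι γ ι′ γ′ t → lu (α j j′) p (+ toℕ t) (h ι γ) (h ι′ γ′))
          (λ ι γ ι′ γ′ t → lv (β j j′) p (+ toℕ t) (h ι γ) (h ι′ γ′))
          0<s₂ (bG₁ j′)
          (ℚ.≤-trans (+-monoʳ-≤ (inv K) (+-monoˡ-≤ (e + e)
            (ℚ.≤-trans (P.N-half-residual Q₀ Q₁ Q₀Q₁ (bF j′)) (+-monoˡ-≤ ((e + e) + (e + e)) (gap j′))))) c₁))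
        c₂
        where
          lu : ∀ α p t h h′ → α ℤ.* p ℤ.* (t ℤ.+ h′) ℤ.+ ℤ.- (α ℤ.* p ℤ.* (t ℤ.+ h)) ≡ + 0 ℤ.+ α ℤ.* p ℤ.* (h′ ℤ.- h)
          lu = solve-∀
          lv : ∀ β p t h h′ → β ℤ.* p ℤ.* p ℤ.* ((t ℤ.+ h′) ℤ.* (t ℤ.+ h′)) ℤ.+ ℤ.- (β ℤ.* p ℤ.* p ℤ.* ((t ℤ.+ h) ℤ.* (t ℤ.+ h))) ≡
            + 2 ℤ.* β ℤ.* p ℤ.* p ℤ.* (h′ ℤ.- h) ℤ.* t ℤ.+ β ℤ.* p ℤ.* p ℤ.* (h′ ℤ.* h′ ℤ.- h ℤ.* h)
          lv = solve-∀

    module _ (gap : ∀ j → P.N (P.⟦ Q₀ ⟧ (P.⟦ P₀ ⟧ (F j))) - P.N (P.⟦ Q₂ ⟧ (P.⟦ P₂ ⟧ (F j))) ≤ θ) where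

      private
        sqQ₁-fine : Fine (sq Q₁) Q₂ (e + e)
        sqQ₁-fine (i , i′) = Inv-+ Q₂ (Q₁Q₂ i′) (Inv-neg Q₂ (Q₁Q₂ i))

        top : ∀ j → P.N (P.⟦ P₀ ⟧ (H j)) ≤ P.N (P.⟦ Q₀ ⟧ (P.⟦ P₀ ⟧ (F j))) + (e + e)
        top j = ℚ.≤-trans (≡≤ (P.N-cong (P.⟦⟧-comm P₀ (sq Q₁) (F j))) (P.N-sq Q₁ (P.⟦ P₀ ⟧ (F j))))
          (P.N-fine Q₀ Q₁ Q₀Q₁ (P.Bd-⟦⟧ P₀ (bF j)))

        -- The displacements of `sq Q₁` are differences of those of Q₁, and Q₂ is long enough to
        -- absorb them. With `top`, this sandwiches the energies of H between energies of F at the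
        -- outer scales; hence the need for a third scale.
        bottom : ∀ j → P.N (P.⟦ Q₂ ⟧ (P.⟦ P₂ ⟧ (F j))) ≤ (P.N (P.⟦ P₁ ⟧ (H j)) + ((e + e) + (e + e))) + (e + e)
        bottom j = begin
          P.N (P.⟦ Q₂ ⟧ (P.⟦ P₂ ⟧ (F j)))
            ≡⟨ P.N-cong (P.⟦⟧-comm Q₂ P₂ (F j)) ⟩
          P.N (P.⟦ P₂ ⟧ (P.⟦ Q₂ ⟧ (F j)))
            ≤⟨ P.N-fine P₁ P₂ P₁P₂ (P.Bd-⟦⟧ Q₂ (bF j)) ⟩
          P.N (P.⟦ P₁ ⟧ (P.⟦ Q₂ ⟧ (F j))) + (e + e)
            ≡⟨ cong (_+ (e + e)) (P.N-cong (P.⟦⟧-comm P₁ Q₂ (F j))) ⟩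
          P.N (P.⟦ Q₂ ⟧ (P.⟦ P₁ ⟧ (F j))) + (e + e)
            ≤⟨ +-monoˡ-≤ (e + e) (P.N-fine (sq Q₁) Q₂ sqQ₁-fine (P.Bd-⟦⟧ P₁ (bF j))) ⟩
          (P.N (P.⟦ sq Q₁ ⟧ (P.⟦ P₁ ⟧ (F j))) + ((e + e) + (e + e))) + (e + e)
            ≡⟨ cong (λ r → (r + ((e + e) + (e + e))) + (e + e)) (P.N-cong (P.⟦⟧-comm (sq Q₁) P₁ (F j))) ⟩
          (P.N (P.⟦ P₁ ⟧ (H j)) + ((e + e) + (e + e))) + (e + e) ∎
          where open ℚ.≤-Reasoning

        -- G₂ is invariant in the second coordinate, so along a curve it is averaged over a line.
        flat : ∀ j j′ z → ∣ P.⟦ curve j j′ ⟧ (G₂ j′) z - P.⟦ line j j′ ⟧ (G₂ j′) z ∣ ≤ e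
        flat j j′ z = E-near τ (λ t → still t)
          where
            module _ (t : IxT) where
              b = v (curve j j′) t
              c = u (curve j j′) t
              y = P.act c (+ 0) z
              y′ = P.act c b z
              y′≡ : y′ ≡ P.act (+ 0) b y
              y′≡ = sym (trans (P.act-+ (+ 0) b c (+ 0) z) (cong₂ (λ r s → P.act r s z) (ℤ.+-identityˡ c) (ℤ.+-identityʳ b)))
              H≈ : ∣ H j′ (P.act (+ 0) b y) - H j′ y ∣ ≤ e
              H≈ = P.inv-act (sq Q₁) (Inv-sq Q₁ (Q₁-β j j′ t)) (bF j′) y
              PH≈ : ∣ P.⟦ sq P₁ ⟧ (H j′) (P.act (+ 0) b y) - P.⟦ sq P₁ ⟧ (H j′) y ∣ ≤ e
              PH≈ = ≡≤ (cong₂ (λ r s → ∣ r - s ∣) (P.⟦⟧-comm (sq P₁) (sq Q₁) (F j′) _) (P.⟦⟧-comm (sq P₁) (sq Q₁) (F j′) _))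
                (P.inv-act (sq Q₁) (Inv-sq Q₁ (Q₁-β j j′ t)) (P.Bd-⟦⟧ (sq P₁) (bF j′)) y)
              still : ∣ G₂ j′ y′ - G₂ j′ y ∣ ≤ e
              still = ≡≤ (trans (cong (λ r → ∣ G₂ j′ r - G₂ j′ y ∣) y′≡)
                  (trans (cong ∣_∣ (solve 5 (λ o a b c d → o :* (a :- b) :- o :* (c :- d) := o :* ((a :- c) :+ (:- (b :- d)))) refl ½ _ _ _ _))
                    (trans (∣p*q∣≡∣p∣*∣q∣ ½ _) (cong (_* ∣ (H j′ (P.act (+ 0) b y) - H j′ y) + (- (P.⟦ sq P₁ ⟧ (H j′) (P.act (+ 0) b y) - P.⟦ sq P₁ ⟧ (H j′) y)) ∣) (0≤p⇒∣p∣≡p (ℚ.nonNegative⁻¹ ½))))))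
                (≤≡ (*-monoˡ (ℚ.nonNegative⁻¹ ½) (ℚ.≤-trans (∣p+q∣≤∣p∣+∣q∣ _ _) (+-mono-≤ H≈ (≡≤ (∣-p∣≡∣p∣ _) PH≈))))
                  (solve 1 (λ e → con ½ :* (e :+ e) := e) refl e))

      -- Along the curve G₂ is averaged over a line, which P₀ controls, and the energy drop of H
      -- from P₀ to P₁ is bounded by the gap. The 16 errors are 2 for passing to the line, 2 for the
      -- line, 4 for the residual, 2 for `top` and 6 for `bottom`.
      G₂-small : ∀ j j′ → j ≢ j′ → P.N (P.⟦ curve j j′ ⟧ (G₂ j′)) ≤ s₃ * s₃
      G₂-small j j′ j≢j′ = ℚ.≤-trans (0≤b-a⇒a≤b (≤≡
          (0≤+ (a≤b⇒0≤b-a i₁) (0≤+ (a≤b⇒0≤b-a i₂) (0≤+ (a≤b⇒0≤b-a (P.N-half-residual P₀ P₁ P₀P₁ (bH j′)))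
            (0≤+ (a≤b⇒0≤b-a (top j′)) (0≤+ (a≤b⇒0≤b-a (bottom j′)) (a≤b⇒0≤b-a (gap j′)))))))
          (solve 9 (λ c l r h₀ h₁ x y e θ →
              ((l :+ (e :+ e)) :- c) :+ (((r :+ (e :+ e)) :- l) :+ (((h₀ :- h₁ :+ ((e :+ e) :+ (e :+ e))) :- r) :+
                (((x :+ (e :+ e)) :- h₀) :+ ((((h₁ :+ ((e :+ e) :+ (e :+ e))) :+ (e :+ e)) :- y) :+ (θ :- (x :- y))))))
              := (θ :+ (con 1ℚ :+ (con 1ℚ :+ (con 1ℚ :+ (con 1ℚ :+ (con 1ℚ :+ (con 1ℚ :+ (con 1ℚ :+ (con 1ℚ :+
                  (con 1ℚ :+ (con 1ℚ :+ (con 1ℚ :+ (con 1ℚ :+ (con 1ℚ :+ (con 1ℚ :+ (con 1ℚ :+ (con 1ℚ :+ con 0ℚ)))))))))))))))) :* e) :- c) refl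
            (P.N (P.⟦ curve j j′ ⟧ (G₂ j′))) (P.N (P.⟦ line j j′ ⟧ (G₂ j′))) (P.N (P.⟦ P₀ ⟧ (G₂ j′)))
            (P.N (P.⟦ P₀ ⟧ (H j′))) (P.N (P.⟦ P₁ ⟧ (H j′))) (P.N (P.⟦ Q₀ ⟧ (P.⟦ P₀ ⟧ (F j′)))) (P.N (P.⟦ Q₂ ⟧ (P.⟦ P₂ ⟧ (F j′)))) e θ)))
        c₄
        where
          i₁ : P.N (P.⟦ curve j j′ ⟧ (G₂ j′)) ≤ P.N (P.⟦ line j j′ ⟧ (G₂ j′)) + (e + e)
          i₁ = P.N-near (P.Bd-⟦⟧ (curve j j′) (bG₂ j′)) (P.Bd-⟦⟧ (line j j′) (bG₂ j′)) (flat j j′)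
          i₂ : P.N (P.⟦ line j j′ ⟧ (G₂ j′)) ≤ P.N (P.⟦ P₀ ⟧ (G₂ j′)) + (e + e)
          i₂ = P.N-fine P₀ (line j j′) (P₀-line j j′ j≢j′) (bG₂ j′)

  -- The contribution of the structured part

  module Structured (𝒮 : System) {𝓇 : Run} (𝓈 : Scales 𝓇) (𝒸 : Constants 𝓈) (f f₁ : System.X 𝒮 → ℚ)
    (uf : Ops.Unit 𝒮 f) (bf₁ : Ops.Bd 𝒮 f₁) where
    open Run 𝓇
    open Scales 𝓈
    open Constants 𝒸
    open OpsLemmas 𝒮
    open Core 𝒮 𝓈

    bf : Bd f
    bf = Unit⇒Bd uf

    open Pairs f f₁ bf bf₁ public
    open Decomposition 𝒮 𝓈 𝒸 f f₁ bf bf₁ public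
    open PP using (0≤e)

    private
      ρ = mean (avg K)
      τ = mean Tμ
      ν = mean (avg m ⊠ avg K)

    module _ (gapR : N (⟦ R₀ ⟧ f) - N (⟦ R₁ ⟧ f) ≤ θ) where

      private
        K₂f : X → ℚ
        K₂f = ⟦ sq R₁ ⟧ f

        uK : Unit K₂f
        uK = Unit-⟦⟧ (sq R₁) uf

        f⊥ : X → ℚ
        f⊥ x = f x - K₂f x

        bf⊥ : Bd f⊥
        bf⊥ x = unit-diff (proj₁ (uf x)) (proj₂ (uf x)) (proj₁ (uK x)) (proj₂ (uK x))

        -- The moving half of Φ averaged over t, and its structured substitute, which no longer
        -- depends on the pair of indices.
        U V : P.X → ℚ
        U z = ⟦ ω-run (proj₁ z) ⟧ f (proj₂ z)
        V z = K₂f (proj₂ z)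

        uU : P.Unit U
        uU z = Unit-⟦⟧ (ω-run (proj₁ z)) uf (proj₂ z)

        near : ∀ z → ∣ (U z - V z) - ⟦ ω-run (proj₁ z) ⟧ f⊥ (proj₂ z) ∣ ≤ e
        near z = ≡≤ (cong ∣_∣ (trans (cong (λ r → (U z - V z) - r) (⟦⟧-- (ω-run w) f K₂f x))
            (solve 3 (λ a b c → (a :- b) :- (a :- c) := c :- b) refl (U z) (V z) (⟦ ω-run w ⟧ K₂f x))))
          (absorb (ω-run w) (λ t y → inv-act (sq R₁) (Inv-sq R₁ (R₁-ω t w)) bf y) x)
          where
            w = proj₁ z
            x = proj₂ z

        -- For ι ≠ ι′ the runs in γ′ are pairwise jointly invariant; the pairs with ι = ι′, where κ
        -- may vanish, cost 1 / K.
        average : E Ω (λ w → N (⟦ ω-run w ⟧ f⊥)) ≤ inv K + s₂ * s₂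
        average = ≡≤ (E-cong ρ (λ ι → swap (avg K) ν (λ ι′ iγ → E ν (λ iγ′ → N (⟦ ω-run ((ι , iγ) , (ι′ , iγ′)) ⟧ f⊥)))))
          (offdiag (λ ι ι′ → E ν (λ iγ → E ν (λ iγ′ → N (⟦ ω-run ((ι , iγ) , (ι′ , iγ′)) ⟧ f⊥)))) (0≤sq s₂)
            (λ ι → E-≤ ν (λ iγ → E-≤ ν (λ iγ′ → Bd-N (Bd-⟦⟧ (ω-run ((ι , iγ) , (ι , iγ′))) bf⊥))))
            (λ ι ι′ ι≢ι′ → E-≤ ν (λ { (i , γ) → E-≤ (mean (avg m)) (λ i′ →
              pairwise-invariant (λ γ′ → ω-run ((ι , i , γ) , (ι′ , i′ , γ′))) R₀ (0<* 0<s₂ 0<s₂) 0≤e bf⊥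
                (R₀-ω ι ι′ ι≢ι′ i γ i′)
                (ℚ.≤-trans (+-monoʳ-≤ (inv K) (+-monoˡ-≤ (e + e) (ℚ.≤-trans (N-residual R₀ R₁ R₀R₁ bf) (+-monoˡ-≤ ((e + e) + (e + e)) gapR)))) c₁)) })))

        N-U-V : P.N (λ z → U z - V z) ≤ s₅ * s₅
        N-U-V = ℚ.≤-trans (P.N-near (λ z → unit-diff (proj₁ (uU z)) (proj₂ (uU z)) (proj₁ (uK _)) (proj₂ (uK _)))
            (λ z → Bd-⟦⟧ (ω-run (proj₁ z)) bf⊥ (proj₂ z)) near)
          (ℚ.≤-trans (+-monoˡ-≤ (e + e) (ℚ.≤-trans average (+-monoʳ-≤ (inv K) (≤≡ (*-monoˡ (ℚ.<⇒≤ 0<s₂) s₂≤1) (*-identityʳ s₂))))) c₅)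

        fG₃ : Fin K → P.X → ℚ
        fG₃ j z = f (proj₂ z) * G₃ j z

        bG₃ : ∀ j → P.Bd (G₃ j)
        bG₃ j = P.Bd-⟦⟧ (sq P₁) (bH j)

        bfG₃ : ∀ j → P.Bd (fG₃ j)
        bfG₃ j z = ∣*∣≤ (bf _) (bG₃ j z)

        G₃-still : ∀ j t z → ∣ G₃ j (move j t z) - G₃ j z ∣ ≤ e + e
        G₃-still j t z = ∣∣-tri {G₃ j (move j t z)} {G₃ j y} {G₃ j z}
          (≡≤ (cong (λ r → ∣ G₃ j r - G₃ j y ∣) (sym split)) (P.inv-act (sq P₁) (Inv-sq P₁ (P₁-δ j t w)) (bH j) y))
          (≡≤ (cong₂ (λ r s → ∣ r - s ∣) (P.⟦⟧-comm (sq P₁) (sq Q₁) (F j) y) (P.⟦⟧-comm (sq P₁) (sq Q₁) (F j) z))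
            (P.inv-act (sq Q₁) (Inv-sq Q₁ (Q₁-δ j t w)) (P.Bd-⟦⟧ (sq P₁) (bF j)) z))
          where
            w = proj₁ z
            D = δ j (tv t) (κ w)
            y = P.act (+ 0) (ℤ.- (D ℤ.* D)) z
            split : P.act D (+ 0) y ≡ move j t z
            split = trans (P.act-+ D (+ 0) (+ 0) (ℤ.- (D ℤ.* D)) z) (cong₂ (λ r s → P.act r s z) (ℤ.+-identityʳ D) (ℤ.+-identityˡ _))

        hh : X → ℚ
        hh x = f x * K₂f x

        uhh : Unit hh
        uhh x = 0≤* (proj₁ (uf x)) (proj₁ (uK x)) ,
          ≤≡ (*-mono (proj₁ (uf x)) 0≤1 (proj₂ (uf x)) (proj₂ (uK x))) (*-identityʳ 1ℚ)

        G₀ : X → ℚ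
        G₀ = ⟦ sq P₁ ⟧ (⟦ sq Q₁ ⟧ hh)

        uG₀ : Unit G₀
        uG₀ = Unit-⟦⟧ (sq P₁) (Unit-⟦⟧ (sq Q₁) uhh)

        ζ : Fin K → IxI → X → ℚ
        ζ j i x = f₁ (act (ee j ℤ.* iv i) (+ 0) x)

        bζ : ∀ j i → Bd (ζ j i)
        bζ j i x = bf₁ _

        -- G₃ is F under symmetric operators. Moved to the other side they act on f · K₂f, a
        -- function without indices, and the bare product F is left.
        transfer : ∀ j → P.⟨ fG₃ j , V ⟩ ≡ E Ω (λ w → E 𝔼 (λ x → F j (w , x) * G₀ x))
        transfer j = begin
          P.⟨ fG₃ j , V ⟩
            ≡⟨ E-cong P.𝔼 (λ z → solve 3 (λ a b c → (a :* b) :* c := b :* (a :* c)) refl (f (proj₂ z)) (G₃ j z) (V z)) ⟩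
          P.⟨ P.⟦ sq P₁ ⟧ (H j) , (λ z → hh (proj₂ z)) ⟩
            ≡⟨ P.sq-self P₁ (H j) (λ z → hh (proj₂ z)) ⟩
          P.⟨ P.⟦ sq Q₁ ⟧ (F j) , P.⟦ sq P₁ ⟧ (λ z → hh (proj₂ z)) ⟩
            ≡⟨ P.sq-self Q₁ (F j) (P.⟦ sq P₁ ⟧ (λ z → hh (proj₂ z))) ⟩
          P.⟨ F j , P.⟦ sq Q₁ ⟧ (P.⟦ sq P₁ ⟧ (λ z → hh (proj₂ z))) ⟩
            ≡⟨ E-cong P.𝔼 (λ z → cong (F j z *_) (⟦⟧-comm (sq Q₁) (sq P₁) hh (proj₂ z))) ⟩
          E Ω (λ w → E 𝔼 (λ x → F j (w , x) * G₀ x)) ∎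
          where open ≡-Reasoning

        -- Translating by the first index replaces the shift by i′ - i by separate shifts by i and
        -- i′; G₀ hardly notices the translation.
        recombine : ∀ j w → E 𝔼 (λ x → F j (w , x) * G₀ x) ≤ E 𝔼 (λ x → (ζ j (proj₁ w) x * ζ j (proj₂ w) x) * G₀ x) + e
        recombine j w = ≡≤ (trans (sym (𝔼-act c (+ 0) (λ x → F j (w , x) * G₀ x)))
            (E-cong 𝔼 (λ x → cong (λ r → (ζ j (proj₁ w) x * f₁ r) * G₀ (act c (+ 0) x)) (trans (act-+ _ _ _ _ x)
              (cong₂ (λ r s → act r s x) (dist (ee j) (iv (proj₁ w)) (iv (proj₂ w))) refl)))))
          (near⇒≤ (⟨⟩-near {λ x → G₀ (act c (+ 0) x)} {G₀} (λ x → ∣*∣≤ (bζ j (proj₁ w) x) (bζ j (proj₂ w) x))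
            (λ x → inv-act (sq P₁) (Inv-sq P₁ (P₁-e j (proj₁ w))) (Unit⇒Bd (Unit-⟦⟧ (sq Q₁) uhh)) x)))
          where
            c = ee j ℤ.* iv (proj₁ w)
            dist : ∀ E i i′ → E ℤ.* (i′ ℤ.- i) ℤ.+ E ℤ.* i ≡ E ℤ.* i′
            dist = solve-∀

        -- With the two shifts separated, the double average over indices is the square of a single
        -- one, and its weight G₀ is at most 1.
        square : ∀ j → E Ω (λ w → E 𝔼 (λ x → (ζ j (proj₁ w) x * ζ j (proj₂ w) x) * G₀ x)) ≤ N (⟦ shifts j ⟧ f₁)
        square j = begin
          E Ω (λ w → E 𝔼 (λ x → (ζ j (proj₁ w) x * ζ j (proj₂ w) x) * G₀ x))
            ≡⟨ sym (swap (Iμ ⊠ Iμ) 𝔼 (λ w x → (ζ j (proj₁ w) x * ζ j (proj₂ w) x) * G₀ x)) ⟩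
          E 𝔼 (λ x → E Ω (λ w → (ζ j (proj₁ w) x * ζ j (proj₂ w) x) * G₀ x))
            ≡⟨ E-cong 𝔼 (λ x → begin-equality
                 E Ω (λ w → (ζ j (proj₁ w) x * ζ j (proj₂ w) x) * G₀ x)
                   ≡⟨ E-cong Ω (λ w → *-comm _ _) ⟩
                 E Ω (λ w → G₀ x * (ζ j (proj₁ w) x * ζ j (proj₂ w) x))
                   ≡⟨ E-* Ω (G₀ x) (λ w → ζ j (proj₁ w) x * ζ j (proj₂ w) x) ⟩
                 G₀ x * E (mean Iμ) (λ i → E (mean Iμ) (λ i′ → ζ j i x * ζ j i′ x))
                   ≡⟨ cong (G₀ x *_) (E-cong (mean Iμ) (λ i → trans (E-* (mean Iμ) (ζ j i x) (λ i′ → ζ j i′ x)) (*-comm _ _))) ⟩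
                 G₀ x * E (mean Iμ) (λ i → ⟦ shifts j ⟧ f₁ x * ζ j i x)
                   ≡⟨ cong (G₀ x *_) (E-* (mean Iμ) (⟦ shifts j ⟧ f₁ x) (λ i → ζ j i x)) ⟩
                 G₀ x * (⟦ shifts j ⟧ f₁ x * ⟦ shifts j ⟧ f₁ x) ∎) ⟩
          E 𝔼 (λ x → G₀ x * (⟦ shifts j ⟧ f₁ x * ⟦ shifts j ⟧ f₁ x))
            ≤⟨ E-mono 𝔼 (λ x → ≤≡ (*-monoʳ (0≤sq (⟦ shifts j ⟧ f₁ x)) (proj₂ (uG₀ x))) (*-identityˡ _)) ⟩
          N (⟦ shifts j ⟧ f₁) ∎
          where open ℚ.≤-Reasoning

      -- G₃ is blind to the moves, so t survives only in Φ, whose average over t is structured. What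
      -- remains is the energy of f₁ along `shifts`.
      𝒯-structured : ∀ {τ₀} → (∀ j → N (⟦ shifts j ⟧ f₁) ≤ τ₀) → 𝒯 G₃ ≤ ((τ₀ + e) + s₅) + (e + e)
      𝒯-structured {τ₀} small = begin
        𝒯 G₃
          ≤⟨ E-mono τ (λ t → E-mono ρ (λ j → near⇒≤ (P.⟨⟩-near {λ z → G₃ j (move j t z)} {G₃ j} (bΦ t) (G₃-still j t)))) ⟩
        E τ (λ t → E ρ (λ j → P.⟨ Φ t , G₃ j ⟩ + (e + e)))
          ≡⟨ trans (E-cong τ (λ t → trans (E-+ ρ _ _) (cong₂ _+_ refl (E-const ρ (e + e)))))
               (trans (E-+ τ _ _) (cong₂ _+_ refl (E-const τ (e + e)))) ⟩
        E τ (λ t → E ρ (λ j → P.⟨ Φ t , G₃ j ⟩)) + (e + e)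
          ≡⟨ cong (_+ (e + e)) (swap (avg K) τ (λ j t → P.⟨ Φ t , G₃ j ⟩)) ⟩
        E ρ (λ j → E τ (λ t → P.⟨ Φ t , G₃ j ⟩)) + (e + e)
          ≤⟨ +-monoˡ-≤ (e + e) (E-≤ ρ each) ⟩
        ((τ₀ + e) + s₅) + (e + e) ∎
        where
          open ℚ.≤-Reasoning
          collect : ∀ j → E τ (λ t → P.⟨ Φ t , G₃ j ⟩) ≡ P.⟨ fG₃ j , U ⟩
          collect j = trans (sym (swap Tμ P.𝔼 (λ t z → Φ t z * G₃ j z))) (E-cong P.𝔼 (λ z →
            trans (E-cong τ (λ t → solve 3 (λ a b c → (a :* b) :* c := (a :* c) :* b) refl (f (proj₂ z)) (f (act (+ 0) (ω (κ (proj₁ z)) (tv t)) (proj₂ z))) (G₃ j z)))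
              (E-* τ (fG₃ j z) (λ t → f (act (+ 0) (ω (κ (proj₁ z)) (tv t)) (proj₂ z))))))
          each : ∀ j → E τ (λ t → P.⟨ Φ t , G₃ j ⟩) ≤ (τ₀ + e) + s₅
          each j = begin
            E τ (λ t → P.⟨ Φ t , G₃ j ⟩)
              ≡⟨ collect j ⟩
            P.⟨ fG₃ j , U ⟩
              ≡⟨ trans (E-cong P.𝔼 (λ z → solve 3 (λ a b c → a :* b := a :* c :+ a :* (b :- c)) refl (fG₃ j z) (U z) (V z))) (E-+ P.𝔼 _ _) ⟩
            P.⟨ fG₃ j , V ⟩ + P.⟨ fG₃ j , (λ z → U z - V z) ⟩
              ≤⟨ +-mono-≤ (≡≤ (transfer j) (ℚ.≤-trans (E-mono Ω (recombine j)) (≡≤ (trans (E-+ Ω _ _) (cong₂ _+_ refl (E-const Ω e)))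
                   (+-monoˡ-≤ e (ℚ.≤-trans (square j) (small j))))))
                   (cauchy-schwarz P.𝔼 (fG₃ j) (λ z → U z - V z) 0<s₅ (P.Bd-N (bfG₃ j)) N-U-V) ⟩
            (τ₀ + e) + s₅ ∎

    total-error : ℚ → ℚ
    total-error τ₀ = ((s₄ + s₄) + (s₄ + s₄)) + (((τ₀ + e) + s₅) + (e + e))

    corner-average-small : ∀ {τ₀} →
      N (⟦ R₀ ⟧ f) - N (⟦ R₁ ⟧ f) ≤ θ →
      (∀ j → P.N (P.⟦ Q₀ ⟧ (F j)) - P.N (P.⟦ Q₁ ⟧ (F j)) ≤ θ) →
      (∀ j → P.N (P.⟦ Q₀ ⟧ (P.⟦ P₀ ⟧ (F j))) - P.N (P.⟦ Q₂ ⟧ (P.⟦ P₂ ⟧ (F j))) ≤ θ) →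
      (∀ j → N (⟦ shifts j ⟧ f₁) ≤ τ₀) →
      E ρ (λ j → N (corner-average j)) ≤ total-error τ₀ + e
    corner-average-small {τ₀} gapR gapQ gapPQ small = ℚ.≤-trans average-bound (+-monoˡ-≤ e (begin
      𝒯 F
        -- ½ enters the identity as an indeterminate, which produces a term with 1 - (½ + ½); the
        -- next step evaluates it to 0.
        ≡⟨ 𝒯-cong {F} {λ j z → ((G₁ j z + G₁ j z) + (G₂ j z + G₂ j z)) + (G₃ j z + (1ℚ - (½ + ½)) * (F j z - G₃ j z))} (λ j z → solve 4 (λ o f h k → f := ((o :* (f :- h) :+ o :* (f :- h)) :+ (o :* (h :- k) :+ o :* (h :- k))) :+ (k :+ ((con 1ℚ :- (o :+ o)) :* (f :- k)))) refl ½ (F j z) (H j z) (G₃ j z)) ⟩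
      𝒯 (λ j z → ((G₁ j z + G₁ j z) + (G₂ j z + G₂ j z)) + (G₃ j z + (1ℚ - (½ + ½)) * (F j z - G₃ j z)))
        ≡⟨ 𝒯-cong {λ j z → ((G₁ j z + G₁ j z) + (G₂ j z + G₂ j z)) + (G₃ j z + (1ℚ - (½ + ½)) * (F j z - G₃ j z))} {λ j z → ((G₁ j z + G₁ j z) + (G₂ j z + G₂ j z)) + G₃ j z} (λ j z → cong (λ r → ((G₁ j z + G₁ j z) + (G₂ j z + G₂ j z)) + r)
             (trans (cong (λ r → G₃ j z + r * (F j z - G₃ j z)) (solve 0 (con 1ℚ :- (con ½ :+ con ½) := con 0ℚ) refl)) (solve 2 (λ a b → a :+ con 0ℚ :* b := a) refl (G₃ j z) (F j z - G₃ j z)))) ⟩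
      𝒯 (λ j z → ((G₁ j z + G₁ j z) + (G₂ j z + G₂ j z)) + G₃ j z)
        ≡⟨ trans (𝒯-+ (λ j z → (G₁ j z + G₁ j z) + (G₂ j z + G₂ j z)) G₃) (cong (_+ 𝒯 G₃) (trans (𝒯-+ (λ j z → G₁ j z + G₁ j z) (λ j z → G₂ j z + G₂ j z)) (cong₂ _+_ (𝒯-+ G₁ G₁) (𝒯-+ G₂ G₂)))) ⟩
      ((𝒯 G₁ + 𝒯 G₁) + (𝒯 G₂ + 𝒯 G₂)) + 𝒯 G₃
        ≤⟨ +-mono-≤ (+-mono-≤ (+-mono-≤ b₁ b₁) (+-mono-≤ b₂ b₂)) (𝒯-structured gapR small) ⟩
      total-error τ₀ ∎))
      where
        open ℚ.≤-Reasoning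
        b₁ = 𝒯-bound G₁ bG₁ (G₁-small gapQ)
        b₂ = 𝒯-bound G₂ bG₂ (G₂-small gapPQ)
        𝒯-cong : ∀ {A B} → (∀ j z → A j z ≡ B j z) → 𝒯 A ≡ 𝒯 B
        𝒯-cong eq = E-cong τ (λ t → E-cong ρ (λ j → E-cong P.𝔼 (λ z → cong (Φ t z *_) (eq j _))))
        𝒯-+ : ∀ A B → 𝒯 (λ j z → A j z + B j z) ≡ 𝒯 A + 𝒯 B
        𝒯-+ A B = trans (E-cong τ (λ t → trans (E-cong ρ (λ j → trans (E-cong P.𝔼 (λ z → *-distribˡ-+ (Φ t z) _ _)) (E-+ P.𝔼 _ _))) (E-+ ρ _ _))) (E-+ τ _ _)

  -- Comparison of the corner count with the main term

  module Contradiction (𝒮 : System) {𝓇 : Run} (𝓈 : Scales 𝓇) (𝒸 : Constants 𝓈) (f : System.X 𝒮 → ℚ) (uf : Ops.Unit 𝒮 f) where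
    open Run 𝓇
    open Scales 𝓈
    open Constants 𝒸
    open OpsLemmas 𝒮
    open Core 𝒮 𝓈

    Kf : X → ℚ
    Kf = ⟦ sq Pc ⟧ f

    uKf : Unit Kf
    uKf = Unit-⟦⟧ (sq Pc) uf

    f₁ : X → ℚ
    f₁ x = f x - Kf x

    bf₁ : Bd f₁
    bf₁ x = unit-diff (proj₁ (uf x)) (proj₂ (uf x)) (proj₁ (uKf x)) (proj₂ (uKf x))

    open Structured 𝒮 𝓈 𝒸 f f₁ uf bf₁ public
    module PS = Parabola 𝒮 𝓈

    private
      ρ = mean (avg K)
      τ = mean Tμ
      σ = mean Iμ
      K₂f : X → ℚ
      K₂f = ⟦ sq Q₁ ⟧ f
      uK : Unit K₂f
      uK = Unit-⟦⟧ (sq Q₁) uf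
      f⊥ : X → ℚ
      f⊥ x = f x - K₂f x
      bf⊥ : Bd f⊥
      bf⊥ x = unit-diff (proj₁ (uf x)) (proj₂ (uf x)) (proj₁ (uK x)) (proj₂ (uK x))
      fKf : X → ℚ
      fKf x = f x * Kf x
      bfKf : Bd fKf
      bfKf x = ∣*∣≤ (bf x) (Unit⇒Bd uKf x)
      Y′ : Fin K → X → ℚ
      Y′ j x = E σ (λ i → ⟦ squares j (iv i) ⟧ f x)
      uY′ : ∀ j → Unit (Y′ j)
      uY′ j x = E-unit σ (λ i → proj₁ (Unit-⟦⟧ (squares j (iv i)) uf x)) (λ i → proj₂ (Unit-⟦⟧ (squares j (iv i)) uf x))

    module _ (gapQ : N (⟦ Q₀ ⟧ f) - N (⟦ Q₁ ⟧ f) ≤ θ) where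

      private
        near : ∀ j x → ∣ (K₂f x - Y′ j x) - (- E σ (λ i → ⟦ squares j (iv i) ⟧ f⊥ x)) ∣ ≤ e
        near j x = ≡≤ (trans (cong ∣_∣ (solve 3 (λ k y s → (k :- y) :- (:- s) := k :- (y :- s)) refl (K₂f x) (Y′ j x) (E σ (λ i → ⟦ squares j (iv i) ⟧ f⊥ x))))
            (trans (∣∣-sym _ _) (cong₂ (λ r s → ∣ r - s ∣)
              (sym (trans (E-cong σ (λ i → solve 2 (λ a b → b := a :- (a :- b)) refl (⟦ squares j (iv i) ⟧ f x) (⟦ squares j (iv i) ⟧ K₂f x)))
                (trans (E-- σ _ _) (cong (λ r → Y′ j x - r) (E-cong σ (λ i → sym (⟦⟧-- (squares j (iv i)) f K₂f x)))))))
              (sym (E-const σ (K₂f x))))))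
          (E-near σ (λ i → absorb (squares j (iv i)) (λ t y → inv-act (sq Q₁) (Inv-sq Q₁ (Q₁-d j t i)) bf y) x))

        -- For fixed i the squares d² are quadratic in t with leading coefficient a² p². Their
        -- linear term contributes only a constant after differencing, so the parabola bound
        -- applies.
        N-squares : ∀ j i → N (⟦ squares j (iv i) ⟧ f⊥) ≤ inv K + s₂
        N-squares j i = PS.parabola (a j ℤ.* a j) (Q₀-a² j) (λ _ _ _ → + 0)
          (λ ι γ t → d j (+ toℕ t ℤ.+ h ι γ) (iv i) ℤ.* d j (+ toℕ t ℤ.+ h ι γ) (iv i))
          (λ _ _ _ _ → + 0)
          (λ ι γ ι′ γ′ → a j ℤ.* a j ℤ.* p ℤ.* p ℤ.* (h ι′ γ′ ℤ.* h ι′ γ′ ℤ.- h ι γ ℤ.* h ι γ) ℤ.+ + 2 ℤ.* (a j ℤ.* p) ℤ.* (ee j ℤ.* iv i) ℤ.* (h ι′ γ′ ℤ.- h ι γ))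
          (λ _ _ _ _ _ → refl)
          (λ ι γ ι′ γ′ t → lv (a j) p (ee j ℤ.* iv i) (+ toℕ t) (h ι γ) (h ι′ γ′))
          0<s₂ bf⊥
          (ℚ.≤-trans (+-monoʳ-≤ (inv K) (+-monoˡ-≤ (e + e) (ℚ.≤-trans (N-residual Q₀ Q₁ Q₀Q₁ bf) (+-monoˡ-≤ ((e + e) + (e + e)) gapQ)))) c₁)
          where
            lv : ∀ a p r t h h′ → (a ℤ.* p ℤ.* (t ℤ.+ h′) ℤ.+ r) ℤ.* (a ℤ.* p ℤ.* (t ℤ.+ h′) ℤ.+ r) ℤ.+ ℤ.- ((a ℤ.* p ℤ.* (t ℤ.+ h) ℤ.+ r) ℤ.* (a ℤ.* p ℤ.* (t ℤ.+ h) ℤ.+ r)) ≡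
              + 2 ℤ.* (a ℤ.* a) ℤ.* p ℤ.* p ℤ.* (h′ ℤ.- h) ℤ.* t ℤ.+ (a ℤ.* a ℤ.* p ℤ.* p ℤ.* (h′ ℤ.* h′ ℤ.- h ℤ.* h) ℤ.+ + 2 ℤ.* (a ℤ.* p) ℤ.* r ℤ.* (h′ ℤ.- h))
            lv = solve-∀

        N-K₂f-Y : ∀ j → N (λ x → K₂f x - Y′ j x) ≤ s₅ * s₅
        N-K₂f-Y j = begin
          N (λ x → K₂f x - Y′ j x)
            ≤⟨ N-near (λ x → unit-diff (proj₁ (uK x)) (proj₂ (uK x)) (proj₁ (uY′ j x)) (proj₂ (uY′ j x)))
                 (λ x → ≡≤ (∣-p∣≡∣p∣ _) (E-∣∣ σ (λ i → Bd-⟦⟧ (squares j (iv i)) bf⊥ x))) (near j) ⟩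
          N (λ x → - E σ (λ i → ⟦ squares j (iv i) ⟧ f⊥ x)) + (e + e)
            ≡⟨ cong (_+ (e + e)) (E-cong 𝔼 (λ x → solve 1 (λ a → (:- a) :* (:- a) := a :* a) refl (E σ (λ i → ⟦ squares j (iv i) ⟧ f⊥ x)))) ⟩
          N (λ x → E σ (λ i → ⟦ squares j (iv i) ⟧ f⊥ x)) + (e + e)
            ≤⟨ +-monoˡ-≤ (e + e) (ℚ.≤-trans (E-mono 𝔼 (λ x → jensen σ (λ i → ⟦ squares j (iv i) ⟧ f⊥ x)))
                 (≡≤ (swap Iμ 𝔼 (λ i x → ⟦ squares j (iv i) ⟧ f⊥ x * ⟦ squares j (iv i) ⟧ f⊥ x)) (E-≤ σ (N-squares j)))) ⟩
          (inv K + s₂) + (e + e)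
            ≤⟨ c₅ ⟩
          s₅ * s₅ ∎
          where open ℚ.≤-Reasoning

      module _ (free : ∀ j t i x → f x * (f (act (d j (tv t) (iv i)) (+ 0) x) * f (act (+ 0) (d j (tv t) (iv i) ℤ.* d j (tv t) (iv i)) x)) ≤ 0ℚ) where

        private
          sqf : Fin K → IxT → IxI → X → ℚ
          sqf j t i x = f (act (+ 0) (d j (tv t) (iv i) ℤ.* d j (tv t) (iv i)) x)

          -- At the horizontal vertex of the corner f is f₁ + Kf. Absence of corners bounds the term
          -- with Kf by minus the term with f₁, and Kf hardly differs between the horizontal vertex
          -- and x.
          each : ∀ j t i → ⟨ fKf , sqf j t i ⟩ ≤ ⟨ (λ x → - f x) , ψ j (tv t) i ⟩ + e
          each j t i = ≤≡ (E-mono 𝔼 pointwise) (trans (E-+ 𝔼 _ _) (cong₂ _+_ refl (E-const 𝔼 e)))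
            where
              D = d j (tv t) (iv i)
              pointwise : ∀ x → fKf x * sqf j t i x ≤ (- f x) * ψ j (tv t) i x + e
              pointwise x = 0≤b-a⇒a≤b (≤≡ (0≤+ (a≤b⇒0≤b-a (free j t i x)) (a≤b⇒0≤b-a still))
                (solve 6 (λ e f k f′ k′ s → (con 0ℚ :- f :* (f′ :* s)) :+ (((f :* s) :* k′ :+ e) :- (f :* s) :* k)
                  := ((:- f) :* ((f′ :- k′) :* s) :+ e) :- (f :* k) :* s) refl e (f x) (Kf x) (f (act D (+ 0) x)) (Kf (act D (+ 0) x)) (sqf j t i x)))
                where
                  still : (f x * sqf j t i x) * Kf x ≤ (f x * sqf j t i x) * Kf (act D (+ 0) x) + e
                  still = near⇒≥ (≡≤ (cong ∣_∣ (solve 3 (λ a b c → a :* b :- a :* c := a :* (b :- c)) refl (f x * sqf j t i x) (Kf (act D (+ 0) x)) (Kf x)))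
                    (∣*∣≤′ (∣*∣≤ (bf x) (bf _)) (inv-act (sq Pc) (Inv-sq Pc (Pc-d j t i)) bf x)))

          gather : ∀ j → ⟨ fKf , Y′ j ⟩ ≤ ⟨ (λ x → - f x) , corner-average j ⟩ + e
          gather j = begin
            ⟨ fKf , Y′ j ⟩
              ≡⟨ out fKf (λ i t → sqf j t i) ⟩
            E σ (λ i → E τ (λ t → ⟨ fKf , sqf j t i ⟩))
              ≤⟨ E-mono σ (λ i → E-mono τ (λ t → each j t i)) ⟩
            E σ (λ i → E τ (λ t → ⟨ (λ x → - f x) , ψ j (tv t) i ⟩ + e))
              ≡⟨ trans (E-cong σ (λ i → trans (E-+ τ _ _) (cong₂ _+_ refl (E-const τ e))))
                   (trans (E-+ σ _ _) (cong₂ _+_ refl (E-const σ e))) ⟩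
            E σ (λ i → E τ (λ t → ⟨ (λ x → - f x) , ψ j (tv t) i ⟩)) + e
              ≡⟨ cong (_+ e) (sym (out (λ x → - f x) (λ i t → ψ j (tv t) i))) ⟩
            ⟨ (λ x → - f x) , (λ x → E σ (λ i → E τ (λ t → ψ j (tv t) i x))) ⟩ + e
              ≡⟨ cong (_+ e) (E-cong 𝔼 (λ x → cong ((- f x) *_) (swap Tμ σ (λ t i → ψ j (tv t) i x)))) ⟩
            ⟨ (λ x → - f x) , corner-average j ⟩ + e ∎
            where
              open ℚ.≤-Reasoning
              out : ∀ (A : X → ℚ) (B : IxI → IxT → X → ℚ) →
                ⟨ A , (λ x → E σ (λ i → E τ (λ t → B i t x))) ⟩ ≡ E σ (λ i → E τ (λ t → ⟨ A , B i t ⟩))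
              out A B = trans (E-cong 𝔼 (λ x → trans (sym (E-* σ (A x) _)) (E-cong σ (λ i → sym (E-* τ (A x) _)))))
                (trans (swap Iμ 𝔼 (λ i x → E τ (λ t → A x * B i t x))) (E-cong σ (λ i → swap Tμ 𝔼 (λ t x → A x * B i t x))))

        -- In the main term the vertical factor K₂f gives way to an average of f along squares, at
        -- cost s₅, and absence of corners then turns the whole into a correlation of -f with the
        -- corner average of f₁. The average over j is taken first because that corner average is
        -- small only in mean over j.
        corner-count : ∀ {η s τ₀} → 0ℚ < η → 0ℚ < s →
          N (⟦ R₀ ⟧ f) - N (⟦ R₁ ⟧ f) ≤ θ →
          (∀ j → P.N (P.⟦ Q₀ ⟧ (F j)) - P.N (P.⟦ Q₁ ⟧ (F j)) ≤ θ) →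
          (∀ j → P.N (P.⟦ Q₀ ⟧ (P.⟦ P₀ ⟧ (F j))) - P.N (P.⟦ Q₂ ⟧ (P.⟦ P₂ ⟧ (F j))) ≤ θ) →
          (∀ j → N (⟦ shifts j ⟧ f₁) ≤ τ₀) →
          total-error τ₀ + e ≤ s * s →
          (η * η) * (E 𝔼 f - (η + η)) ≤ (s + e) + s₅
        corner-count {η} {s} {τ₀} 0<η 0<s gapR gapQF gapPQ small bound = begin
          (η * η) * (E 𝔼 f - (η + η))
            ≡⟨ sym (E-const ρ _) ⟩
          E ρ (λ j → (η * η) * (E 𝔼 f - (η + η)))
            ≤⟨ E-mono ρ step ⟩
          E ρ (λ j → (⟨ (λ x → - f x) , corner-average j ⟩ + e) + s₅)
            ≡⟨ trans (E-+ ρ _ _) (cong₂ _+_ (trans (E-+ ρ _ _) (cong₂ _+_ refl (E-const ρ e))) (E-const ρ s₅)) ⟩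
          (E ρ (λ j → ⟨ (λ x → - f x) , corner-average j ⟩) + e) + s₅
            ≤⟨ +-monoˡ-≤ s₅ (+-monoˡ-≤ e (cauchy-schwarz (ρ ⊗ 𝔼) (λ z → - f (proj₂ z)) (λ z → corner-average (proj₁ z) (proj₂ z)) 0<s
                 (E-≤ ρ (λ j → Bd-N (λ x → ≡≤ (∣-p∣≡∣p∣ (f x)) (bf x))))
                 (ℚ.≤-trans (corner-average-small gapR gapQF gapPQ small) bound))) ⟩
          (s + e) + s₅ ∎
          where
            open ℚ.≤-Reasoning
            step : ∀ j → (η * η) * (E 𝔼 f - (η + η)) ≤ (⟨ (λ x → - f x) , corner-average j ⟩ + e) + s₅
            step j = begin
              (η * η) * (E 𝔼 f - (η + η))
                ≤⟨ main-term uf 0<η Pc Q₁ ⟩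
              ⟨ f , (λ x → Kf x * K₂f x) ⟩
                ≡⟨ trans (E-cong 𝔼 (λ x → solve 4 (λ f k l y → f :* (k :* l) := (f :* k) :* y :+ (f :* k) :* (l :- y)) refl (f x) (Kf x) (K₂f x) (Y′ j x))) (E-+ 𝔼 _ _) ⟩
              ⟨ fKf , Y′ j ⟩ + ⟨ fKf , (λ x → K₂f x - Y′ j x) ⟩
                ≤⟨ +-mono-≤ (gather j) (cauchy-schwarz 𝔼 fKf (λ x → K₂f x - Y′ j x) 0<s₅ (Bd-N bfKf) (N-K₂f-Y j)) ⟩
              (⟨ (λ x → - f x) , corner-average j ⟩ + e) + s₅ ∎

  abs-*≤ : ∀ x y {a b} → ℤ.∣ x ∣ ℕ.≤ a → ℤ.∣ y ∣ ℕ.≤ b → ℤ.∣ x ℤ.* y ∣ ℕ.≤ a ℕ.* b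
  abs-*≤ x y p q = subst (ℕ._≤ _) (sym (ℤ.abs-* x y)) (ℕ.*-mono-≤ p q)

  abs-+≤ : ∀ x y {a b} → ℤ.∣ x ∣ ℕ.≤ a → ℤ.∣ y ∣ ℕ.≤ b → ℤ.∣ x ℤ.+ y ∣ ℕ.≤ a ℕ.+ b
  abs-+≤ x y p q = ℕ.≤-trans (ℤ.∣i+j∣≤∣i∣+∣j∣ x y) (ℕ.+-mono-≤ p q)

  abs--≤ : ∀ x y {a b} → ℤ.∣ x ∣ ℕ.≤ a → ℤ.∣ y ∣ ℕ.≤ b → ℤ.∣ x ℤ.- y ∣ ℕ.≤ a ℕ.+ b
  abs--≤ x y p q = ℕ.≤-trans (ℤ.∣i-j∣≤∣i∣+∣j∣ x y) (ℕ.+-mono-≤ p q)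

  -- Averages over arithmetic progressions at geometric scales

  uAvg vAvg : ℤ → (ℓ : ℕ) .{{_ : NonZero ℓ}} → Op
  uAvg c ℓ = record { μ = avg ℓ ; u = λ i → c ℤ.* + toℕ i ; v = λ _ → + 0 }
  vAvg c ℓ = record { μ = avg ℓ ; u = λ _ → + 0 ; v = λ i → c ℤ.* + toℕ i }

  module _ (c : ℤ) (ℓ : ℕ) .{{_ : NonZero ℓ}} (Θ : ℕ) .{{_ : NonZero Θ}} where

    inv-u : ∀ {x} z → x ≡ c ℤ.* z → 2 ℕ.* ℤ.∣ z ∣ ℕ.* Θ ℕ.≤ ℓ → Inv (uAvg c ℓ) x (+ 0) (inv Θ)
    inv-u z refl p φ φ≤1 = ≡≤ (cong (λ r → ∣ r - E (mean (avg ℓ)) (λ i → φ (c ℤ.* + toℕ i) (+ 0)) ∣)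
        (E-cong (mean (avg ℓ)) (λ i → cong (λ r → φ r (+ 0)) (sym (ℤ.*-distribˡ-+ c (+ toℕ i) z)))))
      (avg-shift′ (λ y → φ (c ℤ.* y) (+ 0)) (λ _ → φ≤1 _ _) z Θ p)

    inv-v : ∀ {x} z → x ≡ c ℤ.* z → 2 ℕ.* ℤ.∣ z ∣ ℕ.* Θ ℕ.≤ ℓ → Inv (vAvg c ℓ) (+ 0) x (inv Θ)
    inv-v z refl p φ φ≤1 = ≡≤ (cong (λ r → ∣ r - E (mean (avg ℓ)) (λ i → φ (+ 0) (c ℤ.* + toℕ i)) ∣)
        (E-cong (mean (avg ℓ)) (λ i → cong (φ (+ 0)) (sym (ℤ.*-distribˡ-+ c (+ toℕ i) z)))))
      (avg-shift′ (λ y → φ (+ 0) (c ℤ.* y)) (λ _ → φ≤1 _ _) z Θ p)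

    inv-u-offset : ∀ o {x} z → x ≡ c ℤ.* z → 2 ℕ.* ℤ.∣ z ∣ ℕ.* Θ ℕ.≤ ℓ →
      Inv (record { μ = avg ℓ ; u = λ i → c ℤ.* (+ toℕ i ℤ.+ o) ; v = λ _ → + 0 }) x (+ 0) (inv Θ)
    inv-u-offset o {x} z eq p φ φ≤1 = ≡≤ (cong₂ (λ r s → ∣ r - s ∣)
        (E-cong (mean (avg ℓ)) (λ i → cong₂ φ (trans (cong (λ r → r ℤ.+ x) (ℤ.*-distribˡ-+ c (+ toℕ i) o)) (+-swap (c ℤ.* + toℕ i) (c ℤ.* o) x)) refl))
        (E-cong (mean (avg ℓ)) (λ i → cong (λ r → φ r (+ 0)) (ℤ.*-distribˡ-+ c (+ toℕ i) o))))
      (inv-u z eq p (λ s t → φ (s ℤ.+ c ℤ.* o) t) (λ _ _ → φ≤1 _ _))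

    inv-v-offset : ∀ o {x} z → x ≡ c ℤ.* z → 2 ℕ.* ℤ.∣ z ∣ ℕ.* Θ ℕ.≤ ℓ →
      Inv (record { μ = avg ℓ ; u = λ _ → + 0 ; v = λ i → c ℤ.* (+ toℕ i ℤ.+ o) }) (+ 0) x (inv Θ)
    inv-v-offset o {x} z eq p φ φ≤1 = ≡≤ (cong₂ (λ r s → ∣ r - s ∣)
        (E-cong (mean (avg ℓ)) (λ i → cong (φ (+ 0)) (trans (cong (λ r → r ℤ.+ x) (ℤ.*-distribˡ-+ c (+ toℕ i) o)) (+-swap (c ℤ.* + toℕ i) (c ℤ.* o) x))))
        (E-cong (mean (avg ℓ)) (λ i → cong (φ (+ 0)) (ℤ.*-distribˡ-+ c (+ toℕ i) o))))
      (inv-v z eq p (λ s t → φ s (t ℤ.+ c ℤ.* o)) (λ _ _ → φ≤1 _ _))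

  inv-halves : ∀ Θ .{{_ : NonZero Θ}} .{{_ : NonZero (2 ℕ.* Θ)}} → inv (2 ℕ.* Θ) + inv (2 ℕ.* Θ) ≡ inv Θ
  inv-halves Θ = trans (cong₂ _+_ (inv-* 2 Θ) (inv-* 2 Θ)) (trans (solve 2 (λ a b → a :* b :+ a :* b := ((con 1ℚ :+ (con 1ℚ :+ con 0ℚ)) :* a) :* b) refl (inv 2) (inv Θ))
    (trans (cong (_* inv Θ) (ι*inv 2)) (*-identityˡ _)))

  -- Absolute values are divided and the signs restored afterwards, so that |Q| |a| ≤ |x| holds for
  -- all signs; rounding down would break this for negative x.
  divide : ∀ x a .{{_ : NonZero ℤ.∣ a ∣}} → ∃[ Q ] ∃[ s ] (x ≡ a ℤ.* Q ℤ.+ s) × (ℤ.∣ Q ∣ ℕ.* ℤ.∣ a ∣ ℕ.≤ ℤ.∣ x ∣) × (ℤ.∣ s ∣ ℕ.≤ ℤ.∣ a ∣)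
  divide x a = signed x a {ℤ.∣ x ∣ ℕ./ ℤ.∣ a ∣} {ℤ.∣ x ∣ ℕ.% ℤ.∣ a ∣} (ℕ.m≡m%n+[m/n]*n ℤ.∣ x ∣ ℤ.∣ a ∣) (ℕ.<⇒≤ (ℕ.m%n<n ℤ.∣ x ∣ ℤ.∣ a ∣)) (ℕ.m/n*n≤m ℤ.∣ x ∣ ℤ.∣ a ∣)
    where
      negs : ∀ a Q s → ℤ.- (a ℤ.* Q ℤ.+ s) ≡ a ℤ.* (ℤ.- Q) ℤ.+ (ℤ.- s)
      negs = solve-∀
      nega : ∀ a Q → ℤ.- a ℤ.* ℤ.- Q ≡ a ℤ.* Q
      nega = solve-∀
      nat : ∀ n m Q s → n ≡ s ℕ.+ Q ℕ.* m → + n ≡ + m ℤ.* + Q ℤ.+ + s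
      nat n m Q s e = trans (cong +_ e) (trans (ℤ.pos-+ s (Q ℕ.* m)) (trans (ℤ.+-comm (+ s) (+ (Q ℕ.* m))) (cong (ℤ._+ + s) (trans (ℤ.pos-* Q m) (ℤ.*-comm (+ Q) (+ m))))))
      signed : ∀ x a {Q s} → ℤ.∣ x ∣ ≡ s ℕ.+ Q ℕ.* ℤ.∣ a ∣ → s ℕ.≤ ℤ.∣ a ∣ → Q ℕ.* ℤ.∣ a ∣ ℕ.≤ ℤ.∣ x ∣ →
        ∃[ Q ] ∃[ s ] (x ≡ a ℤ.* Q ℤ.+ s) × (ℤ.∣ Q ∣ ℕ.* ℤ.∣ a ∣ ℕ.≤ ℤ.∣ x ∣) × (ℤ.∣ s ∣ ℕ.≤ ℤ.∣ a ∣)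
      signed (+ n) (+ m) {Q} {s} e b c = + Q , + s , nat n m Q s e , c , b
      signed (+ n) (-[1+ m ]) {Q} {s} e b c = ℤ.- (+ Q) , + s ,
        trans (nat n (suc m) Q s e) (cong (ℤ._+ + s) (sym (nega (+ suc m) (+ Q)))) ,
        subst (λ r → r ℕ.* suc m ℕ.≤ n) (sym (ℤ.∣-i∣≡∣i∣ (+ Q))) c , b
      signed (-[1+ n ]) (+ m) {Q} {s} e b c = ℤ.- (+ Q) , ℤ.- (+ s) ,
        trans (cong ℤ.-_ (nat (suc n) m Q s e)) (negs (+ m) (+ Q) (+ s)) ,
        subst (λ r → r ℕ.* m ℕ.≤ suc n) (sym (ℤ.∣-i∣≡∣i∣ (+ Q))) c , subst (ℕ._≤ m) (sym (ℤ.∣-i∣≡∣i∣ (+ s))) b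
      signed (-[1+ n ]) (-[1+ m ]) {Q} {s} e b c = + Q , ℤ.- (+ s) ,
        trans (cong ℤ.-_ (nat (suc n) (suc m) Q s e)) (trans (negs (+ suc m) (+ Q) (+ s)) (cong (ℤ._+ ℤ.- (+ s)) (nega′ (+ suc m) (+ Q)))) ,
        c , subst (ℕ._≤ suc m) (sym (ℤ.∣-i∣≡∣i∣ (+ s))) b
        where
          nega′ : ∀ a Q → a ℤ.* ℤ.- Q ≡ ℤ.- a ℤ.* Q
          nega′ = solve-∀

  ∣⇒factor : ∀ z {D} → ℤ.∣ z ∣ ℕᵈ.∣ D → ∃[ y ] (+ D ≡ z ℤ.* y) × (z ≢ + 0 → ℤ.∣ y ∣ ℕ.≤ D)
  ∣⇒factor (+ n) (divides k refl) = + k , trans (ℤ.pos-* k n) (ℤ.*-comm (+ k) (+ n)) , λ z≢0 → ℕ.m≤m*n k n {{ℕ.≢-nonZero (λ e → z≢0 (cong +_ e))}}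
  ∣⇒factor (-[1+ n ]) (divides k refl) = ℤ.- (+ k) ,
    trans (ℤ.pos-* k (suc n)) (trans (ℤ.*-comm (+ k) (+ suc n)) (nn (+ suc n) (+ k))) ,
    λ _ → subst (ℕ._≤ k ℕ.* suc n) (sym (ℤ.∣-i∣≡∣i∣ (+ k))) (ℕ.m≤m*n k (suc n))
    where
      nn : ∀ a Q → a ℤ.* Q ≡ ℤ.- a ℤ.* ℤ.- Q
      nn = solve-∀

  -- With the nonzero proofs irrelevant, progressions agree as soon as their steps and lengths do.
  uAvg-≡ : ∀ {c c′ ℓ ℓ′} .(nz : NonZero ℓ) .(nz′ : NonZero ℓ′) → c ≡ c′ → ℓ ≡ ℓ′ → uAvg c ℓ {{nz}} ≡ uAvg c′ ℓ′ {{nz′}}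
  uAvg-≡ _ _ refl refl = refl

  vAvg-≡ : ∀ {c c′ ℓ ℓ′} .(nz : NonZero ℓ) .(nz′ : NonZero ℓ′) → c ≡ c′ → ℓ ≡ ℓ′ → vAvg c ℓ {{nz}} ≡ vAvg c′ ℓ′ {{nz′}}
  vAvg-≡ _ _ refl refl = refl

  sqAvg : (x ℓ : ℕ) .{{_ : NonZero ℓ}} → Op
  sqAvg x ℓ = vAvg (+ x ℤ.* + x) (ℓ ℕ.* ℓ) {{ℕ.m*n≢0 ℓ ℓ}}

  -- Consecutive scales differ by factors of D; Θ⁻¹ bounds every invariance error.
  record Parameters : Set where
    field
      K Θ D Ln : ℕ
      {{K≢0}} : NonZero K
      {{Θ≢0}} : NonZero Θ
      {{D≢0}} : NonZero D
      {{Ln≢0}} : NonZero Ln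
      gn : Fin K → ℕ
      agn : ∀ j → suc (toℕ j) ℕ.* gn j ≡ Ln
      gn≤ : ∀ j → gn j ℕ.≤ Ln
      dvd : ∀ s → 1 ℕ.≤ s → s ℕ.≤ 2 ℕ.* K → s ℕᵈ.∣ D
      dvdL : 4 ℕ.* (Ln ℕ.* Ln) ℕᵈ.∣ D
      D-large : 2 ℕ.* (256 ℕ.* (K ℕ.* (Ln ℕ.* Ln)) ℕ.* (K ℕ.* (Ln ℕ.* Ln))) ℕ.* Θ ℕ.≤ D
      K≤D : K ℕ.≤ D
      8≤D : 8 ℕ.≤ D

  -- c is the finest step, cc the step of the global coarse operator Pc, and ℓ₀ the length of Pf.
  record Placement (𝒫 : Parameters) : Set where
    open Parameters 𝒫
    field
      c ρ ℓ₀ w cc : ℕ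
      {{c≢0}} : NonZero c
      {{ρ≢0}} : NonZero ρ
      {{ℓ₀≢0}} : NonZero ℓ₀
      {{w≢0}} : NonZero w
      ccw : (D ℕ.* D) ℕ.* (D ℕ.* D) ℕ.* c ≡ cc ℕ.* w

  -- Concrete scales from powers of a single integer

  module Build (𝒫 : Parameters) (𝒬 : Placement 𝒫) where

    open Parameters 𝒫
    open Placement 𝒬

    private
      -- Blocks of t have length M and are placed Sn apart, blocks of i have length m and are placed
      -- Yn apart. The powers of D give K Sn ≤ M and K Yn ≤ J, while Sn dominates the offsets γ, and
      -- Yn dominates both γ and m. The square of ρ makes ℓ a square whenever ℓ₀ is one.
      κ₀ D2 D4 ℓ J m M Sn Yn : ℕ
      κ₀ = K ℕ.* (Ln ℕ.* Ln)
      D2 = D ℕ.* D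
      D4 = D2 ℕ.* D2
      ℓ = (ρ ℕ.* ρ) ℕ.* (D4 ℕ.* D2) ℕ.* ℓ₀
      J = D4 ℕ.* ℓ₀
      m = D2 ℕ.* ℓ₀
      M = D4 ℕ.* ℓ
      Sn = D2 ℕ.* D ℕ.* ℓ
      Yn = D2 ℕ.* D ℕ.* ℓ₀

      instance
        D2≢0 : NonZero D2
        D2≢0 = ℕ.m*n≢0 D D
        D4≢0 : NonZero D4
        D4≢0 = ℕ.m*n≢0 D2 D2
        ℓ≢0 : NonZero ℓ
        ℓ≢0 = ℕ.m*n≢0 ((ρ ℕ.* ρ) ℕ.* (D4 ℕ.* D2)) ℓ₀ {{ℕ.m*n≢0 (ρ ℕ.* ρ) (D4 ℕ.* D2) {{ℕ.m*n≢0 ρ ρ}} {{ℕ.m*n≢0 D4 D2}}}}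
        m≢0 : NonZero m
        m≢0 = ℕ.m*n≢0 D2 ℓ₀
        M≢0 : NonZero M
        M≢0 = ℕ.m*n≢0 D4 ℓ

      -- Every size condition below has this shape, with mono a monomial in the scales.
      fit : ∀ {X} k mono ex {Y} .{{_ : NonZero ex}} → X ℕ.≤ k ℕ.* mono → k ℕ.≤ 256 ℕ.* κ₀ ℕ.* κ₀ → Y ≡ D ℕ.* mono ℕ.* ex → 2 ℕ.* X ℕ.* Θ ℕ.≤ Y
      fit {X} k mono ex {Y} p q refl = begin
        2 ℕ.* X ℕ.* Θ
          ≤⟨ ℕ.*-monoˡ-≤ Θ (ℕ.*-monoʳ-≤ 2 (ℕ.≤-trans p (ℕ.*-monoˡ-≤ mono q))) ⟩
        2 ℕ.* (256 ℕ.* κ₀ ℕ.* κ₀ ℕ.* mono) ℕ.* Θ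
          ≡⟨ rearrange (256 ℕ.* κ₀ ℕ.* κ₀) mono Θ ⟩
        2 ℕ.* (256 ℕ.* κ₀ ℕ.* κ₀) ℕ.* Θ ℕ.* mono
          ≤⟨ ℕ.*-monoˡ-≤ mono D-large ⟩
        D ℕ.* mono
          ≤⟨ ℕ.m≤m*n (D ℕ.* mono) ex ⟩
        D ℕ.* mono ℕ.* ex ∎
        where
          open ℕ.≤-Reasoning
          rearrange : ∀ C m t → 2 ℕ.* (C ℕ.* m) ℕ.* t ≡ 2 ℕ.* C ℕ.* t ℕ.* m
          rearrange = ℕR.solve-∀

      instance
        κ₀≢0 : NonZero κ₀
        κ₀≢0 = ℕ.m*n≢0 K (Ln ℕ.* Ln) {{K≢0}} {{ℕ.m*n≢0 Ln Ln}}

      κ₀≤κ₀² : κ₀ ℕ.≤ κ₀ ℕ.* κ₀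
      κ₀≤κ₀² = ℕ.m≤m*n κ₀ κ₀

      k-lin : ∀ n → n ℕ.≤ 256 → n ℕ.* κ₀ ℕ.≤ 256 ℕ.* κ₀ ℕ.* κ₀
      k-lin n p = ℕ.≤-trans (ℕ.*-mono-≤ p κ₀≤κ₀²) (ℕ.≤-reflexive (sym (ℕ.*-assoc 256 κ₀ κ₀)))

      k-quad : ∀ n → n ℕ.≤ 256 → n ℕ.* (κ₀ ℕ.* κ₀) ℕ.≤ 256 ℕ.* κ₀ ℕ.* κ₀
      k-quad n p = ℕ.≤-trans (ℕ.*-monoˡ-≤ (κ₀ ℕ.* κ₀) p) (ℕ.≤-reflexive (sym (ℕ.*-assoc 256 κ₀ κ₀)))

      k-one : 1 ℕ.≤ 256 ℕ.* κ₀ ℕ.* κ₀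
      k-one = ℕ.>-nonZero⁻¹ _ {{ℕ.m*n≢0 (256 ℕ.* κ₀) κ₀ {{ℕ.m*n≢0 256 κ₀}}}}

      K≤κ₀ : K ℕ.≤ κ₀
      K≤κ₀ = ℕ.m≤m*n K (Ln ℕ.* Ln) {{ℕ.m*n≢0 Ln Ln}}

      L²≤κ₀ : Ln ℕ.* Ln ℕ.≤ κ₀
      L²≤κ₀ = ℕ.m≤n*m (Ln ℕ.* Ln) K

      dz cz ρz wz : ℤ
      dz = + D
      cz = + c
      ρz = + ρ
      wz = + w
      d2 d4 d6 : ℤ
      d2 = dz ℤ.* dz
      d4 = d2 ℤ.* d2
      d6 = d4 ℤ.* d2

      ∣d2∣ : ℤ.∣ d2 ∣ ≡ D2
      ∣d2∣ = ℤ.abs-* dz dz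
      ∣d4∣ : ℤ.∣ d4 ∣ ≡ D4
      ∣d4∣ = trans (ℤ.abs-* d2 d2) (cong₂ ℕ._*_ ∣d2∣ ∣d2∣)

      p q′ : ℤ
      p = d6 ℤ.* cz
      q′ = ρz ℤ.* d4

    run : Run
    run = record { K = K ; m = m ; M = M ; Θ = Θ ; p = p ; q′ = q′ ; S = + Sn ; Y = + Yn ; L = + Ln
      ; a = λ j → + suc (toℕ j) ; g = λ j → + gn j ; ag = λ j → trans (sym (ℤ.pos-* (suc (toℕ j)) (gn j))) (cong +_ (agn j)) }

    open Run run using (tv; iv; κ; h; d; δ; ω; ee; q; e; α; β; a; g; L; S; Y; IxT; IxI; line; curve; ω-run; shifts; quad-run; linear-run)

    private
      N₁ N₂ N₃ : ℕ
      N₁ = D4 ℕ.* D4 ℕ.* ℓ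
      N₂ = D4 ℕ.* D4 ℕ.* N₁
      N₃ = ℓ₀ ℕ.* (D2 ℕ.* D)

      N₁≢0 : NonZero N₁
      N₁≢0 = ℕ.m*n≢0 (D4 ℕ.* D4) ℓ {{ℕ.m*n≢0 D4 D4}}
      N₂≢0 : NonZero N₂
      N₂≢0 = ℕ.m*n≢0 (D4 ℕ.* D4) N₁ {{ℕ.m*n≢0 D4 D4}} {{N₁≢0}}
      N₃≢0 : NonZero N₃
      N₃≢0 = ℕ.m*n≢0 ℓ₀ (D2 ℕ.* D) {{ℓ₀≢0}} {{ℕ.m*n≢0 D2 D}}
      Nc≢0 : NonZero (N₁ ℕ.* (w ℕ.* w))
      Nc≢0 = ℕ.m*n≢0 N₁ (w ℕ.* w) {{N₁≢0}} {{ℕ.m*n≢0 w w}}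

    Pc Pf P₀ P₁ P₂ Q₀ Q₁ Q₂ R₀ R₁ R₂ : Op
    Pc = uAvg (+ cc) (N₁ ℕ.* (w ℕ.* w)) {{Nc≢0}}
    Pf = uAvg (dz ℤ.* q) ℓ₀
    P₀ = uAvg (d4 ℤ.* (d4 ℤ.* cz)) ℓ
    P₁ = uAvg (d4 ℤ.* cz) N₁ {{N₁≢0}}
    P₂ = uAvg cz N₂ {{N₂≢0}}
    Q₀ = vAvg ((d4 ℤ.* (d4 ℤ.* cz)) ℤ.* (d4 ℤ.* (d4 ℤ.* cz))) (ℓ ℕ.* ℓ) {{ℕ.m*n≢0 ℓ ℓ}}
    Q₁ = vAvg ((d4 ℤ.* cz) ℤ.* (d4 ℤ.* cz)) (N₁ ℕ.* N₁) {{ℕ.m*n≢0 N₁ N₁ {{N₁≢0}} {{N₁≢0}}}}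
    Q₂ = vAvg (cz ℤ.* cz) (N₂ ℕ.* N₂) {{ℕ.m*n≢0 N₂ N₂ {{N₂≢0}} {{N₂≢0}}}}
    R₀ = vAvg (q ℤ.* (d4 ℤ.* (d4 ℤ.* cz))) (ℓ ℕ.* N₃) {{ℕ.m*n≢0 ℓ N₃ {{ℓ≢0}} {{N₃≢0}}}}
    R₁ = vAvg (q ℤ.* (d4 ℤ.* cz)) (N₁ ℕ.* N₃) {{ℕ.m*n≢0 N₁ N₃ {{N₁≢0}} {{N₃≢0}}}}
    R₂ = vAvg (q ℤ.* cz) (N₂ ℕ.* N₃) {{ℕ.m*n≢0 N₂ N₃ {{N₂≢0}} {{N₃≢0}}}}

    private
      toℕ≤ : ∀ {n} (i : Fin n) → toℕ i ℕ.≤ n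
      toℕ≤ i = ℕ.<⇒≤ (toℕ<n i)

      SK≤M : Sn ℕ.* K ℕ.≤ M
      SK≤M = ℕ.≤-trans (ℕ.*-monoʳ-≤ Sn K≤D) (ℕ.≤-reflexive (eq D ℓ))
        where
          eq : ∀ D ℓ → D ℕ.* D ℕ.* D ℕ.* ℓ ℕ.* D ≡ (D ℕ.* D) ℕ.* (D ℕ.* D) ℕ.* ℓ
          eq = ℕR.solve-∀

      YK≤J : Yn ℕ.* K ℕ.≤ J
      YK≤J = ℕ.≤-trans (ℕ.*-monoʳ-≤ Yn K≤D) (ℕ.≤-reflexive (eq D ℓ₀))
        where
          eq : ∀ D ℓ → D ℕ.* D ℕ.* D ℕ.* ℓ ℕ.* D ≡ (D ℕ.* D) ℕ.* (D ℕ.* D) ℕ.* ℓ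
          eq = ℕR.solve-∀

      D≤J : D ℕ.≤ J
      D≤J = ℕ.≤-trans (ℕ.m≤m*n D (D ℕ.* D2 ℕ.* ℓ₀) {{ℕ.m*n≢0 (D ℕ.* D2) ℓ₀ {{ℕ.m*n≢0 D D2}}}}) (ℕ.≤-reflexive (eq D ℓ₀))
        where
          eq : ∀ D ℓ → D ℕ.* (D ℕ.* (D ℕ.* D) ℕ.* ℓ) ≡ (D ℕ.* D) ℕ.* (D ℕ.* D) ℕ.* ℓ
          eq = ℕR.solve-∀

      J*≤M : ρ ℕ.* D4 ℕ.* J ℕ.≤ M
      J*≤M = ℕ.≤-trans (ℕ.m≤m*n _ (D2 ℕ.* ρ) {{ℕ.m*n≢0 D2 ρ}}) (ℕ.≤-reflexive (eq D ρ ℓ₀))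
        where
          eq : ∀ D ρ ℓ → ρ ℕ.* ((D ℕ.* D) ℕ.* (D ℕ.* D)) ℕ.* ((D ℕ.* D) ℕ.* (D ℕ.* D) ℕ.* ℓ) ℕ.* ((D ℕ.* D) ℕ.* ρ) ≡
            (D ℕ.* D) ℕ.* (D ℕ.* D) ℕ.* ((ρ ℕ.* ρ) ℕ.* ((D ℕ.* D) ℕ.* (D ℕ.* D) ℕ.* (D ℕ.* D)) ℕ.* ℓ)
          eq = ℕR.solve-∀

      J≤M : J ℕ.≤ M
      J≤M = ℕ.≤-trans (ℕ.m≤n*m J (ρ ℕ.* D4) {{ℕ.m*n≢0 ρ D4}}) J*≤M

      K≤M : K ℕ.≤ M
      K≤M = ℕ.≤-trans K≤D (ℕ.≤-trans D≤J J≤M)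

      tv≤ : ∀ t → ℤ.∣ tv t ∣ ℕ.≤ 3 ℕ.* M
      tv≤ (ι , γ , t) = ℕ.≤-trans (abs-+≤ (+ toℕ t) (+ toℕ γ ℤ.+ + Sn ℤ.* + toℕ ι) (toℕ≤ t) (abs-+≤ (+ toℕ γ) (+ Sn ℤ.* + toℕ ι) (ℕ.≤-trans (toℕ≤ γ) K≤M)
          (ℕ.≤-trans (abs-*≤ (+ Sn) (+ toℕ ι) ℕ.≤-refl (toℕ≤ ι)) SK≤M))) (ℕ.≤-reflexive (eq M))
        where
          eq : ∀ x → x ℕ.+ (x ℕ.+ x) ≡ 3 ℕ.* x
          eq = ℕR.solve-∀

      m≤J : m ℕ.≤ J
      m≤J = ℕ.≤-trans (ℕ.m≤n*m m D2) (ℕ.≤-reflexive (sym (ℕ.*-assoc D2 D2 ℓ₀)))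

      iv≤ : ∀ i → ℤ.∣ iv i ∣ ℕ.≤ 4 ℕ.* J
      iv≤ (ι , i , γ) = ℕ.≤-trans (abs-+≤ (+ toℕ i) (+ toℕ γ ℤ.+ (+ Yn ℤ.* + toℕ ι ℤ.+ + 1)) (ℕ.≤-trans (toℕ≤ i) m≤J) (abs-+≤ (+ toℕ γ) (+ Yn ℤ.* + toℕ ι ℤ.+ + 1) (ℕ.≤-trans (toℕ≤ γ) (ℕ.≤-trans K≤D D≤J))
          (abs-+≤ (+ Yn ℤ.* + toℕ ι) (+ 1) (ℕ.≤-trans (abs-*≤ (+ Yn) (+ toℕ ι) ℕ.≤-refl (toℕ≤ ι)) YK≤J) (ℕ.≤-trans (ℕ.>-nonZero⁻¹ D) D≤J))))
          (ℕ.≤-reflexive (eq J))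
        where
          eq : ∀ x → x ℕ.+ (x ℕ.+ (x ℕ.+ x)) ≡ 4 ℕ.* x
          eq = ℕR.solve-∀

      κ≤ : ∀ w → ℤ.∣ κ w ∣ ℕ.≤ 8 ℕ.* J
      κ≤ (i , i′) = ℕ.≤-trans (abs--≤ (iv i′) (iv i) (iv≤ i′) (iv≤ i)) (ℕ.≤-reflexive (eq J))
        where
          eq : ∀ x → 4 ℕ.* x ℕ.+ 4 ℕ.* x ≡ 8 ℕ.* x
          eq = ℕR.solve-∀

      an≤ : ∀ (j : Fin K) → suc (toℕ j) ℕ.≤ K
      an≤ j = toℕ<n j

      d/p : Fin K → ℤ → ℤ → ℤ
      d/p j t i = + suc (toℕ j) ℤ.* t ℤ.+ (+ 2 ℤ.* + Ln ℤ.* + gn j ℤ.* q′) ℤ.* i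

      δ/p : Fin K → ℤ → ℤ → ℤ
      δ/p j t k = + suc (toℕ j) ℤ.* t ℤ.- (+ Ln ℤ.* + gn j ℤ.* q′) ℤ.* k

      ee/p : Fin K → ℤ → ℤ
      ee/p j i = (+ 2 ℤ.* + Ln ℤ.* + gn j ℤ.* q′) ℤ.* i

      q′≤ : ℤ.∣ q′ ∣ ℕ.≤ ρ ℕ.* D4
      q′≤ = abs-*≤ (ρz) (d4) ℕ.≤-refl (ℕ.≤-reflexive ∣d4∣)

      -- 11 = 3 + 8: `tv` is at most 3 M, and the other term carries 2 · 4 J from `iv` or 8 J from
      -- `κ`.
      big : ∀ x y z → x ℕ.≤ κ₀ → y ℕ.≤ κ₀ → z ℕ.≤ M → x ℕ.* (3 ℕ.* M) ℕ.+ 8 ℕ.* (y ℕ.* z) ℕ.≤ 11 ℕ.* κ₀ ℕ.* M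
      big x y z p r s = ℕ.≤-trans (ℕ.+-mono-≤ (ℕ.*-monoˡ-≤ (3 ℕ.* M) p) (ℕ.*-monoʳ-≤ 8 (ℕ.*-mono-≤ r s))) (ℕ.≤-reflexive (eq κ₀ M))
        where
          eq : ∀ k M → k ℕ.* (3 ℕ.* M) ℕ.+ 8 ℕ.* (k ℕ.* M) ≡ 11 ℕ.* k ℕ.* M
          eq = ℕR.solve-∀

      ee/p≤ : ∀ j i → ℤ.∣ ee/p j (iv i) ∣ ℕ.≤ 8 ℕ.* ((Ln ℕ.* Ln) ℕ.* (ρ ℕ.* D4 ℕ.* J))
      ee/p≤ j i = ℕ.≤-trans (abs-*≤ (+ 2 ℤ.* + Ln ℤ.* + gn j ℤ.* q′) (iv i)
          (abs-*≤ (+ 2 ℤ.* + Ln ℤ.* + gn j) (q′) (abs-*≤ (+ 2 ℤ.* + Ln) (+ gn j) (abs-*≤ (+ 2) (+ Ln) ℕ.≤-refl ℕ.≤-refl) (gn≤ j)) q′≤) (iv≤ i))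
          (ℕ.≤-reflexive (eq Ln ρ D4 J))
        where
          eq : ∀ L ρ D J → 2 ℕ.* L ℕ.* L ℕ.* (ρ ℕ.* D) ℕ.* (4 ℕ.* J) ≡ 8 ℕ.* ((L ℕ.* L) ℕ.* (ρ ℕ.* D ℕ.* J))
          eq = ℕR.solve-∀

      ee/p≤M : ∀ j i → ℤ.∣ ee/p j (iv i) ∣ ℕ.≤ 11 ℕ.* κ₀ ℕ.* M
      ee/p≤M j i = ℕ.≤-trans (ee/p≤ j i) (ℕ.≤-trans (ℕ.m≤n+m _ (0 ℕ.* (3 ℕ.* M))) (big 0 (Ln ℕ.* Ln) _ ℕ.z≤n L²≤κ₀ J*≤M))

      d/p≤ : ∀ j t i → ℤ.∣ d/p j (tv t) (iv i) ∣ ℕ.≤ 11 ℕ.* κ₀ ℕ.* M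
      d/p≤ j t i = ℕ.≤-trans (abs-+≤ (+ suc (toℕ j) ℤ.* tv t) (ee/p j (iv i)) (abs-*≤ (+ suc (toℕ j)) (tv t) (an≤ j) (tv≤ t)) (ee/p≤ j i))
        (big K (Ln ℕ.* Ln) _ K≤κ₀ L²≤κ₀ J*≤M)

      δ/p≤ : ∀ j t w → ℤ.∣ δ/p j (tv t) (κ w) ∣ ℕ.≤ 11 ℕ.* κ₀ ℕ.* M
      δ/p≤ j t w = ℕ.≤-trans (abs--≤ (+ suc (toℕ j) ℤ.* tv t) ((+ Ln ℤ.* + gn j ℤ.* q′) ℤ.* κ w) (abs-*≤ (+ suc (toℕ j)) (tv t) (an≤ j) (tv≤ t))
          (ℕ.≤-trans (abs-*≤ (+ Ln ℤ.* + gn j ℤ.* q′) (κ w) (abs-*≤ (+ Ln ℤ.* + gn j) (q′) (abs-*≤ (+ Ln) (+ gn j) ℕ.≤-refl (gn≤ j)) q′≤) (κ≤ w)) (ℕ.≤-reflexive (eq Ln ρ D4 J))))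
        (big K (Ln ℕ.* Ln) _ K≤κ₀ L²≤κ₀ J*≤M)
        where
          eq : ∀ L ρ D J → L ℕ.* L ℕ.* (ρ ℕ.* D) ℕ.* (8 ℕ.* J) ≡ 8 ℕ.* ((L ℕ.* L) ℕ.* (ρ ℕ.* D ℕ.* J))
          eq = ℕR.solve-∀

      d≡ : ∀ j t i → d j t i ≡ p ℤ.* d/p j t i
      d≡ j t i = eq (+ suc (toℕ j)) (+ Ln) (+ gn j) p q′ t i
        where
          eq : ∀ a L g p q′ t i → a ℤ.* p ℤ.* t ℤ.+ + 2 ℤ.* L ℤ.* g ℤ.* (p ℤ.* q′) ℤ.* i ≡ p ℤ.* (a ℤ.* t ℤ.+ (+ 2 ℤ.* L ℤ.* g ℤ.* q′) ℤ.* i)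
          eq = solve-∀

      δ≡ : ∀ j t k → δ j t k ≡ p ℤ.* δ/p j t k
      δ≡ j t k = eq (+ suc (toℕ j)) (+ Ln) (+ gn j) p q′ t k
        where
          eq : ∀ a L g p q′ t i → a ℤ.* p ℤ.* t ℤ.- L ℤ.* g ℤ.* (p ℤ.* q′) ℤ.* i ≡ p ℤ.* (a ℤ.* t ℤ.- (L ℤ.* g ℤ.* q′) ℤ.* i)
          eq = solve-∀

      ee≡ : ∀ j i → ee j ℤ.* i ≡ p ℤ.* ee/p j i
      ee≡ j i = eq (+ Ln) (+ gn j) p q′ i
        where
          eq : ∀ L g p q′ i → + 2 ℤ.* L ℤ.* g ℤ.* (p ℤ.* q′) ℤ.* i ≡ p ℤ.* ((+ 2 ℤ.* L ℤ.* g ℤ.* q′) ℤ.* i)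
          eq = solve-∀

      P₁-p : ∀ x → ℤ.∣ x ∣ ℕ.≤ 11 ℕ.* κ₀ ℕ.* M → Inv P₁ (p ℤ.* x) (+ 0) e
      P₁-p x b = inv-u (d4 ℤ.* cz) N₁ {{N₁≢0}} Θ (d2 ℤ.* x) (eq dz cz x)
        (fit (11 ℕ.* κ₀) (D2 ℕ.* M) D
          (ℕ.≤-trans (abs-*≤ (d2) (x) (ℕ.≤-reflexive ∣d2∣) b) (ℕ.≤-reflexive (eq₁ D2 (11 ℕ.* κ₀) M)))
          (k-lin 11 (ℕ.m≤m+n 11 245)) (eq₂ D ℓ))
        where
          eq : ∀ d c x → (d ℤ.* d) ℤ.* (d ℤ.* d) ℤ.* (d ℤ.* d) ℤ.* c ℤ.* x ≡ ((d ℤ.* d) ℤ.* (d ℤ.* d) ℤ.* c) ℤ.* ((d ℤ.* d) ℤ.* x)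
          eq = solve-∀
          eq₁ : ∀ D k M → D ℕ.* (k ℕ.* M) ≡ k ℕ.* (D ℕ.* M)
          eq₁ = ℕR.solve-∀
          eq₂ : ∀ D ℓ → ((D ℕ.* D) ℕ.* (D ℕ.* D)) ℕ.* ((D ℕ.* D) ℕ.* (D ℕ.* D)) ℕ.* ℓ ≡ D ℕ.* ((D ℕ.* D) ℕ.* ((D ℕ.* D) ℕ.* (D ℕ.* D) ℕ.* ℓ)) ℕ.* D
          eq₂ = ℕR.solve-∀

      Pc-p : ∀ x → ℤ.∣ x ∣ ℕ.≤ 11 ℕ.* κ₀ ℕ.* M → Inv Pc (p ℤ.* x) (+ 0) e
      Pc-p x b = inv-u (+ cc) (N₁ ℕ.* (w ℕ.* w)) {{Nc≢0}} Θ (d2 ℤ.* wz ℤ.* x)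
        (trans (eq dz cz x) (trans (cong (λ r → r ℤ.* (d2 ℤ.* x)) ccwz) (eq₀ (+ cc) wz d2 x)))
        (fit (11 ℕ.* κ₀) (D2 ℕ.* w ℕ.* M) (D ℕ.* w) {{ℕ.m*n≢0 D w}}
          (ℕ.≤-trans (abs-*≤ (d2 ℤ.* wz) (x) (abs-*≤ (d2) (wz) (ℕ.≤-reflexive ∣d2∣) ℕ.≤-refl) b) (ℕ.≤-reflexive (eq₁ (D2 ℕ.* w) (11 ℕ.* κ₀) M)))
          (k-lin 11 (ℕ.m≤m+n 11 245)) (eq₂ D ℓ w))
        where
          ccwz : d4 ℤ.* cz ≡ + cc ℤ.* wz
          ccwz = trans (cong (ℤ._* cz) (trans (cong₂ ℤ._*_ (sym (ℤ.pos-* D D)) (sym (ℤ.pos-* D D))) (sym (ℤ.pos-* D2 D2))))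
            (trans (sym (ℤ.pos-* D4 c)) (trans (cong +_ ccw) (ℤ.pos-* cc w)))
          eq : ∀ d c x → (d ℤ.* d) ℤ.* (d ℤ.* d) ℤ.* (d ℤ.* d) ℤ.* c ℤ.* x ≡ ((d ℤ.* d) ℤ.* (d ℤ.* d) ℤ.* c) ℤ.* ((d ℤ.* d) ℤ.* x)
          eq = solve-∀
          eq₀ : ∀ c w d x → c ℤ.* w ℤ.* (d ℤ.* x) ≡ c ℤ.* (d ℤ.* w ℤ.* x)
          eq₀ = solve-∀
          eq₁ : ∀ D k M → D ℕ.* (k ℕ.* M) ≡ k ℕ.* (D ℕ.* M)
          eq₁ = ℕR.solve-∀
          eq₂ : ∀ D ℓ w → ((D ℕ.* D) ℕ.* (D ℕ.* D)) ℕ.* ((D ℕ.* D) ℕ.* (D ℕ.* D)) ℕ.* ℓ ℕ.* (w ℕ.* w) ≡ D ℕ.* ((D ℕ.* D) ℕ.* w ℕ.* ((D ℕ.* D) ℕ.* (D ℕ.* D) ℕ.* ℓ)) ℕ.* (D ℕ.* w)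
          eq₂ = ℕR.solve-∀

      Q₁-p² : ∀ y → ℤ.∣ y ∣ ℕ.≤ (11 ℕ.* κ₀ ℕ.* M) ℕ.* (11 ℕ.* κ₀ ℕ.* M) → Inv Q₁ (+ 0) (p ℤ.* p ℤ.* y) e
      Q₁-p² y b = inv-v ((d4 ℤ.* cz) ℤ.* (d4 ℤ.* cz)) (N₁ ℕ.* N₁) {{ℕ.m*n≢0 N₁ N₁ {{N₁≢0}} {{N₁≢0}}}} Θ (d4 ℤ.* y) (eq dz cz y)
        (fit (121 ℕ.* (κ₀ ℕ.* κ₀)) (D4 ℕ.* (M ℕ.* M)) (D2 ℕ.* D) {{ℕ.m*n≢0 D2 D}}
          (ℕ.≤-trans (abs-*≤ (d4) (y) (ℕ.≤-reflexive ∣d4∣) b) (ℕ.≤-reflexive (eq₁ D4 κ₀ M)))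
          (k-quad 121 (ℕ.m≤m+n 121 135)) (eq₂ D ℓ))
        where
          eq : ∀ d c x → ((d ℤ.* d) ℤ.* (d ℤ.* d) ℤ.* (d ℤ.* d) ℤ.* c) ℤ.* ((d ℤ.* d) ℤ.* (d ℤ.* d) ℤ.* (d ℤ.* d) ℤ.* c) ℤ.* x ≡
            (((d ℤ.* d) ℤ.* (d ℤ.* d) ℤ.* c) ℤ.* ((d ℤ.* d) ℤ.* (d ℤ.* d) ℤ.* c)) ℤ.* ((d ℤ.* d) ℤ.* (d ℤ.* d) ℤ.* x)
          eq = solve-∀
          eq₁ : ∀ D k M → D ℕ.* ((11 ℕ.* k ℕ.* M) ℕ.* (11 ℕ.* k ℕ.* M)) ≡ 121 ℕ.* (k ℕ.* k) ℕ.* (D ℕ.* (M ℕ.* M))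
          eq₁ = ℕR.solve-∀
          eq₂ : ∀ D ℓ → (((D ℕ.* D) ℕ.* (D ℕ.* D)) ℕ.* ((D ℕ.* D) ℕ.* (D ℕ.* D)) ℕ.* ℓ) ℕ.* (((D ℕ.* D) ℕ.* (D ℕ.* D)) ℕ.* ((D ℕ.* D) ℕ.* (D ℕ.* D)) ℕ.* ℓ) ≡
            D ℕ.* ((D ℕ.* D) ℕ.* (D ℕ.* D) ℕ.* (((D ℕ.* D) ℕ.* (D ℕ.* D) ℕ.* ℓ) ℕ.* ((D ℕ.* D) ℕ.* (D ℕ.* D) ℕ.* ℓ))) ℕ.* (D ℕ.* D ℕ.* D)
          eq₂ = ℕR.solve-∀

      Q₁-square : ∀ x → ℤ.∣ x ∣ ℕ.≤ 11 ℕ.* κ₀ ℕ.* M → Inv Q₁ (+ 0) ((p ℤ.* x) ℤ.* (p ℤ.* x)) e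
      Q₁-square x b = subst (λ r → Inv Q₁ (+ 0) r e) (eq p x) (Q₁-p² (x ℤ.* x) (abs-*≤ (x) (x) b b))
        where
          eq : ∀ p x → p ℤ.* p ℤ.* (x ℤ.* x) ≡ (p ℤ.* x) ℤ.* (p ℤ.* x)
          eq = solve-∀

      -- From one scale to the next the step shrinks by D⁴ and the number of terms grows by D⁸, so a
      -- displacement of the coarser-stepped operator moves the longer progression by at most D⁴ x
      -- of its D⁸ x terms.
      chain-u : ∀ X x .{{_ : NonZero (D4 ℕ.* D4 ℕ.* x)}} (i : ℕ) → i ℕ.≤ x →
        Inv (uAvg X (D4 ℕ.* D4 ℕ.* x)) (d4 ℤ.* X ℤ.* + i) (+ 0) e
      chain-u X x i i≤x = inv-u X (D4 ℕ.* D4 ℕ.* x) Θ (d4 ℤ.* + i) (eq d4 X (+ i))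
        (fit 1 (D4 ℕ.* x) (D2 ℕ.* D) {{ℕ.m*n≢0 D2 D}}
          (ℕ.≤-trans (abs-*≤ d4 (+ i) (ℕ.≤-reflexive ∣d4∣) i≤x) (ℕ.≤-reflexive (sym (ℕ.*-identityˡ _)))) k-one (eq₂ D x))
        where
          eq : ∀ d X i → d ℤ.* X ℤ.* i ≡ X ℤ.* (d ℤ.* i)
          eq = solve-∀
          eq₂ : ∀ D ℓ → ((D ℕ.* D) ℕ.* (D ℕ.* D)) ℕ.* ((D ℕ.* D) ℕ.* (D ℕ.* D)) ℕ.* ℓ ≡ D ℕ.* ((D ℕ.* D) ℕ.* (D ℕ.* D) ℕ.* ℓ) ℕ.* ((D ℕ.* D) ℕ.* D)
          eq₂ = ℕR.solve-∀

      chain-v : ∀ X x .{{_ : NonZero ((D4 ℕ.* D4 ℕ.* x) ℕ.* (D4 ℕ.* D4 ℕ.* x))}} (i : ℕ) → i ℕ.≤ x ℕ.* x →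
        Inv (vAvg (X ℤ.* X) ((D4 ℕ.* D4 ℕ.* x) ℕ.* (D4 ℕ.* D4 ℕ.* x))) (+ 0) ((d4 ℤ.* X) ℤ.* (d4 ℤ.* X) ℤ.* + i) e
      chain-v X x i i≤ = inv-v (X ℤ.* X) ((D4 ℕ.* D4 ℕ.* x) ℕ.* (D4 ℕ.* D4 ℕ.* x)) Θ (d4 ℤ.* d4 ℤ.* + i) (eq d4 X (+ i))
        (fit 1 (D4 ℕ.* D4 ℕ.* (x ℕ.* x)) (D4 ℕ.* (D2 ℕ.* D)) {{ℕ.m*n≢0 D4 (D2 ℕ.* D) {{D4≢0}} {{ℕ.m*n≢0 D2 D}}}}
          (ℕ.≤-trans (abs-*≤ (d4 ℤ.* d4) (+ i) (abs-*≤ d4 d4 (ℕ.≤-reflexive ∣d4∣) (ℕ.≤-reflexive ∣d4∣)) i≤) (ℕ.≤-reflexive (sym (ℕ.*-identityˡ _)))) k-one (eq₂ D x))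
        where
          eq : ∀ d X i → (d ℤ.* X) ℤ.* (d ℤ.* X) ℤ.* i ≡ (X ℤ.* X) ℤ.* (d ℤ.* d ℤ.* i)
          eq = solve-∀
          eq₂ : ∀ D x → (((D ℕ.* D) ℕ.* (D ℕ.* D)) ℕ.* ((D ℕ.* D) ℕ.* (D ℕ.* D)) ℕ.* x) ℕ.* (((D ℕ.* D) ℕ.* (D ℕ.* D)) ℕ.* ((D ℕ.* D) ℕ.* (D ℕ.* D)) ℕ.* x) ≡
            D ℕ.* (((D ℕ.* D) ℕ.* (D ℕ.* D)) ℕ.* ((D ℕ.* D) ℕ.* (D ℕ.* D)) ℕ.* (x ℕ.* x)) ℕ.* ((D ℕ.* D) ℕ.* (D ℕ.* D) ℕ.* ((D ℕ.* D) ℕ.* D))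
          eq₂ = ℕR.solve-∀

      chain-R : ∀ X x .{{_ : NonZero (D4 ℕ.* D4 ℕ.* x ℕ.* N₃)}} (i : ℕ) → i ℕ.≤ x ℕ.* N₃ →
        Inv (vAvg (q ℤ.* X) (D4 ℕ.* D4 ℕ.* x ℕ.* N₃)) (+ 0) (q ℤ.* (d4 ℤ.* X) ℤ.* + i) e
      chain-R X x i i≤ = inv-v (q ℤ.* X) (D4 ℕ.* D4 ℕ.* x ℕ.* N₃) Θ (d4 ℤ.* + i) (eq q d4 X (+ i))
        (fit 1 (D4 ℕ.* (x ℕ.* N₃)) (D2 ℕ.* D) {{ℕ.m*n≢0 D2 D}}
          (ℕ.≤-trans (abs-*≤ d4 (+ i) (ℕ.≤-reflexive ∣d4∣) i≤) (ℕ.≤-reflexive (sym (ℕ.*-identityˡ _)))) k-one (eq₂ D x N₃))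
        where
          eq : ∀ q d X i → q ℤ.* (d ℤ.* X) ℤ.* i ≡ q ℤ.* X ℤ.* (d ℤ.* i)
          eq = solve-∀
          eq₂ : ∀ D ℓ n → ((D ℕ.* D) ℕ.* (D ℕ.* D)) ℕ.* ((D ℕ.* D) ℕ.* (D ℕ.* D)) ℕ.* ℓ ℕ.* n ≡ D ℕ.* ((D ℕ.* D) ℕ.* (D ℕ.* D) ℕ.* (ℓ ℕ.* n)) ℕ.* ((D ℕ.* D) ℕ.* D)
          eq₂ = ℕR.solve-∀

      small-ω : ∀ t w → Inv R₁ (+ 0) (ω (κ w) (tv t)) e
      small-ω t w = inv-v (q ℤ.* (d4 ℤ.* cz)) (N₁ ℕ.* N₃) {{ℕ.m*n≢0 N₁ N₃ {{N₁≢0}} {{N₃≢0}}}} Θ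
        (+ 4 ℤ.* (+ Ln ℤ.* + Ln) ℤ.* d2 ℤ.* κ w ℤ.* tv t) (eq (+ Ln) dz cz q (κ w) (tv t))
        (fit (96 ℕ.* κ₀) (D2 ℕ.* J ℕ.* M) 1
          (ℕ.≤-trans (abs-*≤ (+ 4 ℤ.* (+ Ln ℤ.* + Ln) ℤ.* d2 ℤ.* κ w) (tv t) (abs-*≤ (+ 4 ℤ.* (+ Ln ℤ.* + Ln) ℤ.* d2) (κ w)
              (abs-*≤ (+ 4 ℤ.* (+ Ln ℤ.* + Ln)) d2 (abs-*≤ (+ 4) (+ Ln ℤ.* + Ln) ℕ.≤-refl (ℕ.≤-trans (abs-*≤ (+ Ln) (+ Ln) ℕ.≤-refl ℕ.≤-refl) L²≤κ₀)) (ℕ.≤-reflexive ∣d2∣)) (κ≤ w)) (tv≤ t))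
            (ℕ.≤-reflexive (eq₁ κ₀ D2 J M)))
          (k-lin 96 (ℕ.m≤m+n 96 160)) (eq₂ D ℓ ℓ₀))
        where
          eq : ∀ L d c q k t → + 4 ℤ.* L ℤ.* L ℤ.* ((d ℤ.* d) ℤ.* (d ℤ.* d) ℤ.* (d ℤ.* d) ℤ.* c) ℤ.* q ℤ.* k ℤ.* t ≡
            q ℤ.* ((d ℤ.* d) ℤ.* (d ℤ.* d) ℤ.* c) ℤ.* (+ 4 ℤ.* (L ℤ.* L) ℤ.* (d ℤ.* d) ℤ.* k ℤ.* t)
          eq = solve-∀
          eq₁ : ∀ k D J M → 4 ℕ.* k ℕ.* D ℕ.* (8 ℕ.* J) ℕ.* (3 ℕ.* M) ≡ 96 ℕ.* k ℕ.* (D ℕ.* J ℕ.* M)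
          eq₁ = ℕR.solve-∀
          eq₂ : ∀ D ℓ ℓ₀ → ((D ℕ.* D) ℕ.* (D ℕ.* D)) ℕ.* ((D ℕ.* D) ℕ.* (D ℕ.* D)) ℕ.* ℓ ℕ.* (ℓ₀ ℕ.* ((D ℕ.* D) ℕ.* D)) ≡
            D ℕ.* ((D ℕ.* D) ℕ.* ((D ℕ.* D) ℕ.* (D ℕ.* D) ℕ.* ℓ₀) ℕ.* ((D ℕ.* D) ℕ.* (D ℕ.* D) ℕ.* ℓ)) ℕ.* 1
          eq₂ = ℕR.solve-∀

      small-β : ∀ j j′ t → Inv Q₁ (+ 0) (β j j′ ℤ.* p ℤ.* p ℤ.* (tv t ℤ.* tv t)) e
      small-β j j′ t = subst (λ r → Inv Q₁ (+ 0) r e) (eq (β j j′) p (tv t ℤ.* tv t)) (Q₁-p² (β j j′ ℤ.* (tv t ℤ.* tv t))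
        (ℕ.≤-trans (abs-*≤ (β j j′) (tv t ℤ.* tv t) (ℕ.≤-trans (abs--≤ (a j ℤ.* a j) (a j′ ℤ.* a j′) (sqa j) (sqa j′)) ℕ.≤-refl) (abs-*≤ (tv t) (tv t) (tv≤ t) (tv≤ t)))
          (ℕ.≤-trans (ℕ.m≤m+n _ (103 ℕ.* (κ₀ ℕ.* κ₀ ℕ.* (M ℕ.* M)))) (ℕ.≤-reflexive (eq₁ κ₀ M)))))
        where
          sqa : ∀ j → ℤ.∣ a j ℤ.* a j ∣ ℕ.≤ κ₀ ℕ.* κ₀
          sqa j = abs-*≤ (a j) (a j) (ℕ.≤-trans (an≤ j) K≤κ₀) (ℕ.≤-trans (an≤ j) K≤κ₀)
          eq : ∀ β p t → p ℤ.* p ℤ.* (β ℤ.* t) ≡ β ℤ.* p ℤ.* p ℤ.* t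
          eq = solve-∀
          eq₁ : ∀ k M → (k ℕ.* k ℕ.+ k ℕ.* k) ℕ.* ((3 ℕ.* M) ℕ.* (3 ℕ.* M)) ℕ.+ 103 ℕ.* (k ℕ.* k ℕ.* (M ℕ.* M)) ≡ (11 ℕ.* k ℕ.* M) ℕ.* (11 ℕ.* k ℕ.* M)
          eq₁ = ℕR.solve-∀

      small-offset : ∀ j i i′ → 2 ℕ.* ℤ.∣ q′ ℤ.* (+ gn j ℤ.* + gn j) ℤ.* (iv i ℤ.+ iv i′) ∣ ℕ.* Θ ℕ.≤ M
      small-offset j i i′ = fit (8 ℕ.* κ₀) (ρ ℕ.* D4 ℕ.* J) (D ℕ.* ρ) {{ℕ.m*n≢0 D ρ}}
        (ℕ.≤-trans (abs-*≤ (q′ ℤ.* (+ gn j ℤ.* + gn j)) (iv i ℤ.+ iv i′) (abs-*≤ q′ (+ gn j ℤ.* + gn j) q′≤ (ℕ.≤-trans (abs-*≤ (+ gn j) (+ gn j) (gn≤ j) (gn≤ j)) L²≤κ₀)) (abs-+≤ (iv i) (iv i′) (iv≤ i) (iv≤ i′)))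
          (ℕ.≤-reflexive (eq₁ ρ D4 κ₀ J)))
        (k-lin 8 (ℕ.m≤m+n 8 248)) (eq₂ D ρ ℓ₀)
        where
          eq₁ : ∀ ρ D k J → ρ ℕ.* D ℕ.* k ℕ.* (4 ℕ.* J ℕ.+ 4 ℕ.* J) ≡ 8 ℕ.* k ℕ.* (ρ ℕ.* D ℕ.* J)
          eq₁ = ℕR.solve-∀
          eq₂ : ∀ D ρ ℓ → (D ℕ.* D) ℕ.* (D ℕ.* D) ℕ.* ((ρ ℕ.* ρ) ℕ.* ((D ℕ.* D) ℕ.* (D ℕ.* D) ℕ.* (D ℕ.* D)) ℕ.* ℓ) ≡
            D ℕ.* (ρ ℕ.* ((D ℕ.* D) ℕ.* (D ℕ.* D)) ℕ.* ((D ℕ.* D) ℕ.* (D ℕ.* D) ℕ.* ℓ)) ℕ.* (D ℕ.* ρ)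
          eq₂ = ℕR.solve-∀

      -- D is a multiple of every nonzero integer up to 2 K. A spare factor D in one step therefore
      -- makes it an exact multiple of another step that contains an unknown small factor z.
      factor : ∀ z → z ≢ + 0 → ℤ.∣ z ∣ ℕ.≤ 2 ℕ.* K → ∃[ y ] (dz ≡ z ℤ.* y) × (ℤ.∣ y ∣ ℕ.≤ D)
      factor z z≢0 z≤ with ∣⇒factor z (dvd ℤ.∣ z ∣ (ℕ.n≢0⇒n>0 (λ e → z≢0 (ℤ.∣i∣≡0⇒i≡0 e))) z≤)
      ... | y , e₁ , e₂ = y , e₁ , e₂ z≢0

      minus-zero : ∀ x y → x ℤ.- y ≡ + 0 → x ≡ y
      minus-zero x y e = ℤ.i-j≡0⇒i≡j x y e

      +-inj : ∀ {n} {i j : Fin n} → + toℕ i ≡ + toℕ j → i ≡ j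
      +-inj e = toℕ-injective (ℤ.+-injective e)

      Fin-diff≤ : ∀ (i j : Fin K) → ℤ.∣ + toℕ i ℤ.- + toℕ j ∣ ℕ.≤ 2 ℕ.* K
      Fin-diff≤ i j = ℕ.≤-trans (abs--≤ (+ toℕ i) (+ toℕ j) (toℕ≤ i) (toℕ≤ j)) (ℕ.≤-reflexive (cong (K ℕ.+_) (sym (ℕ.+-identityʳ K))))

      Fin-diff≢0 : ∀ {i j : Fin K} → i ≢ j → + toℕ i ℤ.- + toℕ j ≢ + 0
      Fin-diff≢0 {i} {j} i≢j e = i≢j (+-inj (minus-zero (+ toℕ i) (+ toℕ j) e))

      suc-diff : ∀ x y → + suc x ℤ.- + suc y ≡ + x ℤ.- + y
      suc-diff x y = trans (ℤ.[+m]-[+n]≡m⊖n (suc x) (suc y)) (trans (ℤ.[1+m]⊖[1+n]≡m⊖n x y) (sym (ℤ.[+m]-[+n]≡m⊖n x y)))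

      -- The step of P₀ is D² p, and one D absorbs α, which makes it a multiple of the step α p of
      -- the line.
      small-line : ∀ j j′ → j ≢ j′ → Fine P₀ (line j j′) e
      small-line j j′ j≢j′ i with factor (α j j′) (λ e → Fin-diff≢0 {j′} {j} (λ e′ → j≢j′ (sym e′)) (trans (sym (suc-diff (toℕ j′) (toℕ j))) e))
        (subst (λ r → ℤ.∣ r ∣ ℕ.≤ 2 ℕ.* K) (sym (suc-diff (toℕ j′) (toℕ j))) (Fin-diff≤ j′ j))
      ... | y , eqy , y≤ = λ φ φ≤1 → E-near (mean (avg K)) (λ ι → E-near (mean (avg K)) (λ γ →
          inv-u-offset (α j j′ ℤ.* p) M Θ (h ι γ) (y ℤ.* dz ℤ.* + toℕ i)
            (trans (eq₀ dz cz (+ toℕ i)) (trans (cong (λ r → r ℤ.* dz ℤ.* (p ℤ.* + toℕ i)) eqy) (eq (α j j′) y dz p (+ toℕ i))))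
            (fit 1 (D ℕ.* D ℕ.* ℓ) D
              (ℕ.≤-trans (abs-*≤ (y ℤ.* dz) (+ toℕ i) (abs-*≤ y dz y≤ ℕ.≤-refl) (toℕ≤ i)) (ℕ.≤-reflexive (sym (ℕ.*-identityˡ _)))) k-one (eq₂ D ℓ)) φ φ≤1))
        where
          eq₀ : ∀ d c i → (d ℤ.* d) ℤ.* (d ℤ.* d) ℤ.* ((d ℤ.* d) ℤ.* (d ℤ.* d) ℤ.* c) ℤ.* i ≡ d ℤ.* d ℤ.* (((d ℤ.* d) ℤ.* (d ℤ.* d) ℤ.* (d ℤ.* d)) ℤ.* c ℤ.* i)
          eq₀ = solve-∀
          eq : ∀ a y d p i → a ℤ.* y ℤ.* d ℤ.* (p ℤ.* i) ≡ a ℤ.* p ℤ.* (y ℤ.* d ℤ.* i)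
          eq = solve-∀
          eq₂ : ∀ D ℓ → (D ℕ.* D) ℕ.* (D ℕ.* D) ℕ.* ℓ ≡ D ℕ.* (D ℕ.* D ℕ.* ℓ) ℕ.* D
          eq₂ = ℕR.solve-∀

      -- 2 L g divides 4 L² = 2 a (2 L g), hence D, so the step D q of Pf is a multiple of the step
      -- 2 L g q of the shifts.
      small-shifts : ∀ j → Fine Pf (shifts j) e
      small-shifts j i with ∣⇒factor (+ 2 ℤ.* + Ln ℤ.* + gn j) {D} dv
        where
          dv : ℤ.∣ + 2 ℤ.* + Ln ℤ.* + gn j ∣ ℕᵈ.∣ D
          dv = ℕᵈ.∣-trans (divides (2 ℕ.* suc (toℕ j)) (trans (eq Ln (suc (toℕ j)) (gn j) (agn j)) (cong (2 ℕ.* suc (toℕ j) ℕ.*_) (sym (trans (ℤ.abs-* (+ 2 ℤ.* + Ln) (+ gn j)) (cong (ℕ._* gn j) (ℤ.abs-* (+ 2) (+ Ln)))))))) dvdL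
            where
              eq₀ : ∀ a g → 4 ℕ.* ((a ℕ.* g) ℕ.* (a ℕ.* g)) ≡ 2 ℕ.* a ℕ.* (2 ℕ.* (a ℕ.* g) ℕ.* g)
              eq₀ = ℕR.solve-∀
              eq : ∀ L a g → a ℕ.* g ≡ L → 4 ℕ.* (L ℕ.* L) ≡ 2 ℕ.* a ℕ.* (2 ℕ.* L ℕ.* g)
              eq L a g refl = eq₀ a g
      ... | y , eqy , y≤ = λ φ φ≤1 → E-near (mean (avg K)) (λ ι →
          ≡≤ (cong₂ (λ r s → ∣ r - s ∣)
              (swap (avg K) (mean (avg m)) (λ γ i′ → φ (ee j ℤ.* iv (ι , i′ , γ) ℤ.+ u Pf i) (+ 0 ℤ.+ + 0)))
              (swap (avg K) (mean (avg m)) (λ γ i′ → φ (ee j ℤ.* iv (ι , i′ , γ)) (+ 0))))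
            (E-near (mean (avg K)) (λ γ → inv-u-offset (ee j) m Θ (+ toℕ γ ℤ.+ (+ Yn ℤ.* + toℕ ι ℤ.+ + 1)) (y ℤ.* + toℕ i)
              (trans (cong (λ r → r ℤ.* q ℤ.* + toℕ i) eqy) (eq (+ Ln) (+ gn j) y q (+ toℕ i)))
              (fit 1 (D ℕ.* ℓ₀) 1
                (ℕ.≤-trans (abs-*≤ y (+ toℕ i) (y≤ nz) (toℕ≤ i)) (ℕ.≤-reflexive (sym (ℕ.*-identityˡ _)))) k-one (eq₂ D ℓ₀)) φ φ≤1)))
        where
          nz : + 2 ℤ.* + Ln ℤ.* + gn j ≢ + 0
          nz e = ℕ.≢-nonZero⁻¹ D (ℤ.+-injective (trans eqy (cong (ℤ._* y) e)))
          eq : ∀ L g y q i → + 2 ℤ.* L ℤ.* g ℤ.* y ℤ.* q ℤ.* i ≡ + 2 ℤ.* L ℤ.* g ℤ.* q ℤ.* (y ℤ.* i)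
          eq = solve-∀
          eq₂ : ∀ D ℓ → D ℕ.* D ℕ.* ℓ ≡ D ℕ.* (D ℕ.* ℓ) ℕ.* 1
          eq₂ = ℕR.solve-∀

      instance
        2Θ≢0 : NonZero (2 ℕ.* Θ)
        2Θ≢0 = ℕ.m*n≢0 2 Θ

      -- If x = a₁ Q + s then r x = (a₂ - a₁) x is reached by r Q - s steps of a₁ and s steps of a₂.
      two-runs : ∀ A B b₀ a₁ a₂ x → (∀ z → 2 ℕ.* ℤ.∣ z ∣ ℕ.* (2 ℕ.* Θ) ℕ.≤ M → Inv A (+ 0) (b₀ ℤ.* a₁ ℤ.* z) (inv (2 ℕ.* Θ))) →
        (∀ z → 2 ℕ.* ℤ.∣ z ∣ ℕ.* (2 ℕ.* Θ) ℕ.≤ M → Inv B (+ 0) (b₀ ℤ.* a₂ ℤ.* z) (inv (2 ℕ.* Θ))) →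
        ∀ lo n .{{_ : NonZero lo}} → lo ℕ.≤ 2 ℕ.* ℤ.∣ a₁ ∣ → ℤ.∣ a₁ ∣ ℕ.≤ 8 ℕ.* (K ℕ.* Sn) → ℤ.∣ a₂ ℤ.- a₁ ∣ ℕ.≤ 2 ℕ.* K →
        2 ℕ.* ℤ.∣ x ∣ ℕ.≤ 2 ℕ.* n ℕ.* lo → n ℕ.≤ Sn →
        Inv (A ∘ B) (+ 0) (b₀ ℤ.* (a₂ ℤ.- a₁) ℤ.* x) e
      two-runs A B b₀ a₁ a₂ x invA invB lo n lo≤ a₁≤ r≤ x≤ n≤ with divide x a₁ {{ℕ.≢-nonZero (λ e → ℕ.≢-nonZero⁻¹ lo (ℕ.n≤0⇒n≡0 (subst (λ r → lo ℕ.≤ 2 ℕ.* r) e lo≤)))}}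
      ... | Q , s , eq , Q≤ , s≤ = subst₂ (λ y ε → Inv (A ∘ B) (+ 0) y ε) (trans (eqz b₀ a₁ a₂ Q s) (cong (b₀ ℤ.* (a₂ ℤ.- a₁) ℤ.*_) (sym eq))) (inv-halves Θ)
          (Inv-+ (A ∘ B) (Inv-∘ˡ A B (invA ((a₂ ℤ.- a₁) ℤ.* Q ℤ.- s) (bound ((a₂ ℤ.- a₁) ℤ.* Q ℤ.- s) (ℕ.≤-trans (abs--≤ ((a₂ ℤ.- a₁) ℤ.* Q) s (abs-*≤ (a₂ ℤ.- a₁) Q r≤ ∣Q∣≤) (ℕ.≤-trans s≤ a₁≤)) (ℕ.≤-reflexive (eqk K Sn))))))
            (Inv-∘ʳ A B (invB s (bound s (ℕ.≤-trans (ℕ.≤-trans s≤ a₁≤) (ℕ.*-monoˡ-≤ (K ℕ.* Sn) (ℕ.m≤m+n 8 4)))))))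
        where
          ∣Q∣≤ : ℤ.∣ Q ∣ ℕ.≤ 2 ℕ.* Sn
          ∣Q∣≤ = ℕ.≤-trans (ℕ.*-cancelʳ-≤ ℤ.∣ Q ∣ (2 ℕ.* n) lo (begin
              ℤ.∣ Q ∣ ℕ.* lo ≤⟨ ℕ.*-monoʳ-≤ ℤ.∣ Q ∣ lo≤ ⟩
              ℤ.∣ Q ∣ ℕ.* (2 ℕ.* ℤ.∣ a₁ ∣) ≡⟨ eq₂ ℤ.∣ Q ∣ ℤ.∣ a₁ ∣ ⟩
              2 ℕ.* (ℤ.∣ Q ∣ ℕ.* ℤ.∣ a₁ ∣) ≤⟨ ℕ.*-monoʳ-≤ 2 Q≤ ⟩
              2 ℕ.* ℤ.∣ x ∣ ≤⟨ x≤ ⟩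
              2 ℕ.* n ℕ.* lo ∎)) (ℕ.*-monoʳ-≤ 2 n≤)
            where
              open ℕ.≤-Reasoning
              eq₂ : ∀ Q a → Q ℕ.* (2 ℕ.* a) ≡ 2 ℕ.* (Q ℕ.* a)
              eq₂ = ℕR.solve-∀
          bound : ∀ z → ℤ.∣ z ∣ ℕ.≤ 12 ℕ.* (K ℕ.* Sn) → 2 ℕ.* ℤ.∣ z ∣ ℕ.* (2 ℕ.* Θ) ℕ.≤ M
          bound z z≤ = ℕ.≤-trans (ℕ.≤-reflexive (eq₃ ℤ.∣ z ∣ Θ)) (fit (24 ℕ.* κ₀) Sn 1
            (ℕ.≤-trans (ℕ.*-monoʳ-≤ 2 (ℕ.≤-trans z≤ (ℕ.*-monoʳ-≤ 12 (ℕ.*-monoˡ-≤ Sn K≤κ₀)))) (ℕ.≤-reflexive (eq₄ κ₀ Sn))) (k-lin 24 (ℕ.m≤m+n 24 232)) (eq₅ D ℓ))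
            where
              eq₃ : ∀ z t → 2 ℕ.* z ℕ.* (2 ℕ.* t) ≡ 2 ℕ.* (2 ℕ.* z) ℕ.* t
              eq₃ = ℕR.solve-∀
              eq₄ : ∀ k S → 2 ℕ.* (12 ℕ.* (k ℕ.* S)) ≡ 24 ℕ.* k ℕ.* S
              eq₄ = ℕR.solve-∀
              eq₅ : ∀ D ℓ → (D ℕ.* D) ℕ.* (D ℕ.* D) ℕ.* ℓ ≡ D ℕ.* (D ℕ.* D ℕ.* D ℕ.* ℓ) ℕ.* 1
              eq₅ = ℕR.solve-∀
          eqk : ∀ K S → 2 ℕ.* K ℕ.* (2 ℕ.* S) ℕ.+ 8 ℕ.* (K ℕ.* S) ≡ 12 ℕ.* (K ℕ.* S)
          eqk = ℕR.solve-∀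
          eqz : ∀ b a a′ Q s → b ℤ.* a ℤ.* ((a′ ℤ.- a) ℤ.* Q ℤ.- s) ℤ.+ b ℤ.* a′ ℤ.* s ≡ b ℤ.* (a′ ℤ.- a) ℤ.* (a ℤ.* Q ℤ.+ s)
          eqz = solve-∀

      instance
        Sn≢0 : NonZero Sn
        Sn≢0 = ℕ.m*n≢0 (D2 ℕ.* D) ℓ {{ℕ.m*n≢0 D2 D}}
        Yn≢0 : NonZero Yn
        Yn≢0 = ℕ.m*n≢0 (D2 ℕ.* D) ℓ₀ {{ℕ.m*n≢0 D2 D}}

      -- Different blocks are at least B apart, and the remaining offset removes at most half of
      -- that. This lower bound keeps the quotient in `two-runs` short.
      gap : ∀ (B o : ℕ) x (ι ι′ : Fin K) → ι ≢ ι′ → 2 ℕ.* o ℕ.≤ B → ℤ.∣ x ∣ ℕ.≤ o → B ℕ.≤ 2 ℕ.* ℤ.∣ x ℤ.+ + B ℤ.* (+ toℕ ι′ ℤ.- + toℕ ι) ∣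
      gap B o x ι ι′ ι≢ι′ o≤ x≤ = ℕ.+-cancelʳ-≤ B B (2 ℕ.* ℤ.∣ a₁ ∣) (begin
        B ℕ.+ B ≤⟨ ℕ.+-mono-≤ B≤ B≤ ⟩
        (ℤ.∣ a₁ ∣ ℕ.+ o) ℕ.+ (ℤ.∣ a₁ ∣ ℕ.+ o) ≡⟨ eq ℤ.∣ a₁ ∣ o ⟩
        2 ℕ.* ℤ.∣ a₁ ∣ ℕ.+ 2 ℕ.* o ≤⟨ ℕ.+-monoʳ-≤ (2 ℕ.* ℤ.∣ a₁ ∣) o≤ ⟩
        2 ℕ.* ℤ.∣ a₁ ∣ ℕ.+ B ∎)
        where
          open ℕ.≤-Reasoning
          Δ = + toℕ ι′ ℤ.- + toℕ ι
          a₁ = x ℤ.+ + B ℤ.* Δ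
          eq : ∀ a o → (a ℕ.+ o) ℕ.+ (a ℕ.+ o) ≡ 2 ℕ.* a ℕ.+ 2 ℕ.* o
          eq = ℕR.solve-∀
          eqx : ∀ x y → x ℤ.+ y ℤ.- x ≡ y
          eqx = solve-∀
          B≤ : B ℕ.≤ ℤ.∣ a₁ ∣ ℕ.+ o
          B≤ = begin
            B ≤⟨ ℕ.m≤m*n B ℤ.∣ Δ ∣ {{ℕ.≢-nonZero (λ e → Fin-diff≢0 {ι′} {ι} (λ e′ → ι≢ι′ (sym e′)) (ℤ.∣i∣≡0⇒i≡0 e))}} ⟩
            B ℕ.* ℤ.∣ Δ ∣ ≡⟨ sym (ℤ.abs-* (+ B) Δ) ⟩
            ℤ.∣ + B ℤ.* Δ ∣ ≡⟨ cong ℤ.∣_∣ (sym (eqx x (+ B ℤ.* Δ))) ⟩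
            ℤ.∣ a₁ ℤ.- x ∣ ≤⟨ abs--≤ a₁ x ℕ.≤-refl x≤ ⟩
            ℤ.∣ a₁ ∣ ℕ.+ o ∎

      4K≤Sn : 2 ℕ.* (2 ℕ.* K) ℕ.≤ Sn
      4K≤Sn = ℕ.≤-trans (ℕ.m≤m+n (2 ℕ.* (2 ℕ.* K)) (60 ℕ.* K)) (ℕ.≤-trans (ℕ.≤-reflexive (eq₁ K))
        (ℕ.≤-trans (ℕ.*-mono-≤ (ℕ.*-mono-≤ 8≤D 8≤D) K≤D) (ℕ.m≤m*n (D ℕ.* D ℕ.* D) ℓ)))
        where
          eq₁ : ∀ K → 2 ℕ.* (2 ℕ.* K) ℕ.+ 60 ℕ.* K ≡ 8 ℕ.* 8 ℕ.* K
          eq₁ = ℕR.solve-∀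

      -- The step of Q₀ is D⁴ p². Its four factors D pay for 2, b₁, b₂ and γ₂ - γ₁, the small
      -- factors in the difference of the two steps; `two-runs` then realises the displacement.
      quad-fine : ∀ b b₁ b₂ → b ≡ b₁ ℤ.* b₂ → b₁ ≢ + 0 → b₂ ≢ + 0 → ℤ.∣ b₁ ∣ ℕ.≤ 2 ℕ.* K → ℤ.∣ b₂ ∣ ℕ.≤ 2 ℕ.* K →
        ∀ ι ι′ → ι ≢ ι′ → ∀ γ γ₁ γ₂ → γ₁ ≢ γ₂ → Fine Q₀ (quad-run b ι γ ι′ γ₁ ∘ quad-run b ι γ ι′ γ₂) e
      quad-fine b b₁ b₂ b≡ b₁≢0 b₂≢0 b₁≤ b₂≤ ι ι′ ι≢ι′ γ γ₁ γ₂ γ₁≢γ₂ i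
        with factor (+ 2) (λ ()) (ℕ.*-monoʳ-≤ 2 (ℕ.>-nonZero⁻¹ K)) | factor b₁ b₁≢0 b₁≤ | factor b₂ b₂≢0 b₂≤
           | factor (+ toℕ γ₂ ℤ.- + toℕ γ₁) (Fin-diff≢0 {γ₂} {γ₁} (λ e → γ₁≢γ₂ (sym e))) (Fin-diff≤ γ₂ γ₁)
      ... | y₁ , e₁ , y₁≤ | y₂ , e₂ , y₂≤ | y₃ , e₃ , y₃≤ | y₄ , e₄ , y₄≤ =
        subst (λ r → Inv (quad-run b ι γ ι′ γ₁ ∘ quad-run b ι γ ι′ γ₂) (+ 0) r e) disp
          (two-runs (quad-run b ι γ ι′ γ₁) (quad-run b ι γ ι′ γ₂) b₀ (h ι′ γ₁ ℤ.- h ι γ) (h ι′ γ₂ ℤ.- h ι γ) x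
            (λ z → inv-v (b₀ ℤ.* (h ι′ γ₁ ℤ.- h ι γ)) M (2 ℕ.* Θ) z refl) (λ z → inv-v (b₀ ℤ.* (h ι′ γ₂ ℤ.- h ι γ)) M (2 ℕ.* Θ) z refl)
            Sn (D ℕ.* ℓ)
            (subst (λ r → Sn ℕ.≤ 2 ℕ.* ℤ.∣ r ∣) (sym (eqh (+ toℕ γ₁) (+ toℕ γ) (+ Sn) (+ toℕ ι′) (+ toℕ ι)))
              (gap Sn (2 ℕ.* K) (+ toℕ γ₁ ℤ.- + toℕ γ) ι ι′ ι≢ι′ 4K≤Sn (Fin-diff≤ γ₁ γ)))
            (ℕ.≤-trans (abs--≤ (h ι′ γ₁) (h ι γ) (h≤ ι′ γ₁) (h≤ ι γ)) (ℕ.≤-trans (ℕ.m≤m+n _ (4 ℕ.* (K ℕ.* Sn))) (ℕ.≤-reflexive (eq₈ (K ℕ.* Sn)))))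
            (subst (λ r → ℤ.∣ r ∣ ℕ.≤ 2 ℕ.* K) (sym (eqr (+ toℕ γ₂) (+ toℕ γ₁) (+ Sn ℤ.* + toℕ ι′) (h ι γ))) (Fin-diff≤ γ₂ γ₁))
            (ℕ.≤-trans (ℕ.*-monoʳ-≤ 2 (abs-*≤ (y₁ ℤ.* y₂ ℤ.* y₃ ℤ.* y₄) (+ toℕ i) (abs-*≤ (y₁ ℤ.* y₂ ℤ.* y₃) y₄ (abs-*≤ (y₁ ℤ.* y₂) y₃ (abs-*≤ y₁ y₂ y₁≤ y₂≤) y₃≤) y₄≤) (toℕ≤ i)))
              (ℕ.≤-reflexive (eqx D ℓ)))
            (ℕ.*-monoˡ-≤ ℓ (ℕ.m≤n*m D (D ℕ.* D) {{D2≢0}})))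
        where
          b₀ = + 2 ℤ.* b ℤ.* p ℤ.* p
          x = y₁ ℤ.* y₂ ℤ.* y₃ ℤ.* y₄ ℤ.* + toℕ i
          eqh : ∀ g₁ g S i′ i → (g₁ ℤ.+ S ℤ.* i′) ℤ.- (g ℤ.+ S ℤ.* i) ≡ (g₁ ℤ.- g) ℤ.+ S ℤ.* (i′ ℤ.- i)
          eqh = solve-∀
          eqr : ∀ g₂ g₁ s c → ((g₂ ℤ.+ s) ℤ.- c) ℤ.- ((g₁ ℤ.+ s) ℤ.- c) ≡ g₂ ℤ.- g₁
          eqr = solve-∀
          h≤ : ∀ ι γ → ℤ.∣ h ι γ ∣ ℕ.≤ 2 ℕ.* (K ℕ.* Sn)
          h≤ ι γ = ℕ.≤-trans (abs-+≤ (+ toℕ γ) (+ Sn ℤ.* + toℕ ι) (ℕ.≤-trans (toℕ≤ γ) (ℕ.m≤m*n K Sn)) (ℕ.≤-trans (abs-*≤ (+ Sn) (+ toℕ ι) ℕ.≤-refl (toℕ≤ ι)) (ℕ.≤-reflexive (ℕ.*-comm Sn K))))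
            (ℕ.≤-reflexive (cong (K ℕ.* Sn ℕ.+_) (sym (ℕ.+-identityʳ (K ℕ.* Sn)))))
          eq₈ : ∀ x → 2 ℕ.* x ℕ.+ 2 ℕ.* x ℕ.+ 4 ℕ.* x ≡ 8 ℕ.* x
          eq₈ = ℕR.solve-∀
          eqx : ∀ D ℓ → 2 ℕ.* (D ℕ.* D ℕ.* D ℕ.* D ℕ.* (ℓ ℕ.* ℓ)) ≡ 2 ℕ.* (D ℕ.* ℓ) ℕ.* (D ℕ.* D ℕ.* D ℕ.* ℓ)
          eqx = ℕR.solve-∀
          eqd₁ : ∀ b₁ b₂ p r y₁ y₂ y₃ y₄ i → + 2 ℤ.* (b₁ ℤ.* b₂) ℤ.* p ℤ.* p ℤ.* r ℤ.* (y₁ ℤ.* y₂ ℤ.* y₃ ℤ.* y₄ ℤ.* i) ≡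
            p ℤ.* p ℤ.* ((+ 2 ℤ.* y₁) ℤ.* (b₁ ℤ.* y₂) ℤ.* (b₂ ℤ.* y₃) ℤ.* (r ℤ.* y₄)) ℤ.* i
          eqd₁ = solve-∀
          eqd₂ : ∀ d c i → ((d ℤ.* d) ℤ.* (d ℤ.* d) ℤ.* (d ℤ.* d) ℤ.* c) ℤ.* ((d ℤ.* d) ℤ.* (d ℤ.* d) ℤ.* (d ℤ.* d) ℤ.* c) ℤ.* (d ℤ.* d ℤ.* d ℤ.* d) ℤ.* i ≡
            ((d ℤ.* d) ℤ.* (d ℤ.* d) ℤ.* ((d ℤ.* d) ℤ.* (d ℤ.* d) ℤ.* c)) ℤ.* ((d ℤ.* d) ℤ.* (d ℤ.* d) ℤ.* ((d ℤ.* d) ℤ.* (d ℤ.* d) ℤ.* c)) ℤ.* i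
          eqd₂ = solve-∀
          disp : b₀ ℤ.* ((h ι′ γ₂ ℤ.- h ι γ) ℤ.- (h ι′ γ₁ ℤ.- h ι γ)) ℤ.* x ≡ v Q₀ i
          disp = trans (cong₂ (λ r s → + 2 ℤ.* r ℤ.* p ℤ.* p ℤ.* s ℤ.* x) b≡ (eqr (+ toℕ γ₂) (+ toℕ γ₁) (+ Sn ℤ.* + toℕ ι′) (h ι γ)))
            (trans (eqd₁ b₁ b₂ p (+ toℕ γ₂ ℤ.- + toℕ γ₁) y₁ y₂ y₃ y₄ (+ toℕ i))
              (trans (cong (λ r → p ℤ.* p ℤ.* r ℤ.* + toℕ i) (cong₂ ℤ._*_ (cong₂ ℤ._*_ (cong₂ ℤ._*_ (sym e₁) (sym e₂)) (sym e₃)) (sym e₄)))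
                (eqd₂ dz cz (+ toℕ i))))

      a≢0 : ∀ j → a j ≢ + 0
      a≢0 j ()

      a≤2K : ∀ j → ℤ.∣ a j ∣ ℕ.≤ 2 ℕ.* K
      a≤2K j = ℕ.≤-trans (an≤ j) (ℕ.m≤m+n K (K ℕ.+ 0))

      β-fine : ∀ j j′ → j ≢ j′ → ∀ ι ι′ → ι ≢ ι′ → ∀ γ γ₁ γ₂ → γ₁ ≢ γ₂ → Fine Q₀ (quad-run (β j j′) ι γ ι′ γ₁ ∘ quad-run (β j j′) ι γ ι′ γ₂) e
      β-fine j j′ j≢j′ = quad-fine (β j j′) (a j ℤ.- a j′) (a j ℤ.+ a j′) (eq (a j) (a j′))
        (λ e → Fin-diff≢0 j≢j′ (trans (sym (suc-diff (toℕ j) (toℕ j′))) e)) (λ ())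
        (subst (λ r → ℤ.∣ r ∣ ℕ.≤ 2 ℕ.* K) (sym (suc-diff (toℕ j) (toℕ j′))) (Fin-diff≤ j j′))
        (ℕ.≤-trans (ℕ.+-mono-≤ (an≤ j) (an≤ j′)) (ℕ.≤-reflexive (cong (K ℕ.+_) (sym (ℕ.+-identityʳ K)))))
        where
          eq : ∀ a a′ → a ℤ.* a ℤ.- a′ ℤ.* a′ ≡ (a ℤ.- a′) ℤ.* (a ℤ.+ a′)
          eq = solve-∀

      -- The step of R₀ is D² p q: one D pays for 4 L², the other for γ₂ - γ₁.
      ω-fine : ∀ ι ι′ → ι ≢ ι′ → ∀ i γ i′ γ₁ γ₂ → γ₁ ≢ γ₂ →
        Fine R₀ (ω-run ((ι , i , γ) , (ι′ , i′ , γ₁)) ∘ ω-run ((ι , i , γ) , (ι′ , i′ , γ₂))) e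
      ω-fine ι ι′ ι≢ι′ i γ i′ γ₁ γ₂ γ₁≢γ₂ k
        with ∣⇒factor (+ 4 ℤ.* (+ Ln ℤ.* + Ln)) {D} (subst (λ r → r ℕᵈ.∣ D) (sym (trans (ℤ.abs-* (+ 4) (+ Ln ℤ.* + Ln)) (cong (4 ℕ.*_) (ℤ.abs-* (+ Ln) (+ Ln))))) dvdL)
           | factor (+ toℕ γ₂ ℤ.- + toℕ γ₁) (Fin-diff≢0 {γ₂} {γ₁} (λ e → γ₁≢γ₂ (sym e))) (Fin-diff≤ γ₂ γ₁)
      ... | y₁ , e₁ , y₁≤′ | y₂ , e₂ , y₂≤ =
        subst (λ r → Inv (ω-run w₁ ∘ ω-run w₂) (+ 0) r e) disp
          (two-runs (ω-run w₁) (ω-run w₂) b₀ (κ w₁) (κ w₂) x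
            (λ z p → steps w₁ z p) (λ z p → steps w₂ z p)
            Yn (D2 ℕ.* ℓ)
            (subst (λ r → Yn ℕ.≤ 2 ℕ.* ℤ.∣ r ∣) (sym (eqκ (+ toℕ i′) (+ toℕ γ₁) (+ Yn) (+ toℕ ι′) (+ toℕ i) (+ toℕ γ) (+ toℕ ι)))
              (gap Yn (2 ℕ.* m ℕ.+ 2 ℕ.* K) ((+ toℕ i′ ℤ.- + toℕ i) ℤ.+ (+ toℕ γ₁ ℤ.- + toℕ γ)) ι ι′ ι≢ι′ mK≤Yn
                (abs-+≤ (+ toℕ i′ ℤ.- + toℕ i) (+ toℕ γ₁ ℤ.- + toℕ γ) (ℕ.≤-trans (abs--≤ (+ toℕ i′) (+ toℕ i) (toℕ≤ i′) (toℕ≤ i)) (ℕ.≤-reflexive (cong (m ℕ.+_) (sym (ℕ.+-identityʳ m))))) (Fin-diff≤ γ₁ γ))))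
            (ℕ.≤-trans (κ≤ w₁) (ℕ.*-monoʳ-≤ 8 (ℕ.≤-trans J≤Sn (ℕ.m≤n*m Sn K))))
            (subst (λ r → ℤ.∣ r ∣ ℕ.≤ 2 ℕ.* K) (sym (eqr (+ toℕ i′) (+ toℕ γ₂) (+ toℕ γ₁) (+ Yn ℤ.* + toℕ ι′ ℤ.+ + 1) (iv (ι , i , γ)))) (Fin-diff≤ γ₂ γ₁))
            (ℕ.≤-trans (ℕ.*-monoʳ-≤ 2 (abs-*≤ (y₁ ℤ.* y₂) (+ toℕ k) (abs-*≤ y₁ y₂ (y₁≤′ nz) y₂≤) (toℕ≤ k))) (ℕ.≤-reflexive (eqx D ℓ ℓ₀)))
            (ℕ.*-monoˡ-≤ ℓ (ℕ.m≤m*n D2 D)))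
        where
          w₁ w₂ : IxI × IxI
          w₁ = (ι , i , γ) , (ι′ , i′ , γ₁)
          w₂ = (ι , i , γ) , (ι′ , i′ , γ₂)
          b₀ = + 4 ℤ.* + Ln ℤ.* + Ln ℤ.* p ℤ.* q
          x = y₁ ℤ.* y₂ ℤ.* + toℕ k
          nz : + 4 ℤ.* (+ Ln ℤ.* + Ln) ≢ + 0
          nz e = ℕ.≢-nonZero⁻¹ D (ℤ.+-injective (trans e₁ (cong (ℤ._* y₁) e)))
          steps : ∀ w z → 2 ℕ.* ℤ.∣ z ∣ ℕ.* (2 ℕ.* Θ) ℕ.≤ M → Inv (ω-run w) (+ 0) (b₀ ℤ.* κ w ℤ.* z) (inv (2 ℕ.* Θ))
          steps w z b φ φ≤1 = E-near (mean (avg K)) (λ ι → E-near (mean (avg K)) (λ γ →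
            inv-v-offset (b₀ ℤ.* κ w) M (2 ℕ.* Θ) (h ι γ) z refl b φ φ≤1))
          eqκ : ∀ i′ g′ Y ι′ i g ι → (i′ ℤ.+ (g′ ℤ.+ (Y ℤ.* ι′ ℤ.+ + 1))) ℤ.- (i ℤ.+ (g ℤ.+ (Y ℤ.* ι ℤ.+ + 1))) ≡ ((i′ ℤ.- i) ℤ.+ (g′ ℤ.- g)) ℤ.+ Y ℤ.* (ι′ ℤ.- ι)
          eqκ = solve-∀
          eqr : ∀ i g₂ g₁ y c → ((i ℤ.+ (g₂ ℤ.+ y)) ℤ.- c) ℤ.- ((i ℤ.+ (g₁ ℤ.+ y)) ℤ.- c) ≡ g₂ ℤ.- g₁
          eqr = solve-∀
          K≤m : K ℕ.≤ m
          K≤m = ℕ.≤-trans K≤D (ℕ.≤-trans (ℕ.m≤m*n D (D ℕ.* ℓ₀) {{ℕ.m*n≢0 D ℓ₀}}) (ℕ.≤-reflexive (sym (ℕ.*-assoc D D ℓ₀))))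
          mK≤Yn : 2 ℕ.* (2 ℕ.* m ℕ.+ 2 ℕ.* K) ℕ.≤ Yn
          mK≤Yn = ℕ.≤-trans (ℕ.*-monoʳ-≤ 2 (ℕ.+-monoʳ-≤ (2 ℕ.* m) (ℕ.*-monoʳ-≤ 2 K≤m)))
            (ℕ.≤-trans (ℕ.≤-reflexive (eq₁ m)) (ℕ.≤-trans (ℕ.*-monoˡ-≤ m 8≤D) (ℕ.≤-reflexive (eq₂ D ℓ₀))))
            where
              eq₁ : ∀ m → 2 ℕ.* (2 ℕ.* m ℕ.+ 2 ℕ.* m) ≡ 8 ℕ.* m
              eq₁ = ℕR.solve-∀
              eq₂ : ∀ D ℓ → D ℕ.* (D ℕ.* D ℕ.* ℓ) ≡ D ℕ.* D ℕ.* D ℕ.* ℓ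
              eq₂ = ℕR.solve-∀
          J≤Sn : J ℕ.≤ Sn
          J≤Sn = ℕ.≤-trans (ℕ.m≤m*n J ((ρ ℕ.* ρ) ℕ.* (D4 ℕ.* D)) {{ℕ.m*n≢0 (ρ ℕ.* ρ) (D4 ℕ.* D) {{ℕ.m*n≢0 ρ ρ}} {{ℕ.m*n≢0 D4 D}}}}) (ℕ.≤-reflexive (eq D ρ ℓ₀))
            where
              eq : ∀ D ρ ℓ → (D ℕ.* D) ℕ.* (D ℕ.* D) ℕ.* ℓ ℕ.* ((ρ ℕ.* ρ) ℕ.* ((D ℕ.* D) ℕ.* (D ℕ.* D) ℕ.* D)) ≡ D ℕ.* D ℕ.* D ℕ.* ((ρ ℕ.* ρ) ℕ.* ((D ℕ.* D) ℕ.* (D ℕ.* D) ℕ.* (D ℕ.* D)) ℕ.* ℓ)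
              eq = ℕR.solve-∀
          eqx : ∀ D ℓ ℓ₀ → 2 ℕ.* (D ℕ.* D ℕ.* (ℓ ℕ.* (ℓ₀ ℕ.* (D ℕ.* D ℕ.* D)))) ≡ 2 ℕ.* (D ℕ.* D ℕ.* ℓ) ℕ.* (D ℕ.* D ℕ.* D ℕ.* ℓ₀)
          eqx = ℕR.solve-∀
          eqd₁ : ∀ L p q r y₁ y₂ k → + 4 ℤ.* L ℤ.* L ℤ.* p ℤ.* q ℤ.* r ℤ.* (y₁ ℤ.* y₂ ℤ.* k) ≡ p ℤ.* q ℤ.* ((+ 4 ℤ.* (L ℤ.* L) ℤ.* y₁) ℤ.* (r ℤ.* y₂)) ℤ.* k
          eqd₁ = solve-∀
          eqd₂ : ∀ d c q k → ((d ℤ.* d) ℤ.* (d ℤ.* d) ℤ.* (d ℤ.* d) ℤ.* c) ℤ.* q ℤ.* (d ℤ.* d) ℤ.* k ≡ q ℤ.* ((d ℤ.* d) ℤ.* (d ℤ.* d) ℤ.* ((d ℤ.* d) ℤ.* (d ℤ.* d) ℤ.* c)) ℤ.* k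
          eqd₂ = solve-∀
          disp : b₀ ℤ.* (κ w₂ ℤ.- κ w₁) ℤ.* x ≡ v R₀ k
          disp = trans (cong (λ s → b₀ ℤ.* s ℤ.* x) (eqr (+ toℕ i′) (+ toℕ γ₂) (+ toℕ γ₁) (+ Yn ℤ.* + toℕ ι′ ℤ.+ + 1) (iv (ι , i , γ))))
            (trans (eqd₁ (+ Ln) p q (+ toℕ γ₂ ℤ.- + toℕ γ₁) y₁ y₂ (+ toℕ k))
              (trans (cong (λ r → p ℤ.* q ℤ.* r ℤ.* + toℕ k) (cong₂ ℤ._*_ (sym e₁) (sym e₂))) (eqd₂ dz cz q (+ toℕ k))))

    scales : Scales run
    scales = record
      { Pc = Pc ; Pf = Pf ; P₀ = P₀ ; P₁ = P₁ ; P₂ = P₂ ; Q₀ = Q₀ ; Q₁ = Q₁ ; Q₂ = Q₂ ; R₀ = R₀ ; R₁ = R₁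
      ; offset-small = small-offset
      ; Pc-d = λ j t i → subst (λ r → Inv Pc r (+ 0) e) (sym (d≡ j (tv t) (iv i))) (Pc-p (d/p j (tv t) (iv i)) (d/p≤ j t i))
      ; P₁-δ = λ j t w → subst (λ r → Inv P₁ r (+ 0) e) (sym (δ≡ j (tv t) (κ w))) (P₁-p (δ/p j (tv t) (κ w)) (δ/p≤ j t w))
      ; P₁-e = λ j i → subst (λ r → Inv P₁ r (+ 0) e) (sym (ee≡ j (iv i))) (P₁-p (ee/p j (iv i)) (ee/p≤M j i))
      ; Q₁-δ = λ j t w → Inv-neg Q₁ {+ 0} {δ j (tv t) (κ w) ℤ.* δ j (tv t) (κ w)} (subst (λ r → Inv Q₁ (+ 0) (r ℤ.* r) e) (sym (δ≡ j (tv t) (κ w))) (Q₁-square (δ/p j (tv t) (κ w)) (δ/p≤ j t w)))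
      ; Q₁-d = λ j t i → subst (λ r → Inv Q₁ (+ 0) (r ℤ.* r) e) (sym (d≡ j (tv t) (iv i))) (Q₁-square (d/p j (tv t) (iv i)) (d/p≤ j t i))
      ; Q₁-β = small-β
      ; R₁-ω = small-ω
      ; P₀P₁ = λ i → chain-u (d4 ℤ.* cz) ℓ {{N₁≢0}} (toℕ i) (toℕ≤ i)
      ; P₁P₂ = λ i → chain-u cz N₁ {{N₂≢0}} (toℕ i) (toℕ≤ i)
      ; Q₀Q₁ = λ i → chain-v (d4 ℤ.* cz) ℓ {{ℕ.m*n≢0 N₁ N₁ {{N₁≢0}} {{N₁≢0}}}} (toℕ i) (toℕ≤ i)
      ; Q₁Q₂ = λ i → chain-v cz N₁ {{ℕ.m*n≢0 N₂ N₂ {{N₂≢0}} {{N₂≢0}}}} (toℕ i) (toℕ≤ i)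
      ; R₀R₁ = λ i → chain-R (d4 ℤ.* cz) ℓ {{ℕ.m*n≢0 N₁ N₃ {{N₁≢0}} {{N₃≢0}}}} (toℕ i) (toℕ≤ i)
      ; P₀-line = small-line
      ; Q₀-β = β-fine
      ; Q₀-a² = λ j → quad-fine (a j ℤ.* a j) (a j) (a j) refl (a≢0 j) (a≢0 j) (a≤2K j) (a≤2K j)
      ; R₀-ω = ω-fine
      ; Pf-shifts = small-shifts
      }

    R₁R₂ : Fine R₁ R₂ e
    R₁R₂ i = chain-R cz N₁ {{ℕ.m*n≢0 N₂ N₃ {{N₂≢0}} {{N₃≢0}}}} (toℕ i) (toℕ≤ i)

    -- The term with i is positive since `iv` is at least 1, and the term with t is a natural
    -- number. With d = 0 the corner would degenerate and its absence could not be invoked.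
    d-positive : ∀ j t i → ∃[ k ] (d j (tv t) (iv i) ≡ + suc k)
    d-positive j t i = ℕ.pred n , trans d≡n (cong +_ (sym (ℕ.suc-pred n {{n≢0}})))
      where
        pn qn tn In n : ℕ
        pn = D4 ℕ.* D2 ℕ.* c
        qn = pn ℕ.* (ρ ℕ.* D4)
        tn = toℕ (proj₂ (proj₂ t)) ℕ.+ (toℕ (proj₁ (proj₂ t)) ℕ.+ Sn ℕ.* toℕ (proj₁ t))
        In = toℕ (proj₁ (proj₂ i)) ℕ.+ (toℕ (proj₂ (proj₂ i)) ℕ.+ (Yn ℕ.* toℕ (proj₁ i) ℕ.+ 1))
        n = suc (toℕ j) ℕ.* pn ℕ.* tn ℕ.+ 2 ℕ.* Ln ℕ.* gn j ℕ.* qn ℕ.* In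
        d2≡ : d2 ≡ + D2
        d2≡ = sym (ℤ.pos-* D D)
        d4≡ : d4 ≡ + D4
        d4≡ = trans (cong₂ ℤ._*_ d2≡ d2≡) (sym (ℤ.pos-* D2 D2))
        p≡ : p ≡ + pn
        p≡ = trans (cong (ℤ._* cz) (trans (cong₂ ℤ._*_ d4≡ d2≡) (sym (ℤ.pos-* D4 D2)))) (sym (ℤ.pos-* (D4 ℕ.* D2) c))
        q≡ : q ≡ + qn
        q≡ = trans (cong₂ ℤ._*_ p≡ (trans (cong (ρz ℤ.*_) d4≡) (sym (ℤ.pos-* ρ D4)))) (sym (ℤ.pos-* pn (ρ ℕ.* D4)))
        t≡ : tv t ≡ + tn
        t≡ = trans (cong (λ r → + toℕ (proj₂ (proj₂ t)) ℤ.+ (+ toℕ (proj₁ (proj₂ t)) ℤ.+ r)) (sym (ℤ.pos-* Sn (toℕ (proj₁ t))))) refl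
        I≡ : iv i ≡ + In
        I≡ = cong (λ r → + toℕ (proj₁ (proj₂ i)) ℤ.+ (+ toℕ (proj₂ (proj₂ i)) ℤ.+ (r ℤ.+ + 1))) (sym (ℤ.pos-* Yn (toℕ (proj₁ i))))
        d≡n : d j (tv t) (iv i) ≡ + n
        d≡n = trans (cong₂ ℤ._+_
            (trans (cong₂ ℤ._*_ (trans (cong (+ suc (toℕ j) ℤ.*_) p≡) (sym (ℤ.pos-* (suc (toℕ j)) pn))) t≡) (sym (ℤ.pos-* (suc (toℕ j) ℕ.* pn) tn)))
            (trans (cong₂ ℤ._*_ (trans (cong₂ ℤ._*_ (trans (cong (ℤ._* + gn j) (sym (ℤ.pos-* 2 Ln))) (sym (ℤ.pos-* (2 ℕ.* Ln) (gn j)))) q≡) (sym (ℤ.pos-* (2 ℕ.* Ln ℕ.* gn j) qn))) I≡)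
              (sym (ℤ.pos-* (2 ℕ.* Ln ℕ.* gn j ℕ.* qn) In))))
          (sym (ℤ.pos-+ (suc (toℕ j) ℕ.* pn ℕ.* tn) (2 ℕ.* Ln ℕ.* gn j ℕ.* qn ℕ.* In)))
        g≢0 : NonZero (gn j)
        g≢0 = ℕ.≢-nonZero (λ e → ℕ.≢-nonZero⁻¹ Ln (trans (sym (agn j)) (trans (cong (suc (toℕ j) ℕ.*_) e) (ℕ.*-zeroʳ (suc (toℕ j))))))
        pn≢0 : NonZero pn
        pn≢0 = ℕ.m*n≢0 (D4 ℕ.* D2) c {{ℕ.m*n≢0 D4 D2}}
        In≢0 : NonZero In
        In≢0 = ℕ.>-nonZero (ℕ.≤-trans (ℕ.m≤n+m 1 (Yn ℕ.* toℕ (proj₁ i))) (ℕ.≤-trans (ℕ.m≤n+m _ (toℕ (proj₂ (proj₂ i)))) (ℕ.m≤n+m _ (toℕ (proj₁ (proj₂ i))))))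
        n≢0 : NonZero n
        n≢0 = ℕ.>-nonZero (ℕ.≤-trans (ℕ.>-nonZero⁻¹ _ {{ℕ.m*n≢0 (2 ℕ.* Ln ℕ.* gn j ℕ.* qn) In
            {{ℕ.m*n≢0 (2 ℕ.* Ln ℕ.* gn j) qn {{ℕ.m*n≢0 (2 ℕ.* Ln) (gn j) {{ℕ.m*n≢0 2 Ln}} {{g≢0}}}} {{ℕ.m*n≢0 pn (ρ ℕ.* D4) {{pn≢0}} {{ℕ.m*n≢0 ρ D4}}}}}} {{In≢0}}}})
          (ℕ.m≤n+m _ (suc (toℕ j) ℕ.* pn ℕ.* tn)))

    d-bounded : ∀ j t i → ℤ.∣ d j (tv t) (iv i) ∣ ℕ.≤ D4 ℕ.* D2 ℕ.* c ℕ.* (D ℕ.* M)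
    d-bounded j t i = subst (λ r → ℤ.∣ r ∣ ℕ.≤ D4 ℕ.* D2 ℕ.* c ℕ.* (D ℕ.* M)) (sym (d≡ j (tv t) (iv i)))
      (abs-*≤ p (d/p j (tv t) (iv i)) (abs-*≤ d6 cz (abs-*≤ d4 d2 (ℕ.≤-reflexive ∣d4∣) (ℕ.≤-reflexive ∣d2∣)) ℕ.≤-refl)
        (ℕ.≤-trans (d/p≤ j t i) (ℕ.*-monoˡ-≤ M 11κ₀≤D)))
      where
        11κ₀≤D : 11 ℕ.* κ₀ ℕ.≤ D
        11κ₀≤D = ℕ.≤-trans (k-lin 11 (ℕ.m≤m+n 11 245)) (ℕ.≤-trans (ℕ.m≤n*m (256 ℕ.* κ₀ ℕ.* κ₀) 2) (ℕ.≤-trans (ℕ.m≤m*n _ Θ) D-large))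

    PfPc : Fine Pf Pc e
    PfPc i = subst (λ r → Inv Pc r (+ 0) e) (eq p q′ dz (+ toℕ i)) (Pc-p (dz ℤ.* q′ ℤ.* + toℕ i)
      (ℕ.≤-trans (abs-*≤ (dz ℤ.* q′) (+ toℕ i) (abs-*≤ dz q′ ℕ.≤-refl q′≤) (toℕ≤ i))
        (ℕ.≤-trans (ℕ.m≤m*n _ (D4 ℕ.* D ℕ.* ρ) {{ℕ.m*n≢0 (D4 ℕ.* D) ρ {{ℕ.m*n≢0 D4 D}}}})
          (ℕ.≤-trans (ℕ.≤-reflexive (eq₁ D ρ ℓ₀)) (ℕ.m≤n*m M (11 ℕ.* κ₀) {{ℕ.m*n≢0 11 κ₀}})))))
      where
        eq : ∀ p q d i → p ℤ.* (d ℤ.* q ℤ.* i) ≡ d ℤ.* (p ℤ.* q) ℤ.* i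
        eq = solve-∀
        eq₁ : ∀ D ρ ℓ → D ℕ.* (ρ ℕ.* ((D ℕ.* D) ℕ.* (D ℕ.* D))) ℕ.* ℓ ℕ.* ((D ℕ.* D) ℕ.* (D ℕ.* D) ℕ.* D ℕ.* ρ) ≡
          (D ℕ.* D) ℕ.* (D ℕ.* D) ℕ.* ((ρ ℕ.* ρ) ℕ.* ((D ℕ.* D) ℕ.* (D ℕ.* D) ℕ.* (D ℕ.* D)) ℕ.* ℓ)
        eq₁ = ℕR.solve-∀

    -- Expresses each operator by its step and length alone. Operators built at neighbouring levels
    -- then coincide, scale 2 of one being scale 0 of the next, and energies telescope.
    module Levels (y b y₈ Xₙ X₁ Xf y꜀ : ℕ) (ℓ₀≡ : ℓ₀ ≡ b ℕ.* b) (y≡ : y ≡ ρ ℕ.* (D ℕ.* (D ℕ.* (D ℕ.* b))))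
      (y₈≡ : y₈ ≡ D4 ℕ.* (D4 ℕ.* y)) (Xₙ≡ : Xₙ ≡ D4 ℕ.* (D4 ℕ.* c)) (X₁≡ : X₁ ≡ D4 ℕ.* (D4 ℕ.* D2) ℕ.* ρ ℕ.* c)
      (Xf≡ : Xf ≡ D ℕ.* X₁) (y꜀≡ : y꜀ ≡ w ℕ.* (D4 ℕ.* y)) where

      private
        ℓ≡ : ℓ ≡ y ℕ.* y
        ℓ≡ = trans (cong ((ρ ℕ.* ρ) ℕ.* (D4 ℕ.* D2) ℕ.*_) ℓ₀≡) (trans (eq ρ D b) (sym (cong₂ ℕ._*_ y≡ y≡)))
          where
            eq : ∀ A D b → (A ℕ.* A) ℕ.* ((D ℕ.* D) ℕ.* (D ℕ.* D) ℕ.* (D ℕ.* D)) ℕ.* (b ℕ.* b) ≡ (A ℕ.* (D ℕ.* (D ℕ.* (D ℕ.* b)))) ℕ.* (A ℕ.* (D ℕ.* (D ℕ.* (D ℕ.* b))))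
            eq = ℕR.solve-∀
        up : ∀ d y → d ℕ.* d ℕ.* (y ℕ.* y) ≡ (d ℕ.* y) ℕ.* (d ℕ.* y)
        up = ℕR.solve-∀
        N₁≡ : N₁ ≡ (D4 ℕ.* y) ℕ.* (D4 ℕ.* y)
        N₁≡ = trans (cong (D4 ℕ.* D4 ℕ.*_) ℓ≡) (up D4 y)
        N₂≡ : N₂ ≡ y₈ ℕ.* y₈
        N₂≡ = trans (cong (D4 ℕ.* D4 ℕ.*_) N₁≡) (trans (up D4 (D4 ℕ.* y)) (sym (cong₂ ℕ._*_ y₈≡ y₈≡)))
        Nc≡ : N₁ ℕ.* (w ℕ.* w) ≡ y꜀ ℕ.* y꜀
        Nc≡ = trans (cong (ℕ._* (w ℕ.* w)) N₁≡) (trans (eq (D4 ℕ.* y) w) (sym (cong₂ ℕ._*_ y꜀≡ y꜀≡)))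
          where
            eq : ∀ y w → y ℕ.* y ℕ.* (w ℕ.* w) ≡ (w ℕ.* y) ℕ.* (w ℕ.* y)
            eq = ℕR.solve-∀
        d2≡ : d2 ≡ + D2
        d2≡ = sym (ℤ.pos-* D D)
        d4≡ : d4 ≡ + D4
        d4≡ = trans (cong₂ ℤ._*_ d2≡ d2≡) (sym (ℤ.pos-* D2 D2))
        z0 : d4 ℤ.* (d4 ℤ.* cz) ≡ + Xₙ
        z0 = trans (cong₂ ℤ._*_ d4≡ (trans (cong (ℤ._* cz) d4≡) (sym (ℤ.pos-* D4 c)))) (trans (sym (ℤ.pos-* D4 (D4 ℕ.* c))) (cong +_ (sym Xₙ≡)))
        sq≡ : ∀ {x z} → x ≡ z → x ℕ.* x ≡ z ℕ.* z
        sq≡ e = cong₂ ℕ._*_ e e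

      q≡ : q ≡ + X₁
      q≡ = trans (eqz d2 d4 cz ρz) (trans (cong (λ r → r ℤ.* ρz ℤ.* cz) (cong₂ ℤ._*_ d4≡ (cong₂ ℤ._*_ d4≡ d2≡)))
          (trans (cong (λ r → r ℤ.* ρz ℤ.* cz) (trans (cong (+ D4 ℤ.*_) (sym (ℤ.pos-* D4 D2))) (sym (ℤ.pos-* D4 (D4 ℕ.* D2)))))
            (trans (cong (ℤ._* cz) (sym (ℤ.pos-* (D4 ℕ.* (D4 ℕ.* D2)) ρ))) (trans (sym (ℤ.pos-* (D4 ℕ.* (D4 ℕ.* D2) ℕ.* ρ) c)) (cong +_ (sym X₁≡))))))
        where
          eqz : ∀ d e c r → (e ℤ.* d ℤ.* c) ℤ.* (r ℤ.* e) ≡ e ℤ.* (e ℤ.* d) ℤ.* r ℤ.* c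
          eqz = solve-∀

      P₀≡ : ∀ .(nz : NonZero (y ℕ.* y)) → P₀ ≡ uAvg (+ Xₙ) (y ℕ.* y) {{nz}}
      P₀≡ nz = uAvg-≡ ℓ≢0 nz z0 ℓ≡

      P₂≡ : ∀ .(nz : NonZero (y₈ ℕ.* y₈)) → P₂ ≡ uAvg (+ c) (y₈ ℕ.* y₈) {{nz}}
      P₂≡ nz = uAvg-≡ N₂≢0 nz (refl {x = cz}) N₂≡

      Q₀≡ : ∀ .(nz : NonZero (y ℕ.* y)) → Q₀ ≡ sqAvg Xₙ (y ℕ.* y) {{nz}}
      Q₀≡ nz = vAvg-≡ (ℕ.m*n≢0 ℓ ℓ) (ℕ.m*n≢0 (y ℕ.* y) (y ℕ.* y) {{nz}} {{nz}}) (cong₂ ℤ._*_ z0 z0) (sq≡ ℓ≡)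

      Q₂≡ : ∀ .(nz : NonZero (y₈ ℕ.* y₈)) → Q₂ ≡ sqAvg c (y₈ ℕ.* y₈) {{nz}}
      Q₂≡ nz = vAvg-≡ (ℕ.m*n≢0 N₂ N₂ {{N₂≢0}} {{N₂≢0}}) (ℕ.m*n≢0 (y₈ ℕ.* y₈) (y₈ ℕ.* y₈) {{nz}} {{nz}}) (refl {x = cz ℤ.* cz}) (sq≡ N₂≡)

      R₀≡ : ∀ .(nz : NonZero ((y ℕ.* y) ℕ.* (b ℕ.* b ℕ.* (D ℕ.* D ℕ.* D)))) → R₀ ≡ vAvg (+ X₁ ℤ.* + Xₙ) ((y ℕ.* y) ℕ.* (b ℕ.* b ℕ.* (D ℕ.* D ℕ.* D))) {{nz}}
      R₀≡ nz = vAvg-≡ (ℕ.m*n≢0 ℓ N₃ {{ℓ≢0}} {{N₃≢0}}) nz (cong₂ ℤ._*_ q≡ z0) (cong₂ (λ k r → k ℕ.* (r ℕ.* (D2 ℕ.* D))) ℓ≡ ℓ₀≡)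

      R₂≡ : ∀ .(nz : NonZero ((y₈ ℕ.* y₈) ℕ.* (b ℕ.* b ℕ.* (D ℕ.* D ℕ.* D)))) → R₂ ≡ vAvg (+ X₁ ℤ.* + c) ((y₈ ℕ.* y₈) ℕ.* (b ℕ.* b ℕ.* (D ℕ.* D ℕ.* D))) {{nz}}
      R₂≡ nz = vAvg-≡ (ℕ.m*n≢0 N₂ N₃ {{N₂≢0}} {{N₃≢0}}) nz (cong (ℤ._* cz) q≡) (cong₂ (λ k r → k ℕ.* (r ℕ.* (D2 ℕ.* D))) N₂≡ ℓ₀≡)

      Pf≡ : Pf ≡ uAvg (+ Xf) ℓ₀
      Pf≡ = uAvg-≡ ℓ₀≢0 ℓ₀≢0 (trans (cong (dz ℤ.*_) q≡) (trans (sym (ℤ.pos-* D X₁)) (cong +_ (sym Xf≡)))) (refl {x = ℓ₀})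

      Pc≡ : ∀ .(nz : NonZero (y꜀ ℕ.* y꜀)) → Pc ≡ uAvg (+ cc) (y꜀ ℕ.* y꜀) {{nz}}
      Pc≡ nz = uAvg-≡ Nc≢0 nz (refl {x = + cc}) Nc≡

      d-small : ∀ {a z} → c ℕ.≤ a → D4 ℕ.* (D2 ℕ.* y) ℕ.≤ z → ∀ j t i → ℤ.∣ d j (tv t) (iv i) ∣ ℕ.≤ D ℕ.* (a ℕ.* (z ℕ.* z))
      d-small {a} {z} c≤ y≤ j t i = ℕ.≤-trans (d-bounded j t i) (begin
        D4 ℕ.* D2 ℕ.* c ℕ.* (D ℕ.* (D4 ℕ.* ℓ))
          ≡⟨ cong (λ x → D4 ℕ.* D2 ℕ.* c ℕ.* (D ℕ.* (D4 ℕ.* x))) ℓ≡ ⟩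
        D4 ℕ.* D2 ℕ.* c ℕ.* (D ℕ.* (D4 ℕ.* (y ℕ.* y)))
          ≤⟨ ℕ.m≤m*n _ D2 ⟩
        D4 ℕ.* D2 ℕ.* c ℕ.* (D ℕ.* (D4 ℕ.* (y ℕ.* y))) ℕ.* D2
          ≡⟨ eq D D2 D4 c y ⟩
        D ℕ.* (c ℕ.* ((D4 ℕ.* (D2 ℕ.* y)) ℕ.* (D4 ℕ.* (D2 ℕ.* y))))
          ≤⟨ ℕ.*-monoʳ-≤ D (ℕ.*-mono-≤ c≤ (ℕ.*-mono-≤ y≤ y≤)) ⟩
        D ℕ.* (a ℕ.* (z ℕ.* z)) ∎)
        where
          open ℕ.≤-Reasoning
          eq : ∀ D d e c y → e ℕ.* d ℕ.* c ℕ.* (D ℕ.* (e ℕ.* (y ℕ.* y))) ℕ.* d ≡ D ℕ.* (c ℕ.* ((e ℕ.* (d ℕ.* y)) ℕ.* (e ℕ.* (d ℕ.* y))))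
          eq = ℕR.solve-∀

  -- Energy increments

  pigeonhole : ∀ (T : ℕ → ℚ) S {θ c} → T 0 ≤ c → 0ℚ ≤ T (suc S) → c ≤ ι (suc S) * θ →
    ∃[ s ] (s ℕ.< suc S) × (T s - T (suc s) ≤ θ)
  pigeonhole T S {θ} {c} T₀ Tₛ c≤ with go S
    where
      shift : ∀ a b θ′ n → (a - b) + (b + n * θ′) ≡ a + n * θ′
      shift = solve 4 (λ a b t n → (a :- b) :+ (b :+ n :* t) := a :+ n :* t) refl
      step : ∀ n → θ ≤ T n - T (suc n) → T n + ι n * θ ≤ T 0 → T (suc n) + ι (suc n) * θ ≤ T 0
      step n p q = ℚ.≤-trans (0≤b-a⇒a≤b (≤≡ (a≤b⇒0≤b-a p)
        (solve 4 (λ a b t n → (a :- b) :- t := (a :+ n :* t) :- (b :+ (con 1ℚ :+ n) :* t)) refl (T n) (T (suc n)) θ (ι n)))) q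
      go : ∀ n → (∃[ s ] (s ℕ.< n) × (T s - T (suc s) ≤ θ)) ⊎ (T n + ι n * θ ≤ T 0)
      go zero = inj₂ (ℚ.≤-reflexive (solve 2 (λ a t → a :+ con 0ℚ :* t := a) refl (T 0) θ))
      go (suc n) with go n
      ... | inj₁ (s , p , q) = inj₁ (s , ℕ.m≤n⇒m≤1+n p , q)
      ... | inj₂ p with ℚ.≤-total (T n - T (suc n)) θ
      ...   | inj₁ q = inj₁ (n , ℕ.≤-refl , q)
      ...   | inj₂ q = inj₂ (step n q p)
  ... | inj₁ (s , p , q) = s , ℕ.m≤n⇒m≤1+n p , q
  ... | inj₂ p = S , ℕ.≤-refl , 0≤b-a⇒a≤b (≤≡ (0≤+ (a≤b⇒0≤b-a p) (0≤+ (a≤b⇒0≤b-a T₀) (0≤+ (a≤b⇒0≤b-a c≤) Tₛ)))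
      (solve 6 (λ a b z c t n → (z :- (a :+ n :* t)) :+ ((c :- z) :+ (((con 1ℚ :+ n) :* t :- c) :+ b)) := t :- (a :- b)) refl (T S) (T (suc S)) (T 0) c θ (ι S)))

  ∑-≥0 : ∀ {n} {x : Fin n → ℚ} → (∀ i → 0ℚ ≤ x i) → 0ℚ ≤ ∑ x
  ∑-≥0 {zero} p = ℚ.≤-refl
  ∑-≥0 {suc n} p = 0≤+ (p Fin.zero) (∑-≥0 (λ i → p (Fin.suc i)))

  ∑-member : ∀ {n} (x : Fin n → ℚ) → (∀ i → 0ℚ ≤ x i) → ∀ j → x j ≤ ∑ x
  ∑-member x p Fin.zero = ≡≤ (sym (+-identityʳ _)) (+-monoʳ-≤ (x Fin.zero) (∑-≥0 (λ i → p (Fin.suc i))))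
  ∑-member x p (Fin.suc j) = ℚ.≤-trans (∑-member (λ i → x (Fin.suc i)) (λ i → p (Fin.suc i)) j)
    (≡≤ (sym (+-identityˡ _)) (+-monoˡ-≤ _ (p Fin.zero)))

  ∑-≤ : ∀ {n} (x : Fin n → ℚ) c → (∀ i → x i ≤ c) → ∑ x ≤ ι n * c
  ∑-≤ {n} x c p = ℚ.≤-trans (∑-mono p) (ℚ.≤-reflexive (trans (∑-cong {n} (λ _ → sym (*-identityʳ c))) (trans (∑-* {n} c (λ _ → 1ℚ)) (trans (cong (c *_) (∑-1 n)) (*-comm c (ι n))))))

  ∑-const : ∀ n c → ∑ {n} (λ _ → c) ≡ ι n * c
  ∑-const n c = trans (∑-cong {n} (λ _ → sym (*-identityʳ c))) (trans (∑-* {n} c (λ _ → 1ℚ)) (trans (cong (c *_) (∑-1 n)) (*-comm c (ι n))))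

  -- No term is below -μ, so little can cancel: a small sum bounds each term, at a price of μ per
  -- index.
  ∑-gap : ∀ {n} (x : Fin n → ℚ) {t μ} → (∀ i → 0ℚ ≤ x i + μ) → 0ℚ ≤ μ → ∑ x ≤ t → ∀ j → x j ≤ t + ι n * μ
  ∑-gap {n} x {t} {μ} p 0≤μ s j = begin
    x j ≡⟨ sym (+-identityʳ (x j)) ⟩
    x j + 0ℚ ≤⟨ +-monoʳ-≤ (x j) 0≤μ ⟩
    x j + μ ≤⟨ ∑-member (λ i → x i + μ) p j ⟩
    ∑ (λ i → x i + μ) ≡⟨ trans (∑-+ x (λ _ → μ)) (cong₂ _+_ refl (∑-const n μ)) ⟩
    ∑ x + ι n * μ ≤⟨ +-monoˡ-≤ (ι n * μ) s ⟩
    t + ι n * μ ∎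
    where open ℚ.≤-Reasoning

  -- Opaque: the conversion checker must not unfold the large exponents below.
  opaque
    pow : ℕ → ℕ → ℕ
    pow D k = D ℕ.^ k

    pow-^ : ∀ D k → pow D k ≡ D ℕ.^ k
    pow-^ D k = refl

    pow-+ : ∀ D i j → pow D (i ℕ.+ j) ≡ pow D i ℕ.* pow D j
    pow-+ = ℕ.^-distribˡ-+-*

    pow-suc : ∀ D k → pow D (suc k) ≡ D ℕ.* pow D k
    pow-suc D k = refl

    pow≢0 : ∀ D k .{{_ : NonZero D}} → NonZero (pow D k)
    pow≢0 D k = ℕ.m^n≢0 D k

    pow-mono : ∀ D .{{_ : NonZero D}} {i j} → i ℕ.≤ j → pow D i ℕ.≤ pow D j
    pow-mono D = ℕ.^-monoʳ-≤ D

  pow-4+ : ∀ D k → pow D (4 ℕ.+ k) ≡ (D ℕ.* D) ℕ.* (D ℕ.* D) ℕ.* pow D k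
  pow-4+ D k = trans (pow-suc D (3 ℕ.+ k)) (trans (cong (D ℕ.*_) (trans (pow-suc D (2 ℕ.+ k)) (cong (D ℕ.*_) (trans (pow-suc D (suc k)) (cong (D ℕ.*_) (pow-suc D k)))))) (eq D (pow D k)))
    where
      eq : ∀ D y → D ℕ.* (D ℕ.* (D ℕ.* (D ℕ.* y))) ≡ (D ℕ.* D) ℕ.* (D ℕ.* D) ℕ.* y
      eq = ℕR.solve-∀

  -- The levels inside a window

  module Window (𝒫 : Parameters) (n₀ cl Z : ℕ) (cl≤Z : cl ℕ.≤ Z) where

    open Parameters 𝒫

    -- Level k has step D^(Z - k) and D^(2 k) terms: with growing k the step shrinks while the total
    -- length D^(Z + k) grows. Levels up to Z have integral steps.
    X C : ℕ → ℕ
    X k = pow D (Z ℕ.∸ k)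
    C k = pow D k ℕ.* pow D k

    instance
      X≢0 : ∀ {k} → NonZero (X k)
      X≢0 {k} = pow≢0 D (Z ℕ.∸ k)

    C≢0 : ∀ k → NonZero (C k)
    C≢0 k = ℕ.m*n≢0 (pow D k) (pow D k) {{pow≢0 D k}} {{pow≢0 D k}}

    C₃≢0 : ∀ k → NonZero (C k ℕ.* (C n₀ ℕ.* (D ℕ.* D ℕ.* D)))
    C₃≢0 k = ℕ.m*n≢0 (C k) (C n₀ ℕ.* (D ℕ.* D ℕ.* D)) {{C≢0 k}} {{ℕ.m*n≢0 (C n₀) (D ℕ.* D ℕ.* D) {{C≢0 n₀}} {{ℕ.m*n≢0 (D ℕ.* D) D {{ℕ.m*n≢0 D D}}}}}}

    Pk Qk Rk : ℕ → Op
    Pk k = uAvg (+ X k) (pow D k ℕ.* pow D k) {{C≢0 k}}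
    Qk k = sqAvg (X k) (pow D k ℕ.* pow D k) {{C≢0 k}}
    Rk k = vAvg (+ X (suc n₀) ℤ.* + X k) ((pow D k ℕ.* pow D k) ℕ.* ((pow D n₀ ℕ.* pow D n₀) ℕ.* (D ℕ.* D ℕ.* D))) {{C₃≢0 k}}

    -- The 8 covers two passages by D⁴ from scale 0 to scale 2; the 3 comes from the factor D⁶ in ℓ,
    -- whose root is ρ D³ times the root of ℓ₀.
    nl : ℕ → ℕ
    nl s = 8 ℕ.* s ℕ.+ (3 ℕ.+ n₀)

    private
      X-step : ∀ j k → j ℕ.+ k ℕ.≤ Z → X k ≡ pow D j ℕ.* X (j ℕ.+ k)
      X-step j k p = trans (cong (pow D) e) (pow-+ D j (Z ℕ.∸ (j ℕ.+ k)))
        where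
          e : Z ℕ.∸ k ≡ j ℕ.+ (Z ℕ.∸ (j ℕ.+ k))
          e = trans (cong (ℕ._∸ k) (sym (trans (cong (ℕ._+ k) (ℕ.+-comm j (Z ℕ.∸ (j ℕ.+ k)))) (trans (ℕ.+-assoc (Z ℕ.∸ (j ℕ.+ k)) j k) (ℕ.m∸n+n≡m p))))) (ℕ.m+n∸n≡m (j ℕ.+ (Z ℕ.∸ (j ℕ.+ k))) k)

      pow4 : pow D 4 ≡ (D ℕ.* D) ℕ.* (D ℕ.* D)
      pow4 = trans (pow-^ D 4) (eq D)
        where
          eq : ∀ D → D ℕ.* (D ℕ.* (D ℕ.* (D ℕ.* 1))) ≡ (D ℕ.* D) ℕ.* (D ℕ.* D)
          eq = ℕR.solve-∀

    module Level (s : ℕ) (hs : 8 ℕ.+ nl s ℕ.≤ cl) where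

      n wx : ℕ
      n = nl s
      wx = cl ℕ.∸ (4 ℕ.+ n)

      private
        4+n≤cl : 4 ℕ.+ n ℕ.≤ cl
        4+n≤cl = ℕ.≤-trans (ℕ.m≤n+m (4 ℕ.+ n) 4) hs
        8+n≤Z : 8 ℕ.+ n ℕ.≤ Z
        8+n≤Z = ℕ.≤-trans hs cl≤Z
        X4 : X (4 ℕ.+ n) ≡ (D ℕ.* D) ℕ.* (D ℕ.* D) ℕ.* X (8 ℕ.+ n)
        X4 = trans (X-step 4 (4 ℕ.+ n) 8+n≤Z) (cong (ℕ._* X (8 ℕ.+ n)) pow4)
        X0 : X n ≡ (D ℕ.* D) ℕ.* (D ℕ.* D) ℕ.* ((D ℕ.* D) ℕ.* (D ℕ.* D) ℕ.* X (8 ℕ.+ n))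
        X0 = trans (X-step 4 n (ℕ.≤-trans (ℕ.m≤n+m (4 ℕ.+ n) 4) 8+n≤Z)) (cong₂ ℕ._*_ pow4 X4)

      ccw : (D ℕ.* D) ℕ.* (D ℕ.* D) ℕ.* X (8 ℕ.+ n) ≡ X cl ℕ.* pow D wx
      ccw = trans (sym X4) (trans (cong (pow D) e) (pow-+ D (Z ℕ.∸ cl) wx))
        where
          e : Z ℕ.∸ (4 ℕ.+ n) ≡ (Z ℕ.∸ cl) ℕ.+ wx
          e = trans (cong (ℕ._∸ (4 ℕ.+ n)) (sym (ℕ.m∸n+n≡m cl≤Z))) (ℕ.+-∸-assoc (Z ℕ.∸ cl) 4+n≤cl)

      placement : Placement 𝒫
      placement = record { c = X (8 ℕ.+ n) ; ρ = pow D (8 ℕ.* s) ; ℓ₀ = pow D n₀ ℕ.* pow D n₀ ; w = pow D wx ; cc = X cl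
        ; c≢0 = X≢0 {8 ℕ.+ n} ; ρ≢0 = pow≢0 D (8 ℕ.* s) ; ℓ₀≢0 = C≢0 n₀ ; w≢0 = pow≢0 D wx ; ccw = ccw }

      module B = Build 𝒫 placement

      private
        idx : ∀ s n → 8 ℕ.+ (8 ℕ.* s ℕ.+ (3 ℕ.+ n)) ≡ (10 ℕ.+ 8 ℕ.* s) ℕ.+ suc n
        idx = ℕR.solve-∀
        eqn : ∀ D A → (D ℕ.* (D ℕ.* (D ℕ.* (D ℕ.* (D ℕ.* (D ℕ.* (D ℕ.* (D ℕ.* (D ℕ.* (D ℕ.* 1)))))))))) ℕ.* A ≡ (D ℕ.* D) ℕ.* (D ℕ.* D) ℕ.* ((D ℕ.* D) ℕ.* (D ℕ.* D) ℕ.* (D ℕ.* D)) ℕ.* A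
        eqn = ℕR.solve-∀
        pow-3+ : pow D (3 ℕ.+ n₀) ≡ D ℕ.* (D ℕ.* (D ℕ.* pow D n₀))
        pow-3+ = trans (pow-suc D (2 ℕ.+ n₀)) (cong (D ℕ.*_) (trans (pow-suc D (suc n₀)) (cong (D ℕ.*_) (pow-suc D n₀))))
        X1 : X n₀ ≡ D ℕ.* X (suc n₀)
        X1 = trans (X-step 1 n₀ (ℕ.≤-trans (ℕ.≤-trans (ℕ.s≤s (ℕ.≤-trans (ℕ.m≤n+m n₀ 3) (ℕ.m≤n+m (3 ℕ.+ n₀) (8 ℕ.* s)))) (ℕ.m≤n+m (suc n) 7)) 8+n≤Z))
          (cong (ℕ._* X (suc n₀)) (trans (pow-^ D 1) (ℕ.*-identityʳ D)))
        main : X (suc n₀) ≡ (D ℕ.* D) ℕ.* (D ℕ.* D) ℕ.* ((D ℕ.* D) ℕ.* (D ℕ.* D) ℕ.* (D ℕ.* D)) ℕ.* pow D (8 ℕ.* s) ℕ.* X (8 ℕ.+ n)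
        main = trans (X-step (10 ℕ.+ 8 ℕ.* s) (suc n₀) (subst (ℕ._≤ Z) (idx s n₀) 8+n≤Z))
          (cong₂ ℕ._*_ (trans (pow-+ D 10 (8 ℕ.* s)) (trans (cong (ℕ._* pow D (8 ℕ.* s)) (pow-^ D 10)) (eqn D (pow D (8 ℕ.* s))))) (cong X (sym (idx s n₀))))
        cl≡ : pow D cl ≡ pow D wx ℕ.* ((D ℕ.* D) ℕ.* (D ℕ.* D) ℕ.* pow D n)
        cl≡ = trans (cong (pow D) (sym (ℕ.m∸n+n≡m 4+n≤cl))) (trans (pow-+ D wx (4 ℕ.+ n)) (cong (pow D wx ℕ.*_) (pow-4+ D n)))

      private
        module L = B.Levels (pow D n) (pow D n₀) (pow D (8 ℕ.+ n)) (X n) (X (suc n₀)) (X n₀) (pow D cl) refl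
          (trans (pow-+ D (8 ℕ.* s) (3 ℕ.+ n₀)) (cong (pow D (8 ℕ.* s) ℕ.*_) pow-3+)) (trans (pow-4+ D (4 ℕ.+ n)) (cong ((D ℕ.* D) ℕ.* (D ℕ.* D) ℕ.*_) (pow-4+ D n))) X0 main X1 cl≡

      -- ρ = D^(8 s) compensates the shrinking of c, so that q does not depend on s. As Pc is fixed
      -- too, the product of f₁ with its shifts is the same function at all levels of the window,
      -- and its energies can be compared.
      q≡ : Run.q B.run ≡ + X (suc n₀)
      q≡ = L.q≡

      P₀≡ : B.P₀ ≡ Pk n
      P₀≡ = L.P₀≡ (C≢0 n)

      P₂≡ : B.P₂ ≡ Pk (8 ℕ.+ n)
      P₂≡ = L.P₂≡ (C≢0 (8 ℕ.+ n))

      Q₀≡ : B.Q₀ ≡ Qk n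
      Q₀≡ = L.Q₀≡ (C≢0 n)

      Q₂≡ : B.Q₂ ≡ Qk (8 ℕ.+ n)
      Q₂≡ = L.Q₂≡ (C≢0 (8 ℕ.+ n))

      R₀≡ : B.R₀ ≡ Rk n
      R₀≡ = L.R₀≡ (C₃≢0 n)

      R₂≡ : B.R₂ ≡ Rk (8 ℕ.+ n)
      R₂≡ = L.R₂≡ (C₃≢0 (8 ℕ.+ n))

      Pf≡ : B.Pf ≡ Pk n₀
      Pf≡ = L.Pf≡

      Pc≡ : B.Pc ≡ Pk cl
      Pc≡ = L.Pc≡ (C≢0 cl)

      d-small : ∀ j t i → ℤ.∣ Run.d B.run j (Run.tv B.run t) (Run.iv B.run i) ∣ ℕ.≤ D ℕ.* (pow D Z ℕ.* (pow D Z ℕ.* pow D Z))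
      d-small = L.d-small (pow-mono D (ℕ.m∸n≤m Z (8 ℕ.+ n)))
        (ℕ.≤-trans (ℕ.≤-reflexive (sym (trans (pow-4+ D (2 ℕ.+ n)) (cong ((D ℕ.* D) ℕ.* (D ℕ.* D) ℕ.*_) (trans (pow-suc D (suc n)) (trans (cong (D ℕ.*_) (pow-suc D n)) (sym (ℕ.*-assoc D D (pow D n))))))))) (pow-mono D (ℕ.≤-trans (ℕ.m≤n+m (6 ℕ.+ n) 2) 8+n≤Z)))

  -- The index space and the product function again, but in terms of data shared by all levels of a
  -- window instead of a single run.
  module Energy (𝒮 : System) (f : System.X 𝒮 → ℚ) (uf : Ops.Unit 𝒮 f) (K m : ℕ) .{{K≢0 : NonZero K}} .{{m≢0 : NonZero m}}
    (Y : ℤ) (Ln : ℕ) (gn : Fin K → ℕ) where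
    open OpsLemmas 𝒮

    IxI : Set
    IxI = Fin K × (Fin m × Fin K)

    Iμ : FMean IxI
    Iμ = avg K ⊠ (avg m ⊠ avg K)

    iv : IxI → ℤ
    iv (ι , i , γ) = + toℕ i ℤ.+ (+ toℕ γ ℤ.+ (Y ℤ.* + toℕ ι ℤ.+ + 1))

    κ : IxI × IxI → ℤ
    κ w = iv (proj₂ w) ℤ.- iv (proj₁ w)

    module P = OpsLemmas ((mean Iμ ⊗ mean Iμ) ⋉ 𝒮)

    residual : Op → X → ℚ
    residual A x = f x - ⟦ sq A ⟧ f x

    product : Op → ℤ → Fin K → P.X → ℚ
    product A q j z = residual A (proj₂ z) * residual A (act (+ 2 ℤ.* + Ln ℤ.* + gn j ℤ.* q ℤ.* κ (proj₁ z)) (+ 0) (proj₂ z))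

    -- Four energies must be flat at one and the same level, so their sum is fed to the pigeonhole.
    cost : Op → ℤ → Op → Op → Op → Fin K → ℚ
    cost A q Q R P j = ((N (⟦ Q ⟧ f) + N (⟦ R ⟧ f)) + P.N (P.⟦ Q ⟧ (product A q j))) + P.N (P.⟦ Q ⟧ (P.⟦ P ⟧ (product A q j)))

    bresidual : ∀ A → Bd (residual A)
    bresidual A x = unit-diff (proj₁ (uf x)) (proj₂ (uf x)) (proj₁ (uA x)) (proj₂ (uA x))
      where uA = Unit-⟦⟧ (sq A) uf

    bproduct : ∀ A q j → P.Bd (product A q j)
    bproduct A q j z = ∣*∣≤ (bresidual A _) (bresidual A _)

    cost≥0 : ∀ A q Q R P j → 0ℚ ≤ cost A q Q R P j
    cost≥0 A q Q R P j = 0≤+ (0≤+ (0≤+ (0≤N (⟦ Q ⟧ f)) (0≤N (⟦ R ⟧ f))) (P.0≤N (P.⟦ Q ⟧ (product A q j)))) (P.0≤N (P.⟦ Q ⟧ (P.⟦ P ⟧ (product A q j))))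

    cost≤4 : ∀ A q Q R P j → cost A q Q R P j ≤ ι 4
    cost≤4 A q Q R P j = ≤≡ (+-mono-≤ (+-mono-≤ (+-mono-≤ (Bd-N (Bd-⟦⟧ Q bf)) (Bd-N (Bd-⟦⟧ R bf))) (P.Bd-N (P.Bd-⟦⟧ Q (bproduct A q j)))) (P.Bd-N (P.Bd-⟦⟧ Q (P.Bd-⟦⟧ P (bproduct A q j)))))
      (solve 0 (((con 1ℚ :+ con 1ℚ) :+ con 1ℚ) :+ con 1ℚ := con 1ℚ :+ (con 1ℚ :+ (con 1ℚ :+ (con 1ℚ :+ con 0ℚ)))) refl)
      where bf = Unit⇒Bd uf

  -- θ₀ and θ₁ bound the energy drops found by the outer and the inner pigeonhole; θ, s and the s i are
  -- the thresholds of the successive applications of the Cauchy–Schwarz inequality.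
  record Numbers (K Θ : ℕ) : Set where
    e : ℚ
    e = inv Θ
    ee : ℚ
    ee = e + e
    ten : ℚ
    ten = (((ee + ee) + (ee + ee)) + ((ee + ee) + (ee + ee))) + (ee + ee)
    field
      θ θ₀ θ₁ s s₂ s₃ s₄ s₅ : ℚ
      0<s : 0ℚ < s
      0<s₂ : 0ℚ < s₂
      0<s₃ : 0ℚ < s₃
      0<s₄ : 0ℚ < s₄
      0<s₅ : 0ℚ < s₅
      s₂≤1 : s₂ ≤ 1ℚ
      c₁ : inv K + ((θ + (ee + ee)) + ee) ≤ (s₂ * s₂) * (s₂ * s₂)
      c₂ : inv K + s₂ ≤ s₃ * s₃
      c₃ : inv K + s₃ ≤ s₄ * s₄
      c₄ : θ + ι 16 * e ≤ s₃ * s₃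
      c₅ : (inv K + s₂) + ee ≤ s₅ * s₅
      c₆ : (θ₁ + ι K * ten) + ten ≤ θ
      c₇ : ((s₄ + s₄) + (s₄ + s₄)) + ((((((θ₀ + (ee + ee)) + ee) + e) + s₅)) + ee) + e ≤ s * s

  module BuildCount (𝒮 : System) (f : System.X 𝒮 → ℚ) (uf : Ops.Unit 𝒮 f) (𝒫 : Parameters) (𝒬 : Placement 𝒫) where

    open Parameters 𝒫
    open Placement 𝒬 using (ℓ₀; ℓ₀≢0)
    open Build 𝒫 𝒬
    open OpsLemmas 𝒮
    open Run run using (q; d; tv; iv; e)
    open Scales scales using (P₀P₁; P₁P₂; Q₀Q₁; Q₁Q₂; R₀R₁; Pf-shifts)

    private
      instance
        m≢0′ : NonZero (D ℕ.* D ℕ.* ℓ₀)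
        m≢0′ = ℕ.m*n≢0 (D ℕ.* D) ℓ₀ {{ℕ.m*n≢0 D D}}

    module 𝓔 = Energy 𝒮 f uf K (D ℕ.* D ℕ.* ℓ₀) (+ (D ℕ.* D ℕ.* D ℕ.* ℓ₀)) Ln gn
    module P = 𝓔.P

    private
      bf : Bd f
      bf = Unit⇒Bd uf
      F : Fin K → P.X → ℚ
      F = 𝓔.product Pc q
      bF : ∀ j → P.Bd (F j)
      bF = 𝓔.bproduct Pc q
      ee = e + e

      module _ (j : Fin K) where
        q₀ q₁ q₂ r₀ r₁ r₂ f₀ f₁ f₂ g₀ g₂ : ℚ
        q₀ = N (⟦ Q₀ ⟧ f)
        q₁ = N (⟦ Q₁ ⟧ f)
        q₂ = N (⟦ Q₂ ⟧ f)
        r₀ = N (⟦ R₀ ⟧ f)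
        r₁ = N (⟦ R₁ ⟧ f)
        r₂ = N (⟦ R₂ ⟧ f)
        f₀ = P.N (P.⟦ Q₀ ⟧ (F j))
        f₁ = P.N (P.⟦ Q₁ ⟧ (F j))
        f₂ = P.N (P.⟦ Q₂ ⟧ (F j))
        g₀ = P.N (P.⟦ Q₀ ⟧ (P.⟦ P₀ ⟧ (F j)))
        g₂ = P.N (P.⟦ Q₂ ⟧ (P.⟦ P₂ ⟧ (F j)))

        g-mono : g₂ ≤ (((g₀ + ee) + ee) + ee) + ee
        g-mono = begin
          g₂
            ≤⟨ P.N-fine Q₁ Q₂ Q₁Q₂ (P.Bd-⟦⟧ P₂ (bF j)) ⟩
          P.N (P.⟦ Q₁ ⟧ (P.⟦ P₂ ⟧ (F j))) + ee
            ≤⟨ +-monoˡ-≤ ee (P.N-fine Q₀ Q₁ Q₀Q₁ (P.Bd-⟦⟧ P₂ (bF j))) ⟩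
          (P.N (P.⟦ Q₀ ⟧ (P.⟦ P₂ ⟧ (F j))) + ee) + ee
            ≡⟨ cong (λ r → (r + ee) + ee) (P.N-cong (P.⟦⟧-comm Q₀ P₂ (F j))) ⟩
          (P.N (P.⟦ P₂ ⟧ (P.⟦ Q₀ ⟧ (F j))) + ee) + ee
            ≤⟨ +-monoˡ-≤ ee (+-monoˡ-≤ ee (P.N-fine P₁ P₂ P₁P₂ (P.Bd-⟦⟧ Q₀ (bF j)))) ⟩
          ((P.N (P.⟦ P₁ ⟧ (P.⟦ Q₀ ⟧ (F j))) + ee) + ee) + ee
            ≤⟨ +-monoˡ-≤ ee (+-monoˡ-≤ ee (+-monoˡ-≤ ee (P.N-fine P₀ P₁ P₀P₁ (P.Bd-⟦⟧ Q₀ (bF j))))) ⟩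
          (((P.N (P.⟦ P₀ ⟧ (P.⟦ Q₀ ⟧ (F j))) + ee) + ee) + ee) + ee
            ≡⟨ cong (λ r → (((r + ee) + ee) + ee) + ee) (P.N-cong (P.⟦⟧-comm P₀ Q₀ (F j))) ⟩
          (((g₀ + ee) + ee) + ee) + ee ∎
          where open ℚ.≤-Reasoning

        q₁₂ : 0ℚ ≤ (q₁ + ee) - q₂
        q₁₂ = a≤b⇒0≤b-a (N-fine Q₁ Q₂ Q₁Q₂ bf)
        q₀₁ : 0ℚ ≤ (q₀ + ee) - q₁
        q₀₁ = a≤b⇒0≤b-a (N-fine Q₀ Q₁ Q₀Q₁ bf)
        r₁₂ : 0ℚ ≤ (r₁ + ee) - r₂
        r₁₂ = a≤b⇒0≤b-a (N-fine R₁ R₂ R₁R₂ bf)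
        r₀₁ : 0ℚ ≤ (r₀ + ee) - r₁
        r₀₁ = a≤b⇒0≤b-a (N-fine R₀ R₁ R₀R₁ bf)
        f₁₂ : 0ℚ ≤ (f₁ + ee) - f₂
        f₁₂ = a≤b⇒0≤b-a (P.N-fine Q₁ Q₂ Q₁Q₂ (bF j))
        f₀₁ : 0ℚ ≤ (f₀ + ee) - f₁
        f₀₁ = a≤b⇒0≤b-a (P.N-fine Q₀ Q₁ Q₀Q₁ (bF j))
        g₀₂ : 0ℚ ≤ ((((g₀ + ee) + ee) + ee) + ee) - g₂
        g₀₂ = a≤b⇒0≤b-a g-mono
        0≤ee : 0ℚ ≤ ee
        0≤ee = 0≤+ (0≤inv Θ) (0≤inv Θ)

    -- From scale 0 to scale 2 each of the first three energies takes two applications of `N-fine`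
    -- and the last one four, at `ee` each.
    ten : ℚ
    ten = (((ee + ee) + (ee + ee)) + ((ee + ee) + (ee + ee))) + (ee + ee)

    cost-mono : ∀ j → 0ℚ ≤ (𝓔.cost Pc q Q₀ R₀ P₀ j - 𝓔.cost Pc q Q₂ R₂ P₂ j) + ten
    cost-mono j = ≤≡ (0≤+ (0≤+ (0≤+ (q₁₂ j) (q₀₁ j)) (0≤+ (r₁₂ j) (r₀₁ j))) (0≤+ (0≤+ (f₁₂ j) (f₀₁ j)) (g₀₂ j)))
      (solve 12 (λ q₀ q₁ q₂ r₀ r₁ r₂ f₀ f₁ f₂ g₀ g₂ e →
        ((((q₁ :+ e) :- q₂) :+ ((q₀ :+ e) :- q₁)) :+ (((r₁ :+ e) :- r₂) :+ ((r₀ :+ e) :- r₁))) :+ ((((f₁ :+ e) :- f₂) :+ ((f₀ :+ e) :- f₁)) :+ (((((g₀ :+ e) :+ e) :+ e) :+ e) :- g₂))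
        := ((((q₀ :+ r₀) :+ f₀) :+ g₀) :- (((q₂ :+ r₂) :+ f₂) :+ g₂)) :+ ((((e :+ e) :+ (e :+ e)) :+ ((e :+ e) :+ (e :+ e))) :+ (e :+ e)))
        refl (q₀ j) (q₁ j) (q₂ j) (r₀ j) (r₁ j) (r₂ j) (f₀ j) (f₁ j) (f₂ j) (g₀ j) (g₂ j) ee)

    module _ {γ : ℚ} (gap : ∀ j → 𝓔.cost Pc q Q₀ R₀ P₀ j - 𝓔.cost Pc q Q₂ R₂ P₂ j ≤ γ) where

      private
        slack : ∀ j → 0ℚ ≤ γ - (𝓔.cost Pc q Q₀ R₀ P₀ j - 𝓔.cost Pc q Q₂ R₂ P₂ j)
        slack j = a≤b⇒0≤b-a (gap j)

      -- The other energies, and that of Q from scale 1 to 2, cannot rise by more than their slack,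
      -- so the total drop dominates this one. The final `ee` only pads the error to `ten`.
      gap-Q : ∀ j → N (⟦ Q₀ ⟧ f) - N (⟦ Q₁ ⟧ f) ≤ γ + ten
      gap-Q j = 0≤b-a⇒a≤b (≤≡ (0≤+ (slack j) (0≤+ (q₁₂ j) (0≤+ (0≤+ (r₁₂ j) (r₀₁ j)) (0≤+ (0≤+ (f₁₂ j) (f₀₁ j)) (0≤+ (g₀₂ j) (0≤ee j))))))
        (solve 13 (λ q₀ q₁ q₂ r₀ r₁ r₂ f₀ f₁ f₂ g₀ g₂ e γ →
          (γ :- ((((q₀ :+ r₀) :+ f₀) :+ g₀) :- (((q₂ :+ r₂) :+ f₂) :+ g₂))) :+ (((q₁ :+ e) :- q₂) :+ ((((r₁ :+ e) :- r₂) :+ ((r₀ :+ e) :- r₁)) :+ ((((f₁ :+ e) :- f₂) :+ ((f₀ :+ e) :- f₁)) :+ ((((((g₀ :+ e) :+ e) :+ e) :+ e) :- g₂) :+ e))))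
          := (γ :+ ((((e :+ e) :+ (e :+ e)) :+ ((e :+ e) :+ (e :+ e))) :+ (e :+ e))) :- (q₀ :- q₁))
          refl (q₀ j) (q₁ j) (q₂ j) (r₀ j) (r₁ j) (r₂ j) (f₀ j) (f₁ j) (f₂ j) (g₀ j) (g₂ j) ee γ))

      gap-R : ∀ j → N (⟦ R₀ ⟧ f) - N (⟦ R₁ ⟧ f) ≤ γ + ten
      gap-R j = 0≤b-a⇒a≤b (≤≡ (0≤+ (slack j) (0≤+ (r₁₂ j) (0≤+ (0≤+ (q₁₂ j) (q₀₁ j)) (0≤+ (0≤+ (f₁₂ j) (f₀₁ j)) (0≤+ (g₀₂ j) (0≤ee j))))))
        (solve 13 (λ q₀ q₁ q₂ r₀ r₁ r₂ f₀ f₁ f₂ g₀ g₂ e γ →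
          (γ :- ((((q₀ :+ r₀) :+ f₀) :+ g₀) :- (((q₂ :+ r₂) :+ f₂) :+ g₂))) :+ (((r₁ :+ e) :- r₂) :+ ((((q₁ :+ e) :- q₂) :+ ((q₀ :+ e) :- q₁)) :+ ((((f₁ :+ e) :- f₂) :+ ((f₀ :+ e) :- f₁)) :+ ((((((g₀ :+ e) :+ e) :+ e) :+ e) :- g₂) :+ e))))
          := (γ :+ ((((e :+ e) :+ (e :+ e)) :+ ((e :+ e) :+ (e :+ e))) :+ (e :+ e))) :- (r₀ :- r₁))
          refl (q₀ j) (q₁ j) (q₂ j) (r₀ j) (r₁ j) (r₂ j) (f₀ j) (f₁ j) (f₂ j) (g₀ j) (g₂ j) ee γ))

      gap-F : ∀ j → P.N (P.⟦ Q₀ ⟧ (F j)) - P.N (P.⟦ Q₁ ⟧ (F j)) ≤ γ + ten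
      gap-F j = 0≤b-a⇒a≤b (≤≡ (0≤+ (slack j) (0≤+ (f₁₂ j) (0≤+ (0≤+ (r₁₂ j) (r₀₁ j)) (0≤+ (0≤+ (q₁₂ j) (q₀₁ j)) (0≤+ (g₀₂ j) (0≤ee j))))))
        (solve 13 (λ q₀ q₁ q₂ r₀ r₁ r₂ f₀ f₁ f₂ g₀ g₂ e γ →
          (γ :- ((((q₀ :+ r₀) :+ f₀) :+ g₀) :- (((q₂ :+ r₂) :+ f₂) :+ g₂))) :+ (((f₁ :+ e) :- f₂) :+ ((((r₁ :+ e) :- r₂) :+ ((r₀ :+ e) :- r₁)) :+ ((((q₁ :+ e) :- q₂) :+ ((q₀ :+ e) :- q₁)) :+ ((((((g₀ :+ e) :+ e) :+ e) :+ e) :- g₂) :+ e))))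
          := (γ :+ ((((e :+ e) :+ (e :+ e)) :+ ((e :+ e) :+ (e :+ e))) :+ (e :+ e))) :- (f₀ :- f₁))
          refl (q₀ j) (q₁ j) (q₂ j) (r₀ j) (r₁ j) (r₂ j) (f₀ j) (f₁ j) (f₂ j) (g₀ j) (g₂ j) ee γ))

      gap-PF : ∀ j → P.N (P.⟦ Q₀ ⟧ (P.⟦ P₀ ⟧ (F j))) - P.N (P.⟦ Q₂ ⟧ (P.⟦ P₂ ⟧ (F j))) ≤ γ + ten
      gap-PF j = 0≤b-a⇒a≤b (≤≡ (0≤+ (slack j) (0≤+ (0≤+ (f₁₂ j) (f₀₁ j)) (0≤+ (0≤+ (r₁₂ j) (r₀₁ j)) (0≤+ (0≤+ (q₁₂ j) (q₀₁ j)) (0≤+ (0≤+ (0≤ee j) (0≤ee j)) (0≤+ (0≤ee j) (0≤ee j)))))))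
        (solve 13 (λ q₀ q₁ q₂ r₀ r₁ r₂ f₀ f₁ f₂ g₀ g₂ e γ →
          (γ :- ((((q₀ :+ r₀) :+ f₀) :+ g₀) :- (((q₂ :+ r₂) :+ f₂) :+ g₂))) :+ ((((f₁ :+ e) :- f₂) :+ ((f₀ :+ e) :- f₁)) :+ ((((r₁ :+ e) :- r₂) :+ ((r₀ :+ e) :- r₁)) :+ ((((q₁ :+ e) :- q₂) :+ ((q₀ :+ e) :- q₁)) :+ ((e :+ e) :+ (e :+ e)))))
          := (γ :+ ((((e :+ e) :+ (e :+ e)) :+ ((e :+ e) :+ (e :+ e))) :+ (e :+ e))) :- (g₀ :- g₂))
          refl (q₀ j) (q₁ j) (q₂ j) (r₀ j) (r₁ j) (r₂ j) (f₀ j) (f₁ j) (f₂ j) (g₀ j) (g₂ j) ee γ))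

      count : (𝒸 : Constants scales) → γ + ten ≤ Constants.θ 𝒸 → Fin K →
        ∀ {θ₀ η s} → N (⟦ Pf ⟧ f) - N (⟦ Pc ⟧ f) ≤ θ₀ → 0ℚ < η → 0ℚ < s →
        (∀ j t i x → f x * (f (act (d j (tv t) (iv i)) (+ 0) x) * f (act (+ 0) (d j (tv t) (iv i) ℤ.* d j (tv t) (iv i)) x)) ≤ 0ℚ) →
        (((Constants.s₄ 𝒸 + Constants.s₄ 𝒸) + (Constants.s₄ 𝒸 + Constants.s₄ 𝒸)) + ((((((θ₀ + (ee + ee)) + ee) + e) + Constants.s₅ 𝒸)) + ee)) + e ≤ s * s →
        (η * η) * (E 𝔼 f - (η + η)) ≤ (s + e) + Constants.s₅ 𝒸
      count 𝒸 γ≤ j₀ {θ₀} outer 0<η 0<s free bound = corner-count (ℚ.≤-trans (gap-Q j₀) γ≤) free 0<η 0<s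
          (ℚ.≤-trans (gap-R j₀) γ≤) (λ j → ℚ.≤-trans (gap-F j) γ≤) (λ j → ℚ.≤-trans (gap-PF j) γ≤)
          (λ j → ℚ.≤-trans (N-fine Pf (Run.shifts run j) (Pf-shifts j) bf₁) (+-monoˡ-≤ ee (ℚ.≤-trans (N-residual Pf Pc PfPc bf) (+-monoˡ-≤ (ee + ee) outer))))
          bound
        where open Contradiction 𝒮 scales 𝒸 f uf using (corner-count; bf₁)

    module _ (𝓃 : Numbers K Θ) where
      open Numbers 𝓃 hiding (e; ee; ten)

      private
        consts : Constants scales
        consts = record { θ = θ ; s₂ = s₂ ; s₃ = s₃ ; s₄ = s₄ ; s₅ = s₅ ; 0<s₂ = 0<s₂ ; 0<s₃ = 0<s₃ ; 0<s₄ = 0<s₄ ; 0<s₅ = 0<s₅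
          ; s₂≤1 = s₂≤1 ; c₁ = c₁ ; c₂ = c₂ ; c₃ = c₃ ; c₄ = c₄ ; c₅ = c₅ }
        j₀ : Fin K
        j₀ = Fin.fromℕ< (ℕ.>-nonZero⁻¹ K)
        nonzero : ∀ j t i → d j (tv t) (iv i) ≢ + 0
        nonzero j t i e with d-positive j t i
        ... | k , e′ with trans (sym e) e′
        ...   | ()
        0≤ten : 0ℚ ≤ ten
        0≤ten = 0≤+ (0≤+ (0≤+ 0≤4e 0≤4e) (0≤+ 0≤4e 0≤4e)) 0≤4e
          where
            0≤2e : 0ℚ ≤ ee
            0≤2e = 0≤+ (0≤inv Θ) (0≤inv Θ)
            0≤4e : 0ℚ ≤ ee + ee
            0≤4e = 0≤+ 0≤2e 0≤2e

      level-count : ∑ (λ j → 𝓔.cost Pc q Q₀ R₀ P₀ j - 𝓔.cost Pc q Q₂ R₂ P₂ j) ≤ θ₁ →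
        N (⟦ Pf ⟧ f) - N (⟦ Pc ⟧ f) ≤ θ₀ → ∀ bound → (∀ j t i → ℤ.∣ d j (tv t) (iv i) ∣ ℕ.≤ bound) →
        (∀ z → z ≢ + 0 → ℤ.∣ z ∣ ℕ.≤ bound → ∀ x → f x * (f (act z (+ 0) x) * f (act (+ 0) (z ℤ.* z) x)) ≤ 0ℚ) →
        ∀ {η} → 0ℚ < η → (η * η) * (E 𝔼 f - (η + η)) ≤ (s + inv Θ) + s₅
      level-count total outer bound d≤ free 0<η =
        count (∑-gap (λ j → 𝓔.cost Pc q Q₀ R₀ P₀ j - 𝓔.cost Pc q Q₂ R₂ P₂ j) cost-mono 0≤ten total) consts c₆ j₀ outer 0<η 0<s
          (λ j t i x → free (d j (tv t) (iv i)) (nonzero j t i) (d≤ j t i) x) c₇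

  ∑-- : ∀ {k} (x y : Fin k → ℚ) → ∑ (λ i → x i - y i) ≡ ∑ x - ∑ y
  ∑-- {zero} x y = sym (+-inverseʳ 0ℚ)
  ∑-- {suc k} x y = trans (cong₂ _+_ refl (∑-- (λ i → x (Fin.suc i)) (λ i → y (Fin.suc i))))
    (solve 4 (λ a b c d → (a :- b) :+ (c :- d) := (a :+ c) :- (b :+ d)) refl (x Fin.zero) (y Fin.zero) (∑ (λ i → x (Fin.suc i))) (∑ (λ i → y (Fin.suc i))))

  cong₅ : ∀ {ℓ₁ ℓ₂ ℓ₃ ℓ₄ ℓ₅ ℓ₆} {A : Set ℓ₁} {B : Set ℓ₂} {C : Set ℓ₃} {D : Set ℓ₄} {E′ : Set ℓ₅} {Z : Set ℓ₆} (f : A → B → C → D → E′ → Z)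
    {a a′ b b′ c c′ d d′ e e′} → a ≡ a′ → b ≡ b′ → c ≡ c′ → d ≡ d′ → e ≡ e′ → f a b c d e ≡ f a′ b′ c′ d′ e′
  cong₅ f refl refl refl refl refl = refl

  module WindowCount (𝒮 : System) (f : System.X 𝒮 → ℚ) (uf : Ops.Unit 𝒮 f)
    (𝒫 : Parameters) (n₀ cl Z : ℕ) (cl≤Z : cl ℕ.≤ Z) where

    open Parameters 𝒫
    open Window 𝒫 n₀ cl Z cl≤Z
    open OpsLemmas 𝒮 hiding (X)

    private
      ℓ₀ : ℕ
      ℓ₀ = pow D n₀ ℕ.* pow D n₀
      instance
        m≢0 : NonZero (D ℕ.* D ℕ.* (pow D n₀ ℕ.* pow D n₀))
        m≢0 = ℕ.m*n≢0 (D ℕ.* D) (pow D n₀ ℕ.* pow D n₀) {{ℕ.m*n≢0 D D}} {{C≢0 n₀}}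

    module 𝓖 = Energy 𝒮 f uf K (D ℕ.* D ℕ.* (pow D n₀ ℕ.* pow D n₀)) (+ (D ℕ.* D ℕ.* D ℕ.* (pow D n₀ ℕ.* pow D n₀))) Ln gn

    price : ℕ → Fin K → ℚ
    price k j = 𝓖.cost (Pk cl) (+ X (suc n₀)) (Qk k) (Rk k) (Pk k) j

    module At (s : ℕ) (hs : 8 ℕ.+ nl s ℕ.≤ cl) where
      open Level s hs

      module BC = BuildCount 𝒮 f uf 𝒫 placement

      price₀ : ∀ j → BC.𝓔.cost B.Pc (Run.q B.run) B.Q₀ B.R₀ B.P₀ j ≡ price n j
      price₀ j = cong₅ (λ A q Q R P → 𝓖.cost A q Q R P j) Pc≡ q≡ Q₀≡ R₀≡ P₀≡

      price₂ : ∀ j → BC.𝓔.cost B.Pc (Run.q B.run) B.Q₂ B.R₂ B.P₂ j ≡ price (8 ℕ.+ n) j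
      price₂ j = cong₅ (λ A q Q R P → 𝓖.cost A q Q R P j) Pc≡ q≡ Q₂≡ R₂≡ P₂≡

      outer≡ : N (⟦ B.Pf ⟧ f) - N (⟦ B.Pc ⟧ f) ≡ N (⟦ Pk n₀ ⟧ f) - N (⟦ Pk cl ⟧ f)
      outer≡ = cong₂ (λ A B → N (⟦ A ⟧ f) - N (⟦ B ⟧ f)) Pf≡ Pc≡

      price-drop : ∀ {γ} → ∑ (price n) - ∑ (price (8 ℕ.+ n)) ≤ γ →
        ∑ (λ j → BC.𝓔.cost B.Pc (Run.q B.run) B.Q₀ B.R₀ B.P₀ j - BC.𝓔.cost B.Pc (Run.q B.run) B.Q₂ B.R₂ B.P₂ j) ≤ γ
      price-drop gap = ≡≤ (trans (∑-cong (λ j → cong₂ _-_ (price₀ j) (price₂ j))) (∑-- (price n) (price (8 ℕ.+ n)))) gap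

      at-count : (𝓃 : Numbers K Θ) → ∑ (price n) - ∑ (price (8 ℕ.+ n)) ≤ Numbers.θ₁ 𝓃 →
        N (⟦ Pk n₀ ⟧ f) - N (⟦ Pk cl ⟧ f) ≤ Numbers.θ₀ 𝓃 →
        (∀ z → z ≢ + 0 → ℤ.∣ z ∣ ℕ.≤ D ℕ.* (pow D Z ℕ.* (pow D Z ℕ.* pow D Z)) → ∀ x → f x * (f (act z (+ 0) x) * f (act (+ 0) (z ℤ.* z) x)) ≤ 0ℚ) →
        ∀ {η} → 0ℚ < η → (η * η) * (E 𝔼 f - (η + η)) ≤ (Numbers.s 𝓃 + inv Θ) + Numbers.s₅ 𝓃
      at-count 𝓃 gap outer free 0<η = BC.level-count 𝓃 (price-drop gap) (≡≤ outer≡ outer)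
        (D ℕ.* (pow D Z ℕ.* (pow D Z ℕ.* pow D Z))) d-small free 0<η

    private
      nl-suc : ∀ s → nl (suc s) ≡ 8 ℕ.+ nl s
      nl-suc s = idx s n₀
        where
          idx : ∀ s n → 8 ℕ.* suc s ℕ.+ (3 ℕ.+ n) ≡ 8 ℕ.+ (8 ℕ.* s ℕ.+ (3 ℕ.+ n))
          idx = ℕR.solve-∀

    -- The pigeonhole runs over the sum in j because the gap is needed for all j at one level; this
    -- sum starts at 4 K or less.
    window-count : (𝓃 : Numbers K Θ) → ∀ S → (∀ s → s ℕ.< suc S → 8 ℕ.+ nl s ℕ.≤ cl) → ι K * ι 4 ≤ ι (suc S) * Numbers.θ₁ 𝓃 →
      N (⟦ Pk n₀ ⟧ f) - N (⟦ Pk cl ⟧ f) ≤ Numbers.θ₀ 𝓃 →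
      (∀ z → z ≢ + 0 → ℤ.∣ z ∣ ℕ.≤ D ℕ.* (pow D Z ℕ.* (pow D Z ℕ.* pow D Z)) → ∀ x → f x * (f (act z (+ 0) x) * f (act (+ 0) (z ℤ.* z) x)) ≤ 0ℚ) →
      ∀ {η} → 0ℚ < η → (η * η) * (E 𝔼 f - (η + η)) ≤ (Numbers.s 𝓃 + inv Θ) + Numbers.s₅ 𝓃
    window-count 𝓃 S hS many outer free {η} 0<η = finish (pigeonhole (λ s → ∑ (price (nl s))) S {θ₁} {ι K * ι 4}
        (∑-≤ (price (nl 0)) (ι 4) (λ j → 𝓖.cost≤4 (Pk cl) (+ X (suc n₀)) (Qk (nl 0)) (Rk (nl 0)) (Pk (nl 0)) j))
        (∑-≥0 (λ j → 𝓖.cost≥0 (Pk cl) (+ X (suc n₀)) (Qk (nl (suc S))) (Rk (nl (suc S))) (Pk (nl (suc S))) j))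
        many)
      where
        open Numbers 𝓃
        finish : ∃[ s′ ] (s′ ℕ.< suc S) × (∑ (price (nl s′)) - ∑ (price (nl (suc s′))) ≤ θ₁) →
          (η * η) * (E 𝔼 f - (η + η)) ≤ (s + inv Θ) + s₅
        finish (s′ , s′< , gap) = At.at-count s′ (hS s′ s′<) 𝓃
          (subst (λ k → ∑ (price (nl s′)) - ∑ (price k) ≤ θ₁) (nl-suc s′) gap) outer free 0<η

  -- Numerical thresholds

  module _ (n₁ n₂ n₃ n₄ n₅ B Θ : ℕ) {{n₁≢0 : NonZero n₁}} {{n₂≢0 : NonZero n₂}} {{n₃≢0 : NonZero n₃}} {{n₄≢0 : NonZero n₄}}
    {{n₅≢0 : NonZero n₅}} {{B≢0 : NonZero B}} {{Θ≢0 : NonZero Θ}}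
    (n₅≡ : n₅ ≡ 4 ℕ.* (n₁ ℕ.* n₁)) (n₄≡ : n₄ ≡ 16 ℕ.* (n₁ ℕ.* n₁)) (n₃≡ : n₃ ≡ 2 ℕ.* (n₄ ℕ.* n₄)) (n₂≡ : n₂ ≡ 2 ℕ.* (n₃ ℕ.* n₃))
    (B≡ : B ≡ 32 ℕ.* ((n₂ ℕ.* n₂) ℕ.* (n₂ ℕ.* n₂))) (Θ≡ : Θ ≡ 80 ℕ.* (B ℕ.* B)) where

    private
      sq-≤ : ∀ n .{{_ : NonZero n}} → n ℕ.≤ n ℕ.* n
      sq-≤ n = ℕ.m≤m*n n n

      instance
        2B≢0 : NonZero (2 ℕ.* B)
        2B≢0 = ℕ.m*n≢0 2 B
        n₁²≢0 : NonZero (n₁ ℕ.* n₁)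
        n₁²≢0 = ℕ.m*n≢0 n₁ n₁
        n₂²≢0 : NonZero (n₂ ℕ.* n₂)
        n₂²≢0 = ℕ.m*n≢0 n₂ n₂
        n₂⁴≢0 : NonZero ((n₂ ℕ.* n₂) ℕ.* (n₂ ℕ.* n₂))
        n₂⁴≢0 = ℕ.m*n≢0 (n₂ ℕ.* n₂) (n₂ ℕ.* n₂)
        n₃²≢0 : NonZero (n₃ ℕ.* n₃)
        n₃²≢0 = ℕ.m*n≢0 n₃ n₃
        n₄²≢0 : NonZero (n₄ ℕ.* n₄)
        n₄²≢0 = ℕ.m*n≢0 n₄ n₄
        n₅²≢0 : NonZero (n₅ ℕ.* n₅)
        n₅²≢0 = ℕ.m*n≢0 n₅ n₅
        2n₄²≢0 : NonZero (2 ℕ.* (n₄ ℕ.* n₄))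
        2n₄²≢0 = ℕ.m*n≢0 2 (n₄ ℕ.* n₄)
        2n₃²≢0 : NonZero (2 ℕ.* (n₃ ℕ.* n₃))
        2n₃²≢0 = ℕ.m*n≢0 2 (n₃ ℕ.* n₃)

      n₁²≤n₅ : n₁ ℕ.* n₁ ℕ.≤ n₅
      n₁²≤n₅ = subst (n₁ ℕ.* n₁ ℕ.≤_) (sym n₅≡) (ℕ.m≤n*m (n₁ ℕ.* n₁) 4)
      n₅≤n₄ : n₅ ℕ.≤ n₄
      n₅≤n₄ = subst₂ ℕ._≤_ (sym n₅≡) (sym n₄≡) (ℕ.*-monoˡ-≤ (n₁ ℕ.* n₁) (ℕ.m≤m+n 4 12))
      n₄²≤n₃ : n₄ ℕ.* n₄ ℕ.≤ n₃
      n₄²≤n₃ = subst (n₄ ℕ.* n₄ ℕ.≤_) (sym n₃≡) (ℕ.m≤n*m (n₄ ℕ.* n₄) 2)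
      n₃²≤n₂ : n₃ ℕ.* n₃ ℕ.≤ n₂
      n₃²≤n₂ = subst (n₃ ℕ.* n₃ ℕ.≤_) (sym n₂≡) (ℕ.m≤n*m (n₃ ℕ.* n₃) 2)
      n₅²≤n₃ : n₅ ℕ.* n₅ ℕ.≤ n₃
      n₅²≤n₃ = ℕ.≤-trans (ℕ.*-mono-≤ n₅≤n₄ n₅≤n₄) n₄²≤n₃
      n₃≤n₂ : n₃ ℕ.≤ n₂
      n₃≤n₂ = ℕ.≤-trans (sq-≤ n₃) n₃²≤n₂
      n₂≤n₂⁴ : n₂ ℕ.≤ (n₂ ℕ.* n₂) ℕ.* (n₂ ℕ.* n₂)
      n₂≤n₂⁴ = ℕ.≤-trans (sq-≤ n₂) (sq-≤ (n₂ ℕ.* n₂))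
      32n₂≤B : 32 ℕ.* n₂ ℕ.≤ B
      32n₂≤B = subst (32 ℕ.* n₂ ℕ.≤_) (sym B≡) (ℕ.*-monoʳ-≤ 32 n₂≤n₂⁴)
      n₂≤B : n₂ ℕ.≤ B
      n₂≤B = ℕ.≤-trans (ℕ.m≤n*m n₂ 32) 32n₂≤B
      n₁≤n₂ : n₁ ℕ.≤ n₂
      n₁≤n₂ = ℕ.≤-trans (sq-≤ n₁) (ℕ.≤-trans n₁²≤n₅ (ℕ.≤-trans (sq-≤ n₅) (ℕ.≤-trans n₅²≤n₃ n₃≤n₂)))
      B≤Θ : B ℕ.≤ Θ
      B≤Θ = subst (B ℕ.≤_) (sym Θ≡) (ℕ.≤-trans (sq-≤ B) (ℕ.m≤n*m (B ℕ.* B) 80))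

      e t : ℚ
      e = inv Θ
      t = inv B
      e≤t : e ≤ t
      e≤t = inv-anti Θ B B≤Θ

      two : ∀ x → x + x ≡ ι 2 * x
      two = solve 1 (λ x → x :+ x := (con 1ℚ :+ (con 1ℚ :+ con 0ℚ)) :* x) refl

      2≤n₃ : 2 ℕ.≤ n₃
      2≤n₃ = subst (2 ℕ.≤_) (sym n₃≡) (ℕ.m≤m*n 2 (n₄ ℕ.* n₄))

    -- The choices run backwards from n₁: 3 / n₅ ≤ 1 / n₁² and 4 / n₄ = 1 / n₅ settle c₇, then n₃ =
    -- 2 n₄² and n₂ = 2 n₃² settle c₃ and c₂, and B = 32 n₂⁴ makes 1 / B negligible in c₁ and c₄. Θ
    -- = 80 B² pays for the B + 1 copies of `ten` in c₆.
    numbers : Numbers B Θ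
    numbers = record
      { θ = t ; θ₀ = t ; θ₁ = inv (2 ℕ.* B) ; s = inv n₁ ; s₂ = inv n₂ ; s₃ = inv n₃ ; s₄ = inv n₄ ; s₅ = inv n₅
      ; 0<s = 0<inv n₁ ; 0<s₂ = 0<inv n₂ ; 0<s₃ = 0<inv n₃ ; 0<s₄ = 0<inv n₄ ; 0<s₅ = 0<inv n₅
      ; s₂≤1 = ≤≡ (inv-anti n₂ 1 (ℕ.>-nonZero⁻¹ n₂)) inv1
      ; c₁ = c₁ ; c₂ = c₂ ; c₃ = c₃ ; c₄ = c₄ ; c₅ = c₅ ; c₆ = c₆ ; c₇ = c₇ }
      where
        inv1 : inv 1 ≡ 1ℚ
        inv1 = trans (solve 1 (λ x → x := (con 1ℚ :+ con 0ℚ) :* x) refl (inv 1)) (ι*inv 1)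
        c₁ : t + ((t + ((e + e) + (e + e))) + (e + e)) ≤ (inv n₂ * inv n₂) * (inv n₂ * inv n₂)
        c₁ = begin
          t + ((t + ((e + e) + (e + e))) + (e + e))
            ≤⟨ +-monoʳ-≤ t (+-mono-≤ (+-monoʳ-≤ t (+-mono-≤ (+-mono-≤ e≤t e≤t) (+-mono-≤ e≤t e≤t))) (+-mono-≤ e≤t e≤t)) ⟩
          t + ((t + ((t + t) + (t + t))) + (t + t))
            ≡⟨ solve 1 (λ t → t :+ ((t :+ ((t :+ t) :+ (t :+ t))) :+ (t :+ t)) := (con 1ℚ :+ (con 1ℚ :+ (con 1ℚ :+ (con 1ℚ :+ (con 1ℚ :+ (con 1ℚ :+ (con 1ℚ :+ (con 1ℚ :+ con 0ℚ)))))))) :* t) refl t ⟩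
          ι 8 * t
            ≤⟨ ι*inv≤inv 8 B ((n₂ ℕ.* n₂) ℕ.* (n₂ ℕ.* n₂)) (subst (8 ℕ.* ((n₂ ℕ.* n₂) ℕ.* (n₂ ℕ.* n₂)) ℕ.≤_) (sym B≡) (ℕ.*-monoˡ-≤ ((n₂ ℕ.* n₂) ℕ.* (n₂ ℕ.* n₂)) (ℕ.m≤m+n 8 24))) ⟩
          inv ((n₂ ℕ.* n₂) ℕ.* (n₂ ℕ.* n₂))
            ≡⟨ trans (inv-* (n₂ ℕ.* n₂) (n₂ ℕ.* n₂)) (cong₂ _*_ (inv-* n₂ n₂) (inv-* n₂ n₂)) ⟩
          (inv n₂ * inv n₂) * (inv n₂ * inv n₂) ∎
          where open ℚ.≤-Reasoning
        halves : ∀ n m .{{_ : NonZero n}} .{{_ : NonZero m}} .{{_ : NonZero (n ℕ.* n)}} .{{_ : NonZero (2 ℕ.* (n ℕ.* n))}} → m ≡ 2 ℕ.* (n ℕ.* n) → m ℕ.≤ B → t + inv m ≤ inv n * inv n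
        halves n m refl p = ℚ.≤-trans (+-monoˡ-≤ (inv m) (inv-anti B m p)) (ℚ.≤-reflexive (trans (inv-halves (n ℕ.* n)) (inv-* n n)))
        c₂ : t + inv n₂ ≤ inv n₃ * inv n₃
        c₂ = halves n₃ n₂ n₂≡ n₂≤B
        c₃ : t + inv n₃ ≤ inv n₄ * inv n₄
        c₃ = halves n₄ n₃ n₃≡ (ℕ.≤-trans n₃≤n₂ n₂≤B)
        c₄ : t + ι 16 * e ≤ inv n₃ * inv n₃
        c₄ = begin
          t + ι 16 * e ≤⟨ +-monoʳ-≤ t (*-monoˡ (0≤ι 16) e≤t) ⟩
          t + ι 16 * t ≡⟨ solve 2 (λ t n → t :+ n :* t := (con 1ℚ :+ n) :* t) refl t (ι 16) ⟩
          ι 17 * t ≤⟨ ι*inv≤inv 17 B (n₃ ℕ.* n₃) (ℕ.≤-trans (ℕ.*-monoʳ-≤ 17 n₃²≤n₂) (ℕ.≤-trans (ℕ.*-monoˡ-≤ n₂ (ℕ.m≤m+n 17 15)) 32n₂≤B)) ⟩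
          inv (n₃ ℕ.* n₃) ≡⟨ inv-* n₃ n₃ ⟩
          inv n₃ * inv n₃ ∎
          where open ℚ.≤-Reasoning
        c₅ : (t + inv n₂) + (e + e) ≤ inv n₅ * inv n₅
        c₅ = begin
          (t + inv n₂) + (e + e) ≤⟨ +-mono-≤ (+-monoˡ-≤ (inv n₂) t≤) (+-mono-≤ (ℚ.≤-trans e≤t t≤) (ℚ.≤-trans e≤t t≤)) ⟩
          (inv n₂ + inv n₂) + (inv n₂ + inv n₂) ≡⟨ solve 1 (λ t → (t :+ t) :+ (t :+ t) := (con 1ℚ :+ (con 1ℚ :+ (con 1ℚ :+ (con 1ℚ :+ con 0ℚ)))) :* t) refl (inv n₂) ⟩
          ι 4 * inv n₂ ≤⟨ ι*inv≤inv 4 n₂ (n₅ ℕ.* n₅) (ℕ.≤-trans (ℕ.*-monoʳ-≤ 4 n₅²≤n₃) (subst (4 ℕ.* n₃ ℕ.≤_) (sym n₂≡) (ℕ.≤-trans (ℕ.≤-reflexive (ℕ.*-assoc 2 2 n₃)) (ℕ.*-monoʳ-≤ 2 (ℕ.*-monoˡ-≤ n₃ 2≤n₃))))) ⟩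
          inv (n₅ ℕ.* n₅) ≡⟨ inv-* n₅ n₅ ⟩
          inv n₅ * inv n₅ ∎
          where
            open ℚ.≤-Reasoning
            t≤ : t ≤ inv n₂
            t≤ = inv-anti B n₂ n₂≤B
        c₆ : (inv (2 ℕ.* B) + ι B * ((((e + e) + (e + e)) + ((e + e) + (e + e))) + (((e + e) + (e + e)) + ((e + e) + (e + e))) + ((e + e) + (e + e)))) + ((((e + e) + (e + e)) + ((e + e) + (e + e))) + (((e + e) + (e + e)) + ((e + e) + (e + e))) + ((e + e) + (e + e))) ≤ t
        c₆ = begin
          (inv (2 ℕ.* B) + ι B * ((((e + e) + (e + e)) + ((e + e) + (e + e))) + (((e + e) + (e + e)) + ((e + e) + (e + e))) + ((e + e) + (e + e)))) + ((((e + e) + (e + e)) + ((e + e) + (e + e))) + (((e + e) + (e + e)) + ((e + e) + (e + e))) + ((e + e) + (e + e)))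
            ≡⟨ solve 3 (λ x b e → let y = (((e :+ e) :+ (e :+ e)) :+ ((e :+ e) :+ (e :+ e))) :+ (((e :+ e) :+ (e :+ e)) :+ ((e :+ e) :+ (e :+ e))) :+ ((e :+ e) :+ (e :+ e)) ; two = con 1ℚ :+ (con 1ℚ :+ con 0ℚ) in
                 (x :+ b :* y) :+ y := x :+ ((con 1ℚ :+ (con 1ℚ :+ (con 1ℚ :+ (con 1ℚ :+ (con 1ℚ :+ con 0ℚ))))) :* (two :* two) :* (con 1ℚ :+ b)) :* e) refl (inv (2 ℕ.* B)) (ι B) e ⟩
          inv (2 ℕ.* B) + (ι 5 * (ι 2 * ι 2) * ι (suc B)) * e
            ≡⟨ cong (λ r → inv (2 ℕ.* B) + r * e) (sym (trans (ι-* (5 ℕ.* 4) (suc B)) (cong (_* ι (suc B)) (trans (ι-* 5 4) (cong (ι 5 *_) (ι-* 2 2)))))) ⟩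
          inv (2 ℕ.* B) + ι (5 ℕ.* 4 ℕ.* suc B) * e
            ≤⟨ +-monoʳ-≤ (inv (2 ℕ.* B)) (ι*inv≤inv (5 ℕ.* 4 ℕ.* suc B) Θ (2 ℕ.* B) (subst (5 ℕ.* 4 ℕ.* suc B ℕ.* (2 ℕ.* B) ℕ.≤_) (sym Θ≡)
                 (ℕ.≤-trans (ℕ.*-monoˡ-≤ (2 ℕ.* B) (ℕ.*-monoʳ-≤ 20 {suc B} {B ℕ.+ B} (ℕ.+-monoˡ-≤ B (ℕ.>-nonZero⁻¹ B)))) (ℕ.≤-reflexive (eq B))))) ⟩
          inv (2 ℕ.* B) + inv (2 ℕ.* B)
            ≡⟨ inv-halves B ⟩
          t ∎
          where
            open ℚ.≤-Reasoning
            eq : ∀ B → 20 ℕ.* (B ℕ.+ B) ℕ.* (2 ℕ.* B) ≡ 80 ℕ.* (B ℕ.* B)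
            eq = ℕR.solve-∀
        c₇ : ((inv n₄ + inv n₄) + (inv n₄ + inv n₄)) + (((((t + ((e + e) + (e + e))) + (e + e)) + e) + inv n₅) + (e + e)) + e ≤ inv n₁ * inv n₁
        c₇ = begin
          ((inv n₄ + inv n₄) + (inv n₄ + inv n₄)) + (((((t + ((e + e) + (e + e))) + (e + e)) + e) + inv n₅) + (e + e)) + e
            ≡⟨ solve 4 (λ a t e b → ((a :+ a) :+ (a :+ a)) :+ (((((t :+ ((e :+ e) :+ (e :+ e))) :+ (e :+ e)) :+ e) :+ b) :+ (e :+ e)) :+ e
                 := (con 1ℚ :+ (con 1ℚ :+ (con 1ℚ :+ (con 1ℚ :+ con 0ℚ)))) :* a :+ ((t :+ (con 1ℚ :+ (con 1ℚ :+ (con 1ℚ :+ (con 1ℚ :+ (con 1ℚ :+ (con 1ℚ :+ (con 1ℚ :+ (con 1ℚ :+ (con 1ℚ :+ (con 1ℚ :+ con 0ℚ)))))))))) :* e) :+ b)) refl (inv n₄) t e (inv n₅) ⟩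
          ι 4 * inv n₄ + ((t + ι 10 * e) + inv n₅)
            ≤⟨ +-mono-≤ (ι*inv≤inv 4 n₄ n₅ (ℕ.≤-reflexive (trans (cong (4 ℕ.*_) n₅≡) (trans (sym (ℕ.*-assoc 4 4 (n₁ ℕ.* n₁))) (sym n₄≡)))))
                 (+-monoˡ-≤ (inv n₅) (ℚ.≤-trans (+-monoʳ-≤ t (*-monoˡ (0≤ι 10) e≤t)) (≡≤ (solve 2 (λ t n → t :+ n :* t := (con 1ℚ :+ n) :* t) refl t (ι 10))
                   (ι*inv≤inv 11 B n₅ (ℕ.≤-trans (ℕ.*-mono-≤ {11} {32} (ℕ.m≤m+n 11 21) (ℕ.≤-trans (sq-≤ n₅) (ℕ.≤-trans n₅²≤n₃ n₃≤n₂))) 32n₂≤B))))) ⟩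
          inv n₅ + (inv n₅ + inv n₅)
            ≡⟨ solve 1 (λ t → t :+ (t :+ t) := (con 1ℚ :+ (con 1ℚ :+ (con 1ℚ :+ con 0ℚ))) :* t) refl (inv n₅) ⟩
          ι 3 * inv n₅
            ≤⟨ ι*inv≤inv 3 n₅ (n₁ ℕ.* n₁) (subst (3 ℕ.* (n₁ ℕ.* n₁) ℕ.≤_) (sym n₅≡) (ℕ.*-monoˡ-≤ (n₁ ℕ.* n₁) (ℕ.m≤m+n 3 1))) ⟩
          inv (n₁ ℕ.* n₁)
            ≡⟨ inv-* n₁ n₁ ⟩
          inv n₁ * inv n₁ ∎
          where open ℚ.≤-Reasoning

    error≤ : (inv n₁ + inv Θ) + inv n₅ ≤ ι 3 * inv n₁
    error≤ = ℚ.≤-trans (+-mono-≤ (+-monoʳ-≤ (inv n₁) (inv-anti Θ n₁ (ℕ.≤-trans n₁≤n₂ (ℕ.≤-trans n₂≤B B≤Θ)))) (inv-anti n₅ n₁ (ℕ.≤-trans (sq-≤ n₁) n₁²≤n₅)))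
      (ℚ.≤-reflexive (solve 1 (λ t → (t :+ t) :+ t := (con 1ℚ :+ (con 1ℚ :+ (con 1ℚ :+ con 0ℚ))) :* t) refl (inv n₁)))

  -- The two nested pigeonholes

  module SystemTheorem (𝒮 : System) (f : System.X 𝒮 → ℚ) (uf : Ops.Unit 𝒮 f) (𝒫 : Parameters)
    (𝓃 : Numbers (Parameters.K 𝒫) (Parameters.Θ 𝒫)) (S W Z : ℕ) (W≡ : W ≡ 8 ℕ.* suc S ℕ.+ 3) (Z≡ : Z ≡ W ℕ.* Parameters.K 𝒫) where

    open OpsLemmas 𝒮
    open Parameters 𝒫 using (K; Θ; D; K≢0; D≢0)
    open Numbers 𝓃 using (θ₀; θ₁; s; s₅)

    private
      level : ℕ → Op
      level k = uAvg (+ pow D (Z ℕ.∸ k)) (pow D k ℕ.* pow D k) {{ℕ.m*n≢0 (pow D k) (pow D k) {{pow≢0 D k}} {{pow≢0 D k}}}}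

      energy : ℕ → ℚ
      energy i = N (⟦ level (W ℕ.* i) ⟧ f)

      -- The energy of f at the ends of K consecutive windows stays between 0 and 1. The window is
      -- found from f alone, before f₁ is formed.
      flat-window : 1ℚ ≤ ι K * θ₀ → ∃[ i ] (i ℕ.< K) × (energy i - energy (suc i) ≤ θ₀)
      flat-window 1≤ = subst (λ b → ∃[ i ] (i ℕ.< b) × (energy i - energy (suc i) ≤ θ₀)) (ℕ.suc-pred K)
        (pigeonhole energy (ℕ.pred K) {θ₀} {1ℚ} (Bd-N (Bd-⟦⟧ (level (W ℕ.* 0)) (Unit⇒Bd uf))) (0≤N (⟦ level (W ℕ.* suc (ℕ.pred K)) ⟧ f))
          (subst (λ b → 1ℚ ≤ ι b * θ₀) (sym (ℕ.suc-pred K)) 1≤))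

    -- The count in the chosen window gives η² (E f - 2 η) ≤ η² · 2 η, and η² is cancelled.
    density-bound : ι K * ι 4 ≤ ι (suc S) * θ₁ → 1ℚ ≤ ι K * θ₀ → ∀ {η} → 0ℚ < η → (s + inv Θ) + s₅ ≤ (η * η) * (η + η) →
      (∀ z → z ≢ + 0 → ℤ.∣ z ∣ ℕ.≤ D ℕ.* (pow D Z ℕ.* (pow D Z ℕ.* pow D Z)) →
        ∀ x → f x * (f (act z (+ 0) x) * f (act (+ 0) (z ℤ.* z) x)) ≤ 0ℚ) →
      E 𝔼 f ≤ (η + η) + (η + η)
    density-bound many enough {η} 0<η error free = 0≤b-a⇒a≤b (≤≡ (a≤b⇒0≤b-a (*-cancelˡ (0<* 0<η 0<η) (ℚ.≤-trans (main (flat-window enough)) error)))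
        (solve 2 (λ x η → (η :+ η) :- (x :- (η :+ η)) := ((η :+ η) :+ (η :+ η)) :- x) refl (E 𝔼 f) η))
      where
        window : ∀ i → i ℕ.< K → energy i - energy (suc i) ≤ θ₀ → (η * η) * (E 𝔼 f - (η + η)) ≤ (s + inv Θ) + s₅
        window i i<K gap = WindowCount.window-count 𝒮 f uf 𝒫 (W ℕ.* i) (W ℕ.* suc i) Z cl≤Z 𝓃 S fits many gap free 0<η
          where
            cl≤Z : W ℕ.* suc i ℕ.≤ Z
            cl≤Z = subst (W ℕ.* suc i ℕ.≤_) (sym Z≡) (ℕ.*-monoʳ-≤ W i<K)
            eq : ∀ s n → 8 ℕ.+ (8 ℕ.* s ℕ.+ (3 ℕ.+ n)) ≡ (8 ℕ.* suc s ℕ.+ 3) ℕ.+ n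
            eq = ℕR.solve-∀
            fits : ∀ s → s ℕ.< suc S → 8 ℕ.+ (8 ℕ.* s ℕ.+ (3 ℕ.+ W ℕ.* i)) ℕ.≤ W ℕ.* suc i
            fits s s< = ℕ.≤-trans (ℕ.≤-reflexive (eq s (W ℕ.* i))) (ℕ.≤-trans (ℕ.+-monoˡ-≤ (W ℕ.* i) (ℕ.+-monoˡ-≤ 3 (ℕ.*-monoʳ-≤ 8 s<)))
              (ℕ.≤-reflexive (trans (cong (ℕ._+ W ℕ.* i) (sym W≡)) (sym (ℕ.*-suc W i)))))

        main : (∃[ i ] (i ℕ.< K) × (energy i - energy (suc i) ≤ θ₀)) → (η * η) * (E 𝔼 f - (η + η)) ≤ (s + inv Θ) + s₅
        main (i , i<K , gap) = window i i<K gap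

  -- Sets of grid points as functions on a torus

  module Torus (n : ℕ) {{n≢0 : NonZero n}} where

    private
      small-multiple : ∀ t (r r′ : ℕ) → r ℕ.< n → r′ ℕ.< n → + r ℤ.- + r′ ≡ t ℤ.* + n → r ≡ r′
      small-multiple t r r′ r< r′< eq = ℤ.+-injective (ℤ.i-j≡0⇒i≡j (+ r) (+ r′) (trans eq (trans (cong (ℤ._* + n) t≡0) refl)))
        where
          bound : ℤ.∣ t ∣ ℕ.* n ℕ.< 1 ℕ.* n
          bound = ℕ.≤-<-trans (ℕ.≤-reflexive (trans (sym (ℤ.abs-* t (+ n))) (trans (cong ℤ.∣_∣ (trans (sym eq) (ℤ.[+m]-[+n]≡m⊖n r r′))) refl)))
            (ℕ.≤-<-trans (ℤ.∣m⊝n∣≤m⊔n r r′) (ℕ.<-≤-trans (ℕ.⊔-lub r< r′<) (ℕ.≤-reflexive (sym (ℕ.*-identityˡ n)))))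
          t≡0 : t ≡ + 0
          t≡0 = ℤ.∣i∣≡0⇒i≡0 (ℕ.n≤0⇒n≡0 (ℕ.≤-pred (ℕ.*-cancelʳ-< n ℤ.∣ t ∣ 1 bound)))

    md : ℤ → Fin n
    md z = Fin.fromℕ< (ℤ.n%ℕd<d z n)

    toℕ-md : ∀ z → toℕ (md z) ≡ z ℤ.%ℕ n
    toℕ-md z = toℕ-fromℕ< (ℤ.n%ℕd<d z n)

    md-cong : ∀ z z′ t → z ℤ.- z′ ≡ t ℤ.* + n → md z ≡ md z′
    md-cong z z′ t eq = toℕ-injective (trans (toℕ-md z) (trans
      (small-multiple (t ℤ.- (z ℤ./ℕ n) ℤ.+ (z′ ℤ./ℕ n)) (z ℤ.%ℕ n) (z′ ℤ.%ℕ n) (ℤ.n%ℕd<d z n) (ℤ.n%ℕd<d z′ n)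
        (trans (cong₂ ℤ._-_ (rem z) (rem z′)) (trans (arr z z′ (z ℤ./ℕ n) (z′ ℤ./ℕ n) (+ n)) (trans (cong (ℤ._+ ((z′ ℤ./ℕ n) ℤ.- (z ℤ./ℕ n)) ℤ.* + n) eq) (arr₂ t (z ℤ./ℕ n) (z′ ℤ./ℕ n) (+ n))))))
      (sym (toℕ-md z′))))
      where
        rem : ∀ z → + (z ℤ.%ℕ n) ≡ z ℤ.- (z ℤ./ℕ n) ℤ.* + n
        rem z = trans (arr₀ (+ (z ℤ.%ℕ n)) ((z ℤ./ℕ n) ℤ.* + n)) (cong (ℤ._- (z ℤ./ℕ n) ℤ.* + n) (sym (ℤ.a≡a%ℕn+[a/ℕn]*n z n)))
          where
            arr₀ : ∀ r m → r ≡ (r ℤ.+ m) ℤ.- m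
            arr₀ = solve-∀
        arr : ∀ z z′ q q′ n → (z ℤ.- q ℤ.* n) ℤ.- (z′ ℤ.- q′ ℤ.* n) ≡ (z ℤ.- z′) ℤ.+ (q′ ℤ.- q) ℤ.* n
        arr = solve-∀
        arr₂ : ∀ t q q′ n → t ℤ.* n ℤ.+ (q′ ℤ.- q) ℤ.* n ≡ (t ℤ.- q ℤ.+ q′) ℤ.* n
        arr₂ = solve-∀

    md-injective : ∀ z z′ → md z ≡ md z′ → ∃[ t ] (z ℤ.- z′ ≡ t ℤ.* + n)
    md-injective z z′ eq = (z ℤ./ℕ n) ℤ.- (z′ ℤ./ℕ n) , trans (cong₂ ℤ._-_ (ℤ.a≡a%ℕn+[a/ℕn]*n z n) (trans (ℤ.a≡a%ℕn+[a/ℕn]*n z′ n) (cong (λ r → + r ℤ.+ (z′ ℤ./ℕ n) ℤ.* + n) (sym r≡))))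
        (arr (+ (z ℤ.%ℕ n)) (z ℤ./ℕ n) (z′ ℤ./ℕ n) (+ n))
      where
        r≡ : z ℤ.%ℕ n ≡ z′ ℤ.%ℕ n
        r≡ = trans (sym (toℕ-md z)) (trans (cong toℕ eq) (toℕ-md z′))
        arr : ∀ r q q′ n → (r ℤ.+ q ℤ.* n) ℤ.- (r ℤ.+ q′ ℤ.* n) ≡ (q ℤ.- q′) ℤ.* n
        arr = solve-∀

    md-toℕ : ∀ x → md (+ toℕ x) ≡ x
    md-toℕ x = toℕ-injective (trans (toℕ-md (+ toℕ x)) (ℕ.m<n⇒m%n≡m (toℕ<n x)))

    rot : ℤ → Fin n → Fin n
    rot a x = md (+ toℕ x ℤ.+ a)

    rot-md : ∀ a z → rot a (md z) ≡ md (z ℤ.+ a)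
    rot-md a z with md-injective (+ toℕ (md z)) z (md-toℕ (md z))
    ... | t , eq = md-cong (+ toℕ (md z) ℤ.+ a) (z ℤ.+ a) t (trans (arr (+ toℕ (md z)) z a) eq)
      where
        arr : ∀ x y a → (x ℤ.+ a) ℤ.- (y ℤ.+ a) ≡ x ℤ.- y
        arr = solve-∀

    rot-0 : ∀ x → rot (+ 0) x ≡ x
    rot-0 x = trans (cong md (ℤ.+-identityʳ (+ toℕ x))) (md-toℕ x)

    rot-+ : ∀ a c x → rot a (rot c x) ≡ rot (a ℤ.+ c) x
    rot-+ a c x = trans (rot-md a (+ toℕ x ℤ.+ c)) (cong md (arr (+ toℕ x) a c))
      where
        arr : ∀ x a c → (x ℤ.+ c) ℤ.+ a ≡ x ℤ.+ (a ℤ.+ c)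
        arr = solve-∀

    private
      module _ (φ : Fin n → ℚ) where
        A : ℤ → ℚ
        A z = ∑ {n} (λ i → φ (md (z ℤ.+ + toℕ i)))

        A-suc : ∀ z → A (z ℤ.+ + 1) ≡ A z
        A-suc z = trans (∑-cong {n} (λ i → cong (λ r → φ (md r)) (ℤ.+-assoc z (+ 1) (+ toℕ i))))
          (cancel (trans (∑-near-cyclic n (λ y → φ (md y)) z) (cong (λ r → A z + φ r) (md-cong (z ℤ.+ + n) (z ℤ.+ + 0) (+ 1) (arr z (+ n))))))
          where
            arr : ∀ z n → (z ℤ.+ n) ℤ.- (z ℤ.+ + 0) ≡ + 1 ℤ.* n
            arr = solve-∀
            cancel : ∀ {a b c} → a + c ≡ b + c → a ≡ b
            cancel {a} {b} {c} e = trans (solve 2 (λ a c → a := (a :+ c) :- c) refl a c) (trans (cong (_- c) e) (solve 2 (λ b c → (b :+ c) :- c := b) refl b c))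

        A-nat : ∀ k z → A (z ℤ.+ + k) ≡ A z
        A-nat zero z = cong A (ℤ.+-identityʳ z)
        A-nat (suc k) z = trans (cong A (sym (ℤ.+-assoc z (+ 1) (+ k)))) (trans (A-nat k (z ℤ.+ + 1)) (A-suc z))

        A-const : ∀ z → A z ≡ A (+ 0)
        A-const (+ k) = trans (cong A (sym (ℤ.+-identityˡ (+ k)))) (A-nat k (+ 0))
        A-const z@(-[1+ k ]) = sym (trans (cong A (sym (ℤ.+-inverseˡ (+ suc k)))) (A-nat (suc k) z))

    -- The sum over n consecutive residues does not change when the block slides by one, since the
    -- entering and the leaving integer are congruent.
    ∑-rot : ∀ a φ → ∑ {n} (λ x → φ (rot a x)) ≡ ∑ {n} φ
    ∑-rot a φ = trans (∑-cong {n} (λ x → cong (λ r → φ (md r)) (ℤ.+-comm (+ toℕ x) a))) (trans (A-const φ a)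
      (∑-cong {n} (λ x → cong φ (trans (cong md (ℤ.+-identityˡ (+ toℕ x))) (md-toℕ x)))))

    torus : System
    torus = record
      { X = Fin n × Fin n
      ; act = λ a b z → rot a (proj₁ z) , rot b (proj₂ z)
      ; act-0 = λ z → cong₂ _,_ (rot-0 (proj₁ z)) (rot-0 (proj₂ z))
      ; act-+ = λ a b c d z → cong₂ _,_ (rot-+ a c (proj₁ z)) (rot-+ b d (proj₂ z))
      ; 𝔼 = mean (avg n) ⊗ mean (avg n)
      ; 𝔼-act = λ a b F → trans (cong (inv n *_) (∑-cong (λ x → cong (inv n *_) (∑-rot b (λ y → F (rot a x , y))))))
          (cong (inv n *_) (∑-rot a (λ x → inv n * ∑ (λ y → F (x , y)))))
      }

    δ : Fin n → Fin n → ℚ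
    δ i j with i Fin.≟ j
    ... | yes _ = 1ℚ
    ... | no _ = 0ℚ

    δ-yes : ∀ i → δ i i ≡ 1ℚ
    δ-yes i with i Fin.≟ i
    ... | yes _ = refl
    ... | no p = ⊥-elim (p refl)

    δ-no : ∀ {i j} → i ≢ j → δ i j ≡ 0ℚ
    δ-no {i} {j} p with i Fin.≟ j
    ... | yes e = ⊥-elim (p e)
    ... | no _ = refl

    ∑-δ≡1 : ∀ i → ∑ (δ i) ≡ 1ℚ
    ∑-δ≡1 i with ∑-δ i 1ℚ
    ... | φ , s , φi , φj = trans (∑-cong eq) s
      where
        eq : ∀ j → δ i j ≡ φ j
        eq j with i Fin.≟ j
        ... | yes refl = sym φi
        ... | no p = sym (φj j p)

  module Points (N n : ℕ) {{n≢0 : NonZero n}} (n≡ : n ≡ N ℕ.+ N) where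

    open Torus n

    private
      small-multiple : ∀ t x → ℤ.∣ x ∣ ℕ.< n → x ≡ t ℤ.* + n → x ≡ + 0
      small-multiple t x x< refl = trans (cong (ℤ._* + n) (ℤ.∣i∣≡0⇒i≡0 {t} (ℕ.n≤0⇒n≡0 (ℕ.≤-pred (ℕ.*-cancelʳ-< n ℤ.∣ t ∣ 1
        (ℕ.<-≤-trans (subst (ℕ._< n) (ℤ.abs-* t (+ n)) x<) (ℕ.≤-reflexive (sym (ℕ.*-identityˡ n))))))))) refl

      grid-diff : ∀ x y → + 1 ℤ.≤ x → x ℤ.≤ + N → + 1 ℤ.≤ y → y ℤ.≤ + N → ℤ.∣ y ℤ.- x ∣ ℕ.< N
      grid-diff (+ suc a) (+ suc b) _ (ℤ.+≤+ a<N) _ (ℤ.+≤+ b<N) = ℕ.≤-<-trans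
        (ℕ.≤-reflexive (cong ℤ.∣_∣ (ℤ.[1+m]⊖[1+n]≡m⊖n b a))) (ℕ.≤-<-trans (ℤ.∣m⊝n∣≤m⊔n b a) (ℕ.⊔-lub b<N a<N))
      grid-diff (+ zero) _ (ℤ.+≤+ ()) _ _ _
      grid-diff -[1+ _ ] _ () _ _ _
      grid-diff (+ suc _) (+ zero) _ _ (ℤ.+≤+ ()) _
      grid-diff (+ suc _) -[1+ _ ] _ _ () _

    -- Displacements of size at most N cannot wrap around a torus of side 2N.
    no-wrap : ∀ {x y} d → (+ 1 ℤ.≤ x) × (x ℤ.≤ + N) → (+ 1 ℤ.≤ y) × (y ℤ.≤ + N) → ℤ.∣ d ∣ ℕ.≤ N → md y ≡ md (x ℤ.+ d) → y ≡ x ℤ.+ d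
    no-wrap {x} {y} d (1≤x , x≤N) (1≤y , y≤N) d≤ e = go (md-injective y (x ℤ.+ d) e)
      where
        arr : ∀ y x d → y ℤ.- (x ℤ.+ d) ≡ (y ℤ.- x) ℤ.- d
        arr = solve-∀
        go : ∃[ t ] (y ℤ.- (x ℤ.+ d) ≡ t ℤ.* + n) → y ≡ x ℤ.+ d
        go (t , eq) = ℤ.i-j≡0⇒i≡j y (x ℤ.+ d) (small-multiple t (y ℤ.- (x ℤ.+ d))
          (ℕ.≤-<-trans (ℕ.≤-reflexive (cong ℤ.∣_∣ (arr y x d))) (ℕ.≤-<-trans (ℤ.∣i-j∣≤∣i∣+∣j∣ (y ℤ.- x) d)
            (ℕ.<-≤-trans (ℕ.+-mono-<-≤ (grid-diff x y 1≤x x≤N 1≤y y≤N) d≤) (ℕ.≤-reflexive (sym n≡)))))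
          eq)

    pt : ℤ × ℤ → Fin n × Fin n
    pt a = md (proj₁ a) , md (proj₂ a)

    pt-injective : ∀ {a b} → InGrid N a → InGrid N b → pt b ≡ pt a → b ≡ a
    pt-injective {a} {b} (ga₁ , ga₂) (gb₁ , gb₂) e = cong₂ _,_
      (coordinate ga₁ gb₁ (cong proj₁ e)) (coordinate ga₂ gb₂ (cong proj₂ e))
      where
        coordinate : ∀ {x y} → (+ 1 ℤ.≤ x) × (x ℤ.≤ + N) → (+ 1 ℤ.≤ y) × (y ℤ.≤ + N) → md y ≡ md x → y ≡ x
        coordinate {x} gx gy e = trans (no-wrap (+ 0) gx gy ℕ.z≤n (trans e (cong md (sym (ℤ.+-identityʳ x))))) (ℤ.+-identityʳ x)

    mass : ℤ × ℤ → Fin n × Fin n → ℚ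
    mass a z = δ (md (proj₁ a)) (proj₁ z) * δ (md (proj₂ a)) (proj₂ z)

    mass-dec : ∀ a z → ((pt a ≡ z) × (mass a z ≡ 1ℚ)) ⊎ ((pt a ≢ z) × (mass a z ≡ 0ℚ))
    mass-dec a (x , y) = go (md (proj₁ a) Fin.≟ x) (md (proj₂ a) Fin.≟ y)
      where
        go : Dec (md (proj₁ a) ≡ x) → Dec (md (proj₂ a) ≡ y) → ((pt a ≡ (x , y)) × (mass a (x , y) ≡ 1ℚ)) ⊎ ((pt a ≢ (x , y)) × (mass a (x , y) ≡ 0ℚ))
        go (yes refl) (yes refl) = inj₁ (refl , trans (cong₂ _*_ (δ-yes x) (δ-yes y)) (*-identityʳ 1ℚ))
        go (no p) _ = inj₂ ((λ e → p (cong proj₁ e)) , trans (cong (_* δ (md (proj₂ a)) y) (δ-no p)) (*-zeroˡ (δ (md (proj₂ a)) y)))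
        go _ (no p) = inj₂ ((λ e → p (cong proj₂ e)) , trans (cong (δ (md (proj₁ a)) x *_) (δ-no p)) (*-zeroʳ (δ (md (proj₁ a)) x)))

    f : List (ℤ × ℤ) → Fin n × Fin n → ℚ
    f [] z = 0ℚ
    f (a ∷ A) z = mass a z + f A z

    f-zero : ∀ A {z} → All (λ b → pt b ≢ z) A → f A z ≡ 0ℚ
    f-zero [] [] = refl
    f-zero (a ∷ A) {z} (p ∷ ps) = go (mass-dec a z)
      where
        go : ((pt a ≡ z) × (mass a z ≡ 1ℚ)) ⊎ ((pt a ≢ z) × (mass a z ≡ 0ℚ)) → mass a z + f A z ≡ 0ℚ
        go (inj₁ (e , _)) = ⊥-elim (p e)
        go (inj₂ (_ , e)) = trans (cong₂ _+_ e (f-zero A ps)) (+-identityʳ 0ℚ)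

    -- Distinct grid points stay distinct on the torus, so at most one mass is nonzero at z.
    f-unit : ∀ A → Unique A → All (InGrid N) A → ∀ z → (0ℚ ≤ f A z) × (f A z ≤ 1ℚ)
    f-unit [] _ _ z = ℚ.≤-refl , 0≤1
    f-unit (a ∷ A) (a∉ ∷ uA) (ga ∷ gA) z = go (mass-dec a z)
      where
        others : pt a ≡ z → ∀ {B} → All (a ≢_) B → All (InGrid N) B → All (λ b → pt b ≢ z) B
        others e [] [] = []
        others e (p ∷ ps) (g ∷ gs) = (λ e′ → p (sym (pt-injective ga g (trans e′ (sym e))))) ∷ others e ps gs
        go : ((pt a ≡ z) × (mass a z ≡ 1ℚ)) ⊎ ((pt a ≢ z) × (mass a z ≡ 0ℚ)) → (0ℚ ≤ mass a z + f A z) × (mass a z + f A z ≤ 1ℚ)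
        go (inj₁ (e , m)) = ≤≡ 0≤1 (sym eq) , ℚ.≤-reflexive eq
          where
            eq : mass a z + f A z ≡ 1ℚ
            eq = trans (cong₂ _+_ m (f-zero A (others e a∉ gA))) (+-identityʳ 1ℚ)
        go (inj₂ (_ , m)) = ≤≡ (proj₁ (f-unit A uA gA z)) (sym eq) , ≡≤ eq (proj₂ (f-unit A uA gA z))
          where
            eq : mass a z + f A z ≡ f A z
            eq = trans (cong (_+ f A z) m) (+-identityˡ (f A z))

    f-support : ∀ A z → (f A z ≡ 0ℚ) ⊎ (∃[ a ] (a ∈ A) × (pt a ≡ z))
    f-support [] z = inj₁ refl
    f-support (a ∷ A) z = go (mass-dec a z) (f-support A z)
      where
        go : ((pt a ≡ z) × (mass a z ≡ 1ℚ)) ⊎ ((pt a ≢ z) × (mass a z ≡ 0ℚ)) → (f A z ≡ 0ℚ) ⊎ (∃[ a ] (a ∈ A) × (pt a ≡ z)) →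
          (mass a z + f A z ≡ 0ℚ) ⊎ (∃[ b ] (b ∈ (a ∷ A)) × (pt b ≡ z))
        go (inj₁ (e , _)) _ = inj₂ (a , here refl , e)
        go (inj₂ (_ , m)) (inj₁ e) = inj₁ (trans (cong₂ _+_ m e) (+-identityʳ 0ℚ))
        go (inj₂ _) (inj₂ (b , b∈ , e)) = inj₂ (b , there b∈ , e)

    open System torus using (𝔼)

    E-mass : ∀ a → E 𝔼 (mass a) ≡ inv n * inv n
    E-mass a = trans (E-cong (mean (avg n)) (λ x → E-* (mean (avg n)) (δ (md (proj₁ a)) x) (δ (md (proj₂ a)))))
      (trans (E-cong (mean (avg n)) (λ x → trans (cong (δ (md (proj₁ a)) x *_) (E-δ (md (proj₂ a)))) (*-comm (δ (md (proj₁ a)) x) (inv n))))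
      (trans (E-* (mean (avg n)) (inv n) (δ (md (proj₁ a)))) (cong (inv n *_) (E-δ (md (proj₁ a))))))
      where
        E-δ : ∀ i → E (mean (avg n)) (δ i) ≡ inv n
        E-δ i = trans (cong (inv n *_) (∑-δ≡1 i)) (*-identityʳ (inv n))

    E-f : ∀ A → E 𝔼 (f A) ≡ ι (length A) * (inv n * inv n)
    E-f [] = trans (E-const 𝔼 0ℚ) (sym (*-zeroˡ (inv n * inv n)))
    E-f (a ∷ A) = trans (E-+ 𝔼 (mass a) (f A)) (trans (cong₂ _+_ (E-mass a) (E-f A))
      (trans (solve 2 (λ w l → w :+ l :* w := (con 1ℚ :+ l) :* w) refl (inv n * inv n) (ι (length A)))
        (cong (_* (inv n * inv n)) refl)))

    E-f≤⇒length≤ : ∀ A a b .{{_ : NonZero b}} → E 𝔼 (f A) ≤ ι a * inv b → length A ℕ.* b ℕ.≤ a ℕ.* (n ℕ.* n)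
    E-f≤⇒length≤ A a b p = ι-cancel (≡≤ (ι-* (length A) b) (≤≡ (≡≤ lhs (*-mono (0≤* (0≤* (0≤ι (length A)) (0≤* (0≤inv n) (0≤inv n))) 0≤1) (0≤* (0≤* (0≤ι n) (0≤ι n)) (0≤ι b)) (≡≤ (*-identityʳ _) (≡≤ (sym (E-f A)) p)) ℚ.≤-refl)) rhs))
      where
        c : ℚ
        c = (ι n * ι n) * ι b
        lhs : ι (length A) * ι b ≡ ((ι (length A) * (inv n * inv n)) * 1ℚ) * ((ι n * ι n) * ι b)
        lhs = sym (trans (solve 4 (λ l i n b → ((l :* (i :* i)) :* con 1ℚ) :* ((n :* n) :* b) := (l :* b) :* ((n :* i) :* (n :* i))) refl (ι (length A)) (inv n) (ι n) (ι b))
          (trans (cong (λ r → (ι (length A) * ι b) * (r * r)) (ι*inv n)) (trans (cong ((ι (length A) * ι b) *_) (*-identityʳ 1ℚ)) (*-identityʳ (ι (length A) * ι b)))))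
        rhs : (ι a * inv b) * ((ι n * ι n) * ι b) ≡ ι (a ℕ.* (n ℕ.* n))
        rhs = trans (solve 4 (λ a i n b → (a :* i) :* ((n :* n) :* b) := (a :* (n :* n)) :* (b :* i)) refl (ι a) (inv b) (ι n) (ι b))
          (trans (cong ((ι a * (ι n * ι n)) *_) (ι*inv b)) (trans (*-identityʳ (ι a * (ι n * ι n)))
            (sym (trans (ι-* a (n ℕ.* n)) (cong (ι a *_) (ι-* n n))))))

    -- Points of the support lift to the grid. As |z| and z² are at most N, nothing wraps around,
    -- and three such points would form a genuine corner.
    free : ∀ A → All (InGrid N) A → NoSquareCorner A → ∀ M → M ℕ.* M ℕ.≤ N → ∀ z → z ≢ + 0 → ℤ.∣ z ∣ ℕ.≤ M →
      ∀ x → f A x * (f A (System.act torus z (+ 0) x) * f A (System.act torus (+ 0) (z ℤ.* z) x)) ≤ 0ℚ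
    free A gA none M M²≤ z z≢0 z≤ (x , y) = go (f-support A (x , y)) (f-support A (rot z x , rot (+ 0) y)) (f-support A (rot (+ 0) x , rot (z ℤ.* z) y))
      where
        F G H : ℚ
        F = f A (x , y)
        G = f A (rot z x , rot (+ 0) y)
        H = f A (rot (+ 0) x , rot (z ℤ.* z) y)
        z²≤ : ℤ.∣ z ℤ.* z ∣ ℕ.≤ N
        z²≤ = ℕ.≤-trans (abs-*≤ z z z≤ z≤) M²≤
        m≤m*m : ∀ m → m ℕ.≤ m ℕ.* m
        m≤m*m zero = ℕ.z≤n
        m≤m*m (suc m) = ℕ.m≤m*n (suc m) (suc m)
        z≤N : ℤ.∣ z ∣ ℕ.≤ N
        z≤N = ℕ.≤-trans z≤ (ℕ.≤-trans (m≤m*m M) M²≤)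
        go : (F ≡ 0ℚ) ⊎ (∃[ a ] (a ∈ A) × (pt a ≡ (x , y))) → (G ≡ 0ℚ) ⊎ (∃[ a ] (a ∈ A) × (pt a ≡ (rot z x , rot (+ 0) y))) →
          (H ≡ 0ℚ) ⊎ (∃[ a ] (a ∈ A) × (pt a ≡ (rot (+ 0) x , rot (z ℤ.* z) y))) → F * (G * H) ≤ 0ℚ
        go (inj₁ e) _ _ = ℚ.≤-reflexive (trans (cong (_* (G * H)) e) (*-zeroˡ (G * H)))
        go _ (inj₁ e) _ = ℚ.≤-reflexive (trans (cong (λ r → F * (r * H)) e) (trans (cong (F *_) (*-zeroˡ H)) (*-zeroʳ F)))
        go _ _ (inj₁ e) = ℚ.≤-reflexive (trans (cong (λ r → F * (G * r)) e) (trans (cong (F *_) (*-zeroʳ G)) (*-zeroʳ F)))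
        go (inj₂ ((a₁ , a₂) , a∈ , refl)) (inj₂ ((b₁ , b₂) , b∈ , eb)) (inj₂ ((c₁ , c₂) , c∈ , ec)) =
          ⊥-elim (none a₁ a₂ z z≢0 a∈
            (subst (_∈ A) (cong₂ _,_ (shift z z≤N ga₁ gb₁ (cong proj₁ eb)) (shift₀ ga₂ gb₂ (cong proj₂ eb))) b∈)
            (subst (_∈ A) (cong₂ _,_ (shift₀ ga₁ gc₁ (cong proj₁ ec)) (shift (z ℤ.* z) z²≤ ga₂ gc₂ (cong proj₂ ec))) c∈))
          where
            ga₁ = proj₁ (All.lookup gA a∈)
            ga₂ = proj₂ (All.lookup gA a∈)
            gb₁ = proj₁ (All.lookup gA b∈)
            gb₂ = proj₂ (All.lookup gA b∈)
            gc₁ = proj₁ (All.lookup gA c∈)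
            gc₂ = proj₂ (All.lookup gA c∈)
            shift : ∀ {p q} d → ℤ.∣ d ∣ ℕ.≤ N → (+ 1 ℤ.≤ p) × (p ℤ.≤ + N) → (+ 1 ℤ.≤ q) × (q ℤ.≤ + N) → md q ≡ rot d (md p) → q ≡ p ℤ.+ d
            shift {p} d d≤ gp gq e = no-wrap d gp gq d≤ (trans e (rot-md d p))
            shift₀ : ∀ {p q} → (+ 1 ℤ.≤ p) × (p ℤ.≤ + N) → (+ 1 ℤ.≤ q) × (q ℤ.≤ + N) → md q ≡ rot (+ 0) (md p) → q ≡ p
            shift₀ {p} gp gq e = trans (shift (+ 0) ℕ.z≤n gp gq e) (ℤ.+-identityʳ p)

  infixl 7 _⊛_
  infixl 6 _⊕_

  -- Choice of parameters

  -- A growth class closed under sums and products; the exponent and the constant of the theorem are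
  -- computed from its closure properties.
  Polynomial : (ℕ → ℕ) → Set
  Polynomial g = ∃[ k ] ∃[ C ] (∀ h → 1 ℕ.≤ h → g h ℕ.≤ C ℕ.* h ℕ.^ k)

  polynomial-const : ∀ c → Polynomial (λ _ → c)
  polynomial-const c = 0 , c , λ h _ → ℕ.≤-reflexive (sym (ℕ.*-identityʳ c))

  polynomial-id : Polynomial (λ h → h)
  polynomial-id = 1 , 1 , λ h _ → ℕ.≤-reflexive (sym (trans (ℕ.*-identityˡ (h ℕ.^ 1)) (ℕ.*-identityʳ h)))

  private
    exponent-≤ : ∀ h C k l → 1 ℕ.≤ h → k ℕ.≤ l → C ℕ.* h ℕ.^ k ℕ.≤ C ℕ.* h ℕ.^ l
    exponent-≤ h C k l 1≤h k≤l = ℕ.*-monoʳ-≤ C (ℕ.^-monoʳ-≤ h {{ℕ.>-nonZero 1≤h}} k≤l)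

  _⊕_ : ∀ {g g′} → Polynomial g → Polynomial g′ → Polynomial (λ h → g h ℕ.+ g′ h)
  (k , C , p) ⊕ (k′ , C′ , p′) = k ℕ.+ k′ , C ℕ.+ C′ , λ h 1≤h → ℕ.≤-trans
    (ℕ.+-mono-≤ (ℕ.≤-trans (p h 1≤h) (exponent-≤ h C k (k ℕ.+ k′) 1≤h (ℕ.m≤m+n k k′)))
      (ℕ.≤-trans (p′ h 1≤h) (exponent-≤ h C′ k′ (k ℕ.+ k′) 1≤h (ℕ.m≤n+m k′ k))))
    (ℕ.≤-reflexive (sym (ℕ.*-distribʳ-+ (h ℕ.^ (k ℕ.+ k′)) C C′)))

  _⊛_ : ∀ {g g′} → Polynomial g → Polynomial g′ → Polynomial (λ h → g h ℕ.* g′ h)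
  (k , C , p) ⊛ (k′ , C′ , p′) = k ℕ.+ k′ , C ℕ.* C′ , λ h 1≤h → ℕ.≤-trans (ℕ.*-mono-≤ (p h 1≤h) (p′ h 1≤h))
    (ℕ.≤-reflexive (trans (arr C (h ℕ.^ k) C′ (h ℕ.^ k′)) (cong (C ℕ.* C′ ℕ.*_) (sym (ℕ.^-distribˡ-+-* h k k′)))))
    where
      arr : ∀ C x C′ y → C ℕ.* x ℕ.* (C′ ℕ.* y) ≡ C ℕ.* C′ ℕ.* (x ℕ.* y)
      arr = ℕR.solve-∀

  Exponential : (ℕ → ℕ) → Set
  Exponential g = ∃[ G ] Polynomial G × (∀ h → g h ℕ.≤ 2 ℕ.^ G h)

  n≤2^n : ∀ n → n ℕ.≤ 2 ℕ.^ n
  n≤2^n zero = ℕ.z≤n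
  n≤2^n (suc n) = ℕ.≤-trans (ℕ.+-mono-≤ (ℕ.m^n>0 2 n) (n≤2^n n))
    (ℕ.≤-reflexive (cong (2 ℕ.^ n ℕ.+_) (sym (ℕ.+-identityʳ (2 ℕ.^ n)))))

  n!≤2^n*n : ∀ n → n ! ℕ.≤ 2 ℕ.^ (n ℕ.* n)
  n!≤2^n*n zero = ℕ.≤-refl
  n!≤2^n*n (suc n) = ℕ.≤-trans (ℕ.*-mono-≤ (n≤2^n (suc n)) (n!≤2^n*n n)) (ℕ.≤-trans
    (ℕ.≤-reflexive (sym (ℕ.^-distribˡ-+-* 2 (suc n) (n ℕ.* n))))
    (ℕ.^-monoʳ-≤ 2 (ℕ.≤-trans (ℕ.m≤m+n (suc n ℕ.+ n ℕ.* n) n) (ℕ.≤-reflexive (arr n)))))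
    where
      arr : ∀ n → suc n ℕ.+ n ℕ.* n ℕ.+ n ≡ suc n ℕ.* suc n
      arr = ℕR.solve-∀

  exponential-polynomial : ∀ {g} → Polynomial g → Exponential g
  exponential-polynomial {g} p = g , p , λ h → n≤2^n (g h)

  exponential-! : ∀ {g} → Polynomial g → Exponential (λ h → g h !)
  exponential-! {g} p = (λ h → g h ℕ.* g h) , p ⊛ p , λ h → n!≤2^n*n (g h)

  exponential-* : ∀ {g g′} → Exponential g → Exponential g′ → Exponential (λ h → g h ℕ.* g′ h)
  exponential-* (G , P , p) (G′ , P′ , p′) = (λ h → G h ℕ.+ G′ h) , P ⊕ P′ ,
    λ h → ℕ.≤-trans (ℕ.*-mono-≤ (p h) (p′ h)) (ℕ.≤-reflexive (sym (ℕ.^-distribˡ-+-* 2 (G h) (G′ h))))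

  exponential-^ : ∀ {g e} → Exponential g → Polynomial e → Exponential (λ h → g h ℕ.^ e h)
  exponential-^ {g} {e} (G , P , p) Q = (λ h → G h ℕ.* e h) , P ⊛ Q ,
    λ h → ℕ.≤-trans (ℕ.^-monoˡ-≤ (e h) (p h)) (ℕ.≤-reflexive (ℕ.^-*-assoc 2 (G h) (e h)))

  polynomial-cong : ∀ {g g′ : ℕ → ℕ} → (∀ h → g′ h ≡ g h) → Polynomial g → Polynomial g′
  polynomial-cong e (k , C , p) = k , C , λ h 1≤h → ℕ.≤-trans (ℕ.≤-reflexive (e h)) (p h 1≤h)

  exponential-cong : ∀ {g g′ : ℕ → ℕ} → (∀ h → g′ h ≡ g h) → Exponential g → Exponential g′
  exponential-cong e (G , P , p) = G , P , λ h → ℕ.≤-trans (ℕ.≤-reflexive (e h)) (p h)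

  opaque
    -- The thresholds for η = 1 / h, with `β` as K and `λ!` as L. `scale` is D: its three factors
    -- provide divisibility by integers up to 2 K, divisibility by 4 L², and the required size.
    -- `depth` is Z: K windows of 8 · 8 K² + 3 levels.
    ν₁ ν₂ ν₃ ν₄ ν₅ β θ λ! scale depth : ℕ → ℕ
    ν₁ h = 2 ℕ.* (h ℕ.* (h ℕ.* h))
    ν₅ h = 4 ℕ.* (ν₁ h ℕ.* ν₁ h)
    ν₄ h = 16 ℕ.* (ν₁ h ℕ.* ν₁ h)
    ν₃ h = 2 ℕ.* (ν₄ h ℕ.* ν₄ h)
    ν₂ h = 2 ℕ.* (ν₃ h ℕ.* ν₃ h)
    β h = 32 ℕ.* ((ν₂ h ℕ.* ν₂ h) ℕ.* (ν₂ h ℕ.* ν₂ h))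
    θ h = 80 ℕ.* (β h ℕ.* β h)
    λ! h = β h !
    scale h = (2 ℕ.* β h) ! ℕ.* (4 ℕ.* (λ! h ℕ.* λ! h)) ℕ.* (2 ℕ.* (256 ℕ.* (β h ℕ.* (λ! h ℕ.* λ! h)) ℕ.* (β h ℕ.* (λ! h ℕ.* λ! h))) ℕ.* θ h)
    depth h = (8 ℕ.* (8 ℕ.* (β h ℕ.* β h)) ℕ.+ 3) ℕ.* β h

    ν₁≡ : ∀ h → ν₁ h ≡ 2 ℕ.* (h ℕ.* (h ℕ.* h))
    ν₁≡ h = refl
    ν₅≡ : ∀ h → ν₅ h ≡ 4 ℕ.* (ν₁ h ℕ.* ν₁ h)
    ν₅≡ h = refl
    ν₄≡ : ∀ h → ν₄ h ≡ 16 ℕ.* (ν₁ h ℕ.* ν₁ h)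
    ν₄≡ h = refl
    ν₃≡ : ∀ h → ν₃ h ≡ 2 ℕ.* (ν₄ h ℕ.* ν₄ h)
    ν₃≡ h = refl
    ν₂≡ : ∀ h → ν₂ h ≡ 2 ℕ.* (ν₃ h ℕ.* ν₃ h)
    ν₂≡ h = refl
    β≡ : ∀ h → β h ≡ 32 ℕ.* ((ν₂ h ℕ.* ν₂ h) ℕ.* (ν₂ h ℕ.* ν₂ h))
    β≡ h = refl
    θ≡ : ∀ h → θ h ≡ 80 ℕ.* (β h ℕ.* β h)
    θ≡ h = refl
    λ!≡ : ∀ h → λ! h ≡ β h !
    λ!≡ h = refl
    scale≡ : ∀ h → scale h ≡ (2 ℕ.* β h) ! ℕ.* (4 ℕ.* (λ! h ℕ.* λ! h)) ℕ.* (2 ℕ.* (256 ℕ.* (β h ℕ.* (λ! h ℕ.* λ! h)) ℕ.* (β h ℕ.* (λ! h ℕ.* λ! h))) ℕ.* θ h)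
    scale≡ h = refl
    depth≡ : ∀ h → depth h ≡ (8 ℕ.* (8 ℕ.* (β h ℕ.* β h)) ℕ.+ 3) ℕ.* β h
    depth≡ h = refl

  -- D · D^(3 Z), the bound of `d-small` for the differences at every level.
  range : ℕ → ℕ
  range h = scale h ℕ.* (pow (scale h) (depth h) ℕ.* (pow (scale h) (depth h) ℕ.* pow (scale h) (depth h)))

  private
    polynomial-square : ∀ {g g′ : ℕ → ℕ} c → (∀ h → g′ h ≡ c ℕ.* (g h ℕ.* g h)) → Polynomial g → Polynomial g′
    polynomial-square c e P = polynomial-cong e (polynomial-const c ⊛ (P ⊛ P))

    polynomial-β : Polynomial β
    polynomial-β = polynomial-cong β≡ (polynomial-const 32 ⊛ ((p₂ ⊛ p₂) ⊛ (p₂ ⊛ p₂)))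
      where
        p₁ : Polynomial ν₁
        p₁ = polynomial-cong ν₁≡ (polynomial-const 2 ⊛ (polynomial-id ⊛ (polynomial-id ⊛ polynomial-id)))
        p₂ : Polynomial ν₂
        p₂ = polynomial-square 2 ν₂≡ (polynomial-square 2 ν₃≡ (polynomial-square 16 ν₄≡ p₁))

    exponential-scale : Exponential scale
    exponential-scale = exponential-cong scale≡ (exponential-* (exponential-* (exponential-! (polynomial-const 2 ⊛ polynomial-β)) (exponential-* (const 4) (exponential-* eλ eλ)))
        (exponential-* (exponential-* (const 2) (exponential-* (exponential-* (const 256) eκ) eκ)) (exponential-polynomial (polynomial-square 80 θ≡ polynomial-β))))
      where
        const : ∀ c → Exponential (λ _ → c)
        const c = exponential-polynomial (polynomial-const c)
        eλ : Exponential λ!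
        eλ = exponential-cong λ!≡ (exponential-! polynomial-β)
        eκ : Exponential (λ h → β h ℕ.* (λ! h ℕ.* λ! h))
        eκ = exponential-* (exponential-polynomial polynomial-β) (exponential-* eλ eλ)

  exponential-range² : Exponential (λ h → range h ℕ.* range h)
  exponential-range² = exponential-* eM eM
    where
      eP : Exponential (λ h → pow (scale h) (depth h))
      eP = exponential-cong (λ h → pow-^ (scale h) (depth h)) (exponential-^ exponential-scale (polynomial-cong depth≡
        ((polynomial-const 8 ⊛ (polynomial-const 8 ⊛ (polynomial-β ⊛ polynomial-β)) ⊕ polynomial-const 3) ⊛ polynomial-β)))
      eM : Exponential range
      eM = exponential-* exponential-scale (exponential-* eP (exponential-* eP eP))

  module Choice (h : ℕ) {{h≢0 : NonZero h}} where

    private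
      nz* : ∀ {g a b} → g ≡ a ℕ.* b → NonZero a → NonZero b → NonZero g
      nz* {a = a} {b} refl p q = ℕ.m*n≢0 a b {{p}} {{q}}

      nz-sq : ∀ {g} c a .{{_ : NonZero c}} → g ≡ c ℕ.* (a ℕ.* a) → NonZero a → NonZero g
      nz-sq c a {{c≢0}} refl p = ℕ.m*n≢0 c (a ℕ.* a) {{c≢0}} {{ℕ.m*n≢0 a a {{p}} {{p}}}}

      instance
        ν₁≢0 : NonZero (ν₁ h)
        ν₁≢0 = nz* {a = 2} {h ℕ.* (h ℕ.* h)} (ν₁≡ h) _ (ℕ.m*n≢0 h (h ℕ.* h) {{h≢0}} {{ℕ.m*n≢0 h h}})
        ν₅≢0 : NonZero (ν₅ h)
        ν₅≢0 = nz-sq 4 (ν₁ h) (ν₅≡ h) ν₁≢0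
        ν₄≢0 : NonZero (ν₄ h)
        ν₄≢0 = nz-sq 16 (ν₁ h) (ν₄≡ h) ν₁≢0
        ν₃≢0 : NonZero (ν₃ h)
        ν₃≢0 = nz-sq 2 (ν₄ h) (ν₃≡ h) ν₄≢0
        ν₂≢0 : NonZero (ν₂ h)
        ν₂≢0 = nz-sq 2 (ν₃ h) (ν₂≡ h) ν₃≢0
        β≢0 : NonZero (β h)
        β≢0 = nz-sq 32 (ν₂ h ℕ.* ν₂ h) (β≡ h) (ℕ.m*n≢0 (ν₂ h) (ν₂ h))
        θ≢0 : NonZero (θ h)
        θ≢0 = nz-sq 80 (β h) (θ≡ h) β≢0
        λ≢0 : NonZero (λ! h)
        λ≢0 = subst NonZero (sym (λ!≡ h)) (ℕ._!≢0 (β h))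

      κ₀ f₀ f₁ f₂ : ℕ
      κ₀ = β h ℕ.* (λ! h ℕ.* λ! h)
      f₀ = (2 ℕ.* β h) !
      f₁ = 4 ℕ.* (λ! h ℕ.* λ! h)
      f₂ = 2 ℕ.* (256 ℕ.* κ₀ ℕ.* κ₀) ℕ.* θ h

      instance
        κ≢0 : NonZero κ₀
        κ≢0 = ℕ.m*n≢0 (β h) (λ! h ℕ.* λ! h) {{β≢0}} {{ℕ.m*n≢0 (λ! h) (λ! h)}}
        f₀≢0 : NonZero f₀
        f₀≢0 = ℕ._!≢0 (2 ℕ.* β h)
        f₁≢0 : NonZero f₁
        f₁≢0 = nz-sq 4 (λ! h) refl λ≢0
        f₂≢0 : NonZero f₂
        f₂≢0 = ℕ.m*n≢0 (2 ℕ.* (256 ℕ.* κ₀ ℕ.* κ₀)) (θ h) {{nz* {a = 2} {256 ℕ.* κ₀ ℕ.* κ₀} refl _ (ℕ.m*n≢0 (256 ℕ.* κ₀) κ₀ {{ℕ.m*n≢0 256 κ₀}})}}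
        f₀f₁≢0 : NonZero (f₀ ℕ.* f₁)
        f₀f₁≢0 = ℕ.m*n≢0 f₀ f₁
        scale≢0 : NonZero (scale h)
        scale≢0 = nz* (scale≡ h) (ℕ.m*n≢0 f₀ f₁) f₂≢0

      f₁∣scale : f₁ ℕᵈ.∣ scale h
      f₁∣scale = ℕᵈ.∣-trans (ℕᵈ.n∣m*n f₀) (subst (f₀ ℕ.* f₁ ℕᵈ.∣_) (sym (scale≡ h)) (ℕᵈ.m∣m*n f₂))

      n∣n! : ∀ n → .{{_ : NonZero n}} → n ℕᵈ.∣ n !
      n∣n! (suc n) = ℕᵈ.m∣m*n (n !)

      small∣scale : ∀ s → 1 ℕ.≤ s → s ℕ.≤ 2 ℕ.* β h → s ℕᵈ.∣ scale h
      small∣scale s 1≤s s≤ = ℕᵈ.∣-trans (n∣n! s {{ℕ.>-nonZero 1≤s}}) (ℕᵈ.∣-trans (ℕᵈ.m≤n⇒m!∣n! s≤)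
        (ℕᵈ.∣-trans (ℕᵈ.m∣m*n f₁) (subst (f₀ ℕ.* f₁ ℕᵈ.∣_) (sym (scale≡ h)) (ℕᵈ.m∣m*n f₂))))

      j∣λ! : ∀ j → suc (toℕ {β h} j) ℕᵈ.∣ λ! h
      j∣λ! j = subst (suc (toℕ j) ℕᵈ.∣_) (sym (λ!≡ h)) (ℕᵈ.∣-trans (n∣n! (suc (toℕ j))) (ℕᵈ.m≤n⇒m!∣n! (toℕ<n j)))

      gn : Fin (β h) → ℕ
      gn j = ℕᵈ.quotient (j∣λ! j)

      agn : ∀ j → suc (toℕ j) ℕ.* gn j ≡ λ! h
      agn j = trans (ℕ.*-comm (suc (toℕ j)) (gn j)) (sym (ℕᵈ._∣_.equality (j∣λ! j)))

      gn≤ : ∀ j → gn j ℕ.≤ λ! h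
      gn≤ j = ℕ.≤-trans (ℕ.m≤n*m (gn j) (suc (toℕ j))) (ℕ.≤-reflexive (agn j))

      f₂≤scale : f₂ ℕ.≤ scale h
      f₂≤scale = ℕ.≤-trans (ℕ.m≤n*m f₂ (f₀ ℕ.* f₁)) (ℕ.≤-reflexive (sym (scale≡ h)))

      κ₀≤f₂ : 256 ℕ.* κ₀ ℕ.≤ f₂
      κ₀≤f₂ = ℕ.≤-trans (ℕ.m≤m*n (256 ℕ.* κ₀) κ₀) (ℕ.≤-trans (ℕ.m≤n*m (256 ℕ.* κ₀ ℕ.* κ₀) 2) (ℕ.m≤m*n (2 ℕ.* (256 ℕ.* κ₀ ℕ.* κ₀)) (θ h)))

      β≤scale : β h ℕ.≤ scale h
      β≤scale = ℕ.≤-trans (ℕ.m≤m*n (β h) (λ! h ℕ.* λ! h) {{ℕ.m*n≢0 (λ! h) (λ! h)}}) (ℕ.≤-trans (ℕ.m≤n*m κ₀ 256) (ℕ.≤-trans κ₀≤f₂ f₂≤scale))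

      8≤scale : 8 ℕ.≤ scale h
      8≤scale = ℕ.≤-trans (ℕ.m≤m+n 8 248) (ℕ.≤-trans (ℕ.m≤m*n 256 κ₀) (ℕ.≤-trans κ₀≤f₂ f₂≤scale))

      parameters : Parameters
      parameters = record { K = β h ; Θ = θ h ; D = scale h ; Ln = λ! h ; gn = gn ; agn = agn ; gn≤ = gn≤
        ; dvd = small∣scale ; dvdL = f₁∣scale ; D-large = f₂≤scale ; K≤D = β≤scale ; 8≤D = 8≤scale }

      𝓃 : Numbers (β h) (θ h)
      𝓃 = numbers (ν₁ h) (ν₂ h) (ν₃ h) (ν₄ h) (ν₅ h) (β h) (θ h) (ν₅≡ h) (ν₄≡ h) (ν₃≡ h) (ν₂≡ h) (β≡ h) (θ≡ h)

      S : ℕ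
      S = ℕ.pred (8 ℕ.* (β h ℕ.* β h))

      S≡ : suc S ≡ 8 ℕ.* (β h ℕ.* β h)
      S≡ = ℕ.suc-pred (8 ℕ.* (β h ℕ.* β h)) {{nz-sq 8 (β h) refl β≢0}}

      instance
        2β≢0 : NonZero (2 ℕ.* β h)
        2β≢0 = ℕ.m*n≢0 2 (β h)
        h³≢0 : NonZero (h ℕ.* (h ℕ.* h))
        h³≢0 = ℕ.m*n≢0 h (h ℕ.* h) {{h≢0}} {{ℕ.m*n≢0 h h}}
        2h³≢0 : NonZero (2 ℕ.* (h ℕ.* (h ℕ.* h)))
        2h³≢0 = ℕ.m*n≢0 2 (h ℕ.* (h ℕ.* h))

      many : ι (β h) * ι 4 ≤ ι (suc S) * inv (2 ℕ.* β h)
      many = ℚ.≤-reflexive (sym (begin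
        ι (suc S) * inv (2 ℕ.* β h)
          ≡⟨ cong (λ r → ι r * inv (2 ℕ.* β h)) (trans S≡ (eq (β h))) ⟩
        ι (β h ℕ.* 4 ℕ.* (2 ℕ.* β h)) * inv (2 ℕ.* β h)
          ≡⟨ cong (_* inv (2 ℕ.* β h)) (ι-* (β h ℕ.* 4) (2 ℕ.* β h)) ⟩
        (ι (β h ℕ.* 4) * ι (2 ℕ.* β h)) * inv (2 ℕ.* β h)
          ≡⟨ trans (*-assoc (ι (β h ℕ.* 4)) (ι (2 ℕ.* β h)) (inv (2 ℕ.* β h))) (cong (ι (β h ℕ.* 4) *_) (ι*inv (2 ℕ.* β h))) ⟩
        ι (β h ℕ.* 4) * 1ℚ
          ≡⟨ trans (*-identityʳ (ι (β h ℕ.* 4))) (ι-* (β h) 4) ⟩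
        ι (β h) * ι 4 ∎))
        where
          open ≡-Reasoning
          eq : ∀ B → 8 ℕ.* (B ℕ.* B) ≡ B ℕ.* 4 ℕ.* (2 ℕ.* B)
          eq = ℕR.solve-∀

      -- 3 is rounded up to 4, and 4 / (2 h³) is the right-hand side.
      3/ν₁≤ : ι 3 * inv (ν₁ h) ≤ (inv h * inv h) * (inv h + inv h)
      3/ν₁≤ = begin
        ι 3 * inv (ν₁ h)
          ≡⟨ cong (λ r → ι 3 * inv r) (ν₁≡ h) ⟩
        ι 3 * inv (2 ℕ.* (h ℕ.* (h ℕ.* h)))
          ≤⟨ *-monoʳ (0≤inv (2 ℕ.* (h ℕ.* (h ℕ.* h)))) (ι-mono (ℕ.m≤m+n 3 1)) ⟩
        ι 4 * inv (2 ℕ.* (h ℕ.* (h ℕ.* h)))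
          ≡⟨ solve 1 (λ x → (con 1ℚ :+ (con 1ℚ :+ (con 1ℚ :+ (con 1ℚ :+ con 0ℚ)))) :* x := (x :+ x) :+ (x :+ x)) refl (inv (2 ℕ.* (h ℕ.* (h ℕ.* h)))) ⟩
        (inv (2 ℕ.* (h ℕ.* (h ℕ.* h))) + inv (2 ℕ.* (h ℕ.* (h ℕ.* h)))) + (inv (2 ℕ.* (h ℕ.* (h ℕ.* h))) + inv (2 ℕ.* (h ℕ.* (h ℕ.* h))))
          ≡⟨ cong₂ _+_ (inv-halves (h ℕ.* (h ℕ.* h))) (inv-halves (h ℕ.* (h ℕ.* h))) ⟩
        inv (h ℕ.* (h ℕ.* h)) + inv (h ℕ.* (h ℕ.* h))
          ≡⟨ cong (λ r → r + r) (trans (inv-* h (h ℕ.* h) {{h≢0}} {{ℕ.m*n≢0 h h}}) (cong (inv h *_) (inv-* h h {{h≢0}} {{h≢0}} {{ℕ.m*n≢0 h h}}))) ⟩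
        inv h * (inv h * inv h) + inv h * (inv h * inv h)
          ≡⟨ solve 1 (λ x → x :* (x :* x) :+ x :* (x :* x) := (x :* x) :* (x :+ x)) refl (inv h) ⟩
        (inv h * inv h) * (inv h + inv h) ∎
        where open ℚ.≤-Reasoning

    density : (𝒮 : System) (f : System.X 𝒮 → ℚ) → Ops.Unit 𝒮 f →
      (∀ z → z ≢ + 0 → ℤ.∣ z ∣ ℕ.≤ range h → ∀ x → f x * (f (System.act 𝒮 z (+ 0) x) * f (System.act 𝒮 (+ 0) (z ℤ.* z) x)) ≤ 0ℚ) →
      E (System.𝔼 𝒮) f ≤ ι 4 * inv h
    density 𝒮 f uf free = ≤≡ (SystemTheorem.density-bound 𝒮 f uf parameters 𝓃 S (8 ℕ.* (8 ℕ.* (β h ℕ.* β h)) ℕ.+ 3) (depth h)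
        (cong (λ s → 8 ℕ.* s ℕ.+ 3) (sym S≡)) (depth≡ h) many (ℚ.≤-reflexive (sym (ι*inv (β h)))) (0<inv h)
        (ℚ.≤-trans (error≤ (ν₁ h) (ν₂ h) (ν₃ h) (ν₄ h) (ν₅ h) (β h) (θ h) (ν₅≡ h) (ν₄≡ h) (ν₃≡ h) (ν₂≡ h) (β≡ h) (θ≡ h)) 3/ν₁≤) free)
      (solve 1 (λ x → (x :+ x) :+ (x :+ x) := (con 1ℚ :+ (con 1ℚ :+ (con 1ℚ :+ (con 1ℚ :+ con 0ℚ)))) :* x) refl (inv h))

  -- From density on the torus to the logarithmic bound

  module GridSet (N : ℕ) {{N≢0 : NonZero N}} (A : List (ℤ × ℤ)) (uA : Unique A) (gA : All (InGrid N) A) (none : NoSquareCorner A) where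

    private
      instance
        2N≢0 : NonZero (N ℕ.+ N)
        2N≢0 = ℕ.>-nonZero (ℕ.≤-trans (ℕ.>-nonZero⁻¹ N) (ℕ.m≤m+n N N))

    open Points N (N ℕ.+ N) refl

    length≤ : length A ℕ.≤ 4 ℕ.* (N ℕ.* N)
    length≤ = ℕ.≤-trans (ℕ.≤-reflexive (sym (ℕ.*-identityʳ (length A)))) (ℕ.≤-trans (E-f≤⇒length≤ A 1 1 (≤≡ (ℚ.≤-trans
        (E-mono (System.𝔼 (Torus.torus (N ℕ.+ N))) (λ z → proj₂ (f-unit A uA gA z)))
        (ℚ.≤-reflexive (E-const (System.𝔼 (Torus.torus (N ℕ.+ N))) 1ℚ))) (sym (ι*inv 1))))
      (ℕ.≤-reflexive (arr N)))
      where
        arr : ∀ N → 1 ℕ.* ((N ℕ.+ N) ℕ.* (N ℕ.+ N)) ≡ 4 ℕ.* (N ℕ.* N)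
        arr = ℕR.solve-∀

    -- Density 4 / h on a torus with (2 N)² points gives the constant 16.
    length*≤ : ∀ h → NonZero h → range h ℕ.* range h ℕ.≤ N → length A ℕ.* h ℕ.≤ 16 ℕ.* (N ℕ.* N)
    length*≤ h h≢0 small = ℕ.≤-trans (E-f≤⇒length≤ A 4 h {{h≢0}} (Choice.density h {{h≢0}} (Torus.torus (N ℕ.+ N)) (f A) (f-unit A uA gA) (free A gA none (range h) small)))
      (ℕ.≤-reflexive (arr N))
      where
        arr : ∀ N → 4 ℕ.* ((N ℕ.+ N) ℕ.* (N ℕ.+ N)) ≡ 16 ℕ.* (N ℕ.* N)
        arr = ℕR.solve-∀

  private
    ^-swap : ∀ a C h K → a ℕ.^ K ℕ.* (C ℕ.* h ℕ.^ K) ≡ C ℕ.* (a ℕ.* h) ℕ.^ K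
    ^-swap a C h K = trans (arr (a ℕ.^ K) C (h ℕ.^ K)) (cong (C ℕ.*_) (sym (^-*-distrib K)))
      where
        arr : ∀ x C y → x ℕ.* (C ℕ.* y) ≡ C ℕ.* (x ℕ.* y)
        arr = ℕR.solve-∀
        ^-*-distrib : ∀ K → (a ℕ.* h) ℕ.^ K ≡ a ℕ.^ K ℕ.* h ℕ.^ K
        ^-*-distrib zero = refl
        ^-*-distrib (suc K) = trans (cong (a ℕ.* h ℕ.*_) (^-*-distrib K)) (arr₂ a h (a ℕ.^ K) (h ℕ.^ K))
          where
            arr₂ : ∀ a h x y → a ℕ.* h ℕ.* (x ℕ.* y) ≡ a ℕ.* x ℕ.* (h ℕ.* y)
            arr₂ = ℕR.solve-∀

    ^-collect : ∀ C N K → C ℕ.* (20 ℕ.* (N ℕ.* N)) ℕ.^ K ≡ C ℕ.* 20 ℕ.^ K ℕ.* N ℕ.^ (2 ℕ.* K)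
    ^-collect C N K = trans (sym (^-swap 20 C (N ℕ.* N) K)) (trans (cong (λ r → 20 ℕ.^ K ℕ.* (C ℕ.* r)) (trans (cong (ℕ._^ K) (cong (N ℕ.*_) (sym (ℕ.*-identityʳ N)))) (ℕ.^-*-assoc N 2 K)))
      (arr (20 ℕ.^ K) C (N ℕ.^ (2 ℕ.* K))))
      where
        arr : ∀ x C y → x ℕ.* (C ℕ.* y) ≡ C ℕ.* x ℕ.* y
        arr = ℕR.solve-∀

    module LogBound (k C : ℕ) (G : ℕ → ℕ) (G≤ : ∀ h → 1 ℕ.≤ h → G h ℕ.≤ C ℕ.* h ℕ.^ k) (range≤ : ∀ h → range h ℕ.* range h ℕ.≤ 2 ℕ.^ G h) where

      -- With h just above 16N²/|A| the bound |A| h ≤ 16N² fails, so N < range h ² ≤ 2 ^ G h.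
      count : ∀ N → 2 ℕ.≤ N → ∀ A → Unique A → All (InGrid N) A → NoSquareCorner A → ∀ a → length A ≡ a →
        (a ℕ.^ suc k) ℕ.* ⌊log₂ N ⌋ ℕ.≤ C ℕ.* 20 ℕ.^ suc k ℕ.* N ℕ.^ (2 ℕ.* suc k)
      count N 2≤N A uA gA none zero e = ℕ.z≤n
      count N 2≤N A uA gA none a@(suc _) e = begin
        (a ℕ.^ suc k) ℕ.* ⌊log₂ N ⌋
          ≤⟨ ℕ.*-monoʳ-≤ (a ℕ.^ suc k) log≤ ⟩
        (a ℕ.^ suc k) ℕ.* (C ℕ.* h ℕ.^ suc k)
          ≡⟨ ^-swap a C h (suc k) ⟩
        C ℕ.* (a ℕ.* h) ℕ.^ suc k
          ≤⟨ ℕ.*-monoʳ-≤ C (ℕ.^-monoˡ-≤ (suc k) ah≤) ⟩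
        C ℕ.* (20 ℕ.* (N ℕ.* N)) ℕ.^ suc k
          ≡⟨ ^-collect C N (suc k) ⟩
        C ℕ.* 20 ℕ.^ suc k ℕ.* N ℕ.^ (2 ℕ.* suc k) ∎
        where
          open ℕ.≤-Reasoning
          Q h : ℕ
          Q = 16 ℕ.* (N ℕ.* N)
          h = suc (Q ℕ./ a)
          instance
            N≢0 : NonZero N
            N≢0 = ℕ.>-nonZero (ℕ.≤-trans (ℕ.n≤1+n 1) 2≤N)
          module 𝒢 = GridSet N A uA gA none

          Q<ah : Q ℕ.< a ℕ.* h
          Q<ah = ℕ.<-≤-trans (subst (ℕ._< a ℕ.+ Q ℕ./ a ℕ.* a) (sym (ℕ.m≡m%n+[m/n]*n Q a)) (ℕ.+-monoˡ-< (Q ℕ./ a ℕ.* a) (ℕ.m%n<n Q a)))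
            (ℕ.≤-reflexive (ℕ.*-comm h a))

          -- a h ≤ Q + a, where the trivial bound 4 N² for a turns 16 into 20.
          ah≤ : a ℕ.* h ℕ.≤ 20 ℕ.* (N ℕ.* N)
          ah≤ = ℕ.≤-trans (ℕ.≤-reflexive (ℕ.*-comm a h)) (ℕ.≤-trans (ℕ.+-mono-≤ (subst (ℕ._≤ 4 ℕ.* (N ℕ.* N)) e 𝒢.length≤) (ℕ.m/n*n≤m Q a))
            (ℕ.≤-reflexive (sym (ℕ.*-distribʳ-+ (N ℕ.* N) 4 16))))

          N≤ : N ℕ.≤ 2 ℕ.^ G h
          N≤ = ℕ.≤-trans (ℕ.<⇒≤ (ℕ.≰⇒> (λ small → ℕ.<⇒≱ Q<ah (subst (λ b → b ℕ.* h ℕ.≤ Q) e (𝒢.length*≤ h _ small))))) (range≤ h)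

          log≤ : ⌊log₂ N ⌋ ℕ.≤ C ℕ.* h ℕ.^ suc k
          log≤ = ℕ.≤-trans (ℕ.≤-trans (⌊log₂⌋-mono-≤ N≤) (ℕ.≤-reflexive (⌊log₂[2^n]⌋≡n (G h))))
            (ℕ.≤-trans (G≤ h (ℕ.s≤s ℕ.z≤n)) (ℕ.*-monoʳ-≤ C (ℕ.^-monoʳ-≤ h (ℕ.n≤1+n k))))

  -- The saving (log N)^c with c = 1 / k, raised to the power k so that only naturals occur.
  square-corners : ∃[ k ] ∃[ C ] ((1 ℕ.≤ k) × (∀ (N : ℕ) → 2 ℕ.≤ N → (A : List (ℤ × ℤ)) → Unique A → All (InGrid N) A → NoSquareCorner A →
    (length A ℕ.^ k) ℕ.* ⌊log₂ N ⌋ ℕ.≤ C ℕ.* (N ℕ.^ (2 ℕ.* k))))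
  square-corners = go exponential-range²
    where
      go : Exponential (λ h → range h ℕ.* range h) → _
      -- The exponent k + 1 is at least 1 whatever degree the polynomial bound returns.
      go (G , (k , C , G≤) , range≤) = suc k , C ℕ.* 20 ℕ.^ suc k , ℕ.s≤s ℕ.z≤n ,
        λ N 2≤N A uA gA none → LogBound.count k C G G≤ range≤ N 2≤N A uA gA none (length A) refl

open import Defs
open import Data.Nat using (ℕ; _≤_; _*_; _^_)
open import Data.Nat.Logarithm using (⌊log₂_⌋)
open import Data.Integer using (ℤ)
open import Data.Product using (_×_; ∃-syntax)
open import Data.List using (List; length)
open import Data.List.Relation.Unary.All using (All)
open import Data.List.Relation.Unary.Unique.Propositional using (Unique)

theorem1p1 : ∃[ k ] ∃[ C ] ((1 ≤ k) × (∀ (N : ℕ) → 2 ≤ N → (A : List (ℤ × ℤ)) → Unique A → All (InGrid N) A → NoSquareCorner A → (length A ^ k) * ⌊log₂ N ⌋ ≤ C * (N ^ (2 * k))))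
theorem1p1 = Corners.square-corners
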